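{- Let $n\geq 13$ and $k\geq 1$ with $n\geq 2k$, and let $G\in\mathfrak{C}_{n,k}(k)$. Then $F(G)\geq F(L_{n,n-k})$. Furthermore, if $n\neq 2k+1$, equality holds if and only if $G\cong L_{n,n-k}$, and if $n=2k+1$, equality holds if and only if $G\in\{L_{2k+1,k+1},\,Q_{2k+1,k}\}$.
   Context: All graphs are simple, finite, undirected and connected. $F(G)$ is the number of connected subgraphs of $G$ (nonempty connected subgraphs consisting of a vertex subset and a subset of edges among them; distinct subgraphs counted separately). $\mathfrak{C}_{n,k}$ is the family of connected graphs on $n$ vertices with exactly $k$ cut vertices; $\mathfrak{C}_{n,k}(g)$ is its subfamily of graphs with girth at least $g$ (trees are considered to have infinite girth). $L_{n,n-k}$ is obtained by identifying an end vertex of the path $P_{k+1}$ with a vertex of the cycle $C_{n-k}$. The path-star tree $P_{m,r}$ is obtained by identifying one end vertex of $P_m$ with the center of the star $K_{1,r}$; its path-part pendant vertex is the other end of $P_m$. $Q_{n,k}$ is obtained by identifying a vertex of $C_{n-k-1}$ with the path-part pendant vertex of $P_{k,2}$. -}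

module Defs where

open import Data.Bool using (Bool; true; false; _∧_; _∨_; not; T)
open import Data.Nat using (ℕ; zero; suc; _+_; _∸_; _≡ᵇ_; _<ᵇ_; _≤_)
open import Data.Fin using (Fin; toℕ; _≟_)
open import Data.Fin.Permutation using (Permutation′; _⟨$⟩ʳ_)
open import Data.Bool.ListAction using (any; all)
open import Data.List using (List; []; _∷_; _++_; map; length; filterᵇ; allFin; upTo; cartesianProduct; concatMap)
open import Data.List.Relation.Unary.Unique.Propositional using (Unique)
open import Data.Product using (_×_; _,_; proj₁; proj₂; ∃)
open import Relation.Nullary.Decidable using (⌊_⌋)
open import Relation.Binary.PropositionalEquality using (_≡_)

Graph : ℕ → Set
Graph n = Fin n → Fin n → Bool

IsSimple : ∀ {n} → Graph n → Set
IsSimple {n} G = (∀ (i j : Fin n) → G i j ≡ G j i) × (∀ (i : Fin n) → G i i ≡ false)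

eqF : ∀ {n} → Fin n → Fin n → Bool
eqF i j = ⌊ i ≟ j ⌋

edges : ∀ {n} → Graph n → List (Fin n × Fin n)
edges {n} G = filterᵇ (λ p → (toℕ (proj₁ p) <ᵇ toℕ (proj₂ p)) ∧ G (proj₁ p) (proj₂ p))
                      (cartesianProduct (allFin n) (allFin n))

sublists : ∀ {A : Set} → List A → List (List A)
sublists [] = [] ∷ []
sublists (x ∷ xs) = let r = sublists xs in r ++ map (x ∷_) r

elemF : ∀ {n} → Fin n → List (Fin n) → Bool
elemF i xs = any (eqF i) xs

adjIn : ∀ {n} → List (Fin n × Fin n) → Fin n → Fin n → Bool
adjIn ES u w = any (λ e → (eqF (proj₁ e) u ∧ eqF (proj₂ e) w) ∨ (eqF (proj₁ e) w ∧ eqF (proj₂ e) u)) ES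

reach : ∀ {n} → List (Fin n × Fin n) → ℕ → Fin n → Fin n → Bool
reach ES zero u v = eqF u v
reach {n} ES (suc m) u v = reach ES m u v ∨ any (λ w → adjIn ES u w ∧ reach ES m w v) (allFin n)

nonempty : ∀ {A : Set} → List A → Bool
nonempty [] = false
nonempty (_ ∷ _) = true

-- the graph with vertex list VS and edge list ES (edges between vertices of VS)
-- is nonempty and connected (walks of length ≤ n suffice on ≤ n vertices)
connectedᵇ : ∀ {n} → List (Fin n) → List (Fin n × Fin n) → Bool
connectedᵇ {n} VS ES = nonempty VS ∧ all (λ u → all (λ v → reach ES n u v) VS) VS

subgraphs : ∀ {n} → Graph n → List (List (Fin n) × List (Fin n × Fin n))
subgraphs {n} G = concatMap (λ VS → map (VS ,_)
    (sublists (filterᵇ (λ e → elemF (proj₁ e) VS ∧ elemF (proj₂ e) VS) (edges G))))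
  (sublists (allFin n))

F : ∀ {n} → Graph n → ℕ
F G = length (filterᵇ (λ s → connectedᵇ (proj₁ s) (proj₂ s)) (subgraphs G))

Connected : ∀ {n} → Graph n → Set
Connected {n} G = T (connectedᵇ (allFin n) (edges G))

isCutᵇ : ∀ {n} → Graph n → Fin n → Bool
isCutᵇ {n} G v = not (connectedᵇ (filterᵇ (λ u → not (eqF u v)) (allFin n))
                                 (filterᵇ (λ e → not (eqF (proj₁ e) v) ∧ not (eqF (proj₂ e) v)) (edges G)))

cutCount : ∀ {n} → Graph n → ℕ
cutCount {n} G = length (filterᵇ (isCutᵇ G) (allFin n))

closesᵇ : ∀ {n} → Graph n → Fin n → List (Fin n) → Bool
closesᵇ G x0 [] = false
closesᵇ G x0 (a ∷ []) = G a x0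
closesᵇ G x0 (a ∷ b ∷ r) = G a b ∧ closesᵇ G x0 (b ∷ r)

cycleWalkᵇ : ∀ {n} → Graph n → List (Fin n) → Bool
cycleWalkᵇ G [] = false
cycleWalkᵇ G (x ∷ xs) = closesᵇ G x (x ∷ xs)

IsCycle : ∀ {n} → Graph n → List (Fin n) → Set
IsCycle G vs = (3 ≤ length vs) × Unique vs × T (cycleWalkᵇ G vs)

-- girth ≥ g (vacuous for acyclic graphs: infinite girth)
GirthAtLeast : ∀ {n} → ℕ → Graph n → Set
GirthAtLeast {n} g G = ∀ (vs : List (Fin n)) → IsCycle G vs → g ≤ length vs

_≅_ : ∀ {n} → Graph n → Graph n → Set
_≅_ {n} G H = ∃ λ (σ : Permutation′ n) → ∀ (i j : Fin n) → G i j ≡ H (σ ⟨$⟩ʳ i) (σ ⟨$⟩ʳ j)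

fromEdges : ∀ {n} → List (ℕ × ℕ) → Graph n
fromEdges es i j = not (eqF i j) ∧
  any (λ p → ((proj₁ p ≡ᵇ toℕ i) ∧ (proj₂ p ≡ᵇ toℕ j)) ∨ ((proj₁ p ≡ᵇ toℕ j) ∧ (proj₂ p ≡ᵇ toℕ i))) es

pathEdges : List ℕ → List (ℕ × ℕ)
pathEdges [] = []
pathEdges (a ∷ []) = []
pathEdges (a ∷ b ∷ r) = (a , b) ∷ pathEdges (b ∷ r)

cycleEdges : ℕ → List (ℕ × ℕ)
cycleEdges c = (c ∸ 1 , 0) ∷ pathEdges (upTo c)

-- L_{n,n-k}: cycle C_{n-k} on 0..n-k-1, path P_{k+1} : 0 - (n-k) - ... - (n-1)
Lgraph : (n k : ℕ) → Graph n
Lgraph n k = fromEdges (cycleEdges (n ∸ k) ++ pathEdges (0 ∷ map ((n ∸ k) +_) (upTo k)))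

lastOr : ℕ → List ℕ → ℕ
lastOr d [] = d
lastOr d (x ∷ xs) = lastOr x xs

-- Q_{n,k}: cycle C_{n-k-1} on 0..c-1 (c = n-k-1); path P_k with vertices
-- 0, c, c+1, ..., c+k-2 (pendant end 0 identified with a cycle vertex);
-- its other end (the star centre) is adjacent to the two leaves n-2, n-1.
Qgraph : (n k : ℕ) → Graph n
Qgraph n k = fromEdges (cycleEdges c ++ pathEdges pv ++ ((ctr , n ∸ 2) ∷ (ctr , n ∸ 1) ∷ []))
  where
    c : ℕ
    c = n ∸ k ∸ 1
    pv : List ℕ
    pv = 0 ∷ map (c +_) (upTo (k ∸ 1))
    ctr : ℕ
    ctr = lastOr 0 pv

{-# OPTIONS --safe #-}
module Submission where

-- Let B be a block with m ≥ 3 vertices; it contains a cycle, so k ≤ m. The rest of the graph hangs at the cut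
-- vertices of B, the roots. Connected vertex sets containing K are counted by growing K: split them by whether
-- they contain a given neighbour x of K, and note that both halves are large if x is not a cut vertex. This gives
-- at least h + C(t,2) sets growing from a root into a piece with h further vertices, t of them non-cut, and at
-- least m + C(m−1,2) sets of B through a given vertex; moreover each of the at least m edges of B may be dropped
-- from a subgraph covering B. Multiplying these counts at the roots and comparing with Φ(n−k,k), the number for
-- L, two or more roots always exceed Φ. With a single root, equality forces B to be a cycle and the piece to be a
-- path, or, when n = 2k+1, a path ending in two leaves. If there is no such block, G is a tree; then the sets
-- containing all k cut vertices together with the two sides of every edge between cut vertices already give more
-- than Φ. The exact values for L and Q come from deciding the edges one after another, starting with one edge of
-- the cycle.

-- Let `d` be the number of non-cut vertices outside the block beyond one per root. Then
-- `n ∸ k = m + d`, so the block of `m` vertices is compared with a cycle on `m + d` vertices, and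
-- every surplus tip has to be worth a longer cycle. Pairs of tips, counted by `ch2`, pay for this
-- as long as `k ≤ m`; that inequality is what the girth gives, apart from excluding one triangle.
--
-- For a single root and `d = 1` the margin over `Φ` is `1 + m * (m - 1 - k)` when `k < m`, but when
-- `k = m` the general count falls `k - 1` short. A piece that ends in two leaves has exactly
-- `k - 1` subgraphs more than the general count sees, which makes a tie, and then
-- `n = m + k + d = 2k + 1`. This is where `Q` comes from.
--
-- The bound `n ≥ 13` is used above all for small blocks with `k = m`, `d ≥ 2` and for small trees.
-- For trees, `2k ≤ n` says that at most half of the vertices are cut vertices.

open import Defs
open import Data.Bool using (Bool; true; false; _∧_; _∨_; not; T; T?; if_then_else_)
open import Data.Bool.ListAction using (any; all)
open import Data.Bool.Properties using (∧-comm; ∨-comm; ¬-not)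
open import Data.Empty using (⊥; ⊥-elim)
open import Data.Fin using (Fin; zero; suc; toℕ; fromℕ<; _≟_)
open import Data.Fin.Properties using (toℕ-injective; toℕ<n; toℕ-fromℕ<; any?)
open import Data.Fin.Permutation using (permutation; _⟨$⟩ʳ_; _⟨$⟩ˡ_; inverseˡ; inverseʳ)
open import Data.List using (List; []; _∷_; _++_; map; length; filterᵇ; allFin; upTo; applyUpTo; cartesianProduct; concatMap)
open import Data.List.Properties using (length-++; map-applyUpTo; length-tabulate)
open import Data.List.Membership.Propositional using (_∈_; _∉_; find; lose)
open import Data.List.Membership.Propositional.Properties
open import Data.List.Relation.Unary.All using (All; []; _∷_)
import Data.List.Relation.Unary.All as All
open import Data.List.Relation.Unary.AllPairs using ([]; _∷_)
open import Data.List.Relation.Unary.Any using (here; there)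
import Data.List.Relation.Unary.Any as Any
open import Data.List.Relation.Unary.Unique.Propositional using (Unique)
import Data.List.Relation.Unary.Unique.Propositional.Properties as Uniq
open import Data.Nat using (ℕ; zero; suc; _+_; _*_; _∸_; _^_; _≤_; _<_; z≤n; s≤s; _≡ᵇ_; _<ᵇ_; _≤?_; _<?_)
open import Data.Nat.Properties renaming (_≟_ to _≟ℕ_)
open import Data.Nat.Tactic.RingSolver using (solve-∀)
open import Data.Product using (∃; _×_; _,_; proj₁; proj₂)
open import Data.Sum using (_⊎_; inj₁; inj₂; [_,_]′)
open import Data.Unit using (tt)
open import Function using (_∘_; id; case_of_)
open import Function.Bundles using (_⇔_; mk⇔)
open import Relation.Nullary using (¬_; Dec; yes; no)
open import Relation.Nullary.Decidable using (toWitness; _×-dec_; _→-dec_)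
open import Relation.Binary.Definitions using (Tri; tri<; tri≈; tri>)
open import Relation.Binary.PropositionalEquality using (_≡_; _≢_; refl; sym; trans; cong; cong₂; subst; subst₂)

private
  variable
    A : Set
    n : ℕ

-- Boolean connectives, quantifiers over lists and filters

true≢false : {b : Bool} → b ≡ true → b ≡ false → ⊥
true≢false refl ()

≢true⇒false : {b : Bool} → ¬ (b ≡ true) → b ≡ false
≢true⇒false {true} h = ⊥-elim (h refl)
≢true⇒false {false} h = refl

true? : (b : Bool) → (b ≡ true) ⊎ (b ≡ false)
true? true = inj₁ refl
true? false = inj₂ refl

∧-elim : {a b : Bool} → a ∧ b ≡ true → (a ≡ true) × (b ≡ true)
∧-elim {true} {true} refl = refl , refl

∧-elimˡ : {a b : Bool} → a ∧ b ≡ true → a ≡ true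
∧-elimˡ = proj₁ ∘ ∧-elim

∧-elimʳ : {a b : Bool} → a ∧ b ≡ true → b ≡ true
∧-elimʳ {true} h = h

∧-intro : {a b : Bool} → a ≡ true → b ≡ true → a ∧ b ≡ true
∧-intro refl refl = refl

∨-elim : {a b : Bool} → a ∨ b ≡ true → (a ≡ true) ⊎ (b ≡ true)
∨-elim {true} h = inj₁ refl
∨-elim {false} h = inj₂ h

∨-introˡ : {a b : Bool} → a ≡ true → a ∨ b ≡ true
∨-introˡ refl = refl

∨-introʳ : {a b : Bool} → b ≡ true → a ∨ b ≡ true
∨-introʳ {true} refl = refl
∨-introʳ {false} refl = refl

not-elim : {a : Bool} → not a ≡ true → a ≡ false
not-elim {false} refl = refl

not-intro : {a : Bool} → a ≡ false → not a ≡ true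
not-intro refl = refl

bool-ext : {a b : Bool} → (a ≡ true → b ≡ true) → (b ≡ true → a ≡ true) → a ≡ b
bool-ext {true} f g = sym (f refl)
bool-ext {false} {true} f g = g refl
bool-ext {false} {false} f g = refl

T⇒≡ : {b : Bool} → T b → b ≡ true
T⇒≡ {true} _ = refl

≡⇒T : {b : Bool} → b ≡ true → T b
≡⇒T refl = tt

eqF⇒≡ : {i j : Fin n} → eqF i j ≡ true → i ≡ j
eqF⇒≡ {i = i} {j} h with i ≟ j
... | yes p = p

eqF-refl : (i : Fin n) → eqF i i ≡ true
eqF-refl i with i ≟ i
... | yes _ = refl
... | no h = ⊥-elim (h refl)

≢⇒eqF : {i j : Fin n} → i ≢ j → eqF i j ≡ false
≢⇒eqF {i = i} {j} h with i ≟ j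
... | yes p = ⊥-elim (h p)
... | no _ = refl

eqF⇒≢ : {i j : Fin n} → eqF i j ≡ false → i ≢ j
eqF⇒≢ h refl = true≢false (eqF-refl _) h

any-intro : (p : A → Bool) {x : A} {xs : List A} → x ∈ xs → p x ≡ true → any p xs ≡ true
any-intro p (here refl) h = ∨-introˡ h
any-intro p {xs = y ∷ xs} (there m) h = ∨-introʳ {p y} (any-intro p m h)

any-elim : (p : A → Bool) (xs : List A) → any p xs ≡ true → ∃ λ x → (x ∈ xs) × (p x ≡ true)
any-elim p (y ∷ xs) h with true? (p y)
... | inj₁ e = y , here refl , e
... | inj₂ e rewrite e with any-elim p xs h
... | x , m , q = x , there m , q

all-intro : (p : A → Bool) (xs : List A) → (∀ {x} → x ∈ xs → p x ≡ true) → all p xs ≡ true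
all-intro p [] h = refl
all-intro p (y ∷ xs) h = ∧-intro (h (here refl)) (all-intro p xs (h ∘ there))

all-elim : (p : A → Bool) {x : A} {xs : List A} → all p xs ≡ true → x ∈ xs → p x ≡ true
all-elim p h (here refl) = ∧-elimˡ h
all-elim p {xs = y ∷ xs} h (there m) = all-elim p (∧-elimʳ {p y} h) m

∈-filterᵇ⁺ : (p : A → Bool) {x : A} {xs : List A} → x ∈ xs → p x ≡ true → x ∈ filterᵇ p xs
∈-filterᵇ⁺ p m h = ∈-filter⁺ (T? ∘ p) m (≡⇒T h)

∈-filterᵇ⁻ : (p : A → Bool) {x : A} {xs : List A} → x ∈ filterᵇ p xs → (x ∈ xs) × (p x ≡ true)
∈-filterᵇ⁻ p {xs = xs} m with ∈-filter⁻ (T? ∘ p) {xs = xs} m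
... | m′ , h = m′ , T⇒≡ h

-- Counting

abstract
  cnt : (A → Bool) → List A → ℕ
  cnt p xs = length (filterᵇ p xs)

  cnt-length : (p : A → Bool) (xs : List A) → cnt p xs ≡ length (filterᵇ p xs)
  cnt-length p xs = refl

  cnt-∷-true : (p : A → Bool) {x : A} (xs : List A) → p x ≡ true → cnt p (x ∷ xs) ≡ suc (cnt p xs)
  cnt-∷-true p xs h rewrite h = refl

  cnt-∷-false : (p : A → Bool) {x : A} (xs : List A) → p x ≡ false → cnt p (x ∷ xs) ≡ cnt p xs
  cnt-∷-false p xs h rewrite h = refl

  cnt-mono-∈ : (p q : A → Bool) (xs : List A) → (∀ {x} → x ∈ xs → p x ≡ true → q x ≡ true) →
    cnt p xs ≤ cnt q xs
  cnt-mono-∈ p q [] h = z≤n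
  cnt-mono-∈ p q (x ∷ xs) h with true? (p x) | true? (q x)
  ... | inj₁ a | inj₁ b rewrite a | b = s≤s (cnt-mono-∈ p q xs (h ∘ there))
  ... | inj₁ a | inj₂ b = ⊥-elim (true≢false (h (here refl) a) b)
  ... | inj₂ a | inj₁ b rewrite a | b = m≤n⇒m≤1+n (cnt-mono-∈ p q xs (h ∘ there))
  ... | inj₂ a | inj₂ b rewrite a | b = cnt-mono-∈ p q xs (h ∘ there)

  cnt-split : (p q : A → Bool) (xs : List A) →
    cnt p xs ≡ cnt (λ x → p x ∧ q x) xs + cnt (λ x → p x ∧ not (q x)) xs
  cnt-split p q [] = refl
  cnt-split p q (x ∷ xs) with true? (p x) | true? (q x)
  ... | inj₁ a | inj₁ b rewrite a | b = cong suc (cnt-split p q xs)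
  ... | inj₁ a | inj₂ b rewrite a | b = trans (cong suc (cnt-split p q xs)) (sym (+-suc _ _))
  ... | inj₂ a | _ rewrite a = cnt-split p q xs

  cnt-none : (p : A → Bool) (xs : List A) → (∀ {x} → x ∈ xs → p x ≡ true → ⊥) → cnt p xs ≡ 0
  cnt-none p [] h = refl
  cnt-none p (x ∷ xs) h rewrite ≢true⇒false (h (here refl)) = cnt-none p xs (h ∘ there)

  cnt-pos : (p : A → Bool) {x : A} {xs : List A} → x ∈ xs → p x ≡ true → 1 ≤ cnt p xs
  cnt-pos p {xs = xs} m h = ∈-length (∈-filterᵇ⁺ p m h)

  cnt-≤1 : (p : A → Bool) {xs : List A} → Unique xs →
    (∀ {x y} → x ∈ xs → y ∈ xs → p x ≡ true → p y ≡ true → x ≡ y) → cnt p xs ≤ 1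
  cnt-≤1 p {[]} u h = z≤n
  cnt-≤1 p {x ∷ xs} (ux ∷ u) h with true? (p x)
  ... | inj₂ e rewrite e = cnt-≤1 p u (λ a b → h (there a) (there b))
  ... | inj₁ e rewrite e = s≤s (≤-reflexive (cnt-none p xs
          (λ m q → All.lookup ux m (h (here refl) (there m) e q))))

  cnt-exists : (p : A → Bool) (xs : List A) → 1 ≤ cnt p xs → ∃ λ x → (x ∈ xs) × (p x ≡ true)
  cnt-exists p (x ∷ xs) h with true? (p x)
  ... | inj₁ e = x , here refl , e
  ... | inj₂ e rewrite e with cnt-exists p xs h
  ... | y , m , q = y , there m , q

  cnt-all : (p : A → Bool) (xs : List A) → (∀ {x} → x ∈ xs → p x ≡ true) → cnt p xs ≡ length xs
  cnt-all p [] h = refl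
  cnt-all p (x ∷ xs) h rewrite h {x} (here refl) = cong suc (cnt-all p xs (h ∘ there))

cnt-mono : (p q : A → Bool) (xs : List A) → (∀ x → p x ≡ true → q x ≡ true) → cnt p xs ≤ cnt q xs
cnt-mono p q xs h = cnt-mono-∈ p q xs (λ {x} _ → h x)

cnt-cong-∈ : (p q : A → Bool) (xs : List A) → (∀ {x} → x ∈ xs → p x ≡ true → q x ≡ true) →
  (∀ {x} → x ∈ xs → q x ≡ true → p x ≡ true) → cnt p xs ≡ cnt q xs
cnt-cong-∈ p q xs f g = ≤-antisym (cnt-mono-∈ p q xs f) (cnt-mono-∈ q p xs g)

cnt-cong : (p q : A → Bool) (xs : List A) → (∀ x → p x ≡ q x) → cnt p xs ≡ cnt q xs
cnt-cong p q xs h = cnt-cong-∈ p q xs (λ {x} _ → trans (sym (h x))) (λ {x} _ → trans (h x))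

cnt-disjoint : (p q r : A → Bool) (xs : List A) → (∀ x → p x ≡ true → r x ≡ true) →
  (∀ x → q x ≡ true → r x ≡ true) → (∀ x → p x ≡ true → q x ≡ true → ⊥) →
  cnt p xs + cnt q xs ≤ cnt r xs
cnt-disjoint p q r xs f g d = ≤-trans
  (+-mono-≤ (cnt-mono p (λ x → r x ∧ p x) xs (λ x h → ∧-intro (f x h) h))
            (cnt-mono q (λ x → r x ∧ not (p x)) xs
              (λ x h → ∧-intro (g x h) (not-intro (≢true⇒false (λ e → d x e h))))))
  (≤-reflexive (sym (cnt-split r p xs)))

∈-remove : {x : A} {ys : List A} → x ∈ ys →
  ∃ λ zs → (length ys ≡ suc (length zs)) × (∀ {y} → y ∈ ys → y ≢ x → y ∈ zs)
∈-remove {ys = y ∷ ys} (here refl) = ys , refl ,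
  λ { (here e) ne → ⊥-elim (ne e) ; (there m) _ → m }
∈-remove {ys = y ∷ ys} (there m) with ∈-remove m
... | zs , e , f = y ∷ zs , cong suc e , λ { (here e) _ → here e ; (there m′) ne → there (f m′ ne) }

Unique-⊆-length : {xs ys : List A} → Unique xs → (∀ {x} → x ∈ xs → x ∈ ys) → length xs ≤ length ys
Unique-⊆-length {xs = []} u h = z≤n
Unique-⊆-length {xs = x ∷ xs} {ys} (ux ∷ u) h with ∈-remove (h (here refl))
... | zs , e , f rewrite e = s≤s (Unique-⊆-length u
        (λ m → f (h (there m)) (λ { refl → All.lookup ux m refl })))

-- Vertex sets

VSet : ℕ → Set
VSet n = Fin n → Bool

_⊑_ : VSet n → VSet n → Set
U ⊑ W = ∀ x → U x ≡ true → W x ≡ true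

∅ : VSet n
∅ _ = false

full : VSet n
full _ = true

⟪_⟫ : Fin n → VSet n
⟪ x ⟫ y = eqF y x

_⊕_ : VSet n → Fin n → VSet n
(U ⊕ x) y = eqF y x ∨ U y

_⊖_ : VSet n → Fin n → VSet n
(U ⊖ x) y = not (eqF y x) ∧ U y

_∖_ : VSet n → VSet n → VSet n
(U ∖ W) y = U y ∧ not (W y)

_∪_ : VSet n → VSet n → VSet n
(U ∪ W) y = U y ∨ W y

_⊓_ : VSet n → VSet n → VSet n
(U ⊓ W) y = U y ∧ W y

card : VSet n → ℕ
card {n} U = cnt U (allFin n)

⊕-new : (U : VSet n) (x : Fin n) → (U ⊕ x) x ≡ true
⊕-new U x = ∨-introˡ (eqF-refl x)

⊕-old : (U : VSet n) (x : Fin n) → U ⊑ (U ⊕ x)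
⊕-old U x y h = ∨-introʳ {eqF y x} h

⊕-elim : (U : VSet n) (x : Fin n) {y : Fin n} → (U ⊕ x) y ≡ true → (y ≡ x) ⊎ (U y ≡ true)
⊕-elim U x {y} h with ∨-elim {eqF y x} h
... | inj₁ e = inj₁ (eqF⇒≡ e)
... | inj₂ e = inj₂ e

⊕-⊑ : {U W : VSet n} {x : Fin n} → U ⊑ W → W x ≡ true → (U ⊕ x) ⊑ W
⊕-⊑ {U = U} {x = x} f h y e with ⊕-elim U x e
... | inj₁ refl = h
... | inj₂ q = f y q

⊖-intro : (U : VSet n) {x y : Fin n} → y ≢ x → U y ≡ true → (U ⊖ x) y ≡ true
⊖-intro U ne h = ∧-intro (not-intro (≢⇒eqF ne)) h

⊖-⊑ : (U : VSet n) (x : Fin n) → (U ⊖ x) ⊑ U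
⊖-⊑ U x y h = ∧-elimʳ {not (eqF y x)} h

⊖-≢ : (U : VSet n) {x y : Fin n} → (U ⊖ x) y ≡ true → y ≢ x
⊖-≢ U {x} {y} h = eqF⇒≢ (not-elim (∧-elimˡ {not (eqF y x)} h))

∖-intro : (U W : VSet n) {y : Fin n} → U y ≡ true → W y ≡ false → (U ∖ W) y ≡ true
∖-intro U W a b = ∧-intro a (not-intro b)

∖-⊑ : (U W : VSet n) → (U ∖ W) ⊑ U
∖-⊑ U W y h = ∧-elimˡ h

∖-out : (U W : VSet n) {y : Fin n} → (U ∖ W) y ≡ true → W y ≡ false
∖-out U W {y} h = not-elim (∧-elimʳ {U y} h)

card-mono : {U W : VSet n} → U ⊑ W → card U ≤ card W
card-mono {n} {U} {W} h = cnt-mono U W (allFin n) h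

card-cong : {U W : VSet n} → U ⊑ W → W ⊑ U → card U ≡ card W
card-cong f g = ≤-antisym (card-mono f) (card-mono g)

card-full : card (full {n}) ≡ n
card-full {n} = trans (cnt-all full (allFin n) (λ _ → refl)) (length-tabulate id)

card-⟪⟫ : (x : Fin n) → card ⟪ x ⟫ ≡ 1
card-⟪⟫ {n} x = ≤-antisym
  (cnt-≤1 ⟪ x ⟫ (Uniq.allFin⁺ n) (λ _ _ a b → trans (eqF⇒≡ a) (sym (eqF⇒≡ b))))
  (cnt-pos ⟪ x ⟫ (∈-allFin x) (eqF-refl x))

card-split : (U W : VSet n) → card U ≡ card (U ⊓ W) + card (U ∖ W)
card-split {n} U W = cnt-split U W (allFin n)

card-pos : {U : VSet n} {x : Fin n} → U x ≡ true → 1 ≤ card U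
card-pos {U = U} {x} h = cnt-pos U (∈-allFin x) h

card-exists : (U : VSet n) → 1 ≤ card U → ∃ λ x → U x ≡ true
card-exists {n} U h with cnt-exists U (allFin n) h
... | x , _ , e = x , e

card-0 : (U : VSet n) → card U ≡ 0 → ∀ x → U x ≡ false
card-0 U e x = ≢true⇒false (λ h → 1+n≰n (≤-trans (card-pos {U = U} h) (≤-reflexive e)))

card-⊖ : (U : VSet n) {x : Fin n} → U x ≡ true → card U ≡ suc (card (U ⊖ x))
card-⊖ {n} U {x} h = trans (card-split U ⟪ x ⟫) (cong₂ _+_
  (trans (card-cong {U = U ⊓ ⟪ x ⟫} {⟪ x ⟫} (λ y e → ∧-elimʳ {U y} e)
     (λ y e → ∧-intro (subst (λ z → U z ≡ true) (sym (eqF⇒≡ e)) h) e)) (card-⟪⟫ x))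
  (cnt-cong (U ∖ ⟪ x ⟫) (U ⊖ x) (allFin n) (λ y → ∧-comm (U y) _)))

card-⊕ : (U : VSet n) {x : Fin n} → U x ≡ false → card (U ⊕ x) ≡ suc (card U)
card-⊕ {n} U {x} h = trans (card-⊖ (U ⊕ x) (⊕-new U x)) (cong suc (card-cong f g))
  where
  f : ((U ⊕ x) ⊖ x) ⊑ U
  f y e with ⊕-elim U x (⊖-⊑ (U ⊕ x) x y e)
  ... | inj₁ q = ⊥-elim (⊖-≢ (U ⊕ x) e q)
  ... | inj₂ q = q
  g : U ⊑ ((U ⊕ x) ⊖ x)
  g y e = ⊖-intro (U ⊕ x) (λ { refl → true≢false e h }) (⊕-old U x y e)

card-∪ : {U W : VSet n} → (∀ x → U x ≡ true → W x ≡ true → ⊥) → card (U ∪ W) ≡ card U + card W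
card-∪ {n} {U} {W} d = trans (card-split (U ∪ W) U) (cong₂ _+_
  (card-cong (λ x e → ∧-elimʳ {U x ∨ W x} e) (λ x e → ∧-intro (∨-introˡ e) e))
  (card-cong f (λ x e → ∖-intro (U ∪ W) U (∨-introʳ {U x} e) (≢true⇒false (λ q → d x q e)))))
  where
  f : ((U ∪ W) ∖ U) ⊑ W
  f x e with ∨-elim {U x} (∖-⊑ (U ∪ W) U x e)
  ... | inj₁ q = ⊥-elim (true≢false q (∖-out (U ∪ W) U e))
  ... | inj₂ q = q

-- Walks and simple paths

_∣_ : Graph n → VSet n → Graph n
(E ∣ U) x y = (U x ∧ U y) ∧ E x y

Symm : Graph n → Set
Symm E = ∀ x y → E x y ≡ true → E y x ≡ true

data Walk {n} (E : Graph n) : Fin n → Fin n → Set where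
  nil : ∀ {x} → Walk E x x
  cons : ∀ {x y z} → E x y ≡ true → Walk E y z → Walk E x z

module _ {E : Graph n} where

  _◅◅_ : ∀ {x y z} → Walk E x y → Walk E y z → Walk E x z
  nil ◅◅ q = q
  cons e p ◅◅ q = cons e (p ◅◅ q)

  walk-rev : Symm E → ∀ {x y} → Walk E x y → Walk E y x
  walk-rev s nil = nil
  walk-rev s (cons e p) = walk-rev s p ◅◅ cons (s _ _ e) nil

  walk-inv : (P : Fin n → Set) → (∀ {x y} → E x y ≡ true → P x → P y) →
    ∀ {x y} → Walk E x y → P x → P y
  walk-inv P f nil h = h
  walk-inv P f (cons e p) h = walk-inv P f p (f e h)

  walk-cross : (P : VSet n) → ∀ {x y} → Walk E x y → P x ≡ true → P y ≡ false →
    ∃ λ u → ∃ λ w → (E u w ≡ true) × (P u ≡ true) × (P w ≡ false)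
  walk-cross P nil a b = ⊥-elim (true≢false a b)
  walk-cross P (cons {x} {y} e p) a b with true? (P y)
  ... | inj₁ c = walk-cross P p c b
  ... | inj₂ c = x , y , e , a , c

walk-map : {E E′ : Graph n} → (∀ {x y} → E x y ≡ true → E′ x y ≡ true) →
  ∀ {x y} → Walk E x y → Walk E′ x y
walk-map f nil = nil
walk-map f (cons e p) = cons (f e) (walk-map f p)

walk-map-inv : {E E′ : Graph n} (P : Fin n → Set) →
  (∀ {x y} → E x y ≡ true → P x → (E′ x y ≡ true) × P y) →
  ∀ {x y} → P x → Walk E x y → Walk E′ x y
walk-map-inv P f h nil = nil
walk-map-inv P f h (cons e p) with f e h
... | e′ , h′ = cons e′ (walk-map-inv P f h′ p)

∣-intro : (E : Graph n) (U : VSet n) {x y : Fin n} →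
  U x ≡ true → U y ≡ true → E x y ≡ true → (E ∣ U) x y ≡ true
∣-intro E U a b c = ∧-intro (∧-intro a b) c

∣-elim : (E : Graph n) (U : VSet n) {x y : Fin n} → (E ∣ U) x y ≡ true →
  (U x ≡ true) × (U y ≡ true) × (E x y ≡ true)
∣-elim E U {x} {y} h with ∧-elim {U x ∧ U y} h
... | a , b with ∧-elim {U x} a
... | c , d = c , d , b

∣-mono : {E : Graph n} {U W : VSet n} → U ⊑ W → ∀ {x y} → Walk (E ∣ U) x y → Walk (E ∣ W) x y
∣-mono {E = E} {U} {W} f = walk-map λ e → let a , b , c = ∣-elim E U e in ∣-intro E W (f _ a) (f _ b) c

∣-symm : {E : Graph n} (U : VSet n) → Symm E → Symm (E ∣ U)
∣-symm {E = E} U s x y h with ∣-elim E U h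
... | a , b , c = ∣-intro E U b a (s x y c)

data Path {n} (E : Graph n) : Fin n → Fin n → List (Fin n) → Set where
  stop : ∀ x → Path E x x (x ∷ [])
  step : ∀ {x y z ps} → E x y ≡ true → x ∉ ps → Path E y z ps → Path E x z (x ∷ ps)

∉⇒All≢ : {x : A} {xs : List A} → x ∉ xs → All (x ≢_) xs
∉⇒All≢ {xs = []} h = []
∉⇒All≢ {xs = y ∷ xs} h = (λ e → h (here e)) ∷ ∉⇒All≢ (h ∘ there)

module _ {E : Graph n} where

  path-unique : ∀ {x y ps} → Path E x y ps → Unique ps
  path-unique (stop x) = [] ∷ []
  path-unique (step e ne p) = ∉⇒All≢ ne ∷ path-unique p

  path-head : ∀ {x y ps} → Path E x y ps → x ∈ ps
  path-head (stop x) = here refl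
  path-head (step e ne p) = here refl

  path-last : ∀ {x y ps} → Path E x y ps → y ∈ ps
  path-last (stop x) = here refl
  path-last (step e ne p) = there (path-last p)

  path-suffix : ∀ {x y z ps} → Path E y z ps → x ∈ ps →
    ∃ λ qs → Path E x z qs × (∀ {w} → w ∈ qs → w ∈ ps)
  path-suffix p@(stop x) (here refl) = _ , p , id
  path-suffix p@(step e ne q) (here refl) = _ , p , id
  path-suffix (step e ne q) (there m) with path-suffix q m
  ... | qs , r , f = qs , r , there ∘ f

  walk⇒path : ∀ {x y} → Walk E x y → ∃ λ ps → Path E x y ps
  walk⇒path nil = _ , stop _
  walk⇒path (cons {x} e p) with walk⇒path p
  ... | ps , q with Any.any? (x ≟_) ps
  ... | yes m = let qs , r , _ = path-suffix q m in qs , r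
  ... | no ne = _ , step e ne q

  path-length : ∀ {x y ps} → Path E x y ps → length ps ≤ n
  path-length p = ≤-trans (Unique-⊆-length (path-unique p) (λ {x} _ → ∈-allFin x))
    (≤-reflexive (length-tabulate id))

  path-avoid : ∀ {x y w ps} → Path E x y ps → w ∉ ps → Walk (E ∣ (full ⊖ w)) x y
  path-avoid (stop x) nw = nil
  path-avoid {w = w} (step e nx p) nw = cons
    (∣-intro E (full ⊖ w) (⊖-intro full (λ { refl → nw (here refl) }) refl)
      (⊖-intro full (λ { refl → nw (there (path-head p)) }) refl) e)
    (path-avoid p (nw ∘ there))

  -- A simple path passes through `w` at most once, so one of its two halves at `z` avoids `w`.
  split-walks : Symm E → ∀ {x y z w ps} → Path E x y ps → z ∈ ps → w ≢ z →
    ((x ≢ w) × Walk (E ∣ (full ⊖ w)) z x) ⊎ ((y ≢ w) × Walk (E ∣ (full ⊖ w)) z y)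
  split-walks s (stop x) (here refl) ne = inj₁ (ne ∘ sym , nil)
  split-walks s (step e nx p) (here refl) ne = inj₁ (ne ∘ sym , nil)
  split-walks s {w = w} (step {x} e nx p) (there m) ne with x ≟ w
  ... | yes refl = let qs , q , f = path-suffix p m in
        inj₂ ((λ { refl → nx (path-last p) }) , path-avoid q (nx ∘ f))
  ... | no a with split-walks s p m ne
  ... | inj₂ q = inj₂ q
  ... | inj₁ (b , q) = inj₁ (a , q ◅◅ cons (∣-intro E (full ⊖ w) (⊖-intro full b refl) (⊖-intro full a refl) (s _ _ e)) nil)

-- Walks and the Boolean reachability of the definitions

adjIn-elim : (ES : List (Fin n × Fin n)) {u w : Fin n} → adjIn ES u w ≡ true →
  ((u , w) ∈ ES) ⊎ ((w , u) ∈ ES)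
adjIn-elim ES {u} {w} h with any-elim _ ES h
... | (a , b) , m , e with ∨-elim {eqF a u ∧ eqF b w} e
... | inj₁ q with ∧-elim {eqF a u} q
... | c , d = inj₁ (subst₂ (λ i j → (i , j) ∈ ES) (eqF⇒≡ c) (eqF⇒≡ d) m)
adjIn-elim ES {u} {w} h | (a , b) , m , e | inj₂ q with ∧-elim {eqF a w} q
... | c , d = inj₂ (subst₂ (λ i j → (i , j) ∈ ES) (eqF⇒≡ c) (eqF⇒≡ d) m)

adjIn-introˡ : {ES : List (Fin n × Fin n)} {u w : Fin n} → (u , w) ∈ ES → adjIn ES u w ≡ true
adjIn-introˡ {u = u} {w} m = any-intro _ m (∨-introˡ (∧-intro (eqF-refl u) (eqF-refl w)))

adjIn-introʳ : {ES : List (Fin n × Fin n)} {u w : Fin n} → (w , u) ∈ ES → adjIn ES u w ≡ true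
adjIn-introʳ {u = u} {w} m = any-intro _ m
  (∨-introʳ {eqF w u ∧ eqF u w} (∧-intro (eqF-refl w) (eqF-refl u)))

adjIn-symm : (ES : List (Fin n × Fin n)) → Symm (adjIn ES)
adjIn-symm ES x y h with adjIn-elim ES h
... | inj₁ m = adjIn-introʳ m
... | inj₂ m = adjIn-introˡ m

reach-sound : (ES : List (Fin n × Fin n)) (m : ℕ) {u v : Fin n} → reach ES m u v ≡ true → Walk (adjIn ES) u v
reach-sound ES zero h rewrite eqF⇒≡ h = nil
reach-sound ES (suc m) {u} {v} h with ∨-elim {reach ES m u v} h
... | inj₁ q = reach-sound ES m q
... | inj₂ q with any-elim _ (allFin _) q
... | w , _ , e with ∧-elim {adjIn ES u w} e
... | a , b = cons a (reach-sound ES m b)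

reach-refl : (ES : List (Fin n × Fin n)) (m : ℕ) (u : Fin n) → reach ES m u u ≡ true
reach-refl ES zero u = eqF-refl u
reach-refl ES (suc m) u = ∨-introˡ (reach-refl ES m u)

-- A path listed by `m + 1` vertices makes `m` steps; hence the `suc` in the length bound.
reach-complete : (ES : List (Fin n × Fin n)) (m : ℕ) {u v : Fin n} {ps : List (Fin n)} →
  Path (adjIn ES) u v ps → length ps ≤ suc m → reach ES m u v ≡ true
reach-complete ES m (stop x) l = reach-refl ES m x
reach-complete ES zero (step e nx (stop x)) (s≤s ())
reach-complete ES zero (step e nx (step _ _ _)) (s≤s ())
reach-complete ES (suc m) {u} {v} (step {y = y} e nx p) (s≤s l) = ∨-introʳ {reach ES m u v}
  (any-intro _ (∈-allFin y) (∧-intro e (reach-complete ES m p l)))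

-- A walk shortens to a simple path, which has at most `n` vertices, so depth `n` suffices.
walk⇒reach : (ES : List (Fin n × Fin n)) {u v : Fin n} → Walk (adjIn ES) u v → reach ES n u v ≡ true
walk⇒reach {n} ES p with walk⇒path p
... | ps , q = reach-complete ES n q (m≤n⇒m≤1+n (path-length q))

connectedᵇ-elim : {VS : List (Fin n)} {ES : List (Fin n × Fin n)} → connectedᵇ VS ES ≡ true →
  (∃ λ x → x ∈ VS) × (∀ {u v} → u ∈ VS → v ∈ VS → Walk (adjIn ES) u v)
connectedᵇ-elim {n} {x ∷ VS} {ES} h = (x , here refl) ,
  λ a b → reach-sound ES n (all-elim _ (all-elim _ h a) b)

connectedᵇ-intro : {VS : List (Fin n)} {ES : List (Fin n × Fin n)} {x : Fin n} → x ∈ VS →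
  (∀ {u v} → u ∈ VS → v ∈ VS → Walk (adjIn ES) u v) → connectedᵇ VS ES ≡ true
connectedᵇ-intro {VS = VS@(_ ∷ _)} {ES} _ h =
  all-intro _ VS λ a → all-intro _ VS λ b → walk⇒reach ES (h a b)

-- Lists the related pairs so that `reach` also decides walks in graphs such as `G ∣ U`. This is
-- needed because a block, being a `VSet`, has to be a Boolean predicate.
relEdges : Graph n → List (Fin n × Fin n)
relEdges {n} E = filterᵇ (λ p → E (proj₁ p) (proj₂ p)) (cartesianProduct (allFin n) (allFin n))

walkᵇ : Graph n → Fin n → Fin n → Bool
walkᵇ {n} E x y = reach (relEdges E) n x y

∈-relEdges⁻ : {E : Graph n} {u w : Fin n} → (u , w) ∈ relEdges E → E u w ≡ true
∈-relEdges⁻ {n} m = proj₂ (∈-filterᵇ⁻ _ {xs = cartesianProduct (allFin n) (allFin n)} m)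

∈-relEdges⁺ : {E : Graph n} {u w : Fin n} → E u w ≡ true → (u , w) ∈ relEdges E
∈-relEdges⁺ {u = u} {w} h = ∈-filterᵇ⁺ _ (∈-cartesianProduct⁺ (∈-allFin u) (∈-allFin w)) h

walkᵇ-sound : {E : Graph n} → Symm E → ∀ {x y} → walkᵇ E x y ≡ true → Walk E x y
walkᵇ-sound {n} {E} s h = walk-map (λ e → [ ∈-relEdges⁻ , (λ m → s _ _ (∈-relEdges⁻ m)) ]′ (adjIn-elim (relEdges E) e))
  (reach-sound (relEdges E) n h)

walkᵇ-complete : {E : Graph n} → ∀ {x y} → Walk E x y → walkᵇ E x y ≡ true
walkᵇ-complete {E = E} p = walk⇒reach (relEdges E) 
  (walk-map {E′ = adjIn (relEdges E)} (λ {x} {y} e → adjIn-introˡ {ES = relEdges E} {x} {y} (∈-relEdges⁺ {E = E} e)) p)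

-- The connected subgraphs counted by F

∈-edges⁻ : {G : Graph n} {u w : Fin n} → (u , w) ∈ edges G → (toℕ u < toℕ w) × (G u w ≡ true)
∈-edges⁻ {n} {G} {u} {w} m with ∈-filterᵇ⁻ _ {xs = cartesianProduct (allFin n) (allFin n)} m
... | _ , h with ∧-elim {toℕ u <ᵇ toℕ w} h
... | a , b = <ᵇ⇒< (toℕ u) (toℕ w) (≡⇒T a) , b

∈-edges⁺ : {G : Graph n} {u w : Fin n} → toℕ u < toℕ w → G u w ≡ true → (u , w) ∈ edges G
∈-edges⁺ {u = u} {w} l h = ∈-filterᵇ⁺ _ (∈-cartesianProduct⁺ (∈-allFin u) (∈-allFin w))
  (∧-intro (T⇒≡ (<⇒<ᵇ l)) h)

elemF-elim : {x : Fin n} {xs : List (Fin n)} → elemF x xs ≡ true → x ∈ xs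
elemF-elim {xs = xs} h with any-elim _ xs h
... | y , m , e rewrite eqF⇒≡ e = m

elemF-intro : {x : Fin n} {xs : List (Fin n)} → x ∈ xs → elemF x xs ≡ true
elemF-intro {x = x} m = any-intro _ m (eqF-refl x)

∈-sublists⁻ : {xs ys : List A} → ys ∈ sublists xs → ∀ {y} → y ∈ ys → y ∈ xs
∈-sublists⁻ {xs = []} (here refl) ()
∈-sublists⁻ {xs = x ∷ xs} m {y} my with ∈-++⁻ (sublists xs) m
... | inj₁ q = there (∈-sublists⁻ q my)
... | inj₂ q with ∈-map⁻ (x ∷_) q
... | zs , mz , refl with my
... | here e = here e
... | there r = there (∈-sublists⁻ mz r)

filterᵇ∈sublists : (p : A → Bool) (xs : List A) → filterᵇ p xs ∈ sublists xs
filterᵇ∈sublists p [] = here refl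
filterᵇ∈sublists p (x ∷ xs) with p x
... | true = ∈-++⁺ʳ (sublists xs) (∈-map⁺ (x ∷_) (filterᵇ∈sublists p xs))
... | false = ∈-++⁺ˡ (filterᵇ∈sublists p xs)

sublists-unique : {xs : List A} → Unique xs → Unique (sublists xs)
sublists-unique {xs = []} u = [] ∷ []
sublists-unique {xs = x ∷ xs} (ux ∷ u) = Uniq.++⁺ (sublists-unique u)
  (Uniq.map⁺ (λ { refl → refl }) (sublists-unique u)) disj
  where
  disj : ∀ {ys} → (ys ∈ sublists xs) × (ys ∈ map (x ∷_) (sublists xs)) → ⊥
  disj (a , b) with ∈-map⁻ (x ∷_) b
  ... | zs , mz , refl = All.lookup ux (∈-sublists⁻ a (here refl)) refl

-- A sublist inherits the order of `xs`, so in the absence of repetitions its members determine it.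
sublists-ext : {xs ys zs : List A} → Unique xs → ys ∈ sublists xs → zs ∈ sublists xs →
  (∀ {y} → y ∈ ys → y ∈ zs) → (∀ {y} → y ∈ zs → y ∈ ys) → ys ≡ zs
sublists-ext {xs = []} u (here refl) (here refl) f g = refl
sublists-ext {xs = x ∷ xs} (ux ∷ u) a b f g with ∈-++⁻ (sublists xs) a | ∈-++⁻ (sublists xs) b
... | inj₁ p | inj₁ q = sublists-ext u p q f g
... | inj₁ p | inj₂ q with ∈-map⁻ (x ∷_) q
... | zs′ , mz , refl = ⊥-elim (All.lookup ux (∈-sublists⁻ p (g (here refl))) refl)
sublists-ext {xs = x ∷ xs} (ux ∷ u) a b f g | inj₂ p | inj₁ q with ∈-map⁻ (x ∷_) p
... | ys′ , my , refl = ⊥-elim (All.lookup ux (∈-sublists⁻ q (f (here refl))) refl)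
sublists-ext {xs = x ∷ xs} (ux ∷ u) a b f g | inj₂ p | inj₂ q with ∈-map⁻ (x ∷_) p | ∈-map⁻ (x ∷_) q
... | ys′ , my , refl | zs′ , mz , refl = cong (x ∷_) (sublists-ext u my mz
  (λ m → strip (∈-sublists⁻ my m) (f (there m))) (λ m → strip (∈-sublists⁻ mz m) (g (there m))))
  where
  strip : ∀ {y ws} → y ∈ xs → y ∈ (x ∷ ws) → y ∈ ws
  strip m (here refl) = ⊥-elim (All.lookup ux m refl)
  strip m (there q) = q

Sub : ℕ → Set
Sub n = List (Fin n) × List (Fin n × Fin n)

V : Sub n → VSet n
V s x = elemF x (proj₁ s)

E : Sub n → Graph n
E s = adjIn (proj₂ s)

conn : Sub n → Bool
conn s = connectedᵇ (proj₁ s) (proj₂ s)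

conn-elim : (s : Sub n) → conn s ≡ true →
  (∃ λ x → V s x ≡ true) × (∀ {u v} → V s u ≡ true → V s v ≡ true → Walk (E s) u v)
conn-elim s h with connectedᵇ-elim {VS = proj₁ s} h
... | (x , m) , f = (x , elemF-intro m) , λ a b → f (elemF-elim a) (elemF-elim b)

conn-intro : (s : Sub n) {x : Fin n} → V s x ≡ true →
  (∀ {u v} → V s u ≡ true → V s v ≡ true → Walk (E s) u v) → conn s ≡ true
conn-intro s a f = connectedᵇ-intro {VS = proj₁ s} {ES = proj₂ s} (elemF-elim a) λ p q → f (elemF-intro p) (elemF-intro q)

module Universe {n : ℕ} (G : Graph n) (G-simple : IsSimple G) where

  G-sym : Symm G
  G-sym x y h = trans (sym (proj₁ G-simple x y)) h

  G-irr : ∀ {x y} → G x y ≡ true → x ≢ y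
  G-irr h refl = true≢false h (proj₂ G-simple _)

  Us : List (Sub n)
  Us = subgraphs G

  private
    inner : List (Fin n) → List (Fin n × Fin n)
    inner VS = filterᵇ (λ e → elemF (proj₁ e) VS ∧ elemF (proj₂ e) VS) (edges G)

    Us⁻ : ∀ {s} → s ∈ Us → (proj₁ s ∈ sublists (allFin n)) × (proj₂ s ∈ sublists (inner (proj₁ s)))
    Us⁻ m with find (∈-concatMap⁻ (λ VS → map (VS ,_) (sublists (inner VS))) {xs = sublists (allFin n)} m)
    ... | VS , a , b with ∈-map⁻ (VS ,_) b
    ... | ES , c , refl = a , c

    Us⁺ : ∀ {VS ES} → VS ∈ sublists (allFin n) → ES ∈ sublists (inner VS) → (VS , ES) ∈ Us
    Us⁺ {VS} a b = ∈-concatMap⁺ (λ VS → map (VS ,_) (sublists (inner VS))) {xs = sublists (allFin n)}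
      (lose a (∈-map⁺ (VS ,_) b))

    inner⁻ : ∀ {VS u w} → (u , w) ∈ inner VS →
      (toℕ u < toℕ w) × (G u w ≡ true) × (elemF u VS ≡ true) × (elemF w VS ≡ true)
    inner⁻ {VS} {u} m with ∈-filterᵇ⁻ _ {xs = edges G} m
    ... | a , h with ∈-edges⁻ {G = G} a | ∧-elim {elemF u VS} h
    ... | l , g | p , q = l , g , p , q

    edges-unique : Unique (edges G)
    edges-unique = Uniq.filter⁺ _ (Uniq.cartesianProduct⁺ (Uniq.allFin⁺ n) (Uniq.allFin⁺ n))

    inner-unique : ∀ VS → Unique (inner VS)
    inner-unique VS = Uniq.filter⁺ _ edges-unique

    -- Edge lists contain only pairs with increasing ends, so the symmetric relation `adjIn` does
    -- not lose the orientation.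
    E⇒∈ : ∀ {VS ES u w} → ES ∈ sublists (inner VS) → toℕ u < toℕ w → adjIn ES u w ≡ true → (u , w) ∈ ES
    E⇒∈ {VS} {ES} m l h with adjIn-elim ES h
    ... | inj₁ q = q
    ... | inj₂ q = ⊥-elim (<-asym l (proj₁ (inner⁻ {VS} (∈-sublists⁻ m q))))

  E-valid : ∀ {s u w} → s ∈ Us → E s u w ≡ true → (G u w ≡ true) × (V s u ≡ true) × (V s w ≡ true)
  E-valid {s} m h with adjIn-elim (proj₂ s) h
  ... | inj₁ q = let _ , a , b , c = inner⁻ {proj₁ s} (∈-sublists⁻ (proj₂ (Us⁻ m)) q) in a , b , c
  ... | inj₂ q = let _ , a , b , c = inner⁻ {proj₁ s} (∈-sublists⁻ (proj₂ (Us⁻ m)) q) in G-sym _ _ a , c , b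

  E-symm : ∀ s → Symm (E {n} s)
  E-symm s = adjIn-symm (proj₂ s)

  Us-unique : Unique Us
  Us-unique = go (sublists-unique (Uniq.allFin⁺ n))
    where
    f = λ VS → map (VS ,_) (sublists (inner VS))
    go : ∀ {xs} → Unique xs → Unique (concatMap f xs)
    go {[]} _ = []
    go {VS ∷ xs} (ux ∷ u) = Uniq.++⁺ (Uniq.map⁺ (λ { refl → refl }) (sublists-unique (inner-unique VS)))
      (go u) disj
      where
      disj : ∀ {s} → (s ∈ f VS) × (s ∈ concatMap f xs) → ⊥
      disj (a , b) with ∈-map⁻ (VS ,_) a | find (∈-concatMap⁻ f {xs = xs} b)
      ... | _ , _ , refl | VS′ , m , c with ∈-map⁻ (VS′ ,_) c
      ... | _ , _ , refl = All.lookup ux m refl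

  Us-ext : ∀ {s t} → s ∈ Us → t ∈ Us → (∀ x → V s x ≡ V t x) → (∀ x y → E s x y ≡ E t x y) → s ≡ t
  Us-ext {VS , ES} {VT , ET} a b f g with Us⁻ a | Us⁻ b
  ... | a₁ , a₂ | b₁ , b₂ with sublists-ext (Uniq.allFin⁺ n) a₁ b₁
        (λ {x} m → elemF-elim (trans (sym (f x)) (elemF-intro m)))
        (λ {x} m → elemF-elim (trans (f x) (elemF-intro m)))
  ... | refl = cong (VS ,_) (sublists-ext (inner-unique VS) a₂ b₂
    (λ {e} m → E⇒∈ {VS} b₂ (proj₁ (inner⁻ {VS} (∈-sublists⁻ a₂ m))) (trans (sym (g (proj₁ e) (proj₂ e))) (adjIn-introˡ m)))
    (λ {e} m → E⇒∈ {VS} a₂ (proj₁ (inner⁻ {VS} (∈-sublists⁻ b₂ m))) (trans (g (proj₁ e) (proj₂ e)) (adjIn-introˡ m))))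

  -- Together with `Us-ext` this identifies the listed subgraphs with pairs of a vertex predicate
  -- and a symmetric edge predicate, so that later counts can argue about predicates and leave the
  -- lists aside.
  Us-make : (U : VSet n) (I : Graph n) → Symm I →
    (∀ {u w} → I u w ≡ true → (G u w ≡ true) × (U u ≡ true) × (U w ≡ true)) →
    ∃ λ s → (s ∈ Us) × (∀ x → V s x ≡ U x) × (∀ x y → E s x y ≡ I x y)
  Us-make U I s f = (VS , ES) , Us⁺ (filterᵇ∈sublists U (allFin n)) (filterᵇ∈sublists J (inner VS)) ,
    (λ x → bool-ext (λ h → proj₂ (∈-filterᵇ⁻ U {xs = allFin n} (elemF-elim h))) (inV x)) ,
    λ x y → bool-ext (to x y) (from x y)
    where
    J : Fin n × Fin n → Bool
    J e = I (proj₁ e) (proj₂ e)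
    VS = filterᵇ U (allFin n)
    ES = filterᵇ J (inner VS)
    inV : ∀ x → U x ≡ true → elemF x VS ≡ true
    inV x h = elemF-intro (∈-filterᵇ⁺ U (∈-allFin x) h)
    to : ∀ x y → adjIn ES x y ≡ true → I x y ≡ true
    to x y h with adjIn-elim ES h
    ... | inj₁ m = proj₂ (∈-filterᵇ⁻ J {xs = inner VS} m)
    ... | inj₂ m = s _ _ (proj₂ (∈-filterᵇ⁻ J {xs = inner VS} m))
    half : ∀ x y → toℕ x < toℕ y → I x y ≡ true → (x , y) ∈ ES
    half x y l h with f h
    ... | a , b , c = ∈-filterᵇ⁺ J (∈-filterᵇ⁺ _ (∈-edges⁺ l a) (∧-intro (inV x b) (inV y c))) h
    from : ∀ x y → I x y ≡ true → adjIn ES x y ≡ true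
    from x y h with <-cmp (toℕ x) (toℕ y)
    ... | tri< l _ _ = adjIn-introˡ (half x y l h)
    ... | tri≈ _ e _ = ⊥-elim (G-irr (proj₁ (f h)) (toℕ-injective e))
    ... | tri> _ _ l = adjIn-introʳ (half y x l (s _ _ h))

  -- Vertex sets inducing connected subgraphs

  -- The empty set satisfies this vacuously; where a nonempty set is meant, an element is passed
  -- separately.
  Conn : VSet n → Set
  Conn U = ∀ {x y} → U x ≡ true → U y ≡ true → Walk (G ∣ U) x y

  Conn-cong : {U W : VSet n} → U ⊑ W → W ⊑ U → Conn U → Conn W
  Conn-cong f g c a b = ∣-mono f (c (g _ a) (g _ b))

  Conn-⟪⟫ : ∀ x → Conn ⟪ x ⟫
  Conn-⟪⟫ x a b rewrite eqF⇒≡ a | eqF⇒≡ b = nil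

  Conn-⊕ : {K : VSet n} {x z : Fin n} → Conn K → K z ≡ true → G z x ≡ true → Conn (K ⊕ x)
  Conn-⊕ {K} {x} {z} c kz g a b = toz a ◅◅ walk-rev (∣-symm (K ⊕ x) G-sym) (toz b)
    where
    toz : ∀ {y} → (K ⊕ x) y ≡ true → Walk (G ∣ (K ⊕ x)) y z
    toz h with ⊕-elim K x h
    ... | inj₁ refl = cons (∣-intro G (K ⊕ x) h (⊕-old K x z kz) (G-sym _ _ g)) nil
    ... | inj₂ q = ∣-mono (⊕-old K x) (c q kz)

  Conn-∪ : {K W : VSet n} {z : Fin n} → Conn K → Conn W → K z ≡ true → W z ≡ true → Conn (K ∪ W)
  Conn-∪ {K} {W} {z} c d kz wz a b = toz a ◅◅ walk-rev (∣-symm (K ∪ W) G-sym) (toz b)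
    where
    toz : ∀ {y} → (K ∪ W) y ≡ true → Walk (G ∣ (K ∪ W)) y z
    toz {y} h with ∨-elim {K y} h
    ... | inj₁ q = ∣-mono {U = K} {W = K ∪ W} (λ x e → ∨-introˡ e) (c q kz)
    ... | inj₂ q = ∣-mono {U = W} {W = K ∪ W} (λ x e → ∨-introʳ {K x} e) (d q wz)

  boundary : {U K : VSet n} → Conn U → K ⊑ U → ∀ {z y} → K z ≡ true → U y ≡ true → K y ≡ false →
    ∃ λ u → ∃ λ x → (K u ≡ true) × (U x ≡ true) × (K x ≡ false) × (G u x ≡ true)
  boundary {U} {K} c f kz uy ky with walk-cross K (c (f _ kz) uy) kz ky
  ... | u , x , e , a , b = let _ , p , q = ∣-elim G U e in u , x , a , p , b , q

  adjIn-edges : ∀ {u w} → adjIn (edges G) u w ≡ true → G u w ≡ true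
  adjIn-edges h with adjIn-elim (edges G) h
  ... | inj₁ m = proj₂ (∈-edges⁻ {G = G} m)
  ... | inj₂ m = G-sym _ _ (proj₂ (∈-edges⁻ {G = G} m))

  Connected⇒Conn : Connected G → Conn full
  Connected⇒Conn h _ _ = walk-map (λ e → adjIn-edges e)
    (proj₂ (connectedᵇ-elim {VS = allFin n} (T⇒≡ h)) (∈-allFin _) (∈-allFin _))

  cut : VSet n
  cut = isCutᵇ G

  noncut⇒Conn : ∀ {v} → cut v ≡ false → Conn (full ⊖ v)
  noncut⇒Conn {v} h {x} {y} a b = walk-map get (proj₂ (connectedᵇ-elim {VS = filterᵇ P (allFin n)} {ES = ES} h′)
      (∈-filterᵇ⁺ P (∈-allFin x) (∧-elimˡ a)) (∈-filterᵇ⁺ P (∈-allFin y) (∧-elimˡ b)))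
    where
    P : Fin n → Bool
    P u = not (eqF u v)
    ES = filterᵇ (λ e → P (proj₁ e) ∧ P (proj₂ e)) (edges G)
    h′ : connectedᵇ (filterᵇ P (allFin n)) ES ≡ true
    h′ = ¬-not (λ e → true≢false (cong not e) h)
    mem : ∀ {u w} → (u , w) ∈ ES → (G ∣ (full ⊖ v)) u w ≡ true
    mem {u} {w} m with ∈-filterᵇ⁻ _ {xs = edges G} m
    ... | p , q with ∧-elim {P u} q
    ... | r , s = ∣-intro G (full ⊖ v) (∧-intro r refl) (∧-intro s refl) (proj₂ (∈-edges⁻ {G = G} p))
    get : ∀ {u w} → adjIn ES u w ≡ true → (G ∣ (full ⊖ v)) u w ≡ true
    get e with adjIn-elim ES e
    ... | inj₁ m = mem m
    ... | inj₂ m = ∣-symm (full ⊖ v) G-sym _ _ (mem m)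

  -- The witness `z` is required because `connectedᵇ` rejects the empty vertex list: in a graph with
  -- one vertex that vertex counts as cut.
  Conn⇒noncut : ∀ {v z} → z ≢ v → Conn (full ⊖ v) → cut v ≡ false
  Conn⇒noncut {v} {z} ne c = cong not (connectedᵇ-intro {VS = filterᵇ P (allFin n)} {ES = ES}
      (∈-filterᵇ⁺ P (∈-allFin z) (not-intro (≢⇒eqF ne)))
      λ a b → walk-map put (c (in′ a) (in′ b)))
    where
    P : Fin n → Bool
    P u = not (eqF u v)
    ES = filterᵇ (λ e → P (proj₁ e) ∧ P (proj₂ e)) (edges G)
    in′ : ∀ {u} → u ∈ filterᵇ P (allFin n) → (full ⊖ v) u ≡ true
    in′ m = ∧-intro (proj₂ (∈-filterᵇ⁻ P {xs = allFin n} m)) refl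
    half : ∀ {u w} → toℕ u < toℕ w → (G ∣ (full ⊖ v)) u w ≡ true → (u , w) ∈ ES
    half {u} {w} l e with ∣-elim G (full ⊖ v) e
    ... | p , q , g = ∈-filterᵇ⁺ _ (∈-edges⁺ l g) (∧-intro (∧-elimˡ {not (eqF u v)} p) (∧-elimˡ {not (eqF w v)} q))
    put : ∀ {u w} → (G ∣ (full ⊖ v)) u w ≡ true → adjIn ES u w ≡ true
    put {u} {w} e with <-cmp (toℕ u) (toℕ w)
    ... | tri< l _ _ = adjIn-introˡ (half l e)
    ... | tri≈ _ q _ = ⊥-elim (G-irr (proj₂ (proj₂ (∣-elim G (full ⊖ v) e))) (toℕ-injective q))
    ... | tri> _ _ l = adjIn-introʳ (half l (∣-symm (full ⊖ v) G-sym _ _ e))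

-- Growing connected sets

-- The binomial coefficient "`t` choose 2".
ch2 : ℕ → ℕ
ch2 zero = 0
ch2 (suc t) = t + ch2 t

-- Equal to `h * (h + 3) / 2`, the number of connected subgraphs of a path on `h + 1` vertices
-- without one fixed single vertex. The increment `2 + h` counts the subpaths that end at a newly
-- appended vertex.
tri′ : ℕ → ℕ
tri′ zero = 0
tri′ (suc h) = tri′ h + (2 + h)

-- val K D behaves like the number of sets S with K ⊆ S and S ∩ D = ∅.
record Valuation (n : ℕ) : Set where
  field
    val : VSet n → VSet n → ℕ
    anti : ∀ {K K′ D D′} → K ⊑ K′ → D ⊑ D′ → val K′ D′ ≤ val K D
    -- Superadditivity in place of equality: valuations serve only for lower bounds.
    split : ∀ K D x → val (K ⊕ x) D + val K (D ⊕ x) ≤ val K D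

card-∖-⊕ : (U K : VSet n) {x : Fin n} {p : ℕ} → U x ≡ true → K x ≡ false → card (U ∖ K) ≡ suc p →
  card (U ∖ (K ⊕ x)) ≡ p
card-∖-⊕ U K {x} ux kx e = suc-injective (trans (cong suc (card-cong f g))
  (trans (sym (card-⊖ (U ∖ K) (∖-intro U K ux kx))) e))
  where
  f : (U ∖ (K ⊕ x)) ⊑ ((U ∖ K) ⊖ x)
  f y h = ⊖-intro (U ∖ K)
    (λ { refl → true≢false (⊕-new K x) (∖-out U (K ⊕ x) {x} h) })
    (∖-intro U K (∖-⊑ U (K ⊕ x) y h) (≢true⇒false (λ q → true≢false (⊕-old K x y q) (∖-out U (K ⊕ x) {y} h))))
  g : ((U ∖ K) ⊖ x) ⊑ (U ∖ (K ⊕ x))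
  g y h = ∖-intro U (K ⊕ x) (∖-⊑ U K y (⊖-⊑ (U ∖ K) x y h)) (≢true⇒false λ q → case ⊕-elim K x q of λ
    { (inj₁ r) → ⊖-≢ (U ∖ K) h r
    ; (inj₂ r) → true≢false r (∖-out U K {y} (⊖-⊑ (U ∖ K) x y h)) })

card-⊖-∖ : (U K : VSet n) {x : Fin n} {p : ℕ} → U x ≡ true → K x ≡ false → card (U ∖ K) ≡ suc p →
  card ((U ⊖ x) ∖ K) ≡ p
card-⊖-∖ U K {x} ux kx e = suc-injective (trans (trans (cong suc (card-cong
  {U = (U ⊖ x) ∖ K} {W = (U ∖ K) ⊖ x}
  (λ w q → ⊖-intro (U ∖ K) (⊖-≢ U (∖-⊑ (U ⊖ x) K w q))
    (∖-intro U K (⊖-⊑ U x w (∖-⊑ (U ⊖ x) K w q)) (∖-out (U ⊖ x) K {w} q)))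
  (λ w q → ∖-intro (U ⊖ x) K (⊖-intro U (⊖-≢ (U ∖ K) q) (∖-⊑ U K w (⊖-⊑ (U ∖ K) x w q)))
    (∖-out U K {w} (⊖-⊑ (U ∖ K) x w q)))))
  (sym (card-⊖ (U ∖ K) (∖-intro U K ux kx)))) e)

∖-exists : (U K : VSet n) {p : ℕ} → card (U ∖ K) ≡ suc p → ∃ λ y → (U y ≡ true) × (K y ≡ false)
∖-exists U K e with card-exists (U ∖ K) (≤-trans (s≤s z≤n) (≤-reflexive (sym e)))
... | y , h = y , ∖-⊑ U K y h , ∖-out U K {y} h

module Growth {n : ℕ} (G : Graph n) (G-simple : IsSimple G) where
  open Universe G G-simple

  Proper : VSet n → VSet n → Set
  Proper K K′ = ∃ λ y → (K′ y ≡ true) × (K y ≡ false)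

  -- `val c K′ (W ∖ K′)` plays the part of the number of objects whose trace on `W` is exactly `K′`.
  -- So `N` is a weight guaranteed for each connected set strictly between `K` and `U`, with `U`
  -- included.
  Terminals : Valuation n → VSet n → VSet n → VSet n → ℕ → Set
  Terminals c W K U N = ∀ K′ → Conn K′ → K ⊑ K′ → K′ ⊑ U → Proper K K′ → N ≤ Valuation.val c K′ (W ∖ K′)

  module _ (c : Valuation n) (W : VSet n) where
    open Valuation c

    private
      Proper-⊕ : ∀ {K K′ x} → K x ≡ false → (K ⊕ x) ⊑ K′ → Proper K K′
      Proper-⊕ {K} {K′} {x} kx f = x , f x (⊕-new K x) , kx

      shrink : ∀ {U K x} → U x ≡ true → U ⊑ W →
        val K (W ∖ (U ⊖ x)) ≤ val K ((W ∖ U) ⊕ x)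
      shrink {U} {K} {x} ux UW = anti {K} {K} {(W ∖ U) ⊕ x} {W ∖ (U ⊖ x)} (λ _ q → q) λ w q → case ⊕-elim (W ∖ U) x q of λ
            { (inj₁ refl) → ∖-intro W (U ⊖ x) (UW x ux) (≢true⇒false (λ r → ⊖-≢ U {x} r refl))
            ; (inj₂ r) → ∖-intro W (U ⊖ x) (∖-⊑ W U w r)
                (≢true⇒false (λ s → true≢false (⊖-⊑ U x w s) (∖-out W U {w} r))) }

    -- Adding boundary vertices one at a time produces a chain of connected sets from `K` to `U`.
    -- The trace `K` itself contributes `N₀`, each of the `p` later members contributes `N`.
    grow₁ : ∀ p {U K z} N₀ N → K z ≡ true → Conn U → Conn K → K ⊑ U → U ⊑ W → card (U ∖ K) ≡ p →
      N₀ ≤ val K (W ∖ K) → Terminals c W K U N → N₀ + N * p ≤ val K (W ∖ U)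
    grow₁ zero {U} {K} N₀ N kz cU cK KU UW e h₀ h rewrite *-zeroʳ N | +-identityʳ N₀ =
      ≤-trans h₀ (anti {K} {K} {W ∖ U} {W ∖ K} (λ _ q → q) (λ y q → ∖-intro W K (∖-⊑ W U y q)
        (≢true⇒false (λ r → true≢false (KU y r) (∖-out W U {y} q)))))
    grow₁ (suc p) {U} {K} {z} N₀ N kz cU cK KU UW e h₀ h with ∖-exists U K e
    ... | y , uy , ky with boundary cU KU kz uy ky
    ... | u , x , ku , ux , kx , g = begin
      N₀ + N * suc p ≡⟨ cong (N₀ +_) (*-suc N p) ⟩
      N₀ + (N + N * p) ≡⟨ +-comm N₀ _ ⟩
      N + N * p + N₀ ≤⟨ +-mono-≤ IH avoid ⟩
      val (K ⊕ x) (W ∖ U) + val K ((W ∖ U) ⊕ x) ≤⟨ split K (W ∖ U) x ⟩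
      val K (W ∖ U) ∎
      where
      open ≤-Reasoning
      cKx : Conn (K ⊕ x)
      cKx = Conn-⊕ cK ku g
      KxU : (K ⊕ x) ⊑ U
      KxU = ⊕-⊑ KU ux
      IH : N + N * p ≤ val (K ⊕ x) (W ∖ U)
      IH = grow₁ p N N (⊕-new K x) cU cKx KxU UW (card-∖-⊕ U K ux kx e)
        (h (K ⊕ x) cKx (⊕-old K x) KxU (x , ⊕-new K x , kx))
        (λ K′ cK′ f f′ _ → h K′ cK′ (λ w q → f w (⊕-old K x w q)) f′ (Proper-⊕ kx f))
      avoid : N₀ ≤ val K ((W ∖ U) ⊕ x)
      avoid = ≤-trans h₀ (anti {K} {K} {(W ∖ U) ⊕ x} {W ∖ K} (λ _ q → q) λ w q → case ⊕-elim (W ∖ U) x q of λ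
        { (inj₁ refl) → ∖-intro W K (UW x ux) kx
        ; (inj₂ r) → ∖-intro W K (∖-⊑ W U w r) (≢true⇒false (λ t → true≢false (KU w t) (∖-out W U {w} r))) })

    -- The sets avoiding a non-cut vertex x of U are bounded by grow₁ in U − x; the others by induction.
    grow₂ : ∀ p {U K z} T N₀ N M → K z ≡ true → Conn U → Conn K → K ⊑ U → U ⊑ W → card (U ∖ K) ≡ suc p →
      T ⊑ (U ∖ K) → (∀ x → T x ≡ true → Conn (U ⊖ x)) →
      N₀ ≤ val K (W ∖ K) → Terminals c W K U N → N + M ≤ val U (W ∖ U) →
      N₀ + N * (suc p + ch2 (card T)) + M ≤ val K (W ∖ U)
    grow₂ p {U} {K} {z} T N₀ N M kz cU cK KU UW e TU nc h₀ h top with ∖-exists U K e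
    ... | y , uy , ky with boundary cU KU kz uy ky
    ... | u , x , ku , ux , kx , g = result (true? (T x))
      where
      open ≤-Reasoning
      cKx : Conn (K ⊕ x)
      cKx = Conn-⊕ cK ku g
      KxU : (K ⊕ x) ⊑ U
      KxU = ⊕-⊑ KU ux
      hx : Terminals c W (K ⊕ x) U N
      hx K′ cK′ f f′ _ = h K′ cK′ (λ w q → f w (⊕-old K x w q)) f′ (Proper-⊕ kx f)
      tx : N ≤ val (K ⊕ x) (W ∖ (K ⊕ x))
      tx = h (K ⊕ x) cKx (⊕-old K x) KxU (x , ⊕-new K x , kx)
      -- From `K ⊕ x` on, the starting set is a terminal too, so its weight is `N`. When nothing is
      -- left to add, `top` takes over and supplies the bonus `M` of the full set.
      next : ∀ p T′ → card (U ∖ (K ⊕ x)) ≡ p → T′ ⊑ (U ∖ (K ⊕ x)) → T′ ⊑ T →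
        N * (suc p + ch2 (card T′)) + M ≤ val (K ⊕ x) (W ∖ U)
      next zero T′ e′ T′U T′T = ≤-trans
        (+-monoˡ-≤ M (≤-reflexive (trans (cong (λ q → N * (1 + ch2 q)) T′0) (*-identityʳ N))))
        (≤-trans top (anti {K ⊕ x} {U} {W ∖ U} {W ∖ U} KxU (λ _ q → q)))
        where
        T′0 : card T′ ≡ 0
        T′0 = n≤0⇒n≡0 (≤-trans (card-mono T′U) (≤-reflexive e′))
      next (suc p) T′ e′ T′U T′T = ≤-trans
        (≤-reflexive (cong (_+ M) (*-suc N (suc p + ch2 (card T′)))))
        (grow₂ p T′ N N M (⊕-new K x) cU cKx KxU UW e′ T′U (λ w q → nc w (T′T w q)) tx hx top)
      e′ : card (U ∖ (K ⊕ x)) ≡ p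
      e′ = card-∖-⊕ U K ux kx e
      inside : ∀ {w} → T w ≡ true → w ≢ x → (U ∖ (K ⊕ x)) w ≡ true
      inside {w} q ne = ∖-intro U (K ⊕ x) (∖-⊑ U K w (TU w q)) (≢true⇒false λ r → case ⊕-elim K x r of λ
        { (inj₁ s) → ne s ; (inj₂ s) → true≢false s (∖-out U K {w} (TU w q)) })
      result : (T x ≡ true) ⊎ (T x ≡ false) → N₀ + N * (suc p + ch2 (card T)) + M ≤ val K (W ∖ U)
      result (inj₂ tx′) = begin
        N₀ + N * (suc p + ch2 (card T)) + M ≡⟨ trans (+-assoc N₀ _ M) (+-comm N₀ _) ⟩
        N * (suc p + ch2 (card T)) + M + N₀
          ≤⟨ +-mono-≤ (next p T e′ (λ w q → inside q (λ { refl → true≢false q tx′ })) (λ _ q → q)) avoid ⟩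
        val (K ⊕ x) (W ∖ U) + val K ((W ∖ U) ⊕ x) ≤⟨ split K (W ∖ U) x ⟩
        val K (W ∖ U) ∎
        where
        avoid : N₀ ≤ val K ((W ∖ U) ⊕ x)
        avoid = ≤-trans h₀ (anti {K} {K} {(W ∖ U) ⊕ x} {W ∖ K} (λ _ q → q) λ w q → case ⊕-elim (W ∖ U) x q of λ
          { (inj₁ refl) → ∖-intro W K (UW x ux) kx
          ; (inj₂ r) → ∖-intro W K (∖-⊑ W U w r) (≢true⇒false (λ t → true≢false (KU w t) (∖-out W U {w} r))) })
      result (inj₁ tx′) = begin
        N₀ + N * (suc p + ch2 (card T)) + M
          ≡⟨ cong (λ q → N₀ + N * (suc p + ch2 q) + M) (card-⊖ T tx′) ⟩
        N₀ + N * (suc p + (t + ch2 t)) + M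
          ≤⟨ +-monoˡ-≤ M (+-monoʳ-≤ N₀ (*-monoʳ-≤ N (+-monoʳ-≤ (suc p) (+-monoˡ-≤ (ch2 t) t≤p)))) ⟩
        N₀ + N * (suc p + (p + ch2 t)) + M ≡⟨ rearrange N₀ N p (ch2 t) M ⟩
        (N * (suc p + ch2 t) + M) + (N₀ + N * p)
          ≤⟨ +-mono-≤ (next p (T ⊖ x) e′ (λ w q → inside (⊖-⊑ T x w q) (⊖-≢ T {x} q)) (⊖-⊑ T x)) avoid ⟩
        val (K ⊕ x) (W ∖ U) + val K ((W ∖ U) ⊕ x) ≤⟨ split K (W ∖ U) x ⟩
        val K (W ∖ U) ∎
        where
        t = card (T ⊖ x)
        -- Removing `x` from `T` costs the `t` pairs that contain `x`. They are paid for by the `p`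
        -- sets grown inside `U ⊖ x`, and `t ≤ p` because the rest of `T` lies in `U ∖ (K ⊕ x)`.
        t≤p : t ≤ p
        t≤p = ≤-trans (card-mono {U = T ⊖ x} {W = U ∖ (K ⊕ x)}
          (λ w q → inside (⊖-⊑ T x w q) (⊖-≢ T {x} q))) (≤-reflexive e′)
        rearrange : ∀ a b p q m → a + b * (suc p + (p + q)) + m ≡ (b * (suc p + q) + m) + (a + b * p)
        rearrange = solve-∀
        KU⊖ : K ⊑ (U ⊖ x)
        KU⊖ w q = ⊖-intro U (λ { refl → true≢false q kx }) (KU w q)
        avoid : N₀ + N * p ≤ val K ((W ∖ U) ⊕ x)
        avoid = ≤-trans
          (grow₁ p N₀ N kz (nc x tx′) cK KU⊖ (λ w q → UW w (⊖-⊑ U x w q))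
            (card-⊖-∖ U K ux kx e)
            h₀ (λ K′ cK′ f f′ pr → h K′ cK′ f (λ w q → ⊖-⊑ U x w (f′ w q)) pr))
          (shrink {U} {K} ux UW)

    -- Here every set between `K` and `U` is a terminal, so all subsets of `U ∖ K` count instead of
    -- a chain only. The intended situation is a connected core to which leaves are added freely.
    grow-all : ∀ p {U K} → K ⊑ U → U ⊑ W → card (U ∖ K) ≡ p →
      (∀ K′ → K ⊑ K′ → K′ ⊑ U → 1 ≤ val K′ (W ∖ K′)) → 2 ^ p ≤ val K (W ∖ U)
    -- The `suc` on the right makes up for `K` itself, about which nothing is assumed.
    grow-proper : ∀ p {U K} → K ⊑ U → U ⊑ W → card (U ∖ K) ≡ p →
      (∀ K′ → K ⊑ K′ → K′ ⊑ U → Proper K K′ → 1 ≤ val K′ (W ∖ K′)) → 2 ^ p ≤ suc (val K (W ∖ U))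

    grow-all zero {U} {K} KU UW e h = ≤-trans (h K (λ _ q → q) KU)
      (anti {K} {K} {W ∖ U} {W ∖ K} (λ _ q → q) λ y q → ∖-intro W K (∖-⊑ W U y q)
        (≢true⇒false (λ r → true≢false (KU y r) (∖-out W U {y} q))))
    grow-all (suc p) {U} {K} KU UW e h with ∖-exists U K e
    ... | x , ux , kx = begin
      2 ^ p + (2 ^ p + 0) ≡⟨ cong (2 ^ p +_) (+-identityʳ _) ⟩
      2 ^ p + 2 ^ p ≤⟨ +-mono-≤
          (grow-all p {U} {K ⊕ x} (⊕-⊑ KU ux) UW (card-∖-⊕ U K ux kx e)
            (λ K′ f g → h K′ (λ w q → f w (⊕-old K x w q)) g))
          (≤-trans (grow-all p {U ⊖ x} {K} (λ w q → ⊖-intro U (λ { refl → true≢false q kx }) (KU w q))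
              (λ w q → UW w (⊖-⊑ U x w q)) (card-⊖-∖ U K ux kx e) (λ K′ f g → h K′ f (λ w q → ⊖-⊑ U x w (g w q))))
            (shrink {U} {K} ux UW)) ⟩
      val (K ⊕ x) (W ∖ U) + val K ((W ∖ U) ⊕ x) ≤⟨ split K (W ∖ U) x ⟩
      val K (W ∖ U) ∎
      where open ≤-Reasoning
    grow-proper zero KU UW e h = s≤s z≤n
    grow-proper (suc p) {U} {K} KU UW e h with ∖-exists U K e
    ... | x , ux , kx = begin
      2 ^ p + (2 ^ p + 0) ≡⟨ cong (2 ^ p +_) (+-identityʳ _) ⟩
      2 ^ p + 2 ^ p ≤⟨ +-mono-≤
          (grow-all p {U} {K ⊕ x} (⊕-⊑ KU ux) UW (card-∖-⊕ U K ux kx e)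
            (λ K′ f g → h K′ (λ w q → f w (⊕-old K x w q)) g (Proper-⊕ kx f)))
          (≤-trans (grow-proper p {U ⊖ x} {K} (λ w q → ⊖-intro U (λ { refl → true≢false q kx }) (KU w q))
              (λ w q → UW w (⊖-⊑ U x w q)) (card-⊖-∖ U K ux kx e) (λ K′ f g → h K′ f (λ w q → ⊖-⊑ U x w (g w q))))
            (s≤s (shrink {U} {K} ux UW))) ⟩
      val (K ⊕ x) (W ∖ U) + suc (val K ((W ∖ U) ⊕ x)) ≡⟨ +-suc _ _ ⟩
      suc (val (K ⊕ x) (W ∖ U) + val K ((W ∖ U) ⊕ x)) ≤⟨ s≤s (split K (W ∖ U) x) ⟩
      suc (val K (W ∖ U)) ∎
      where open ≤-Reasoning

-- Counting connected subgraphs by their vertex sets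

_⊑ᵇ_ : VSet n → VSet n → Bool
_⊑ᵇ_ {n} U W = all (λ x → not (U x) ∨ W x) (allFin n)

⊑ᵇ-intro : {U W : VSet n} → U ⊑ W → U ⊑ᵇ W ≡ true
⊑ᵇ-intro {n} {U} {W} f = all-intro _ (allFin n) (λ {x} _ → put (U x) (f x))
  where
  put : ∀ a {b} → (a ≡ true → b ≡ true) → not a ∨ b ≡ true
  put true f = f refl
  put false f = refl

⊑ᵇ-elim : {U W : VSet n} → U ⊑ᵇ W ≡ true → U ⊑ W
⊑ᵇ-elim {n} {U} {W} h x e = get (U x) (all-elim _ h (∈-allFin x)) e
  where
  get : ∀ a {b} → not a ∨ b ≡ true → a ≡ true → b ≡ true
  get true h refl = h

Disjoint : VSet n → VSet n → Set
Disjoint D W = ∀ x → D x ≡ true → W x ≡ true → ⊥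

disjᵇ : VSet n → VSet n → Bool
disjᵇ {n} D W = all (λ x → not (D x ∧ W x)) (allFin n)

disjᵇ-intro : {D W : VSet n} → Disjoint D W → disjᵇ D W ≡ true
disjᵇ-intro {n} {D} {W} f = all-intro _ (allFin n)
  (λ {x} _ → not-intro (≢true⇒false (λ e → f x (∧-elimˡ e) (∧-elimʳ {D x} e))))

disjᵇ-elim : {D W : VSet n} → disjᵇ D W ≡ true → Disjoint D W
disjᵇ-elim {n} {D} {W} h x a b = true≢false (∧-intro a b) (not-elim (all-elim _ h (∈-allFin x)))

within : VSet n → Sub n → Bool
within U s = V s ⊑ᵇ U

meets : VSet n → Sub n → Bool
meets {n} U s = any (λ x → U x ∧ V s x) (allFin n)

meets-intro : (U : VSet n) (s : Sub n) {x : Fin n} → U x ≡ true → V s x ≡ true → meets U s ≡ true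
meets-intro {n} U s {x} a b = any-intro _ (∈-allFin x) (∧-intro a b)

meets-elim : (U : VSet n) (s : Sub n) → meets U s ≡ true → ∃ λ x → (U x ≡ true) × (V s x ≡ true)
meets-elim {n} U s h with any-elim _ (allFin n) h
... | x , _ , e = x , ∧-elimˡ e , ∧-elimʳ {U x} e

_⊘_ : Graph n → Fin n × Fin n → Graph n
(E ⊘ e) u w = E u w ∧ not (adjIn (e ∷ []) u w)

walk-bind : {E E′ : Graph n} → (∀ {x y} → E x y ≡ true → Walk E′ x y) → ∀ {x y} → Walk E x y → Walk E′ x y
walk-bind f nil = nil
walk-bind f (cons e p) = f e ◅◅ walk-bind f p

⊘-symm : {E : Graph n} {e : Fin n × Fin n} → Symm E → Symm (E ⊘ e)
⊘-symm {E = E} {e} s x y h = ∧-intro (s x y (∧-elimˡ h))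
  (not-intro (≢true⇒false (λ q → true≢false (adjIn-symm (e ∷ []) y x q) (not-elim (∧-elimʳ {E x y} h)))))

⊘-detour : {E : Graph n} {a b : Fin n} → Symm E → Walk (E ⊘ (a , b)) a b →
  ∀ {x y} → Walk E x y → Walk (E ⊘ (a , b)) x y
⊘-detour {E = E} {a} {b} s d = walk-bind f
  where
  f : ∀ {x y} → E x y ≡ true → Walk (E ⊘ (a , b)) x y
  f {x} {y} h with true? (adjIn ((a , b) ∷ []) x y)
  ... | inj₂ q = cons (∧-intro h (not-intro q)) nil
  ... | inj₁ q with adjIn-elim ((a , b) ∷ []) {x} {y} q
  ... | inj₁ (here refl) = d
  ... | inj₂ (here refl) = walk-rev (⊘-symm {e = a , b} s) d

module Counting {n : ℕ} (G : Graph n) (G-simple : IsSimple G) where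
  open Universe G G-simple public
  open Growth G G-simple public
  open Valuation public

  counted : (Sub n → Bool) → VSet n → VSet n → Sub n → Bool
  counted Z K D s = (conn s ∧ Z s) ∧ ((K ⊑ᵇ V s) ∧ disjᵇ D (V s))

  counted-intro : ∀ Z K D s → conn s ≡ true → Z s ≡ true → K ⊑ V s → Disjoint D (V s) →
    counted Z K D s ≡ true
  counted-intro Z K D s a b c d = ∧-intro (∧-intro a b) (∧-intro (⊑ᵇ-intro c) (disjᵇ-intro d))

  counted-elim : ∀ Z K D s → counted Z K D s ≡ true →
    (conn s ≡ true) × (Z s ≡ true) × (K ⊑ V s) × Disjoint D (V s)
  counted-elim Z K D s h with ∧-elim {conn s ∧ Z s} h
  ... | a , b with ∧-elim {conn s} a | ∧-elim {K ⊑ᵇ V s} b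
  ... | p , q | r , t = p , q , ⊑ᵇ-elim r , disjᵇ-elim t

  count : (Sub n → Bool) → Valuation n
  count Z .val K D = cnt (counted Z K D) Us
  count Z .anti {K} {K′} {D} {D′} f g = cnt-mono (counted Z K′ D′) (counted Z K D) Us λ s h →
    let p , q , r , t = counted-elim Z K′ D′ s h in
    counted-intro Z K D s p q (λ x e → r x (f x e)) (λ x e → t x (g x e))
  count Z .split K D x = cnt-disjoint (counted Z (K ⊕ x) D) (counted Z K (D ⊕ x)) (counted Z K D) Us
    (λ s h → let p , q , r , t = counted-elim Z (K ⊕ x) D s h in
       counted-intro Z K D s p q (λ y e → r y (⊕-old K x y e)) t)
    (λ s h → let p , q , r , t = counted-elim Z K (D ⊕ x) s h in
       counted-intro Z K D s p q r (λ y e → t y (⊕-old D x y e)))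
    (λ s h h′ → let p , q , r , t = counted-elim Z (K ⊕ x) D s h ; p′ , q′ , r′ , t′ = counted-elim Z K (D ⊕ x) s h′ in
       t′ x (⊕-new D x) (r x (⊕-new K x)))

  private
    ForV : (Sub n → Bool) → VSet n → Set
    ForV Z K = ∀ s → (∀ y → V s y ≡ K y) → Z s ≡ true

    counted-exact : ∀ Z K D s {x} → (∀ y → V s y ≡ K y) → K x ≡ true → Disjoint D K → ForV Z K →
      (∀ {u v} → K u ≡ true → K v ≡ true → Walk (E s) u v) → counted Z K D s ≡ true
    counted-exact Z K D s {x} eq kx d z w = counted-intro Z K D s
      (conn-intro s (trans (eq x) kx) (λ a b → w (trans (sym (eq _)) a) (trans (sym (eq _)) b)))
      (z s eq) (λ y e → trans (eq y) e) (λ y a b → d y a (trans (sym (eq y)) b))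

  -- The subgraph induced on `K` is one of the objects counted.
  count-pos : ∀ Z K D {x} → Conn K → K x ≡ true → Disjoint D K →
    (∀ s → (∀ y → V s y ≡ K y) → Z s ≡ true) → 1 ≤ val (count Z) K D
  count-pos Z K D {x} c kx d z with Us-make K (G ∣ K) (∣-symm K G-sym)
    (λ h → let a , b , g = ∣-elim G K h in g , a , b)
  ... | s , m , eV , eE = cnt-pos (counted Z K D) m (counted-exact Z K D s eV kx d z
    (λ a b → walk-map (λ e → trans (eE _ _) e) (c a b)))

  -- Besides the induced subgraph on K, each edge of es may be dropped alone.
  count-edges : ∀ Z K D {x} es → Conn K → K x ≡ true → Disjoint D K →
    (∀ s → (∀ y → V s y ≡ K y) → Z s ≡ true) → Unique es →
    (∀ {a b} → (a , b) ∈ es → (toℕ a < toℕ b) × ((G ∣ K) a b ≡ true) × Walk ((G ∣ K) ⊘ (a , b)) a b) →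
    suc (length es) ≤ val (count Z) K D
  count-edges Z K D {x} es c kx d z u h = ≤-trans (go es u h)
      (cnt-mono (P es) (counted Z K D) Us (λ s e → ∧-elimˡ e))
    where
    -- `covers es s` says that each edge inside `K` that is not in `es` is present in `s`. When `es`
    -- is enlarged by an edge, the subgraph lacking just that edge violates the old condition and
    -- satisfies the new one, so each edge of `es` adds one to the count.
    covers : List (Fin n × Fin n) → Sub n → Bool
    covers es s = all (λ a → all (λ b → not ((G ∣ K) a b) ∨ (adjIn es a b ∨ E s a b)) (allFin n)) (allFin n)
    covers-intro : ∀ es s → (∀ a b → (G ∣ K) a b ≡ true → (adjIn es a b ≡ true) ⊎ (E s a b ≡ true)) → covers es s ≡ true
    covers-intro es s f = all-intro _ (allFin n) λ {a} _ → all-intro _ (allFin n) λ {b} _ →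
      put ((G ∣ K) a b) {adjIn es a b} (f a b)
      where
      put : ∀ p {q r} → (p ≡ true → (q ≡ true) ⊎ (r ≡ true)) → not p ∨ (q ∨ r) ≡ true
      put false f = refl
      put true {q} f with f refl
      ... | inj₁ e = ∨-introˡ e
      ... | inj₂ e = ∨-introʳ {q} e
    covers-elim : ∀ es s → covers es s ≡ true → ∀ a b → (G ∣ K) a b ≡ true → (adjIn es a b ≡ true) ⊎ (E s a b ≡ true)
    covers-elim es s h a b g = get ((G ∣ K) a b) {adjIn es a b}
        (all-elim _ (all-elim _ h (∈-allFin a)) (∈-allFin b)) g
      where
      get : ∀ p {q r} → not p ∨ (q ∨ r) ≡ true → p ≡ true → (q ≡ true) ⊎ (r ≡ true)
      get true h refl = ∨-elim h
    P : List (Fin n × Fin n) → Sub n → Bool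
    P es s = counted Z K D s ∧ covers es s
    go : ∀ es → Unique es →
      (∀ {a b} → (a , b) ∈ es → (toℕ a < toℕ b) × ((G ∣ K) a b ≡ true) × Walk ((G ∣ K) ⊘ (a , b)) a b) →
      suc (length es) ≤ cnt (P es) Us
    go [] u h with Us-make K (G ∣ K) (∣-symm K G-sym) (λ h → let a , b , g = ∣-elim G K h in g , a , b)
    ... | s , m , eV , eE = cnt-pos (P []) m (∧-intro
      (counted-exact Z K D s eV kx d z (λ a b → walk-map (λ e → trans (eE _ _) e) (c a b)))
      (covers-intro [] s (λ a b g → inj₂ (trans (eE a b) g))))
    go ((a , b) ∷ es) (ux ∷ u) h = ≤-trans (≤-reflexive (+-comm 1 (suc (length es))))
        (≤-trans (+-mono-≤ (go es u (h ∘ there)) one)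
        (cnt-disjoint (P es) Q (P ((a , b) ∷ es)) Us
          (λ s q → ∧-intro (∧-elimˡ q) (covers-intro ((a , b) ∷ es) s
            (λ i j g → [ (λ r → inj₁ (weaken i j r)) , inj₂ ]′ (covers-elim es s (∧-elimʳ {counted Z K D s} q) i j g))))
          (λ s q → ∧-elimˡ q)
          (λ s q r → true≢false (present s (covers-elim es s (∧-elimʳ {counted Z K D s} q) a b (proj₁ (proj₂ (h (here refl))))))
            (not-elim (∧-elimʳ {P ((a , b) ∷ es) s} r)))))
      where
      Q : Sub n → Bool
      Q s = P ((a , b) ∷ es) s ∧ not (E s a b)
      weaken : ∀ i j → adjIn es i j ≡ true → adjIn ((a , b) ∷ es) i j ≡ true
      weaken i j e = ∨-introʳ {(eqF a i ∧ eqF b j) ∨ (eqF a j ∧ eqF b i)} e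
      present : ∀ s → (adjIn es a b ≡ true) ⊎ (E s a b ≡ true) → E s a b ≡ true
      present s (inj₂ e) = e
      present s (inj₁ e) with adjIn-elim es e
      ... | inj₁ m = ⊥-elim (All.lookup ux m refl)
      ... | inj₂ m = ⊥-elim (<-asym (proj₁ (h (here refl))) (proj₁ (h (there m))))
      one : 1 ≤ cnt Q Us
      one with Us-make K ((G ∣ K) ⊘ (a , b)) (⊘-symm {E = G ∣ K} {e = a , b} (∣-symm K G-sym))
        (λ {i} {j} h → let p , q , g = ∣-elim G K (∧-elimˡ {(G ∣ K) i j} h) in g , p , q)
      ... | s , m , eV , eE = cnt-pos Q m (∧-intro (∧-intro
        (counted-exact Z K D s eV kx d z (λ p q → walk-map (λ e → trans (eE _ _) e)
          (⊘-detour (∣-symm K G-sym) (proj₂ (proj₂ (h (here refl)))) (c p q))))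
        (covers-intro ((a , b) ∷ es) s λ i j g → case true? (adjIn ((a , b) ∷ []) i j) of λ
          { (inj₁ e) → inj₁ (first i j e)
          ; (inj₂ e) → inj₂ (trans (eE i j) (∧-intro g (not-intro e))) }))
        (not-intro (trans (eE a b) (≢true⇒false (λ e → true≢false (adjIn-introˡ {ES = (a , b) ∷ []} {a} {b} (here refl))
          (not-elim (∧-elimʳ {(G ∣ K) a b} e)))))))
        where
        first : ∀ i j → adjIn ((a , b) ∷ []) i j ≡ true → adjIn ((a , b) ∷ es) i j ≡ true
        first i j e with adjIn-elim ((a , b) ∷ []) {i} {j} e
        ... | inj₁ (here refl) = adjIn-introˡ {ES = (a , b) ∷ es} (here refl)
        ... | inj₂ (here refl) = adjIn-introʳ {ES = (a , b) ∷ es} (here refl)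

  -- Induction along an order of the vertices of `U` in which each vertex after `v` is adjacent to
  -- an earlier one. `resp` takes the place of extensionality, since the set finally reached agrees
  -- with `U` only pointwise.
  grow-ind : (P : VSet n → Set) (U : VSet n) {v : Fin n} → Conn U → U v ≡ true →
    (∀ {K K′} → K ⊑ K′ → K′ ⊑ K → P K → P K′) → P ⟪ v ⟫ →
    (∀ {K x u} → Conn K → K v ≡ true → K u ≡ true → K x ≡ false → G u x ≡ true → (K ⊕ x) ⊑ U → P K → P (K ⊕ x)) →
    P U
  grow-ind P U {v} cU uv resp base step′ = go (card (U ∖ ⟪ v ⟫)) ⟪ v ⟫ refl (Conn-⟪⟫ v) (eqF-refl v)
      (λ y e → subst (λ w → U w ≡ true) (sym (eqF⇒≡ e)) uv) base
    where
    go : ∀ p K → card (U ∖ K) ≡ p → Conn K → K v ≡ true → K ⊑ U → P K → P U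
    go zero K e cK kv KU pK = resp KU (λ y uy → [ id , (λ ky → ⊥-elim (true≢false (∖-intro U K uy ky) (card-0 (U ∖ K) e y))) ]′ (true? (K y))) pK
    go (suc p) K e cK kv KU pK with ∖-exists U K e
    ... | y , uy , ky with boundary cU KU kv uy ky
    ... | u , x , ku , ux , kx , g = go p (K ⊕ x) (card-∖-⊕ U K ux kx e) (Conn-⊕ cK ku g)
      (⊕-old K x v kv) (⊕-⊑ KU ux) (step′ cK kv ku kx g (⊕-⊑ KU ux) pK)

  inside : VSet n → Sub n → Bool
  inside U s = conn s ∧ within U s

  -- A chain of connected sets grown from `x` to `U` has one member of each size.
  through-bound : ∀ (U : VSet n) {x} → Conn U → U x ≡ true → card U ≤ val (count (within U)) ⟪ x ⟫ ∅
  through-bound U {x} cU ux = ≤-trans (≤-reflexive (trans (trans (card-⊖ U ux) (cong suc (cnt-cong (U ⊖ x) (U ∖ ⟪ x ⟫) (allFin n) (λ y → ∧-comm _ (U y)))))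
      (sym (cong suc (*-identityˡ (card (U ∖ ⟪ x ⟫)))))))
    (≤-trans (grow₁ (count (within U)) U (card (U ∖ ⟪ x ⟫)) 1 1 (eqF-refl x) cU (Conn-⟪⟫ x) xU (λ _ q → q) refl
      (count-pos (within U) ⟪ x ⟫ (U ∖ ⟪ x ⟫) (Conn-⟪⟫ x) (eqF-refl x)
        (λ y a b → true≢false b (∖-out U ⟪ x ⟫ {y} a)) (λ s eq → ⊑ᵇ-intro (λ y e → xU y (trans (sym (eq y)) e))))
      (λ K′ cK′ f f′ _ → count-pos (within U) K′ (U ∖ K′) cK′ (f x (eqF-refl x))
        (λ y a b → true≢false b (∖-out U K′ {y} a)) (λ s eq → ⊑ᵇ-intro (λ y e → f′ y (trans (sym (eq y)) e)))))
      (anti (count (within U)) {⟪ x ⟫} {⟪ x ⟫} {∅} {U ∖ U} (λ _ q → q) (λ _ ())))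
    where
    xU : ⟪ x ⟫ ⊑ U
    xU y e = subst (λ w → U w ≡ true) (sym (eqF⇒≡ e)) ux

  insideBeyond : VSet n → Fin n → Sub n → Bool
  insideBeyond U v s = inside U s ∧ meets (U ⊖ v) s

  -- When `U` is grown from `v`, every subgraph through the newly added vertex is new, and
  -- `through-bound` finds as many of them as there are vertices so far. Paths attain equality.
  pairs-bound : ∀ (U : VSet n) {v} → Conn U → U v ≡ true → tri′ (card (U ⊖ v)) ≤ cnt (insideBeyond U v) Us
  pairs-bound U {v} cU uv = grow-ind (λ K → tri′ (card (K ⊖ v)) ≤ cnt (insideBeyond K v) Us) U cU uv resp base step′
    where
    mono : ∀ {K K′} → K ⊑ K′ → ∀ s → insideBeyond K v s ≡ true → insideBeyond K′ v s ≡ true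
    mono {K} {K′} f s h with ∧-elim {inside K s} h
    ... | a , b with ∧-elim {conn s} a | meets-elim (K ⊖ v) s b
    ... | c , d | y , p , q = ∧-intro (∧-intro c (⊑ᵇ-intro (λ z e → f z (⊑ᵇ-elim {U = V s} {W = K} d z e))))
      (meets-intro (K′ ⊖ v) s (⊖-intro K′ (⊖-≢ K p) (f y (⊖-⊑ K v y p))) q)
    resp : ∀ {K K′} → K ⊑ K′ → K′ ⊑ K → tri′ (card (K ⊖ v)) ≤ cnt (insideBeyond K v) Us →
      tri′ (card (K′ ⊖ v)) ≤ cnt (insideBeyond K′ v) Us
    resp {K} {K′} f g h = subst (λ q → tri′ q ≤ _) (card-cong {U = K ⊖ v} {W = K′ ⊖ v}
        (λ y e → ⊖-intro K′ (⊖-≢ K e) (f y (⊖-⊑ K v y e))) (λ y e → ⊖-intro K (⊖-≢ K′ e) (g y (⊖-⊑ K′ v y e))))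
      (≤-trans h (cnt-mono (insideBeyond K v) (insideBeyond K′ v) Us (mono f)))
    base : tri′ (card (⟪ v ⟫ ⊖ v)) ≤ cnt (insideBeyond ⟪ v ⟫ v) Us
    base = subst (λ q → tri′ q ≤ cnt (insideBeyond ⟪ v ⟫ v) Us) (sym (suc-injective (trans (sym (card-⊖ ⟪ v ⟫ (eqF-refl v))) (card-⟪⟫ v)))) z≤n
    step′ : ∀ {K x u} → Conn K → K v ≡ true → K u ≡ true → K x ≡ false → G u x ≡ true → (K ⊕ x) ⊑ U →
      tri′ (card (K ⊖ v)) ≤ cnt (insideBeyond K v) Us → tri′ (card ((K ⊕ x) ⊖ v)) ≤ cnt (insideBeyond (K ⊕ x) v) Us
    step′ {K} {x} {u} cK kv ku kx g KU h = ≤-trans (≤-reflexive (cong tri′ e₁)) (≤-trans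
      (+-mono-≤ h (≤-trans (≤-reflexive e₂) (through-bound (K ⊕ x) (Conn-⊕ cK ku g) (⊕-new K x))))
      (cnt-disjoint (insideBeyond K v) (counted (within (K ⊕ x)) ⟪ x ⟫ ∅) (insideBeyond (K ⊕ x) v) Us
        (mono (⊕-old K x))
        (λ s q → let a , b , c , d = counted-elim (within (K ⊕ x)) ⟪ x ⟫ ∅ s q in
           ∧-intro (∧-intro a b) (meets-intro ((K ⊕ x) ⊖ v) s (⊖-intro (K ⊕ x) x≢v (⊕-new K x)) (c x (eqF-refl x))))
        (λ s p q → let a , b , c , d = counted-elim (within (K ⊕ x)) ⟪ x ⟫ ∅ s q in
           true≢false (⊑ᵇ-elim {U = V s} {W = K} (∧-elimʳ {conn s} (∧-elimˡ {inside K s} p)) x (c x (eqF-refl x))) kx)))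
      where
      x≢v : x ≢ v
      x≢v refl = true≢false kv kx
      e₂ : 2 + card (K ⊖ v) ≡ card (K ⊕ x)
      e₂ = trans (cong suc (sym (card-⊖ K kv))) (sym (card-⊕ K kx))
      e₁ : card ((K ⊕ x) ⊖ v) ≡ suc (card (K ⊖ v))
      e₁ = suc-injective (trans (sym (card-⊖ (K ⊕ x) (⊕-old K x v kv))) (sym e₂))

  inside-bound : ∀ (U : VSet n) {v} → Conn U → U v ≡ true → 1 + tri′ (card (U ⊖ v)) ≤ cnt (inside U) Us
  inside-bound U {v} cU uv = ≤-trans
    (+-mono-≤ (count-pos (within ⟪ v ⟫) ⟪ v ⟫ ∅ (Conn-⟪⟫ v) (eqF-refl v) (λ _ ())
      (λ s eq → ⊑ᵇ-intro (λ y e → trans (sym (eq y)) e))) (pairs-bound U cU uv))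
    (cnt-disjoint (counted (within ⟪ v ⟫) ⟪ v ⟫ ∅) (insideBeyond U v) (inside U) Us
      (λ s h → let a , b , c , d = counted-elim (within ⟪ v ⟫) ⟪ v ⟫ ∅ s h in
        ∧-intro a (⊑ᵇ-intro (λ y e → subst (λ w → U w ≡ true) (sym (eqF⇒≡ (⊑ᵇ-elim {U = V s} {W = ⟪ v ⟫} b y e))) uv)))
      (λ s h → ∧-elimˡ {inside U s} h)
      (λ s h q → let a , b , c , d = counted-elim (within ⟪ v ⟫) ⟪ v ⟫ ∅ s h
                     y , p , r = meets-elim (U ⊖ v) s (∧-elimʳ {inside U s} q) in
        ⊖-≢ U p (eqF⇒≡ (⊑ᵇ-elim {U = V s} {W = ⟪ v ⟫} b y r))))

-- Handshake

sumOver : (A → ℕ) → List A → ℕ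
sumOver f [] = 0
sumOver f (x ∷ xs) = f x + sumOver f xs

sumOver-cong : (f g : A → ℕ) (xs : List A) → (∀ x → f x ≡ g x) → sumOver f xs ≡ sumOver g xs
sumOver-cong f g [] h = refl
sumOver-cong f g (x ∷ xs) h = cong₂ _+_ (h x) (sumOver-cong f g xs h)

sumOver-+ : (f g : A → ℕ) (xs : List A) → sumOver (λ x → f x + g x) xs ≡ sumOver f xs + sumOver g xs
sumOver-+ f g [] = refl
sumOver-+ f g (x ∷ xs) rewrite sumOver-+ f g xs = lemma (f x) (g x) (sumOver f xs) (sumOver g xs)
  where
  lemma : ∀ a b c d → a + b + (c + d) ≡ a + c + (b + d)
  lemma = solve-∀

bit : Bool → ℕ
bit true = 1
bit false = 0

cnt-bit : (p : A → Bool) (xs : List A) → cnt p xs ≡ sumOver (bit ∘ p) xs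
cnt-bit p [] = cnt-length p []
cnt-bit p (x ∷ xs) with p x in eq
... | true = trans (cnt-∷-true p xs eq) (cong suc (cnt-bit p xs))
... | false = trans (cnt-∷-false p xs eq) (cnt-bit p xs)

sumOver-swap : {B : Set} (f : A → B → ℕ) (xs : List A) (ys : List B) →
  sumOver (λ x → sumOver (f x) ys) xs ≡ sumOver (λ y → sumOver (λ x → f x y) xs) ys
sumOver-swap f [] [] = refl
sumOver-swap f [] (y ∷ ys) = sumOver-swap f [] ys
sumOver-swap f (x ∷ xs) ys = trans (cong (sumOver (f x) ys +_) (sumOver-swap f xs ys))
  (sym (sumOver-+ (f x) (λ y → sumOver (λ x → f x y) xs) ys))

cnt-++ : (p : A → Bool) (xs ys : List A) → cnt p (xs ++ ys) ≡ cnt p xs + cnt p ys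
cnt-++ p [] ys = cong (_+ cnt p ys) (sym (cnt-length p []))
cnt-++ p (x ∷ xs) ys with true? (p x)
... | inj₁ e = trans (cnt-∷-true p (xs ++ ys) e) (trans (cong suc (cnt-++ p xs ys)) (cong (_+ cnt p ys) (sym (cnt-∷-true p xs e))))
... | inj₂ e = trans (cnt-∷-false p (xs ++ ys) e) (trans (cnt-++ p xs ys) (cong (_+ cnt p ys) (sym (cnt-∷-false p xs e))))

cnt-map : {B : Set} (p : B → Bool) (f : A → B) (xs : List A) → cnt p (map f xs) ≡ cnt (p ∘ f) xs
cnt-map p f [] = trans (cnt-length p []) (sym (cnt-length (p ∘ f) []))
cnt-map p f (x ∷ xs) with true? (p (f x))
... | inj₁ e = trans (cnt-∷-true p (map f xs) e) (trans (cong suc (cnt-map p f xs)) (sym (cnt-∷-true (p ∘ f) xs e)))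
... | inj₂ e = trans (cnt-∷-false p (map f xs) e) (trans (cnt-map p f xs) (sym (cnt-∷-false (p ∘ f) xs e)))

cnt-cartesian : {B : Set} (p : A × B → Bool) (xs : List A) (ys : List B) →
  cnt p (cartesianProduct xs ys) ≡ sumOver (λ x → cnt (λ y → p (x , y)) ys) xs
cnt-cartesian p [] ys = cnt-length p []
cnt-cartesian p (x ∷ xs) ys = trans (cnt-++ p (map (x ,_) ys) _)
  (cong₂ _+_ (cnt-map p (x ,_) ys) (cnt-cartesian p xs ys))

handshake : (H : Graph n) → Symm H → (∀ {x y} → H x y ≡ true → x ≢ y) →
  sumOver (λ x → card (H x)) (allFin n) ≡ length (edges H) + length (edges H)
handshake {n} H s irr = trans (sumOver-cong _ _ (allFin n) each)
  (trans (sumOver-+ (λ x → cnt (up x) (allFin n)) (λ x → cnt (down x) (allFin n)) (allFin n))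
    (cong₂ _+_ (sym edges≡) (trans flip (sym edges≡))))
  where
  up down : Fin n → Fin n → Bool
  up x y = (toℕ x <ᵇ toℕ y) ∧ H x y
  down x y = up y x
  edges≡ : length (edges H) ≡ sumOver (λ x → cnt (up x) (allFin n)) (allFin n)
  edges≡ = trans (sym (cnt-length _ (cartesianProduct (allFin n) (allFin n)))) (cnt-cartesian _ (allFin n) (allFin n))
  flip : sumOver (λ x → cnt (down x) (allFin n)) (allFin n) ≡ sumOver (λ x → cnt (up x) (allFin n)) (allFin n)
  flip = trans (sumOver-cong _ _ (allFin n) (λ x → cnt-bit (down x) (allFin n)))
    (trans (sumOver-swap (λ x y → bit (down x y)) (allFin n) (allFin n))
      (sumOver-cong _ _ (allFin n) (λ x → sym (cnt-bit (up x) (allFin n)))))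
  each : ∀ x → card (H x) ≡ cnt (up x) (allFin n) + cnt (down x) (allFin n)
  each x = trans (cnt-split (H x) (λ y → toℕ x <ᵇ toℕ y) (allFin n)) (cong₂ _+_
    (cnt-cong _ _ (allFin n) (λ y → ∧-comm (H x y) _))
    (cnt-cong _ _ (allFin n) (λ y → bool-ext (to y) (from y))))
    where
    to : ∀ y → H x y ∧ not (toℕ x <ᵇ toℕ y) ≡ true → down x y ≡ true
    to y h with ∧-elim {H x y} h
    ... | a , b with <-cmp (toℕ x) (toℕ y)
    ... | tri< l _ _ = ⊥-elim (true≢false (T⇒≡ (<⇒<ᵇ l)) (not-elim b))
    ... | tri≈ _ e _ = ⊥-elim (irr a (toℕ-injective e))
    ... | tri> _ _ l = ∧-intro (T⇒≡ (<⇒<ᵇ l)) (s _ _ a)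
    from : ∀ y → down x y ≡ true → H x y ∧ not (toℕ x <ᵇ toℕ y) ≡ true
    from y h with ∧-elim {toℕ y <ᵇ toℕ x} h
    ... | a , b = ∧-intro (s _ _ b) (not-intro (≢true⇒false
      (λ e → <-asym (<ᵇ⇒< (toℕ y) (toℕ x) (≡⇒T a)) (<ᵇ⇒< (toℕ x) (toℕ y) (≡⇒T e)))))

sumOver-bound : (f : Fin n → ℕ) (B : VSet n) (xs : List (Fin n)) → (∀ x → B x ≡ true → 2 ≤ f x) →
  cnt B xs + cnt B xs ≤ sumOver f xs
sumOver-bound f B [] h rewrite cnt-length B [] = z≤n
sumOver-bound f B (x ∷ xs) h with true? (B x)
... | inj₂ e rewrite cnt-∷-false B xs e = ≤-trans (sumOver-bound f B xs h) (m≤n+m _ (f x))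
... | inj₁ e rewrite cnt-∷-true B xs e = ≤-trans (≤-reflexive (cong suc (+-suc _ _))) (+-mono-≤ (h x e) (sumOver-bound f B xs h))

sumOver-bound-strict : (f : Fin n → ℕ) (B : VSet n) {xs : List (Fin n)} {z : Fin n} → (∀ x → B x ≡ true → 2 ≤ f x) →
  z ∈ xs → B z ≡ true → 3 ≤ f z → suc (cnt B xs + cnt B xs) ≤ sumOver f xs
sumOver-bound-strict f B {x ∷ xs} h (here refl) bz l rewrite cnt-∷-true B xs bz =
  ≤-trans (s≤s (≤-reflexive (cong suc (+-suc _ _)))) (+-mono-≤ l (sumOver-bound f B xs h))
sumOver-bound-strict f B {x ∷ xs} h (there m) bz l with true? (B x)
... | inj₂ e rewrite cnt-∷-false B xs e = ≤-trans (sumOver-bound-strict f B h m bz l) (m≤n+m _ (f x))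
... | inj₁ e rewrite cnt-∷-true B xs e = ≤-trans (≤-reflexive (cong (λ q → suc (suc q)) (+-suc _ _)))
        (+-mono-≤ (h x e) (sumOver-bound-strict f B h m bz l))

-- Blocks

path-map : {E E′ : Graph n} → (∀ {x y} → E x y ≡ true → E′ x y ≡ true) →
  ∀ {x y ps} → Path E x y ps → Path E′ x y ps
path-map f (stop x) = stop x
path-map f (step e nx p) = step (f e) nx (path-map f p)

path-within : {E : Graph n} {U : VSet n} → ∀ {x y ps} → Path E x y ps → (∀ {z} → z ∈ ps → U z ≡ true) →
  Walk (E ∣ U) x y
path-within (stop x) f = nil
path-within {E = E} {U} (step e nx p) f =
  cons (∣-intro E U (f (here refl)) (f (there (path-head p))) e) (path-within p (f ∘ there))

first-step : {E : Graph n} {x y : Fin n} → Walk E x y → x ≢ y → ∃ λ z → E x z ≡ true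
first-step nil ne = ⊥-elim (ne refl)
first-step (cons e _) _ = _ , e

two-elements : (U : VSet n) {x y : Fin n} → U x ≡ true → U y ≡ true → y ≢ x → 2 ≤ card U
two-elements U {x} {y} a b ne = ≤-trans (s≤s (card-pos {U = U ⊖ x} {y} (⊖-intro U ne b)))
  (≤-reflexive (sym (card-⊖ U a)))

closes-path : {G : Graph n} {x y z : Fin n} {ps : List (Fin n)} → Path G x y ps → G y z ≡ true →
  closesᵇ G z ps ≡ true
closes-path (stop x) h = h
closes-path (step e nx (stop y)) h = ∧-intro e h
closes-path (step e nx p@(step _ _ _)) h = ∧-intro e (closes-path p h)

module Blocks {n : ℕ} (G : Graph n) (G-simple : IsSimple G) (G-conn : ∀ x y → Walk G x y) where
  open Counting G G-simple

  -- A block with at least three vertices, given by the properties that the counts rely on. The map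
  -- `ρ` sends every vertex to the vertex of the block at which its piece hangs, so the pieces are
  -- the fibres of `ρ`.
  record Block : Set where
    field
      B : VSet n
      ρ : Fin n → Fin n
      B-conn : Conn B
      B-conn⊖ : ∀ w → Conn (B ⊖ w)
      B-third : ∀ x y → ∃ λ z → (B z ≡ true) × (z ≢ x) × (z ≢ y)
      -- The girth condition enters through this cycle: it makes the number of cut vertices at most
      -- `card B`.
      B-cycle : ∃ λ vs → IsCycle G vs × (length vs ≤ card B)
      ρ-in : ∀ x → B (ρ x) ≡ true
      ρ-fix : ∀ {x} → B x ≡ true → ρ x ≡ x
      ρ-edge : ∀ {x y} → G x y ≡ true → (B x ≡ true → B y ≡ true → ⊥) → ρ x ≡ ρ y
      ρ-walk : ∀ x → Walk (G ∣ (λ y → eqF (ρ y) (ρ x))) x (ρ x)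

  link : Fin n → Fin n → Fin n → Set
  link w = Walk (G ∣ (full ⊖ w))

  -- The vertices that no single vertex separates from the edge ab: the block containing ab.
  blockOf : Fin n → Fin n → VSet n
  blockOf a b x = all (λ w → eqF w x ∨ ((eqF a w ∨ walkᵇ (G ∣ (full ⊖ w)) x a) ∧
                                       (eqF b w ∨ walkᵇ (G ∣ (full ⊖ w)) x b))) (allFin n)

  blockOf-elim : ∀ {a b x} → blockOf a b x ≡ true → ∀ w → w ≢ x → (a ≢ w → link w x a) × (b ≢ w → link w x b)
  blockOf-elim {a} {b} {x} h w ne with ∨-elim {eqF w x} (all-elim _ h (∈-allFin w))
  ... | inj₁ e = ⊥-elim (ne (eqF⇒≡ e))
  ... | inj₂ e = get a (∧-elimˡ e) , get b (∧-elimʳ {eqF a w ∨ walkᵇ (G ∣ (full ⊖ w)) x a} e)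
    where
    get : ∀ c → eqF c w ∨ walkᵇ (G ∣ (full ⊖ w)) x c ≡ true → c ≢ w → link w x c
    get c h ne′ with ∨-elim {eqF c w} h
    ... | inj₁ q = ⊥-elim (ne′ (eqF⇒≡ q))
    ... | inj₂ q = walkᵇ-sound (∣-symm (full ⊖ w) G-sym) q

  blockOf-intro : ∀ {a b x} → (∀ w → w ≢ x → (a ≢ w → link w x a) × (b ≢ w → link w x b)) → blockOf a b x ≡ true
  blockOf-intro {a} {b} {x} f = all-intro _ (allFin n) λ {w} _ → case w ≟ x of λ
    { (yes e) → ∨-introˡ (subst (λ z → eqF w z ≡ true) e (eqF-refl w))
    ; (no ne) → ∨-introʳ {eqF w x} (∧-intro (put w a (proj₁ (f w ne))) (put w b (proj₂ (f w ne)))) }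
    where
    put : ∀ w c → (c ≢ w → link w x c) → eqF c w ∨ walkᵇ (G ∣ (full ⊖ w)) x c ≡ true
    put w c g with c ≟ w
    ... | yes e = refl
    ... | no ne = walkᵇ-complete (g ne)

  link-edge : ∀ {w x y} → G x y ≡ true → x ≢ w → y ≢ w → link w x y
  link-edge {w} g a b = cons (∣-intro G (full ⊖ w) (⊖-intro full a refl) (⊖-intro full b refl) g) nil

  module _ {a b : Fin n} (ab : G a b ≡ true) where
    private
      B : VSet n
      B = blockOf a b

    left-in-block : B a ≡ true
    left-in-block = blockOf-intro λ w ne → (λ _ → nil) , λ b≢w → link-edge ab (ne ∘ sym) b≢w

    right-in-block : B b ≡ true
    right-in-block = blockOf-intro λ w ne → (λ a≢w → link-edge (G-sym _ _ ab) (ne ∘ sym) a≢w) , λ _ → nil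

    -- At least one end of the edge `ab` differs from `w`, and both vertices are linked to that end
    -- without `w`.
    block-link : ∀ {w x y} → B x ≡ true → B y ≡ true → x ≢ w → y ≢ w → link w x y
    block-link {w} {x} {y} bx by x≢w y≢w with a ≟ w
    ... | no a≢w = proj₁ (blockOf-elim bx w (x≢w ∘ sym)) a≢w ◅◅
          walk-rev (∣-symm (full ⊖ w) G-sym) (proj₁ (blockOf-elim by w (y≢w ∘ sym)) a≢w)
    ... | yes refl = proj₂ (blockOf-elim bx w (x≢w ∘ sym)) b≢w ◅◅
          walk-rev (∣-symm (full ⊖ w) G-sym) (proj₂ (blockOf-elim by w (y≢w ∘ sym)) b≢w)
      where
      b≢w : b ≢ a
      b≢w e = G-irr ab (sym e)

    -- For `w ≢ z`, one half of the path at `z` avoids `w` by `split-walks`, and it leads to a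
    -- vertex of the block, from which `a` and `b` are reached without `w`.
    path-in-block : ∀ {x y ps} → Path G x y ps → B x ≡ true → B y ≡ true → ∀ {z} → z ∈ ps → B z ≡ true
    path-in-block p bx by {z} m = blockOf-intro {a} {b} {z} λ w ne → case split-walks G-sym p m ne of λ
      { (inj₁ (x≢w , q)) → (λ h → q ◅◅ proj₁ (blockOf-elim {a} {b} bx w (x≢w ∘ sym)) h) ,
                           (λ h → q ◅◅ proj₂ (blockOf-elim {a} {b} bx w (x≢w ∘ sym)) h)
      ; (inj₂ (y≢w , q)) → (λ h → q ◅◅ proj₁ (blockOf-elim {a} {b} by w (y≢w ∘ sym)) h) ,
                           (λ h → q ◅◅ proj₂ (blockOf-elim {a} {b} by w (y≢w ∘ sym)) h) }

    block-conn⊖ : ∀ w → Conn (B ⊖ w)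
    block-conn⊖ w {x} {y} hx hy with walk⇒path (block-link (⊖-⊑ B w x hx) (⊖-⊑ B w y hy) (⊖-≢ B hx) (⊖-≢ B hy))
    ... | ps , p = walk-map (λ {u} {v} e → conv u v e) (path-within {U = B} p
          (path-in-block (path-map (λ {u} {v} e → proj₂ (proj₂ (∣-elim G (full ⊖ w) {u} {v} e))) p)
            (⊖-⊑ B w x hx) (⊖-⊑ B w y hy)))
      where
      conv : ∀ u v → ((G ∣ (full ⊖ w)) ∣ B) u v ≡ true → (G ∣ (B ⊖ w)) u v ≡ true
      conv u v e with ∣-elim (G ∣ (full ⊖ w)) B {u} {v} e
      ... | p , q , r with ∣-elim G (full ⊖ w) {u} {v} r
      ... | s , t , g = ∣-intro G (B ⊖ w) (⊖-intro B (⊖-≢ full s) p) (⊖-intro B (⊖-≢ full t) q) g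

    block-conn : Conn B
    block-conn {x} {y} bx by with walk⇒path (G-conn x y)
    ... | ps , p = path-within {U = B} p (path-in-block p bx by)

    -- The edges that do not lie inside the block. Each component of this graph meets the block in
    -- exactly one vertex: at least one by connectedness (`to-block`), at most one by
    -- `outer-separates`.
    outer : Graph n
    outer x y = G x y ∧ not (B x ∧ B y)

    outer-symm : Symm outer
    outer-symm x y h = ∧-intro (G-sym _ _ (∧-elimˡ h))
      (not-intro (trans (∧-comm (B y) (B x)) (not-elim (∧-elimʳ {G x y} h))))

    -- A nontrivial path of outer edges between two vertices of the block would stay in the block by
    -- `path-in-block`, so its first edge would not be outer.
    outer-separates : ∀ {u v} → B u ≡ true → B v ≡ true → Walk outer u v → u ≡ v
    outer-separates bu bv q with walk⇒path q
    ... | _ , stop _ = refl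
    ... | _ , p@(step {u} {y} e nx r) = ⊥-elim (true≢false
          (∧-intro bu (path-in-block (path-map {E = outer} {G} (λ {s} {t} h → ∧-elimˡ {G s t} h) p) bu bv (there (path-head r))))
          (not-elim (∧-elimʳ {G u y} e)))

    to-block : ∀ {x y} → Walk G x y → B y ≡ true → ∃ λ u → (B u ≡ true) × Walk outer x u
    to-block nil by = _ , by , nil
    to-block (cons {x} {y} e p) bz with true? (B x)
    ... | inj₁ bx = x , bx , nil
    ... | inj₂ bx = let u , bu , q = to-block p bz in
          u , bu , cons (∧-intro e (not-intro (≢true⇒false (λ h → true≢false (∧-elimˡ h) bx)))) q

    module _ {c : Fin n} (bc : B c ≡ true) (c≢a : c ≢ a) (c≢b : c ≢ b) where

      private
        ρ : Fin n → Fin n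
        ρ x = proj₁ (to-block (G-conn x a) left-in-block)

        ρ-in : ∀ x → B (ρ x) ≡ true
        ρ-in x = proj₁ (proj₂ (to-block (G-conn x a) left-in-block))

        ρ-outer : ∀ x → Walk outer x (ρ x)
        ρ-outer x = proj₂ (proj₂ (to-block (G-conn x a) left-in-block))

        ρ-outer-edge : ∀ {x y} → outer x y ≡ true → ρ x ≡ ρ y
        ρ-outer-edge {x} {y} e = outer-separates (ρ-in x) (ρ-in y)
          (walk-rev outer-symm (ρ-outer x) ◅◅ cons e (ρ-outer y))

        third : ∀ x y → ∃ λ z → (B z ≡ true) × (z ≢ x) × (z ≢ y)
        third x y with a ≟ x | a ≟ y | b ≟ x | b ≟ y
        ... | no p | no q | _ | _ = a , left-in-block , p , q
        ... | _ | _ | no p | no q = b , right-in-block , p , q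
        ... | yes refl | _ | yes refl | _ = ⊥-elim (G-irr ab refl)
        ... | yes refl | _ | _ | yes refl = c , bc , c≢a , c≢b
        ... | _ | yes refl | yes refl | _ = c , bc , c≢b , c≢a
        ... | _ | yes refl | _ | yes refl = ⊥-elim (G-irr ab refl)

        -- A walk from `a` to the third vertex `c` inside the block without `b` starts with an edge
        -- from `a` to some `p ≢ b`. A path from `p` to `b` without `a` then closes up with the edge
        -- `ab`.
        cycle : ∃ λ vs → IsCycle G vs × (length vs ≤ card B)
        cycle with first-step (block-conn⊖ b (⊖-intro B (G-irr ab) left-in-block) (⊖-intro B c≢b bc)) (c≢a ∘ sym)
        ... | p , e with ∣-elim G (B ⊖ b) {a} {p} e
        ... | _ , hp , g with walk⇒path (block-conn⊖ a (⊖-intro B (λ { refl → G-irr g refl }) (⊖-⊑ B b p hp))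
                                 (⊖-intro B (λ q → G-irr ab (sym q)) right-in-block))
        ... | ps , q = a ∷ ps , (len q , path-unique q′ , ≡⇒T (closes-path q′ (G-sym _ _ ab))) ,
              ≤-trans (Unique-⊆-length (path-unique q′) (λ m → ∈-filterᵇ⁺ B (∈-allFin _) (path-in-block q′ left-in-block right-in-block m)))
                (≤-reflexive (sym (cnt-length B (allFin n))))
          where
          G′ = G ∣ (B ⊖ a)
          avoid : ∀ {x ps} → Path G′ x b ps → a ∉ ps
          avoid (stop .b) (here r) = G-irr ab r
          avoid (step {x} {y} e _ r) (here refl) = ⊖-≢ B (proj₁ (∣-elim G (B ⊖ a) {x} {y} e)) refl
          avoid (step e _ r) (there m) = avoid r m
          q′ : Path G a b (a ∷ ps)
          q′ = step g (avoid q) (path-map (λ {x} {y} e → proj₂ (proj₂ (∣-elim G (B ⊖ a) {x} {y} e))) q)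
          len : ∀ {ps} → Path G′ p b ps → 3 ≤ length (a ∷ ps)
          len (stop .b) = ⊥-elim (⊖-≢ B hp refl)
          len (step _ _ (stop _)) = s≤s (s≤s (s≤s z≤n))
          len (step _ _ (step _ _ _)) = s≤s (s≤s (s≤s z≤n))

      toBlock : Block
      toBlock = record
        { B = B ; ρ = ρ ; B-conn = block-conn ; B-conn⊖ = block-conn⊖ ; B-third = third ; B-cycle = cycle
        ; ρ-in = ρ-in
        ; ρ-fix = λ {x} bx → sym (outer-separates bx (ρ-in x) (ρ-outer x))
        ; ρ-edge = λ {x} {y} g h → ρ-outer-edge (∧-intro g (not-intro (≢true⇒false (λ e → h (∧-elimˡ e) (∧-elimʳ {B x} e)))))
        ; ρ-walk = λ x → walk-map-inv (λ y → ρ y ≡ ρ x)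
            (λ {y} {z} e h → let h′ = trans (sym (ρ-outer-edge e)) h in
               ∣-intro G (λ y → eqF (ρ y) (ρ x)) (≡⇒eqF h) (≡⇒eqF h′) (∧-elimˡ {G y z} e) , h′) refl (ρ-outer x) }
        where
        ≡⇒eqF : ∀ {i j : Fin n} → i ≡ j → eqF i j ≡ true
        ≡⇒eqF {i} refl = eqF-refl i

  -- The block of every edge is just its two ends; for a connected graph this means being a tree.
  Treelike : Set
  Treelike = ∀ {a b c} → G a b ≡ true → c ≢ a → c ≢ b → blockOf a b c ≡ false

  block-or-tree : Block ⊎ Treelike
  block-or-tree with any? (λ a → any? (λ b → any? (λ c → T? ((G a b ∧ blockOf a b c) ∧ (not (eqF c a) ∧ not (eqF c b))))))
  ... | yes (a , b , c , h) with ∧-elim {G a b ∧ blockOf a b c} (T⇒≡ h)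
  ... | p , q with ∧-elim {G a b} p | ∧-elim {not (eqF c a)} q
  ... | ab , bc | r , s = inj₁ (toBlock ab bc (eqF⇒≢ (not-elim r)) (eqF⇒≢ (not-elim s)))
  block-or-tree | no h = inj₂ λ {a} {b} {c} ab ca cb → ≢true⇒false λ bc → h (a , b , c , ≡⇒T
    (∧-intro (∧-intro ab bc) (∧-intro (not-intro (≢⇒eqF ca)) (not-intro (≢⇒eqF cb)))))

-- Gluing the pieces hanging off a block

≡⇒eqF : {i j : Fin n} → i ≡ j → eqF i j ≡ true
≡⇒eqF {i = i} refl = eqF-refl i

pred-∸ : ∀ {m} → 3 ≤ m → suc (m ∸ 2) ≡ m ∸ 1
pred-∸ (s≤s (s≤s _)) = refl

module Gluing {n : ℕ} (G : Graph n) (G-simple : IsSimple G) (G-conn : ∀ x y → Walk G x y) where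
  open Counting G G-simple public
  open Blocks G G-simple G-conn public

  Conn-hub : (X S : VSet n) → Conn S → S ⊑ X →
    (∀ y → X y ≡ true → ∃ λ z → (S z ≡ true) × Walk (G ∣ X) y z) → Conn X
  Conn-hub X S cS SX f {x} {y} a b with f x a | f y b
  ... | z , sz , p | w , sw , q = p ◅◅ (∣-mono SX (cS sz sw) ◅◅ walk-rev (∣-symm X G-sym) q)

  -- q sets, other than {v} itself, can be grown from v inside U.
  Grows : VSet n → Fin n → ℕ → Set
  Grows U v q = ∀ c N → Terminals c U ⟪ v ⟫ U N → N * q ≤ val c ⟪ v ⟫ ∅

  -- This is `grow₂` started at `{v}` with weight 0, as `{v}` is not one of the sets wanted, and
  -- without a bonus for the full set.
  Grows-tips : ∀ (U T : VSet n) {v x} → Conn U → U v ≡ true → U x ≡ true → x ≢ v → T ⊑ (U ⊖ v) →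
    (∀ y → T y ≡ true → Conn (U ⊖ y)) → Grows U v (card (U ⊖ v) + ch2 (card T))
  Grows-tips U T {v} {x} cU uv ux ne TU nc c N h with card (U ∖ ⟪ v ⟫) in eq
  ... | zero = ⊥-elim (true≢false (∖-intro U ⟪ v ⟫ ux (≢⇒eqF ne)) (card-0 (U ∖ ⟪ v ⟫) eq x))
  ... | suc p = ≤-trans (≤-reflexive (trans (cong (λ k → N * (k + ch2 (card T))) e′)
          (sym (+-identityʳ _))))
      (≤-trans (grow₂ c U p T 0 N 0 (eqF-refl v) cU (Conn-⟪⟫ v) vU (λ _ q → q) eq
        (λ y q → ∖-intro U ⟪ v ⟫ (⊖-⊑ U v y (TU y q)) (≢⇒eqF (⊖-≢ U (TU y q)))) nc z≤n h
        (≤-trans (≤-reflexive (+-identityʳ N)) (h U cU vU (λ _ q → q) (x , ux , ≢⇒eqF ne))))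
      (anti c {⟪ v ⟫} {⟪ v ⟫} {∅} {U ∖ U} (λ _ q → q) (λ _ ())))
    where
    vU : ⟪ v ⟫ ⊑ U
    vU y e = subst (λ w → U w ≡ true) (sym (eqF⇒≡ e)) uv
    e′ : card (U ⊖ v) ≡ suc p
    e′ = trans (cnt-cong (U ⊖ v) (U ∖ ⟪ v ⟫) (allFin n) (λ y → ∧-comm _ (U y))) eq

  module Hanging (𝔅 : Block) where
    open Block 𝔅 public

    m : ℕ
    m = card B

    abstract
      e : ℕ
      e = length (edges (G ∣ B))

      e≡ : e ≡ length (edges (G ∣ B))
      e≡ = refl

    tip : VSet n
    tip x = not (B x) ∧ not (cut x)

    H : Fin n → VSet n
    H u y = eqF (ρ y) u

    H-self : ∀ {u} → B u ≡ true → H u u ≡ true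
    H-self bu = ≡⇒eqF (ρ-fix bu)

    H-B : ∀ {u x} → H u x ≡ true → B x ≡ true → x ≡ u
    H-B h bx = trans (sym (ρ-fix bx)) (eqF⇒≡ h)

    H-conn : ∀ {u} → B u ≡ true → Conn (H u)
    H-conn {u} bu {x} {y} hx hy = to hx ◅◅ walk-rev (∣-symm (H u) G-sym) (to hy)
      where
      to : ∀ {z} → H u z ≡ true → Walk (G ∣ H u) z u
      to {z} h with eqF⇒≡ h
      ... | refl = ρ-walk z

    -- A walk can leave the fibre of `r` only at `r` itself, and there it may be cut off.
    stay : ∀ {x y r} → ρ y ≡ r → Walk (G ∣ (full ⊖ x)) y r → B r ≡ true → y ≢ x → Walk (G ∣ (H r ⊖ x)) y r
    stay h nil br _ = nil
    stay {x} {y} {r} h (cons {y = z} g p) br ne with ∣-elim G (full ⊖ x) {y} {z} g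
    ... | _ , hz , yz with ρ z ≟ r
    ... | yes e = cons (∣-intro G (H r ⊖ x) (⊖-intro (H r) ne (≡⇒eqF h)) (⊖-intro (H r) (⊖-≢ full hz) (≡⇒eqF e)) yz)
            (stay e p br (⊖-≢ full hz))
    ... | no ¬e with y ≟ r
    ... | yes refl = nil
    ... | no y≢r = ⊥-elim (¬e (trans (sym (ρ-edge yz (λ by _ → y≢r (trans (sym (ρ-fix by)) h)))) h))

    tip-walk : ∀ {x y} → tip x ≡ true → y ≢ x → Walk (G ∣ (H (ρ y) ⊖ x)) y (ρ y)
    tip-walk {x} {y} t ne = stay refl (noncut⇒Conn (not-elim (∧-elimʳ {not (B x)} t)) (⊖-intro full ne refl)
        (⊖-intro full (λ e → true≢false (subst (λ z → B z ≡ true) e (ρ-in y)) (not-elim (∧-elimˡ t))) refl)) (ρ-in y) ne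

    -- Once `u` is removed, no edge leaves the rest of `H u`, so `x` is separated from the other
    -- vertices of the block.
    root-cut : ∀ {u x} → B u ≡ true → H u x ≡ true → x ≢ u → cut u ≡ true
    root-cut {u} {x} bu hx ne with true? (cut u)
    ... | inj₁ h = h
    ... | inj₂ h with B-third u u
    ... | z , bz , z≢u , _ = ⊥-elim (z≢u (H-B (walk-inv (λ y → H u y ≡ true) inv
          (noncut⇒Conn h (⊖-intro full ne refl) (⊖-intro full z≢u refl)) hx) bz))
      where
      inv : ∀ {y z} → (G ∣ (full ⊖ u)) y z ≡ true → H u y ≡ true → H u z ≡ true
      inv {y} {z} g hy with ∣-elim G (full ⊖ u) {y} {z} g
      ... | a , _ , yz = ≡⇒eqF (trans (sym (ρ-edge yz (λ by _ → ⊖-≢ full a (H-B hy by)))) (eqF⇒≡ hy))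

    lone-noncut : ∀ {u} → B u ≡ true → (∀ x → H u x ≡ true → x ≡ u) → cut u ≡ false
    lone-noncut {u} bu f with B-third u u
    ... | z , bz , z≢u , _ = Conn⇒noncut z≢u (Conn-hub (full ⊖ u) (B ⊖ u) (B-conn⊖ u)
          (λ y h → ⊖-intro full (⊖-≢ B h) refl)
          λ y h → ρ y , ⊖-intro B (λ q → ⊖-≢ full h (f y (≡⇒eqF q))) (ρ-in y) ,
            ∣-mono {E = G} {U = H (ρ y)} {W = full ⊖ u} (λ w q → ⊖-intro full (λ { refl → ⊖-≢ full h (f y (≡⇒eqF (trans (sym (eqF⇒≡ q)) (ρ-fix bu)))) }) refl) (ρ-walk y))

    -- The vertex added last when `H u` is grown from `u` can be removed again without disconnecting
    -- `H u`, and therefore without disconnecting `G`.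
    root-tip : ∀ {u x} → B u ≡ true → H u x ≡ true → x ≢ u → ∃ λ y → (H u y ≡ true) × (tip y ≡ true)
    root-tip {u} {x} bu hx ne with grow-ind P (H u) (H-conn bu) (H-self bu) resp base step′ (x , hx , ne)
      where
      P : VSet n → Set
      P K = (∃ λ y → (K y ≡ true) × (y ≢ u)) → ∃ λ x → (K x ≡ true) × (x ≢ u) × Conn (K ⊖ x)
      resp : ∀ {K K′} → K ⊑ K′ → K′ ⊑ K → P K → P K′
      resp {K} {K′} f g p (y , ky , ne) with p (y , g y ky , ne)
      ... | x , kx , nx , c = x , f x kx , nx , Conn-cong {U = K ⊖ x} {W = K′ ⊖ x}
        (λ z h → ⊖-intro K′ (⊖-≢ K h) (f z (⊖-⊑ K x z h))) (λ z h → ⊖-intro K (⊖-≢ K′ h) (g z (⊖-⊑ K′ x z h))) c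
      base : P ⟪ u ⟫
      base (y , e , ne) = ⊥-elim (ne (eqF⇒≡ e))
      step′ : ∀ {K x v} → Conn K → K u ≡ true → K v ≡ true → K x ≡ false → G v x ≡ true → (K ⊕ x) ⊑ H u → P K → P (K ⊕ x)
      step′ {K} {x} cK ku kv kx g _ _ _ = x , ⊕-new K x , (λ { refl → true≢false ku kx }) ,
        Conn-cong {U = K} {W = (K ⊕ x) ⊖ x}
          (λ z h → ⊖-intro (K ⊕ x) (λ { refl → true≢false h kx }) (⊕-old K x z h))
          (λ z h → [ (λ e → ⊥-elim (⊖-≢ (K ⊕ x) h e)) , id ]′ (⊕-elim K x (⊖-⊑ (K ⊕ x) x z h))) cK
    ... | y , hy , y≢u , c = y , hy , ∧-intro (not-intro ¬by) (not-intro (Conn⇒noncut (y≢u ∘ sym)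
          (Conn-hub (full ⊖ y) B B-conn (λ z h → ⊖-intro full (λ { refl → true≢false h ¬by }) refl) walks)))
      where
      ¬by : B y ≡ false
      ¬by = ≢true⇒false (λ h → y≢u (H-B hy h))
      walks : ∀ z → (full ⊖ y) z ≡ true → ∃ λ w → (B w ≡ true) × Walk (G ∣ (full ⊖ y)) z w
      walks z h with ρ z ≟ u
      ... | yes q = u , bu , ∣-mono {E = G} {U = H u ⊖ y} {W = full ⊖ y} (λ w r → ⊖-intro full (⊖-≢ (H u) r) refl)
              (c (⊖-intro (H u) (⊖-≢ full h) (≡⇒eqF q)) (⊖-intro (H u) (y≢u ∘ sym) (H-self bu)))
      ... | no q = ρ z , ρ-in z , ∣-mono {E = G} {U = H (ρ z)} {W = full ⊖ y} (λ w r → ⊖-intro full (λ { refl → q (trans (sym (eqF⇒≡ r)) (eqF⇒≡ hy)) }) refl) (ρ-walk z)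

    -- Take one neighbour `p` of `x` in the block. A walk in `B ⊖ p` from `x` to a third vertex
    -- begins with a second neighbour.
    B-degree : ∀ {x} → B x ≡ true → 2 ≤ card ((G ∣ B) x)
    B-degree {x} bx with B-third x x
    ... | y , by , y≢x , _ with first-step (B-conn bx by) (y≢x ∘ sym)
    ... | p , gp with B-third x p
    ... | z , bz , z≢x , z≢p with ∣-elim G B {x} {p} gp
    ... | _ , bp , xp with first-step (B-conn⊖ p (⊖-intro B (λ { refl → G-irr xp refl }) bx) (⊖-intro B z≢p bz)) (z≢x ∘ sym)
    ... | q , gq with ∣-elim G (B ⊖ p) {x} {q} gq
    ... | _ , bq , xq = two-elements ((G ∣ B) x) gp (∣-intro G B bx (⊖-⊑ B p q bq) xq) (⊖-≢ B bq)

    -- Through a third vertex `z` of the block: from `a` to `z` avoiding `b`, then from `z` to `b`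
    -- avoiding `a`. Neither half can use the edge `ab`.
    B-detour : ∀ {a b} (K : VSet n) → B ⊑ K → (G ∣ B) a b ≡ true → Walk ((G ∣ K) ⊘ (a , b)) a b
    B-detour {a} {b} K BK h with ∣-elim G B {a} {b} h | B-third a b
    ... | ba , bb , g | z , bz , z≢a , z≢b =
      walk-map (λ {u} {w} → conv b u w (λ { (inj₁ (here refl)) → inj₂ refl ; (inj₂ (here refl)) → inj₁ refl }))
        (B-conn⊖ b (⊖-intro B (G-irr g) ba) (⊖-intro B z≢b bz)) ◅◅
      walk-map (λ {u} {w} → conv a u w (λ { (inj₁ (here refl)) → inj₁ refl ; (inj₂ (here refl)) → inj₂ refl }))
        (B-conn⊖ a (⊖-intro B z≢a bz) (⊖-intro B (G-irr g ∘ sym) bb))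
      where
      conv : ∀ c u w → ((((u , w) ∈ (a , b) ∷ []) ⊎ ((w , u) ∈ (a , b) ∷ [])) → (u ≡ c) ⊎ (w ≡ c)) →
        (G ∣ (B ⊖ c)) u w ≡ true → ((G ∣ K) ⊘ (a , b)) u w ≡ true
      conv c u w f e with ∣-elim G (B ⊖ c) {u} {w} e
      ... | p , q , g = ∧-intro (∣-intro G K (BK u (⊖-⊑ B c u p)) (BK w (⊖-⊑ B c w q)) g)
        (not-intro (≢true⇒false (λ r → [ ⊖-≢ B p , ⊖-≢ B q ]′ (f (adjIn-elim ((a , b) ∷ []) {u} {w} r)))))

    3≤m : 3 ≤ m
    3≤m = ≤-trans (proj₁ (proj₁ (proj₂ B-cycle))) (proj₂ (proj₂ B-cycle))

    B⊖-card : ∀ {v} → B v ≡ true → card (B ⊖ v) ≡ m ∸ 1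
    B⊖-card {v} bv = cong (_∸ 1) (sym (card-⊖ B bv))

    count-block : ∀ Z K D → Conn K → B ⊑ K → Disjoint D K → (∀ s → (∀ y → V s y ≡ K y) → Z s ≡ true) →
      suc e ≤ val (count Z) K D
    count-block Z K D cK BK d z with card-exists B (≤-trans (s≤s z≤n) 3≤m)
    ... | x , bx = ≤-trans (≤-reflexive (cong suc e≡)) (count-edges Z K D (edges (G ∣ B)) cK (BK x bx) d z
      (Uniq.filter⁺ _ (Uniq.cartesianProduct⁺ (Uniq.allFin⁺ n) (Uniq.allFin⁺ n)))
      λ {a} {b} q → let l , g = ∈-edges⁻ {G = G ∣ B} q ; ba , bb , ab = ∣-elim G B {a} {b} g in
        l , ∣-intro G K (BK a ba) (BK b bb) ab , B-detour K BK g)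

    private
      half-≤ : ∀ {a b} → a + a ≤ b + b → a ≤ b
      half-≤ {a} {b} h with a ≤? b
      ... | yes q = q
      ... | no q = ⊥-elim (<⇒≱ (+-mono-< (≰⇒> q) (≰⇒> q)) h)

      handshake-B : sumOver (λ x → card ((G ∣ B) x)) (allFin n) ≡ e + e
      handshake-B = trans (handshake (G ∣ B) (∣-symm B G-sym) (λ {x} {y} h → G-irr (proj₂ (proj₂ (∣-elim G B {x} {y} h)))))
        (sym (cong₂ _+_ e≡ e≡))

    m≤e : m ≤ e
    m≤e = half-≤ (≤-trans (sumOver-bound (λ x → card ((G ∣ B) x)) B (allFin n) (λ x → B-degree)) (≤-reflexive handshake-B))

    m<e : ∀ {x} → B x ≡ true → 3 ≤ card ((G ∣ B) x) → suc m ≤ e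
    m<e {x} bx l with suc m ≤? e
    ... | yes q = q
    ... | no q = ⊥-elim (1+n≰n (≤-trans (≤-trans (sumOver-bound-strict (λ x → card ((G ∣ B) x)) B {allFin n}
            (λ x → B-degree) (∈-allFin x) bx l) (≤-reflexive handshake-B)) (+-mono-≤ e≤m e≤m)))
      where
      e≤m : e ≤ m
      e≤m = ≤-pred (≰⇒> q)

    attached : VSet n → VSet n
    attached L x = B x ∨ L (ρ x)

    attached-walk : ∀ L y → attached L y ≡ true → Walk (G ∣ attached L) y (ρ y)
    attached-walk L y h with ∨-elim {B y} h
    ... | inj₁ by = subst (Walk (G ∣ attached L) y) (sym (ρ-fix by)) nil
    ... | inj₂ l = ∣-mono (λ z q → ∨-introʳ {B z} (subst (λ w → L w ≡ true) (sym (eqF⇒≡ q)) l)) (ρ-walk y)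

    attached-conn : ∀ L → Conn (attached L)
    attached-conn L = Conn-hub (attached L) B B-conn (λ x → ∨-introˡ) λ y h → ρ y , ρ-in y , attached-walk L y h

    attached-conn⊖ : ∀ L {x} → tip x ≡ true → Conn (attached L ⊖ x)
    attached-conn⊖ L {x} t = Conn-hub (attached L ⊖ x) B B-conn
      (λ y by → ⊖-intro (attached L) (λ { refl → true≢false by (not-elim (∧-elimˡ t)) }) (∨-introˡ by)) walks
      where
      walks : ∀ y → (attached L ⊖ x) y ≡ true → ∃ λ z → (B z ≡ true) × Walk (G ∣ (attached L ⊖ x)) y z
      walks y h with ∨-elim {B y} (⊖-⊑ (attached L) x y h)
      ... | inj₁ by = y , by , nil
      ... | inj₂ l = ρ y , ρ-in y , ∣-mono (λ z q → ⊖-intro (attached L) (⊖-≢ (H (ρ y)) q)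
              (∨-introʳ {B z} (subst (λ w → L w ≡ true) (sym (eqF⇒≡ (⊖-⊑ (H (ρ y)) x z q))) l)))
              (tip-walk t (⊖-≢ (attached L) h))

    total : VSet n → ℕ
    total U = cnt (inside U) Us

    tipsOf : VSet n → VSet n
    tipsOf L x = tip x ∧ L (ρ x)

    -- A lower bound for the number of ways to extend a fixed connected set hanging at a root by
    -- more of the block and nothing else: `m ∸ 1 + ch2 (m ∸ 1)` vertex sets, and `e` further
    -- subgraphs over the whole block that lack one of its edges. For a cycle it equals `tri m`.
    R′ : ℕ
    R′ = (m ∸ 1 + ch2 (m ∸ 1)) + e

    -- The first summand counts the subgraphs that avoid `v`, found in the connected set `B ⊖ v` by
    -- `inside-bound` with base point `w`. The second counts those through `v`, by `grow₂` with the
    -- bonus `e` for the full block.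
    block-total : ∀ {v w} → B v ≡ true → B w ≡ true → w ≢ v →
      (1 + tri′ (m ∸ 2)) + (1 + R′) ≤ total B
    block-total {v} {w} bv bw ne = ≤-trans (+-mono-≤ avoiding containing)
      (cnt-disjoint (inside (B ⊖ v)) (counted (within B) ⟪ v ⟫ ∅) (inside B) Us
        (λ s h → ∧-intro (∧-elimˡ h) (⊑ᵇ-intro (λ y q → ⊖-⊑ B v y (⊑ᵇ-elim {U = V s} {W = B ⊖ v} (∧-elimʳ {conn s} h) y q))))
        (λ s h → let p , q , _ = counted-elim (within B) ⟪ v ⟫ ∅ s h in ∧-intro p q)
        (λ s h q → let _ , _ , r , _ = counted-elim (within B) ⟪ v ⟫ ∅ s q in
          ⊖-≢ B (⊑ᵇ-elim {U = V s} {W = B ⊖ v} (∧-elimʳ {conn s} h) v (r v (eqF-refl v))) refl))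
      where
      vB : ⟪ v ⟫ ⊑ B
      vB y q = subst (λ z → B z ≡ true) (sym (eqF⇒≡ q)) bv
      avoiding : 1 + tri′ (m ∸ 2) ≤ cnt (inside (B ⊖ v)) Us
      avoiding = ≤-trans (≤-reflexive (cong (λ k → 1 + tri′ k)
          (trans (cong (λ k → k ∸ 2) (card-⊖ B bv)) (cong (_∸ 1) (card-⊖ (B ⊖ v) (⊖-intro B ne bw))))))
        (inside-bound (B ⊖ v) (B-conn⊖ v) (⊖-intro B ne bw))
      m-1≡ : card (B ∖ ⟪ v ⟫) ≡ m ∸ 1
      m-1≡ = trans (cnt-cong (B ∖ ⟪ v ⟫) (B ⊖ v) (allFin n) (λ y → ∧-comm (B y) _)) (B⊖-card bv)
      containing : 1 + R′ ≤ val (count (within B)) ⟪ v ⟫ ∅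
      containing = ≤-trans (≤-reflexive eq) (≤-trans
        (grow₂ (count (within B)) B (m ∸ 2) (B ⊖ v) 1 1 e (eqF-refl v) B-conn (Conn-⟪⟫ v) vB (λ _ q → q)
          (trans m-1≡ (sym 1+m-2))
          (λ y q → ∖-intro B ⟪ v ⟫ (⊖-⊑ B v y q) (≢⇒eqF (⊖-≢ B q))) (λ y _ → B-conn⊖ y)
          (count-pos (within B) ⟪ v ⟫ (B ∖ ⟪ v ⟫) (Conn-⟪⟫ v) (eqF-refl v)
            (λ y p q → true≢false q (∖-out B ⟪ v ⟫ {y} p)) (λ s eq → ⊑ᵇ-intro (λ y q → vB y (trans (sym (eq y)) q))))
          (λ K′ cK′ f f′ _ → count-pos (within B) K′ (B ∖ K′) cK′ (f v (eqF-refl v))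
            (λ y p q → true≢false q (∖-out B K′ {y} p)) (λ s eq → ⊑ᵇ-intro (λ y q → f′ y (trans (sym (eq y)) q))))
          (count-block (within B) B (B ∖ B) B-conn (λ _ q → q) (λ y p q → true≢false q (∖-out B B {y} p))
            (λ s eq → ⊑ᵇ-intro (λ y q → trans (sym (eq y)) q))))
        (anti (count (within B)) {⟪ v ⟫} {⟪ v ⟫} {∅} {B ∖ B} (λ _ q → q) (λ _ ())))
        where
        1+m-2 : suc (m ∸ 2) ≡ m ∸ 1
        1+m-2 = pred-∸ 3≤m
        eq : 1 + R′ ≡ 1 + 1 * (suc (m ∸ 2) + ch2 (card (B ⊖ v))) + e
        eq = cong suc (cong (_+ e) (trans (cong₂ (λ i j → i + ch2 j) (sym 1+m-2) (sym (B⊖-card bv))) (sym (*-identityˡ _))))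

    -- Three disjoint classes: subgraphs inside `attached L`, subgraphs inside `H v` with a vertex
    -- beyond `v`, and subgraphs with vertices on both sides of `v`. For the third class, growing
    -- the trace on `H v` supplies the factor `q`, and each trace carries a weight: either the
    -- remaining part stays in the block (`R′`), or the whole block is covered in one of `suc e`
    -- ways and the subgraph reaches into the pieces attached earlier.
    glue : ∀ L {v q τ} → L ⊑ B → B v ≡ true → L v ≡ false → Grows (H v) v q → τ ≤ cnt (insideBeyond (H v) v) Us →
      total (attached L) + τ + (R′ + suc e * (card (attached L ∖ B) + ch2 (card (tipsOf L)))) * q ≤ total (attached (L ⊕ v))
    glue L {v} {q} {τ} LB bv lv gr hτ = ≤-trans (+-mono-≤ (+-monoʳ-≤ (total 𝔸) hτ) (gr c₃ N terminals))
        (≤-trans (+-monoˡ-≤ (val c₃ ⟪ v ⟫ ∅) (cnt-disjoint (inside 𝔸) (insideBeyond (H v) v) PA∪H Us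
          (λ s h → ∨-introˡ h) (λ s h → ∨-introʳ {inside 𝔸 s} h)
          (λ s h h′ → let y , hy , vy = meets-elim (H v ⊖ v) s (∧-elimʳ {inside (H v) s} h′) in
             AH (⊑ᵇ-elim {U = V s} {W = 𝔸} (∧-elimʳ {conn s} h) y vy) hy)))
        (cnt-disjoint PA∪H (counted Z₃ ⟪ v ⟫ ∅) (inside X) Us
          (λ s h → [ (λ p → ∧-intro (∧-elimˡ p) (⊑ᵇ-intro (λ y r → AX y (⊑ᵇ-elim {U = V s} {W = 𝔸} (∧-elimʳ {conn s} p) y r))))
                   , (λ p → let p′ = ∧-elimˡ {inside (H v) s} p in ∧-intro (∧-elimˡ p′)
                       (⊑ᵇ-intro (λ y r → HX y (⊑ᵇ-elim {U = V s} {W = H v} (∧-elimʳ {conn s} p′) y r)))) ]′ (∨-elim {inside 𝔸 s} h))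
          (λ s h → let p , z , _ = counted-elim Z₃ ⟪ v ⟫ ∅ s h in ∧-intro p (∧-elimˡ z))
          (λ s h h′ → let p , z , _ = counted-elim Z₃ ⟪ v ⟫ ∅ s h′
                          z₁ , z₂ = ∧-elim {meets (𝔸 ⊖ v) s} (∧-elimʳ {within X s} z) in
             [ (λ r → let y , hy , vy = meets-elim (H v ⊖ v) s z₂ in
                  AH (⊑ᵇ-elim {U = V s} {W = 𝔸} (∧-elimʳ {conn s} r) y vy) hy)
             , (λ r → let y , ay , vy = meets-elim (𝔸 ⊖ v) s z₁ in
                  ⊖-≢ 𝔸 ay (AH′ (⊖-⊑ 𝔸 v y ay) (⊑ᵇ-elim {U = V s} {W = H v} (∧-elimʳ {conn s} (∧-elimˡ {inside (H v) s} r)) y vy))) ]′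
             (∨-elim {inside 𝔸 s} h))))
      where
      𝔸 X : VSet n
      𝔸 = attached L
      X = attached (L ⊕ v)
      Z₃ : Sub n → Bool
      Z₃ s = within X s ∧ (meets (𝔸 ⊖ v) s ∧ meets (H v ⊖ v) s)
      c₃ : Valuation n
      c₃ = count Z₃
      PA∪H : Sub n → Bool
      PA∪H s = inside 𝔸 s ∨ insideBeyond (H v) v s
      hA tA N : ℕ
      hA = card (𝔸 ∖ B)
      tA = card (tipsOf L)
      N = R′ + suc e * (hA + ch2 tA)
      AX : 𝔸 ⊑ X
      AX y h with ∨-elim {B y} h
      ... | inj₁ by = ∨-introˡ by
      ... | inj₂ l = ∨-introʳ {B y} (⊕-old L v (ρ y) l)
      BX : B ⊑ X
      BX y h = ∨-introˡ h
      HX : H v ⊑ X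
      HX y h = ∨-introʳ {B y} (subst (λ z → (L ⊕ v) z ≡ true) (sym (eqF⇒≡ h)) (⊕-new L v))
      AH′ : ∀ {y} → 𝔸 y ≡ true → H v y ≡ true → y ≡ v
      AH′ {y} a h with ∨-elim {B y} a
      ... | inj₁ by = H-B h by
      ... | inj₂ l = ⊥-elim (true≢false (subst (λ z → L z ≡ true) (eqF⇒≡ h) l) lv)
      AH : ∀ {y} → 𝔸 y ≡ true → (H v ⊖ v) y ≡ true → ⊥
      AH {y} a h = ⊖-≢ (H v) h (AH′ a (⊖-⊑ (H v) v y h))
      terminals : Terminals c₃ (H v) ⟪ v ⟫ (H v) N
      terminals K cK vK KH (y₀ , ky₀ , vy₀) = ≤-trans (+-mono-≤ class₁ class₂)
          (cnt-disjoint (counted Z₃ K (X ∖ U₁)) (counted Z₂ U₁ (X ∖ U₂)) (counted Z₃ K (H v ∖ K)) Us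
            (λ s h → let p , z , r , t = counted-elim Z₃ K (X ∖ U₁) s h in
              counted-intro Z₃ K (H v ∖ K) s p z r (λ y a b → t y (∖-intro X U₁ (HX y (∖-⊑ (H v) K y a))
                (≢true⇒false (λ u → [ (λ k → true≢false k (∖-out (H v) K {y} a))
                                    , (λ by → true≢false (subst (λ z → K z ≡ true) (sym (H-B (∖-⊑ (H v) K y a) by)) kv) (∖-out (H v) K {y} a)) ]′
                     (∨-elim {K y} u)))) b))
            (λ s h → let p , z , r , t = counted-elim Z₂ U₁ (X ∖ U₂) s h in
              counted-intro Z₃ K (H v ∖ K) s p (∧-elimˡ z) (λ y k → r y (∨-introˡ k)) (λ y a b → t y (∖-intro X U₂ (HX y (∖-⊑ (H v) K y a))
                (≢true⇒false (λ u → [ (λ k → true≢false k (∖-out (H v) K {y} a))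
                                    , (λ ay → true≢false (subst (λ z → K z ≡ true) (sym (AH′ ay (∖-⊑ (H v) K y a))) kv) (∖-out (H v) K {y} a)) ]′
                     (∨-elim {K y} u)))) b))
            (λ s h h′ → let p , z , r , t = counted-elim Z₃ K (X ∖ U₁) s h
                            p′ , z′ , r′ , t′ = counted-elim Z₂ U₁ (X ∖ U₂) s h′
                            y , ay , vy = meets-elim (𝔸 ∖ B) s (∧-elimʳ {Z₃ s} z′) in
              t y (∖-intro X U₁ (AX y (∖-⊑ 𝔸 B y ay)) (≢true⇒false (λ u → [
                  (λ k → true≢false (subst (λ z → B z ≡ true) (sym (AH′ (∖-⊑ 𝔸 B y ay) (KH y k))) bv) (∖-out 𝔸 B {y} ay))
                , (λ by → true≢false by (∖-out 𝔸 B {y} ay)) ]′ (∨-elim {K y} u)))) vy))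
        where
        kv : K v ≡ true
        kv = vK v (eqF-refl v)
        U₁ U₂ : VSet n
        U₁ = K ∪ B
        U₂ = K ∪ 𝔸
        Z₂ : Sub n → Bool
        Z₂ s = Z₃ s ∧ meets (𝔸 ∖ B) s
        U₁X : U₁ ⊑ X
        U₁X y h = [ (λ k → HX y (KH y k)) , BX y ]′ (∨-elim {K y} h)
        U₂X : U₂ ⊑ X
        U₂X y h = [ (λ k → HX y (KH y k)) , AX y ]′ (∨-elim {K y} h)
        cU₁ : Conn U₁
        cU₁ = Conn-∪ cK B-conn kv bv
        cU₂ : Conn U₂
        cU₂ = Conn-∪ cK (attached-conn L) kv (∨-introˡ bv)
        Z₃-ok : ∀ K′ {a} → K ⊑ K′ → K′ ⊑ X → K′ a ≡ true → (𝔸 ⊖ v) a ≡ true → ∀ s → (∀ y → V s y ≡ K′ y) → Z₃ s ≡ true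
        Z₃-ok K′ {a} f g ka av s eq = ∧-intro (⊑ᵇ-intro (λ y r → g y (trans (sym (eq y)) r)))
          (∧-intro (meets-intro (𝔸 ⊖ v) s av (trans (eq a) ka))
            (meets-intro (H v ⊖ v) s (⊖-intro (H v) (eqF⇒≢ vy₀) (KH y₀ ky₀)) (trans (eq y₀) (f y₀ ky₀))))
        disj : ∀ K′ → Disjoint (X ∖ K′) K′
        disj K′ y a b = true≢false b (∖-out X K′ {y} a)
        notK : ∀ {y} → B y ≡ true → y ≢ v → K y ≡ false
        notK {y} by ne = ≢true⇒false (λ k → ne (H-B (KH y k) by))
        -- The starting weight is 0, because `K` alone has no vertex on the block's side beyond `v`.
        class₁ : R′ ≤ val c₃ K (X ∖ U₁)
        class₁ = ≤-trans (≤-reflexive eq) (grow₂ c₃ X (m ∸ 2) (B ⊖ v) 0 1 e kv cU₁ cK (λ y k → ∨-introˡ k) U₁X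
          (trans (card-cong {U = U₁ ∖ K} {W = B ⊖ v} toB fromB) (trans (B⊖-card bv) (sym 1+m-2)))
          fromB noncut′ z≤n
          (λ K′ cK′ f f′ pr → count-pos Z₃ K′ (X ∖ K′) cK′ (f v kv) (disj K′)
            (Z₃-ok K′ f (λ y r → U₁X y (f′ y r)) (proj₁ (proj₂ pr)) (proper (proj₁ pr) (f′ _ (proj₁ (proj₂ pr))) (proj₂ (proj₂ pr)))))
          (count-block Z₃ U₁ (X ∖ U₁) cU₁ (λ y h → ∨-introʳ {K y} h) (disj U₁)
            (Z₃-ok U₁ (λ y k → ∨-introˡ k) U₁X (∨-introʳ {K w} bw) (⊖-intro 𝔸 w≢v (∨-introˡ bw)))))
          where
          w : Fin n
          w = proj₁ (B-third v v)
          bw : B w ≡ true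
          bw = proj₁ (proj₂ (B-third v v))
          w≢v : w ≢ v
          w≢v = proj₁ (proj₂ (proj₂ (B-third v v)))
          1+m-2 : suc (m ∸ 2) ≡ m ∸ 1
          1+m-2 = pred-∸ 3≤m
          eq : R′ ≡ 0 + 1 * (suc (m ∸ 2) + ch2 (card (B ⊖ v))) + e
          eq = cong (_+ e) (trans (cong₂ (λ i j → i + ch2 j) (sym 1+m-2) (sym (B⊖-card bv))) (sym (*-identityˡ _)))
          toB : (U₁ ∖ K) ⊑ (B ⊖ v)
          toB y h with ∨-elim {K y} (∖-⊑ U₁ K y h)
          ... | inj₁ k = ⊥-elim (true≢false k (∖-out U₁ K {y} h))
          ... | inj₂ by = ⊖-intro B (λ { refl → true≢false kv (∖-out U₁ K {y} h) }) by
          fromB : (B ⊖ v) ⊑ (U₁ ∖ K)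
          fromB y h = ∖-intro U₁ K (∨-introʳ {K y} (⊖-⊑ B v y h)) (notK (⊖-⊑ B v y h) (⊖-≢ B h))
          proper : ∀ y → U₁ y ≡ true → K y ≡ false → (𝔸 ⊖ v) y ≡ true
          proper y u k = let b = toB y (∖-intro U₁ K u k) in ⊖-intro 𝔸 (⊖-≢ B b) (∨-introˡ (⊖-⊑ B v y b))
          noncut′ : ∀ x → (B ⊖ v) x ≡ true → Conn (U₁ ⊖ x)
          noncut′ x h = Conn-cong {U = K ∪ (B ⊖ x)} {W = U₁ ⊖ x}
            (λ y r → [ (λ k → ⊖-intro U₁ (λ { refl → true≢false k (notK (⊖-⊑ B v x h) (⊖-≢ B h)) }) (∨-introˡ k))
                     , (λ b → ⊖-intro U₁ (⊖-≢ B b) (∨-introʳ {K y} (⊖-⊑ B x y b))) ]′ (∨-elim {K y} r))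
            (λ y r → [ ∨-introˡ , (λ b → ∨-introʳ {K y} (⊖-intro B (⊖-≢ U₁ r) b)) ]′ (∨-elim {K y} (⊖-⊑ U₁ x y r)))
            (Conn-∪ cK (B-conn⊖ x) kv (⊖-intro B (⊖-≢ B h ∘ sym) bv))
        toA : (U₂ ∖ U₁) ⊑ (𝔸 ∖ B)
        toA y h with ∨-elim {K y} (∖-⊑ U₂ U₁ y h)
        ... | inj₁ k = ⊥-elim (true≢false (∨-introˡ k) (∖-out U₂ U₁ {y} h))
        ... | inj₂ ay = ∖-intro 𝔸 B ay (≢true⇒false (λ by → true≢false (∨-introʳ {K y} by) (∖-out U₂ U₁ {y} h)))
        fromA : (𝔸 ∖ B) ⊑ (U₂ ∖ U₁)
        fromA y h = ∖-intro U₂ U₁ (∨-introʳ {K y} (∖-⊑ 𝔸 B y h)) (≢true⇒false (λ u → [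
            (λ k → true≢false (subst (λ z → B z ≡ true) (sym (AH′ (∖-⊑ 𝔸 B y h) (KH y k))) bv) (∖-out 𝔸 B {y} h))
          , (λ b → true≢false b (∖-out 𝔸 B {y} h)) ]′ (∨-elim {K y} u)))
        tipsA : tipsOf L ⊑ (𝔸 ∖ B)
        tipsA y h = ∖-intro 𝔸 B (∨-introʳ {B y} (∧-elimʳ {tip y} h)) (not-elim (∧-elimˡ {not (B y)} (∧-elimˡ {tip y} h)))
        -- Every set grown here contains the whole block and so weighs `suc e`. It starts from
        -- weight 0, since subgraphs confined to `K ∪ B` belong to `class₁`.
        class₂ : suc e * (hA + ch2 tA) ≤ val (count Z₂) U₁ (X ∖ U₂)
        class₂ with hA in hAeq
        ... | zero = ≤-trans (≤-reflexive (trans (cong (λ k → suc e * ch2 k) tA0) (*-zeroʳ (suc e)))) z≤n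
          where
          tA0 : tA ≡ 0
          tA0 = n≤0⇒n≡0 (≤-trans (card-mono {U = tipsOf L} {W = 𝔸 ∖ B} tipsA) (≤-reflexive hAeq))
        ... | suc p = ≤-trans (≤-reflexive (sym (+-identityʳ _))) (grow₂ (count Z₂) X p (tipsOf L) 0 (suc e) 0
            (∨-introˡ kv) cU₂ cU₁ U₁U₂ U₂X
            (trans (card-cong {U = U₂ ∖ U₁} {W = 𝔸 ∖ B} toA fromA) hAeq)
            (λ y t → fromA y (tipsA y t)) noncut′ z≤n tm
            (≤-trans (≤-reflexive (+-identityʳ (suc e))) (tm U₂ cU₂ U₁U₂ (λ _ r → r) (∖-exists U₂ U₁
              (trans (card-cong {U = U₂ ∖ U₁} {W = 𝔸 ∖ B} toA fromA) hAeq)))))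
          where
          U₁U₂ : U₁ ⊑ U₂
          U₁U₂ y h = [ ∨-introˡ , (λ b → ∨-introʳ {K y} (∨-introˡ b)) ]′ (∨-elim {K y} h)
          tm : Terminals (count Z₂) X U₁ U₂ (suc e)
          tm K′ cK′ f f′ (y , ky , uy) = count-block Z₂ K′ (X ∖ K′) cK′ (λ z b → f z (∨-introʳ {K z} b)) (disj K′)
            λ s eq → ∧-intro (Z₃-ok K′ (λ z k → f z (∨-introˡ k)) (λ z r → U₂X z (f′ z r)) ky
                (⊖-intro 𝔸 (λ { refl → true≢false bv (∖-out 𝔸 B {y} ay) }) (∖-⊑ 𝔸 B y ay)) s eq)
              (meets-intro (𝔸 ∖ B) s ay (trans (eq y) ky))
            where
            ay : (𝔸 ∖ B) y ≡ true
            ay = toA y (∖-intro U₂ U₁ (f′ y ky) uy)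
          noncut′ : ∀ x → tipsOf L x ≡ true → Conn (U₂ ⊖ x)
          noncut′ x h = Conn-cong {U = K ∪ (𝔸 ⊖ x)} {W = U₂ ⊖ x}
            (λ y r → [ (λ k → ⊖-intro U₂ (λ { refl → x∉K k }) (∨-introˡ k))
                     , (λ b → ⊖-intro U₂ (⊖-≢ 𝔸 b) (∨-introʳ {K y} (⊖-⊑ 𝔸 x y b))) ]′ (∨-elim {K y} r))
            (λ y r → [ ∨-introˡ , (λ b → ∨-introʳ {K y} (⊖-intro 𝔸 (⊖-≢ U₂ r) b)) ]′ (∨-elim {K y} (⊖-⊑ U₂ x y r)))
            (Conn-∪ cK (attached-conn⊖ L (∧-elimˡ h)) kv (⊖-intro 𝔸 v≢x (∨-introˡ bv)))
            where
            v≢x : v ≢ x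
            v≢x refl = true≢false bv (∖-out 𝔸 B {v} (tipsA v h))
            x∉K : K x ≡ true → ⊥
            x∉K k = v≢x (sym (AH′ (∖-⊑ 𝔸 B x (tipsA x h)) (KH x k)))

-- Arithmetic of the extremal value

tri : ℕ → ℕ
tri zero = 0
tri (suc k) = tri k + suc k

-- Number of connected subgraphs of the cycle C_c with a pendant path of k further vertices.
Φ : ℕ → ℕ → ℕ
Φ c k = c * c + 1 + tri k + (tri c + 1) * k

tri-+ : ∀ a b → tri (a + b) ≡ tri a + tri b + a * b
tri-+ zero b = sym (+-identityʳ _)
tri-+ (suc a) b rewrite tri-+ a b = lemma (tri a) (tri b) a b
  where
  lemma : ∀ x y a b → x + y + a * b + suc (a + b) ≡ x + suc a + y + (b + a * b)
  lemma = solve-∀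

tri≡ch2 : ∀ d → tri d ≡ ch2 d + d
tri≡ch2 zero = refl
tri≡ch2 (suc d) rewrite tri≡ch2 d = lemma (ch2 d) d
  where
  lemma : ∀ x d → x + d + suc d ≡ d + x + suc d
  lemma = solve-∀

sq≡ch2 : ∀ d → d * d ≡ 2 * ch2 d + d
sq≡ch2 zero = refl
sq≡ch2 (suc d) = trans (lemma d) (trans (cong (λ z → z + d + suc d) (sq≡ch2 d)) (lemma₂ (ch2 d) d))
  where
  lemma : ∀ d → suc d * suc d ≡ d * d + d + suc d
  lemma = solve-∀
  lemma₂ : ∀ x d → 2 * x + d + d + suc d ≡ 2 * (d + x) + suc d
  lemma₂ = solve-∀

tri′≡tri : ∀ h → tri′ h ≡ tri h + h
tri′≡tri zero = refl
tri′≡tri (suc h) rewrite tri′≡tri h = lemma (tri h) h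
  where
  lemma : ∀ x h → x + h + (2 + h) ≡ x + suc h + suc h
  lemma = solve-∀

ch2-+ : ∀ a b → ch2 (a + b) ≡ ch2 a + ch2 b + a * b
ch2-+ zero b = sym (+-identityʳ _)
ch2-+ (suc a) b rewrite ch2-+ a b = lemma (ch2 a) (ch2 b) a b
  where
  lemma : ∀ x y a b → a + b + (x + y + a * b) ≡ a + x + y + (b + a * b)
  lemma = solve-∀

tri′-+ : ∀ a b → tri′ (a + b) ≡ tri′ a + tri′ b + a * b
tri′-+ a b rewrite tri′≡tri (a + b) | tri-+ a b | tri′≡tri a | tri′≡tri b = lemma (tri a) (tri b) a b
  where
  lemma : ∀ x y a b → x + y + a * b + (a + b) ≡ x + a + (y + b) + a * b
  lemma = solve-∀

m≤tri : ∀ m → m ≤ tri m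
m≤tri zero = z≤n
m≤tri (suc m) = m≤n+m (suc m) (tri m)

ch2-mono : ∀ {a b} → a ≤ b → ch2 a ≤ ch2 b
ch2-mono {zero} h = z≤n
ch2-mono {suc a} {suc b} (s≤s h) = +-mono-≤ h (ch2-mono h)

tri≥2 : ∀ {m} → 4 ≤ m → suc m + suc m ≤ tri m
tri≥2 h with m≤n⇒∃[o]m+o≡n h
... | o , refl rewrite tri-+ 4 o = ≤-trans (m≤m+n _ (tri o + 2 * o)) (≤-reflexive (lemma o (tri o)))
  where
  lemma : ∀ o x → (5 + o) + (5 + o) + (x + 2 * o) ≡ 10 + x + 4 * o
  lemma = solve-∀

tri≥3 : ∀ {m} → 6 ≤ m → 2 * m + suc m ≤ tri m
tri≥3 h with m≤n⇒∃[o]m+o≡n h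
... | o , refl rewrite tri-+ 6 o = ≤-trans (m≤m+n _ (2 + tri o + 3 * o)) (≤-reflexive (lemma o (tri o)))
  where
  lemma : ∀ o x → 2 * (6 + o) + (7 + o) + (2 + x + 3 * o) ≡ 21 + x + 6 * o
  lemma = solve-∀

ch2≥ : ∀ {d} → 3 ≤ d → d ≤ ch2 d
ch2≥ h with m≤n⇒∃[o]m+o≡n h
... | o , refl rewrite ch2-+ 3 o = ≤-trans (m≤m+n _ (ch2 o + 2 * o)) (≤-reflexive (lemma o (ch2 o)))
  where
  lemma : ∀ o x → (3 + o) + (x + 2 * o) ≡ 3 + x + 3 * o
  lemma = solve-∀

ch2≥3 : ∀ {d} → 7 ≤ d → 3 * d ≤ ch2 d
ch2≥3 h with m≤n⇒∃[o]m+o≡n h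
... | o , refl rewrite ch2-+ 7 o = ≤-trans (m≤m+n _ (ch2 o + 4 * o)) (≤-reflexive (lemma o (ch2 o)))
  where
  lemma : ∀ o x → 3 * (7 + o) + (x + 4 * o) ≡ 21 + x + 7 * o
  lemma = solve-∀

suc≤tri : ∀ {m} → 3 ≤ m → suc m ≤ tri m
suc≤tri {suc m} (s≤s h) = +-monoˡ-≤ (suc m) (≤-trans (≤-trans (s≤s z≤n) h) (m≤tri m))

2tri : ∀ m → tri m + tri m ≡ m * m + m
2tri m = trans (cong₂ _+_ (tri≡ch2 m) (tri≡ch2 m)) (trans (lemma (ch2 m) m) (cong (_+ m) (sym (sq≡ch2 m))))
  where
  lemma : ∀ x m → x + m + (x + m) ≡ 2 * x + m + m
  lemma = solve-∀

-- Squares and triangular numbers of `d` are expressed through `ch2 d`, so that the comparisons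
-- become identities linear in `ch2 d` and free of division.
Φ-+ : ∀ m d k → Φ (m + d) k ≡
  (m * m + 2 * (m * d) + 2 * ch2 d + d) + 1 + tri k + (tri m + (ch2 d + d) + m * d + 1) * k
Φ-+ m d k = cong₂ (λ x y → x + 1 + tri k + (y + 1) * k)
  (trans (lemma m d) (trans (cong (λ z → m * m + 2 * (m * d) + z) (sq≡ch2 d)) (sym (+-assoc (m * m + 2 * (m * d)) (2 * ch2 d) d))))
  (trans (tri-+ m d) (cong (λ z → tri m + z + m * d) (tri≡ch2 d)))
  where
  lemma : ∀ m d → (m + d) * (m + d) ≡ m * m + 2 * (m * d) + d * d
  lemma = solve-∀

-- Bound minus Φ for a single root, with the negative terms moved to the left so that no subtraction occurs.
one-root-excess : ∀ m d k → m * m + 1 + tri′ (k + d) + tri m * (k + d + (d + ch2 d)) + (ch2 d + 2 * (m * d) + k * ch2 d + k * (m * d))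
  ≡ Φ (m + d) k + (d + d * (m * m + m) + tri m * ch2 d)
one-root-excess m d k rewrite tri′≡tri (k + d) | tri-+ k d | tri≡ch2 d | Φ-+ m d k =
  trans (lemma₁ m d k (ch2 d) (tri k) (tri m)) (trans
    (cong (λ z → m * m + 1 + (tri k + (ch2 d + d) + k * d + (k + d)) + tri m * (k + ch2 d) + d * z + (ch2 d + 2 * (m * d) + k * ch2 d + k * (m * d))) (2tri m))
    (lemma₂ m d k (ch2 d) (tri k) (tri m)))
  where
  lemma₁ : ∀ m d k x K R → m * m + 1 + (K + (x + d) + k * d + (k + d)) + R * (k + d + (d + x)) + (x + 2 * (m * d) + k * x + k * (m * d))
    ≡ m * m + 1 + (K + (x + d) + k * d + (k + d)) + R * (k + x) + d * (R + R) + (x + 2 * (m * d) + k * x + k * (m * d))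
  lemma₁ = solve-∀
  lemma₂ : ∀ m d k x K R → m * m + 1 + (K + (x + d) + k * d + (k + d)) + R * (k + x) + d * (m * m + m) + (x + 2 * (m * d) + k * x + k * (m * d))
    ≡ (m * m + 2 * (m * d) + 2 * x + d) + 1 + K + (R + (x + d) + m * d + 1) * k + (d + d * (m * m + m) + R * x)
  lemma₂ = solve-∀

-- The left side is the bound that holds from the second root on. Writing `m` as `k + j` uses
-- `k ≤ m` and leaves an excess over `Φ` in which no term is negative.
two-root-excess : ∀ k j d → let m = k + j in
  m * m + 1 + tri′ (k + d) + (k + d + d) * tri m + suc m * ch2 d + (d * m + m)
  ≡ Φ (m + d) k + (d + m + j * ch2 d + m * d * j)
two-root-excess k j d rewrite tri′≡tri (k + d) | tri-+ k d | tri≡ch2 d | Φ-+ (k + j) d k =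
  trans (lemma₁ (k + j) d k (ch2 d) (tri k) (tri (k + j))) (trans
    (cong (λ z → (k + j) * (k + j) + 1 + (tri k + (ch2 d + d) + k * d + (k + d)) + k * tri (k + j) + d * z + suc (k + j) * ch2 d + (d * (k + j) + (k + j))) (2tri (k + j)))
    (lemma₂ j d k (ch2 d) (tri k) (tri (k + j))))
  where
  lemma₁ : ∀ m d k x K R → m * m + 1 + (K + (x + d) + k * d + (k + d)) + (k + d + d) * R + suc m * x + (d * m + m)
    ≡ m * m + 1 + (K + (x + d) + k * d + (k + d)) + k * R + d * (R + R) + suc m * x + (d * m + m)
  lemma₁ = solve-∀
  lemma₂ : ∀ j d k x K R → (k + j) * (k + j) + 1 + (K + (x + d) + k * d + (k + d)) + k * R + d * ((k + j) * (k + j) + (k + j)) + suc (k + j) * x + (d * (k + j) + (k + j))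
    ≡ ((k + j) * (k + j) + 2 * ((k + j) * d) + 2 * x + d) + 1 + K + (R + (x + d) + (k + j) * d + 1) * k + (d + (k + j) + j * x + (k + j) * d * j)
  lemma₂ = solve-∀

-- Attaching one more root, with h₁ vertices and suc d₁ tips, to h vertices with d + r tips at r ≥ 1 roots.
attach-root : ∀ {T} m h d r h₁ d₁ E R′ → 3 ≤ m → m ≤ E → tri m ≤ R′ → d + r ≤ h → 1 ≤ r → suc d₁ ≤ h₁ →
  m * m + 1 + tri′ h + (h + d) * tri m + suc m * ch2 d ≤ T →
  m * m + 1 + tri′ (h + h₁) + (h + h₁ + (d + d₁)) * tri m + suc m * ch2 (d + d₁) + ((d + d₁) * m + m)
    ≤ T + tri′ h₁ + (R′ + suc E * (h + ch2 (d + r))) * (h₁ + ch2 (suc d₁))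
attach-root {T} m h d r h₁ d₁ E R′ 3≤m mE RR′ th 1≤r dh hT = begin
  m * m + 1 + tri′ (h + h₁) + (h + h₁ + (d + d₁)) * R + suc m * ch2 (d + d₁) + ((d + d₁) * m + m)
    ≡⟨ cong₂ (λ x y → m * m + 1 + x + (h + h₁ + (d + d₁)) * R + suc m * y + ((d + d₁) * m + m)) (tri′-+ h h₁) (ch2-+ d d₁) ⟩
  m * m + 1 + (tri′ h + tri′ h₁ + h * h₁) + (h + h₁ + (d + d₁)) * R + suc m * (ch2 d + ch2 d₁ + d * d₁) + ((d + d₁) * m + m)
    ≡⟨ lemma₁ m h h₁ d d₁ R (tri′ h) (tri′ h₁) (ch2 d) (ch2 d₁) ⟩
  (m * m + 1 + tri′ h + (h + d) * R + suc m * ch2 d) + tri′ h₁ + ((R * (h₁ + d₁) + suc m * ch2 d₁) + (h * h₁ + (suc m * (d * d₁) + ((d + d₁) * m + m))))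
    ≤⟨ +-mono-≤ (+-monoˡ-≤ (tri′ h₁) hT) (+-mono-≤ part₁ part₂) ⟩
  T + tri′ h₁ + (R * q + suc m * N * q)
    ≡⟨ cong (T + tri′ h₁ +_) (sym (*-distribʳ-+ q R (suc m * N))) ⟩
  T + tri′ h₁ + (R + suc m * N) * q
    ≤⟨ +-monoʳ-≤ (T + tri′ h₁) (*-monoˡ-≤ q (+-mono-≤ RR′ (*-monoˡ-≤ N (s≤s mE)))) ⟩
  T + tri′ h₁ + (R′ + suc E * N) * q ∎
  where
  open ≤-Reasoning
  R N q : ℕ
  R = tri m
  N = h + ch2 (d + r)
  q = h₁ + ch2 (suc d₁)
  1≤m : 1 ≤ m
  1≤m = ≤-trans (s≤s z≤n) 3≤m
  sm≤R : suc m ≤ R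
  sm≤R = suc≤tri 3≤m
  lemma₁ : ∀ m h h₁ d d₁ R t t₁ x x₁ →
    m * m + 1 + (t + t₁ + h * h₁) + (h + h₁ + (d + d₁)) * R + suc m * (x + x₁ + d * d₁) + ((d + d₁) * m + m)
    ≡ (m * m + 1 + t + (h + d) * R + suc m * x) + t₁ + ((R * (h₁ + d₁) + suc m * x₁) + (h * h₁ + (suc m * (d * d₁) + ((d + d₁) * m + m))))
  lemma₁ = solve-∀
  part₁ : R * (h₁ + d₁) + suc m * ch2 d₁ ≤ R * q
  part₁ = ≤-trans (+-monoʳ-≤ (R * (h₁ + d₁)) (*-monoˡ-≤ (ch2 d₁) sm≤R)) (≤-reflexive (lem R h₁ d₁ (ch2 d₁)))
    where
    lem : ∀ R h d x → R * (h + d) + R * x ≡ R * (h + (d + x))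
    lem = solve-∀
  N≥ : d + suc d ≤ N
  N≥ = ≤-trans (≤-reflexive (+-comm d (suc d))) (+-mono-≤ (≤-trans (≤-trans (≤-reflexive (+-comm 1 d)) (+-monoʳ-≤ d 1≤r)) th)
    (≤-trans (m≤m+n d (ch2 d)) (ch2-mono (≤-trans (≤-reflexive (+-comm 1 d)) (+-monoʳ-≤ d 1≤r)))))
  q≥ : d₁ + suc d₁ ≤ q
  q≥ = ≤-trans (≤-reflexive (+-comm d₁ (suc d₁))) (+-mono-≤ dh (m≤m+n d₁ (ch2 d₁)))
  -- One copy of `N * q` covers the cross term `h * h₁`. The other `m` copies use `N ≥ 2d + 1` and
  -- `q ≥ 2d₁ + 1`: the product is at least `2 * d * d₁ + d + d₁ + 1`, which pays for the cross term
  -- of `ch2` and for the surplus `(d + d₁) * m + m`.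
  part₂ : h * h₁ + (suc m * (d * d₁) + ((d + d₁) * m + m)) ≤ suc m * N * q
  part₂ = begin
    h * h₁ + (suc m * (d * d₁) + ((d + d₁) * m + m))
      ≤⟨ +-monoʳ-≤ (h * h₁) (+-monoˡ-≤ ((d + d₁) * m + m) (+-monoˡ-≤ (m * (d * d₁)) (≤-trans (≤-reflexive (sym (*-identityˡ (d * d₁)))) (*-monoˡ-≤ (d * d₁) 1≤m)))) ⟩
    h * h₁ + ((m * (d * d₁) + m * (d * d₁)) + ((d + d₁) * m + m))
      ≤⟨ +-monoʳ-≤ (h * h₁) (≤-trans (m≤m+n _ (2 * (m * (d * d₁)) + m * (d + d₁))) (≤-reflexive (lem m d d₁))) ⟩
    h * h₁ + m * ((d + suc d) * (d₁ + suc d₁))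
      ≤⟨ +-mono-≤ (*-mono-≤ (m≤m+n h _) (m≤m+n h₁ _)) (*-monoʳ-≤ m (*-mono-≤ N≥ q≥)) ⟩
    N * q + m * (N * q) ≡⟨ lem₂ m N q ⟩
    suc m * N * q ∎
    where
    lem : ∀ m d e → (m * (d * e) + m * (d * e)) + ((d + e) * m + m) + (2 * (m * (d * e)) + m * (d + e)) ≡ m * ((d + suc d) * (e + suc e))
    lem = solve-∀
    lem₂ : ∀ m N q → N * q + m * (N * q) ≡ suc m * N * q
    lem₂ = solve-∀

-- By `one-root-excess` it remains to beat `deficit`. If `k < m`, the coefficients of `ch2 d` and of
-- `d` dominate one by one. If `k = m`, a term `m * d` is left over, and only what `tri m` has to
-- spare above `suc m` in the coefficient of `ch2 d` can pay for it.
one-root-strict : ∀ m d k → 3 ≤ m → 1 ≤ k → k ≤ m → 2 ≤ d → 13 ≤ m + (k + d) →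
  suc (Φ (m + d) k) ≤ m * m + 1 + tri′ (k + d) + tri m * (k + d + (d + ch2 d))
one-root-strict m d k 3≤m 1≤k k≤m 2≤d 13≤n = +-cancelʳ-≤ deficit _ _ (begin
  suc (Φ (m + d) k) + deficit ≡⟨ sym (+-suc (Φ (m + d) k) deficit) ⟩
  Φ (m + d) k + suc deficit ≤⟨ +-monoʳ-≤ (Φ (m + d) k) main ⟩
  Φ (m + d) k + (d + d * (m * m + m) + tri m * x) ≡⟨ sym (one-root-excess m d k) ⟩
  m * m + 1 + tri′ (k + d) + tri m * (k + d + (d + x)) + deficit ∎)
  where
  open ≤-Reasoning
  x deficit : ℕ
  x = ch2 d
  deficit = x + 2 * (m * d) + k * x + k * (m * d)
  1≤d : 1 ≤ d
  1≤d = ≤-trans (s≤s z≤n) 2≤d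
  main : suc deficit ≤ d + d * (m * m + m) + tri m * x
  main with k <? m
  ... | yes k<m = begin
    suc deficit ≡⟨ lem₁ m d k x ⟩
    1 + (suc k * x + d * (suc k * m + m)) ≤⟨ +-mono-≤ 1≤d (+-mono-≤ (*-monoˡ-≤ x (≤-trans k<m (m≤tri m)))
        (*-monoʳ-≤ d (+-monoˡ-≤ m (*-monoˡ-≤ m k<m)))) ⟩
    d + (tri m * x + d * (m * m + m)) ≡⟨ lem₂ d (tri m * x) _ ⟩
    d + d * (m * m + m) + tri m * x ∎
    where
    lem₁ : ∀ m d k x → suc (x + 2 * (m * d) + k * x + k * (m * d)) ≡ 1 + (suc k * x + d * (suc k * m + m))
    lem₁ = solve-∀
    lem₂ : ∀ d a b → d + (a + b) ≡ d + b + a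
    lem₂ = solve-∀
  ... | no k≮m with ≤-antisym k≤m (≮⇒≥ k≮m)
  ... | refl = begin
    suc deficit ≡⟨ lem₁ m d x ⟩
    suc (m * d) + (suc m * x + d * (m * m + m)) ≤⟨ +-monoˡ-≤ _ balanced ⟩
    d + spare * x + (suc m * x + d * (m * m + m)) ≡⟨ lem₂ d spare m x (d * (m * m + m)) ⟩
    d + d * (m * m + m) + (spare + suc m) * x ≤⟨ +-monoʳ-≤ (d + d * (m * m + m)) (*-monoˡ-≤ x (≤-reflexive spare≡)) ⟩
    d + d * (m * m + m) + tri m * x ∎
    where
    lem₁ : ∀ m d x → suc (x + 2 * (m * d) + m * x + m * (m * d)) ≡ suc (m * d) + (suc m * x + d * (m * m + m))
    lem₁ = solve-∀
    lem₂ : ∀ d s m x b → d + s * x + (suc m * x + b) ≡ d + b + (s + suc m) * x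
    lem₂ = solve-∀
    spare : ℕ
    spare = tri m ∸ suc m
    spare≡ : spare + suc m ≡ tri m
    spare≡ = m∸n+n≡m (suc≤tri 3≤m)
    spare≥ : ∀ {b} → b + suc m ≤ tri m → b ≤ spare
    spare≥ {b} h = +-cancelʳ-≤ (suc m) b spare (≤-trans h (≤-reflexive (sym spare≡)))
    -- The size bound decides the small cases: `d = 2` forces `m ≥ 6`, and `m = 3` forces `d ≥ 7`.
    balanced : suc (m * d) ≤ d + spare * x
    balanced with 4 ≤? m | 3 ≤? d
    ... | yes 4≤m | yes 3≤d = +-mono-≤ 1≤d (*-mono-≤ (≤-trans (n≤1+n m) (spare≥ (tri≥2 4≤m))) (ch2≥ 3≤d))
    ... | yes 4≤m | no d≱3 with ≤-antisym (≤-pred (≰⇒> d≱3)) 2≤d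
    ... | refl = ≤-trans (≤-trans (n≤1+n (suc (m * 2))) (≤-reflexive (lem m))) (+-monoʳ-≤ 2 (*-monoˡ-≤ 1 (spare≥ (tri≥3 6≤m))))
      where
      lem : ∀ m → 2 + m * 2 ≡ 2 + 2 * m * 1
      lem = solve-∀
      6≤m : 6 ≤ m
      6≤m with 6 ≤? m
      ... | yes q = q
      ... | no q = ⊥-elim (1+n≰n (≤-trans 13≤n (+-mono-≤ (≤-pred (≰⇒> q)) (+-monoˡ-≤ 2 (≤-pred (≰⇒> q))))))
    balanced | no m≱4 | _ with ≤-antisym (≤-pred (≰⇒> m≱4)) 3≤m
    ... | refl = +-mono-≤ 1≤d (≤-trans (ch2≥3 (+-cancelˡ-≤ 6 7 d 13≤n)) (m≤m+n (ch2 d) (1 * ch2 d)))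

-- Summing over the cut vertices of a block

ch2-pred : ∀ {m} → 1 ≤ m → m ∸ 1 + ch2 (m ∸ 1) ≡ ch2 m
ch2-pred (s≤s _) = refl

-- With `ε = 0` the value `m * m + 1` is the number of connected subgraphs of a cycle on `m`
-- vertices; `ε` stands for the edges of the block in excess of `m`.
block-arith : ∀ m ε → 2 ≤ m → (1 + tri′ (m ∸ 2)) + (1 + (ch2 m + (m + ε))) ≡ m * m + 1 + ε
block-arith (suc (suc j)) ε (s≤s (s≤s _)) rewrite tri′≡tri j | tri≡ch2 j =
  trans (lemma j (ch2 j) ε) (cong (λ z → z + 1 + ε) (sym (sq≡ch2 (suc (suc j)))))
  where
  lemma : ∀ j x ε → (1 + (x + j + j)) + (1 + ((suc j + (j + x)) + (suc (suc j) + ε))) ≡ 2 * (suc j + (j + x)) + suc (suc j) + 1 + ε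
  lemma = solve-∀

-- The coefficient of `ch2 d` is lowered from `tri m` to `suc m`, so that the bound keeps one and
-- the same form `base` when further roots are attached.
first-root : ∀ m h d ε R′ → 3 ≤ m → tri m ≤ R′ →
  m * m + 1 + tri′ h + (h + d) * tri m + suc m * ch2 d ≤ m * m + 1 + ε + tri′ h + R′ * (h + ch2 (suc d))
first-root m h d ε R′ 3≤m RR′ = ≤-trans (≤-reflexive (+-assoc (m * m + 1 + tri′ h) _ _)) (+-mono-≤
    (≤-trans (m≤m+n _ ε) (≤-reflexive (lem (m * m + 1) (tri′ h) ε)))
    (≤-trans (≤-trans (+-monoʳ-≤ ((h + d) * tri m) (*-monoˡ-≤ (ch2 d) (suc≤tri 3≤m))) (≤-reflexive (lem₂ h d (tri m) (ch2 d))))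
      (*-monoˡ-≤ (h + ch2 (suc d)) RR′)))
  where
  lem : ∀ a t ε → a + t + ε ≡ a + ε + t
  lem = solve-∀
  lem₂ : ∀ h d R x → (h + d) * R + R * x ≡ R * (h + (d + x))
  lem₂ = solve-∀

module Roots {n : ℕ} (G : Graph n) (G-simple : IsSimple G) (G-conn : ∀ x y → Walk G x y)
  (𝔅 : Blocks.Block G G-simple G-conn) where
  open Gluing G G-simple G-conn public
  open Hanging 𝔅 public

  R′≡ : R′ ≡ ch2 m + e
  R′≡ = cong (_+ e) (ch2-pred (≤-trans (s≤s z≤n) 3≤m))

  tri≤R′ : tri m ≤ R′
  tri≤R′ = ≤-trans (≤-reflexive (tri≡ch2 m)) (≤-trans (+-monoʳ-≤ (ch2 m) m≤e) (≤-reflexive (sym R′≡)))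

  total≤F : ∀ U → total U ≤ F G
  total≤F U = ≤-trans (cnt-mono (inside U) conn Us (λ s h → ∧-elimˡ h)) (≤-reflexive (cnt-length conn Us))

  total-mono : ∀ {U W} → U ⊑ W → total U ≤ total W
  total-mono {U} {W} f = cnt-mono (inside U) (inside W) Us (λ s h → ∧-intro (∧-elimˡ h)
    (⊑ᵇ-intro (λ y q → f y (⊑ᵇ-elim {U = V s} {W = U} (∧-elimʳ {conn s} h) y q))))

  block-total-sq : ∀ {v} → B v ≡ true → m * m + 1 + (e ∸ m) ≤ total B
  block-total-sq {v} bv with B-third v v
  ... | w , bw , w≢v , _ = ≤-trans (≤-reflexive (trans (sym (block-arith m (e ∸ m) (≤-trans (s≤s (s≤s z≤n)) 3≤m)))
          (cong (λ z → (1 + tri′ (m ∸ 2)) + (1 + z)) (trans (cong (ch2 m +_) (m+[n∸m]≡n m≤e)) (sym R′≡)))))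
        (block-total bv bw w≢v)

  glue-first : ∀ {v q τ} → B v ≡ true → Grows (H v) v q → τ ≤ cnt (insideBeyond (H v) v) Us →
    m * m + 1 + (e ∸ m) + τ + R′ * q ≤ total (attached (∅ ⊕ v))
  glue-first {v} {q} {τ} bv gr hτ = ≤-trans
    (+-mono-≤ (+-monoˡ-≤ τ (≤-trans (block-total-sq bv) (total-mono (λ x h → ∨-introˡ h))))
      (*-monoˡ-≤ q (m≤m+n R′ _)))
    (glue ∅ (λ _ ()) bv refl gr hτ)

  tips : Fin n → VSet n
  tips v = tip ⊓ H v

  tips⊑ : ∀ {v} → B v ≡ true → tips v ⊑ (H v ⊖ v)
  tips⊑ {v} bv x h = ⊖-intro (H v) (λ { refl → true≢false bv (not-elim (∧-elimˡ {not (B x)} (∧-elimˡ {tip x} h))) }) (∧-elimʳ {tip x} h)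

  Grows-H : ∀ {v x} → B v ≡ true → H v x ≡ true → x ≢ v → Grows (H v) v (card (H v ⊖ v) + ch2 (card (tips v)))
  Grows-H {v} {x} bv hx ne = Grows-tips (H v) (tips v) (H-conn bv) (H-self bv) hx ne (tips⊑ bv)
    (λ y h {a} {b} ha hb → walk y h ha ◅◅ walk-rev (∣-symm (H v ⊖ y) G-sym) (walk y h hb))
    where
    walk : ∀ y → tips v y ≡ true → ∀ {a} → (H v ⊖ y) a ≡ true → Walk (G ∣ (H v ⊖ y)) a v
    walk y h {a} ha with eqF⇒≡ (⊖-⊑ (H v) y a ha)
    ... | refl = tip-walk (∧-elimˡ {tip y} h) (⊖-≢ (H v) ha)

  roots : VSet n
  roots = B ⊓ cut

  hOf tOf rOf : VSet n → ℕ
  hOf L = card (attached L ∖ B)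
  tOf L = card (tipsOf L)
  rOf L = card (roots ⊓ L)

  base : ℕ → ℕ → ℕ
  base d h = m * m + 1 + tri′ h + (h + d) * tri m + suc m * ch2 d

  -- Here `d` is the number of attached tips beyond one per attached root. The second alternative
  -- holds from the second root on; its surplus `d * m + m`, the one needed in `two-root-excess`, is
  -- gained afresh at each new root and not accumulated.
  Inv : VSet n → Set
  Inv L = ∃ λ d → (tOf L ≡ d + rOf L) × (1 ≤ rOf L) × (tOf L ≤ hOf L) × (base d (hOf L) ≤ total (attached L)) ×
    ((rOf L ≡ 1) ⊎ (base d (hOf L) + (d * m + m) ≤ total (attached L)))

  module _ (L : VSet n) (LB : L ⊑ B) {v : Fin n} (bv : B v ≡ true) (lv : L v ≡ false) where

    hOf-⊕ : hOf (L ⊕ v) ≡ hOf L + card (H v ⊖ v)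
    hOf-⊕ = trans (card-cong to from) (card-∪ {U = attached L ∖ B} {W = H v ⊖ v} disj)
      where
      disj : ∀ x → (attached L ∖ B) x ≡ true → (H v ⊖ v) x ≡ true → ⊥
      disj x a b with ∨-elim {B x} (∖-⊑ (attached L) B x a)
      ... | inj₁ q = true≢false q (∖-out (attached L) B {x} a)
      ... | inj₂ q = true≢false (subst (λ z → L z ≡ true) (eqF⇒≡ (⊖-⊑ (H v) v x b)) q) lv
      to : (attached (L ⊕ v) ∖ B) ⊑ ((attached L ∖ B) ∪ (H v ⊖ v))
      to x h with ∨-elim {B x} (∖-⊑ (attached (L ⊕ v)) B x h)
      ... | inj₁ q = ⊥-elim (true≢false q (∖-out (attached (L ⊕ v)) B {x} h))
      ... | inj₂ q with ⊕-elim L v q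
      ... | inj₁ r = ∨-introʳ {(attached L ∖ B) x} (⊖-intro (H v) (λ { refl → true≢false bv (∖-out (attached (L ⊕ v)) B {x} h) }) (≡⇒eqF r))
      ... | inj₂ r = ∨-introˡ (∖-intro (attached L) B (∨-introʳ {B x} r) (∖-out (attached (L ⊕ v)) B {x} h))
      from : ((attached L ∖ B) ∪ (H v ⊖ v)) ⊑ (attached (L ⊕ v) ∖ B)
      from x h with ∨-elim {(attached L ∖ B) x} h
      ... | inj₁ q = ∖-intro (attached (L ⊕ v)) B (∨-introʳ {B x}
              (⊕-old L v (ρ x) ([ (λ b → ⊥-elim (true≢false b (∖-out (attached L) B {x} q))) , id ]′ (∨-elim {B x} (∖-⊑ (attached L) B x q)))))
              (∖-out (attached L) B {x} q)
      ... | inj₂ q = ∖-intro (attached (L ⊕ v)) B (∨-introʳ {B x} (subst (λ z → (L ⊕ v) z ≡ true) (sym (eqF⇒≡ (⊖-⊑ (H v) v x q))) (⊕-new L v)))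
              (≢true⇒false (λ b → ⊖-≢ (H v) q (H-B (⊖-⊑ (H v) v x q) b)))

    tOf-⊕ : tOf (L ⊕ v) ≡ tOf L + card (tips v)
    tOf-⊕ = trans (card-cong to from) (card-∪ {U = tipsOf L} {W = tips v}
        (λ x a b → true≢false (subst (λ z → L z ≡ true) (eqF⇒≡ (∧-elimʳ {tip x} b)) (∧-elimʳ {tip x} a)) lv))
      where
      to : tipsOf (L ⊕ v) ⊑ (tipsOf L ∪ tips v)
      to x h with ⊕-elim L v (∧-elimʳ {tip x} h)
      ... | inj₁ r = ∨-introʳ {tipsOf L x} (∧-intro (∧-elimˡ {tip x} h) (≡⇒eqF r))
      ... | inj₂ r = ∨-introˡ (∧-intro (∧-elimˡ {tip x} h) r)
      from : (tipsOf L ∪ tips v) ⊑ tipsOf (L ⊕ v)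
      from x h with ∨-elim {tipsOf L x} h
      ... | inj₁ q = ∧-intro (∧-elimˡ {tip x} q) (⊕-old L v (ρ x) (∧-elimʳ {tip x} q))
      ... | inj₂ q = ∧-intro (∧-elimˡ {tip x} q) (subst (λ z → (L ⊕ v) z ≡ true) (sym (eqF⇒≡ (∧-elimʳ {tip x} q))) (⊕-new L v))

    rOf-⊕-root : cut v ≡ true → rOf (L ⊕ v) ≡ suc (rOf L)
    rOf-⊕-root cv = trans (card-cong
        (λ x h → [ (λ q → ∨-introˡ (≡⇒eqF q)) , (λ q → ∨-introʳ {eqF x v} (∧-intro (∧-elimˡ {roots x} h) q)) ]′ (⊕-elim L v (∧-elimʳ {roots x} h)))
        from) (card-⊕ (roots ⊓ L) (≢true⇒false (λ h → true≢false (∧-elimʳ {roots v} h) lv)))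
      where
      from : ((roots ⊓ L) ⊕ v) ⊑ (roots ⊓ (L ⊕ v))
      from x h with ⊕-elim (roots ⊓ L) v h
      ... | inj₁ refl = ∧-intro (∧-intro bv cv) (⊕-new L v)
      ... | inj₂ q = ∧-intro (∧-elimˡ {roots x} q) (⊕-old L v x (∧-elimʳ {roots x} q))

    rOf-⊕-lone : cut v ≡ false → rOf (L ⊕ v) ≡ rOf L
    rOf-⊕-lone cv = card-cong
      (λ x h → ∧-intro (∧-elimˡ {roots x} h) ([ (λ { refl → ⊥-elim (true≢false (∧-elimʳ {B x} (∧-elimˡ {roots x} h)) cv) }) , id ]′ (⊕-elim L v (∧-elimʳ {roots x} h))))
      (λ x h → ∧-intro (∧-elimˡ {roots x} h) (⊕-old L v x (∧-elimʳ {roots x} h)))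

  lone-H : ∀ {v} → B v ≡ true → cut v ≡ false → ∀ x → H v x ≡ true → x ≡ v
  lone-H {v} bv cv x h with x ≟ v
  ... | yes q = q
  ... | no q = ⊥-elim (true≢false (root-cut bv h q) cv)

  lone-card : ∀ {v} → B v ≡ true → cut v ≡ false → (card (H v ⊖ v) ≡ 0) × (card (tips v) ≡ 0)
  lone-card {v} bv cv = h0 , n≤0⇒n≡0 (≤-trans (card-mono {U = tips v} {W = H v ⊖ v} (tips⊑ bv)) (≤-reflexive h0))
    where
    h0 : card (H v ⊖ v) ≡ 0
    h0 = cnt-none (H v ⊖ v) (allFin n) (λ {x} _ h → ⊖-≢ (H v) h (lone-H bv cv x (⊖-⊑ (H v) v x h)))

  cut-hangs : ∀ {v} → B v ≡ true → cut v ≡ true → ∃ λ x → (H v x ≡ true) × (x ≢ v)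
  cut-hangs {v} bv cv with any? (λ x → T? (H v x ∧ not (eqF x v)))
  ... | yes (x , h) = x , ∧-elimˡ (T⇒≡ h) , eqF⇒≢ (not-elim (∧-elimʳ {H v x} (T⇒≡ h)))
  ... | no h = ⊥-elim (true≢false cv (lone-noncut bv λ x hx → case x ≟ v of λ
        { (yes q) → q ; (no q) → ⊥-elim (h (x , ≡⇒T (∧-intro hx (not-intro (≢⇒eqF q))))) }))

  tips-card : ∀ {v} → B v ≡ true → cut v ≡ true → ∃ λ d → (card (tips v) ≡ suc d) × (suc d ≤ card (H v ⊖ v))
  tips-card {v} bv cv = card (tips v) ∸ 1 , sym pos ,
      ≤-trans (≤-reflexive pos) (card-mono {U = tips v} {W = H v ⊖ v} (tips⊑ bv))
    where
    one : 1 ≤ card (tips v)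
    one = let x , hx , ne = cut-hangs bv cv ; y , hy , ty = root-tip bv hx ne in card-pos {U = tips v} {y} (∧-intro ty hy)
    pos : suc (card (tips v) ∸ 1) ≡ card (tips v)
    pos = m+[n∸m]≡n one

  Inv-first : ∀ {u d x} → B u ≡ true → cut u ≡ true → card (tips u) ≡ suc d → suc d ≤ card (H u ⊖ u) →
    H u x ≡ true → x ≢ u → Inv (∅ ⊕ u)
  Inv-first {u} {d} {x} bu cu td dh hx ne = d , trans t≡ (trans td (trans (+-comm 1 d) (cong (d +_) (sym r≡)))) ,
      ≤-reflexive (sym r≡) ,
      ≤-trans (≤-reflexive (trans t≡ td)) (≤-trans dh (≤-reflexive (sym h≡))) ,
      ≤-trans (≤-reflexive (cong (base d) h≡)) (≤-trans (first-root m (card (H u ⊖ u)) d (e ∸ m) R′ 3≤m tri≤R′)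
        (≤-trans (≤-reflexive (cong (λ t → m * m + 1 + (e ∸ m) + tri′ (card (H u ⊖ u)) + R′ * (card (H u ⊖ u) + ch2 t)) (sym td)))
          (glue-first bu (Grows-H bu hx ne) (pairs-bound (H u) (H-conn bu) (H-self bu))))) ,
      inj₁ r≡
    where
    none : ∀ (U : VSet n) → card (U ⊓ ∅) ≡ 0
    none U = cnt-none (U ⊓ ∅) (allFin n) (λ {x} _ h → case ∧-elimʳ {U x} h of λ ())
    h≡ : hOf (∅ ⊕ u) ≡ card (H u ⊖ u)
    h≡ = trans (hOf-⊕ ∅ (λ _ ()) bu refl) (cong (_+ card (H u ⊖ u)) (cnt-none (attached ∅ ∖ B) (allFin n)
      (λ {x} _ h → [ (λ b → true≢false b (∖-out (attached ∅) B {x} h)) , (λ ()) ]′ (∨-elim {B x} (∖-⊑ (attached ∅) B x h)))))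
    t≡ : tOf (∅ ⊕ u) ≡ card (tips u)
    t≡ = trans (tOf-⊕ ∅ (λ _ ()) bu refl) (cong (_+ card (tips u)) (none tip))
    r≡ : rOf (∅ ⊕ u) ≡ 1
    r≡ = trans (rOf-⊕-root ∅ (λ _ ()) bu refl cu) (cong suc (none roots))

  Inv-⊕-lone : ∀ L {v} → L ⊑ B → B v ≡ true → L v ≡ false → cut v ≡ false → Inv L → Inv (L ⊕ v)
  Inv-⊕-lone L {v} LB bv lv cv (d , td , 1≤r , th , bd , alt) = d , trans t≡ (trans td (cong (d +_) (sym r≡))) , ≤-trans 1≤r (≤-reflexive (sym r≡)) ,
        ≤-trans (≤-reflexive t≡) (≤-trans th (≤-reflexive (sym h≡))) ,
        ≤-trans (≤-reflexive (cong (base d) h≡)) (≤-trans bd (total-mono AX)) ,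
        [ (λ q → inj₁ (trans r≡ q)) , (λ q → inj₂ (≤-trans (≤-reflexive (cong (λ h → base d h + (d * m + m)) h≡)) (≤-trans q (total-mono AX)))) ]′ alt
    where
    AX : attached L ⊑ attached (L ⊕ v)
    AX y h = [ ∨-introˡ , (λ l → ∨-introʳ {B y} (⊕-old L v (ρ y) l)) ]′ (∨-elim {B y} h)
    h≡ : hOf (L ⊕ v) ≡ hOf L
    h≡ = trans (hOf-⊕ L LB bv lv) (trans (cong (hOf L +_) (proj₁ (lone-card bv cv))) (+-identityʳ _))
    t≡ : tOf (L ⊕ v) ≡ tOf L
    t≡ = trans (tOf-⊕ L LB bv lv) (trans (cong (tOf L +_) (proj₂ (lone-card bv cv))) (+-identityʳ _))
    r≡ : rOf (L ⊕ v) ≡ rOf L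
    r≡ = rOf-⊕-lone L LB bv lv cv

  Inv-⊕-root : ∀ L {v d₁ x} → L ⊑ B → B v ≡ true → L v ≡ false → cut v ≡ true →
    card (tips v) ≡ suc d₁ → suc d₁ ≤ card (H v ⊖ v) → H v x ≡ true → x ≢ v → Inv L → Inv (L ⊕ v)
  Inv-⊕-root L {v} {d₁} {x} LB bv lv cv td₁ dh₁ hx ne (d , td , 1≤r , th , bd , alt) = d + d₁ , t≡ , ≤-trans (s≤s z≤n) (≤-reflexive (sym r≡)) ,
        ≤-trans (≤-reflexive (tOf-⊕ L LB bv lv)) (≤-trans (+-mono-≤ th (≤-trans (≤-reflexive td₁) dh₁)) (≤-reflexive (sym h≡))) ,
        ≤-trans (m≤m+n _ _) strong , inj₂ strong
    where
    h≡ : hOf (L ⊕ v) ≡ hOf L + card (H v ⊖ v)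
    h≡ = hOf-⊕ L LB bv lv
    r≡ : rOf (L ⊕ v) ≡ suc (rOf L)
    r≡ = rOf-⊕-root L LB bv lv cv
    t≡ : tOf (L ⊕ v) ≡ d + d₁ + rOf (L ⊕ v)
    t≡ = trans (tOf-⊕ L LB bv lv) (trans (cong₂ _+_ td td₁) (trans (lem d (rOf L) d₁) (cong (d + d₁ +_) (sym r≡))))
      where
      lem : ∀ d r e → d + r + suc e ≡ d + e + suc r
      lem = solve-∀
    strong : base (d + d₁) (hOf (L ⊕ v)) + ((d + d₁) * m + m) ≤ total (attached (L ⊕ v))
    strong = ≤-trans (≤-reflexive (cong (λ h → base (d + d₁) h + ((d + d₁) * m + m)) h≡))
      (≤-trans (attach-root m (hOf L) d (rOf L) (card (H v ⊖ v)) d₁ e R′ 3≤m m≤e tri≤R′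
          (≤-trans (≤-reflexive (sym td)) th) 1≤r dh₁ bd)
      (≤-trans (≤-reflexive (cong₂ (λ t t₁ → total (attached L) + tri′ (card (H v ⊖ v)) + (R′ + suc e * (hOf L + ch2 t)) * (card (H v ⊖ v) + ch2 t₁)) (sym td) (sym td₁)))
        (glue L LB bv lv (Grows-H bv hx ne) (pairs-bound (H v) (H-conn bv) (H-self bv)))))

  Inv-⊕ : ∀ L {v} → L ⊑ B → B v ≡ true → L v ≡ false → Inv L → Inv (L ⊕ v)
  Inv-⊕ L {v} LB bv lv i = [ (λ cv → let d₁ , td₁ , dh₁ = tips-card bv cv ; x , hx , ne = cut-hangs bv cv in
      Inv-⊕-root L LB bv lv cv td₁ dh₁ hx ne i) , (λ cv → Inv-⊕-lone L LB bv lv cv i) ]′ (true? (cut v))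

  Inv-all : ∀ us L → L ⊑ B → Inv L → ∃ λ L′ → (L′ ⊑ B) × Inv L′ × (L ⊑ L′) × (∀ {v} → v ∈ us → B v ≡ true → L′ v ≡ true)
  Inv-all [] L LB i = L , LB , i , (λ _ q → q) , λ ()
  Inv-all (v ∷ us) L LB i = go (true? (B v)) (true? (L v))
    where
    Res : Set
    Res = ∃ λ L′ → (L′ ⊑ B) × Inv L′ × (L ⊑ L′) × (∀ {w} → w ∈ v ∷ us → B w ≡ true → L′ w ≡ true)
    go : (B v ≡ true) ⊎ (B v ≡ false) → (L v ≡ true) ⊎ (L v ≡ false) → Res
    go (inj₂ bv) _ = let L′ , a , b , c , d = Inv-all us L LB i in
      L′ , a , b , c , λ { (here refl) bv′ → ⊥-elim (true≢false bv′ bv) ; (there q) → d q }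
    go (inj₁ bv) (inj₁ lv) = let L′ , a , b , c , d = Inv-all us L LB i in
      L′ , a , b , c , λ { (here refl) _ → c v lv ; (there q) → d q }
    go (inj₁ bv) (inj₂ lv) = let L′ , a , b , c , d = Inv-all us (L ⊕ v) (⊕-⊑ LB bv) (Inv-⊕ L LB bv lv i) in
      L′ , a , b , (λ x q → c x (⊕-old L v x q)) , λ { (here refl) _ → c v (⊕-new L v) ; (there q) → d q }

  n≡m+ : n ≡ m + card (full ∖ B)
  n≡m+ = trans (sym card-full) (trans (card-split full B) (cong (_+ card (full ∖ B)) (card-cong (λ x h → h) (λ x h → h))))

  -- Outside the block a vertex is either a cut vertex or a tip, and the cut vertices inside the
  -- block are the roots. If the tips exceed the roots by `d`, then `k + d` vertices lie outside the
  -- block.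
  outside-count : card (full ∖ B) + card roots ≡ card cut + card tip
  outside-count = trans (cong (_+ card roots) (card-split (full ∖ B) cut))
    (trans (cong₂ (λ a b → a + b + card roots) {u = card tip}
      (card-cong {U = (full ∖ B) ⊓ cut} {W = cut ∖ B} (λ x h → ∧-intro (∧-elimʳ {(full ∖ B) x} h) (∧-elimˡ h))
        (λ x h → ∧-intro (∧-elimʳ {cut x} h) (∧-elimˡ h))) (card-cong (λ x h → h) (λ x h → h)))
    (trans (lem (card (cut ∖ B)) (card tip) (card roots)) (cong (_+ card tip)
      (trans (cong (_+ card (cut ∖ B)) (card-cong {U = roots} {W = cut ⊓ B} (λ x h → ∧-intro (∧-elimʳ {B x} h) (∧-elimˡ h)) (λ x h → ∧-intro (∧-elimʳ {cut x} h) (∧-elimˡ h))))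
        (sym (card-split cut B))))))
    where
    lem : ∀ a b c → a + b + c ≡ c + a + b
    lem = solve-∀

  root-exists : 1 ≤ card cut → ∃ λ u → roots u ≡ true
  root-exists h with card-exists cut h
  ... | x , cx with true? (B x)
  ... | inj₁ bx = x , ∧-intro bx cx
  ... | inj₂ bx = ρ x , ∧-intro (ρ-in x) (root-cut (ρ-in x) (eqF-refl (ρ x))
        (λ q → true≢false (subst (λ z → B z ≡ true) (sym q) (ρ-in x)) bx))

  Inv-final : ∀ L k → card cut ≡ k → k ≤ m → 2 ≤ card roots → Inv L → B ⊑ L → suc (Φ (n ∸ k) k) ≤ F G
  Inv-final L k ck k≤m 2≤r (d , td , 1≤r , th , bd , alt) BL = result alt (m≤n⇒∃[o]m+o≡n k≤m)
    where
    h≡ : hOf L ≡ card (full ∖ B)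
    h≡ = card-cong (λ x q → ∧-elimʳ {attached L x} q) (λ x q → ∧-intro (∨-introʳ {B x} (BL (ρ x) (ρ-in x))) q)
    t≡ : tOf L ≡ card tip
    t≡ = card-cong (λ x q → ∧-elimˡ {tip x} q) (λ x q → ∧-intro q (BL (ρ x) (ρ-in x)))
    r≡ : rOf L ≡ card roots
    r≡ = card-cong (λ x q → ∧-elimˡ {roots x} q) (λ x q → ∧-intro q (BL x (∧-elimˡ {B x} q)))
    h≡k+d : hOf L ≡ k + d
    h≡k+d = +-cancelʳ-≡ (card roots) _ _ (trans (cong (_+ card roots) h≡) (trans outside-count
      (trans (cong₂ _+_ ck (trans (sym t≡) (trans td (cong (d +_) r≡)))) (sym (+-assoc k d _)))))
    n∸k : n ∸ k ≡ m + d
    n∸k = trans (cong (_∸ k) (trans n≡m+ (cong (m +_) (trans (sym h≡) h≡k+d)))) (trans (cong (_∸ k) (lem m k d)) (m+n∸n≡m (m + d) k))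
      where
      lem : ∀ m k d → m + (k + d) ≡ m + d + k
      lem = solve-∀
    result : (rOf L ≡ 1) ⊎ (base d (hOf L) + (d * m + m) ≤ total (attached L)) → (∃ λ j → k + j ≡ m) → suc (Φ (n ∸ k) k) ≤ F G
    result (inj₁ q) _ = ⊥-elim (1+n≰n (≤-trans 2≤r (≤-reflexive (trans (sym r≡) q))))
    result (inj₂ q) (j , kj) = ≤-trans (≤-trans (≤-reflexive (trans (cong (λ z → suc (Φ z k)) n∸k) (+-comm 1 _)))
          (≤-trans (+-monoʳ-≤ (Φ (m + d) k) pos) (≤-reflexive (sym (subst (λ z → z * z + 1 + tri′ (k + d) + (k + d + d) * tri z + suc z * ch2 d + (d * z + z)
             ≡ Φ (z + d) k + (d + z + j * ch2 d + z * d * j)) kj (two-root-excess k j d))))))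
          (≤-trans (≤-reflexive (cong (λ h → base d h + (d * m + m)) (sym h≡k+d))) (≤-trans q (total≤F (attached L))))
      where
      pos : 1 ≤ d + m + j * ch2 d + m * d * j
      pos = ≤-trans (≤-trans (≤-trans (s≤s z≤n) 3≤m) (m≤n+m m d)) (≤-trans (m≤m+n (d + m) _) (m≤m+n _ _))

  many-roots : ∀ k → card cut ≡ k → 1 ≤ k → k ≤ m → 2 ≤ card roots → suc (Φ (n ∸ k) k) ≤ F G
  many-roots k ck 1≤k k≤m 2≤r =
    let u , ru = root-exists (≤-trans 1≤k (≤-reflexive (sym ck)))
        bu = ∧-elimˡ {B u} ru ; cu = ∧-elimʳ {B u} ru
        d , td , dh = tips-card bu cu
        x , hx , ne = cut-hangs bu cu
        L , LB , i , _ , all′ = Inv-all (allFin n) (∅ ⊕ u) (⊕-⊑ {U = ∅} {W = B} (λ _ ()) bu) (Inv-first bu cu td dh hx ne)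
    in Inv-final L k ck k≤m 2≤r i (λ x → all′ (∈-allFin x))

-- Shapes of a piece hanging at a vertex

module Shapes {n : ℕ} (G : Graph n) (G-simple : IsSimple G) (G-conn : ∀ x y → Walk G x y) where
  open Gluing G G-simple G-conn

  -- A path from v, each of whose proper initial segments K has exactly one neighbour in U ∖ K; newest vertex first.
  data Chain (U : VSet n) (v : Fin n) : VSet n → Fin n → List (Fin n) → Set where
    base : Chain U v ⟪ v ⟫ v (v ∷ [])
    snoc : ∀ {K z xs x} → Chain U v K z xs → U x ≡ true → K x ≡ false → G z x ≡ true →
      (∀ {y} → K y ≡ true → G y x ≡ true → y ≡ z) →
      (∀ {w y} → U w ≡ true → K w ≡ false → K y ≡ true → G y w ≡ true → w ≡ x) →
      Chain U v (K ⊕ x) x (x ∷ xs)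

  module _ {U : VSet n} {v : Fin n} where

    chain-⊑ : U v ≡ true → ∀ {K z xs} → Chain U v K z xs → K ⊑ U
    chain-⊑ uv base y e = subst (λ w → U w ≡ true) (sym (eqF⇒≡ e)) uv
    chain-⊑ uv (snoc c ux _ _ _ _) = ⊕-⊑ (chain-⊑ uv c) ux

    chain-root : ∀ {K z xs} → Chain U v K z xs → K v ≡ true
    chain-root base = eqF-refl v
    chain-root (snoc {K} {x = x} c _ _ _ _ _) = ⊕-old K x v (chain-root c)

    chain-last : ∀ {K z xs} → Chain U v K z xs → K z ≡ true
    chain-last base = eqF-refl v
    chain-last (snoc {K} {x = x} c _ _ _ _ _) = ⊕-new K x

    chain-conn : ∀ {K z xs} → Chain U v K z xs → Conn K
    chain-conn base = Conn-⟪⟫ v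
    chain-conn (snoc c _ _ g _ _) = Conn-⊕ (chain-conn c) (chain-last c) g

    chain-card : ∀ {K z xs} → Chain U v K z xs → card K ≡ length xs
    chain-card base = card-⟪⟫ v
    chain-card (snoc {K} c _ kx _ _ _) = trans (card-⊕ K kx) (cong suc (chain-card c))

    chain-∈ : ∀ {K z xs} → Chain U v K z xs → ∀ {y} → y ∈ xs → K y ≡ true
    chain-∈ base (here refl) = eqF-refl v
    chain-∈ (snoc {K} {x = x} c _ _ _ _ _) (here refl) = ⊕-new K x
    chain-∈ (snoc {K} {x = x} c _ _ _ _ _) (there m) = ⊕-old K x _ (chain-∈ c m)

    ∈-chain : ∀ {K z xs} → Chain U v K z xs → ∀ {y} → K y ≡ true → y ∈ xs
    ∈-chain base e = here (eqF⇒≡ e)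
    ∈-chain (snoc {K} {x = x} c _ _ _ _ _) e with ⊕-elim K x e
    ... | inj₁ q = here q
    ... | inj₂ q = there (∈-chain c q)

    -- `K₀` is the initial segment that ends just before `y`; by the uniqueness built into `snoc`,
    -- `y` is the only way out of it.
    chain-separates : ∀ {K z xs} → Chain U v K z xs → ∀ {y} → K y ≡ true → y ≢ v →
      ∃ λ K₀ → (K₀ v ≡ true) × (K₀ y ≡ false) × (K₀ z ≡ false) × (K₀ ⊑ K) ×
        (∀ {w a} → U w ≡ true → K₀ w ≡ false → K₀ a ≡ true → G a w ≡ true → w ≡ y)
    chain-separates base e ne = ⊥-elim (ne (eqF⇒≡ e))
    chain-separates (snoc {K} {z} {x = x} c ux kx g _ u) {y} e ne with ⊕-elim K x e
    ... | inj₁ refl = K , chain-root c , kx , kx , ⊕-old K x , u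
    ... | inj₂ q with chain-separates c q ne
    ... | K₀ , a , b , _ , f , h = K₀ , a , b , ≢true⇒false (λ r → true≢false (f x r) kx) , (λ w r → ⊕-old K x w (f w r)) , h

    -- Removing any vertex of a chain other than its two ends separates `v` from `z`.
    chain-noncut : ∀ {K z xs} → Chain U v K z xs → U ⊑ K → ∀ {y} → U y ≡ true → y ≢ v → Conn (U ⊖ y) → U z ≡ true → U v ≡ true → y ≡ z
    chain-noncut {K} {z} c UK {y} uy ne cn uz uv with y ≟ z
    ... | yes q = q
    ... | no q with chain-separates c (UK y uy) ne
    ... | K₀ , kv , ky , kz , _ , u with walk-cross K₀ (cn (⊖-intro U (ne ∘ sym) uv) (⊖-intro U (q ∘ sym) uz)) kv kz
    ... | a , b , e , ka , kb with ∣-elim G (U ⊖ y) {a} {b} e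
    ... | _ , hb , g = ⊥-elim (⊖-≢ U hb (u (⊖-⊑ U y b hb) kb ka g))

  -- From `K` one can grow inside `U` at least `s` sets more than the chain of `grow₁` provides.
  Grown : VSet n → VSet n → ℕ → Set
  Grown U K s = ∀ c N₀ N → N₀ ≤ val c K (U ∖ K) → Terminals c U K U N → N₀ + N * (card (U ∖ K) + s) ≤ val c K (U ∖ U)

  private
    ∖∖ : ∀ {U K : VSet n} → (U ∖ U) ⊑ (U ∖ K)
    ∖∖ {U} {K} y h = ⊥-elim (true≢false (∖-⊑ U U y h) (∖-out U U {y} h))

  -- A step from `K` to `K ⊕ x` accounts for one vertex and one set, so a surplus found beyond it is
  -- inherited.
  grown-step : ∀ {U K s x u} → Conn K → K ⊑ U → U x ≡ true → K x ≡ false → K u ≡ true → G u x ≡ true →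
    Grown U (K ⊕ x) s → Grown U K s
  grown-step {U} {K} {s} {x} {u} cK KU ux kx ku g w c N₀ N h₀ h = begin
      N₀ + N * (card (U ∖ K) + s) ≡⟨ cong (λ k → N₀ + N * (k + s)) e ⟩
      N₀ + N * (suc p + s) ≡⟨ lem N₀ N (p + s) ⟩
      (N + N * (p + s)) + N₀ ≤⟨ +-mono-≤
        (w c N N (h (K ⊕ x) (Conn-⊕ cK ku g) (⊕-old K x) (⊕-⊑ KU ux) (x , ⊕-new K x , kx))
          (λ K′ cK′ f f′ _ → h K′ cK′ (λ y q → f y (⊕-old K x y q)) f′ (x , f x (⊕-new K x) , kx)))
        (≤-trans h₀ (anti c {K} {K} {(U ∖ U) ⊕ x} {U ∖ K} (λ _ q → q) (⊕-⊑ {U = U ∖ U} {W = U ∖ K} (∖∖ {U} {K}) (∖-intro U K ux kx)))) ⟩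
      val c (K ⊕ x) (U ∖ U) + val c K ((U ∖ U) ⊕ x) ≤⟨ split c K (U ∖ U) x ⟩
      val c K (U ∖ U) ∎
    where
    open ≤-Reasoning
    p : ℕ
    p = card (U ∖ (K ⊕ x))
    e : card (U ∖ K) ≡ suc p
    e = trans (card-⊖ (U ∖ K) (∖-intro U K ux kx)) (cong suc (sym (card-∖-⊕ U K ux kx (card-⊖ (U ∖ K) (∖-intro U K ux kx)))))
    lem : ∀ a N k → a + N * suc k ≡ (N + N * k) + a
    lem = solve-∀

  Grown⇒Grows : ∀ {U v s} → U v ≡ true → Grown U ⟪ v ⟫ s → Grows U v (card (U ⊖ v) + s)
  Grown⇒Grows {U} {v} {s} uv w c N h = ≤-trans (≤-reflexive (cong (λ k → N * (k + s))
      (cnt-cong (U ⊖ v) (U ∖ ⟪ v ⟫) (allFin n) (λ y → ∧-comm _ (U y)))))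
    (≤-trans (w c 0 N z≤n h) (anti c {⟪ v ⟫} {⟪ v ⟫} {∅} {U ∖ U} (λ _ q → q) (λ _ ())))

  module Fork {U K : VSet n} {z x y : Fin n} (cU : Conn U) (cK : Conn K) (KU : K ⊑ U) (kz : K z ≡ true)
    (ux : U x ≡ true) (uy : U y ≡ true) (kx : K x ≡ false) (ky : K y ≡ false) (x≢y : x ≢ y)
    (zx : G z x ≡ true) (zy : G z y ≡ true) where

    cKx : Conn (K ⊕ x)
    cKx = Conn-⊕ cK kz zx
    cKy : Conn (K ⊕ y)
    cKy = Conn-⊕ cK kz zy
    cKxy : Conn ((K ⊕ x) ⊕ y)
    cKxy = Conn-⊕ cKx (⊕-old K x z kz) zy
    KxU : (K ⊕ x) ⊑ U
    KxU = ⊕-⊑ KU ux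
    KyU : (K ⊕ y) ⊑ U
    KyU = ⊕-⊑ KU uy
    KxyU : ((K ⊕ x) ⊕ y) ⊑ U
    KxyU = ⊕-⊑ KxU uy
    Kx-y : (K ⊕ x) y ≡ false
    Kx-y = ≢true⇒false (λ h → [ (λ e → x≢y (sym e)) , (λ e → true≢false e ky) ]′ (⊕-elim K x h))
    Ky-x : (K ⊕ y) x ≡ false
    Ky-x = ≢true⇒false (λ h → [ x≢y , (λ e → true≢false e kx) ]′ (⊕-elim K y h))

    p : ℕ
    p = card (U ∖ ((K ⊕ x) ⊕ y))

    p≡ : card (U ∖ K) ≡ 2 + p
    p≡ = trans (card-⊖ (U ∖ K) (∖-intro U K ux kx)) (cong suc (trans (sym (card-∖-⊕ U K ux kx (card-⊖ (U ∖ K) (∖-intro U K ux kx))))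
      (trans (card-⊖ (U ∖ (K ⊕ x)) (∖-intro U (K ⊕ x) uy Kx-y)) (cong suc (sym (card-∖-⊕ U (K ⊕ x) uy Kx-y (card-⊖ (U ∖ (K ⊕ x)) (∖-intro U (K ⊕ x) uy Kx-y))))))))

    module Count (c : Valuation n) (N₀ N : ℕ) (h₀ : N₀ ≤ val c K (U ∖ K)) (h : Terminals c U K U N) where
      O : VSet n
      O = U ∖ U
      term : ∀ K′ D → Conn K′ → K ⊑ K′ → K′ ⊑ U → Proper K K′ → D ⊑ (U ∖ K′) → N ≤ val c K′ D
      term K′ D a b d pr f = ≤-trans (h K′ a b d pr) (anti c {K′} {K′} {D} {U ∖ K′} (λ _ q → q) f)
      start : ∀ D → D ⊑ (U ∖ K) → N₀ ≤ val c K D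
      start D f = ≤-trans h₀ (anti c {K} {K} {D} {U ∖ K} (λ _ q → q) f)
      outx : (O ⊕ x) ⊑ (U ∖ K)
      outx = ⊕-⊑ {U = O} {W = U ∖ K} (∖∖ {U} {K}) (∖-intro U K ux kx)
      outxy : ((O ⊕ x) ⊕ y) ⊑ (U ∖ K)
      outxy = ⊕-⊑ {U = O ⊕ x} {W = U ∖ K} outx (∖-intro U K uy ky)
      out-y : (O ⊕ y) ⊑ (U ∖ (K ⊕ x))
      out-y = ⊕-⊑ {U = O} {W = U ∖ (K ⊕ x)} (∖∖ {U} {K ⊕ x}) (∖-intro U (K ⊕ x) uy Kx-y)
      out-x : (O ⊕ x) ⊑ (U ∖ (K ⊕ y))
      out-x = ⊕-⊑ {U = O} {W = U ∖ (K ⊕ y)} (∖∖ {U} {K ⊕ y}) (∖-intro U (K ⊕ y) ux Ky-x)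
      both : N + N * p ≤ val c ((K ⊕ x) ⊕ y) O
      both = grow₁ c U p {z = y} N N (⊕-new (K ⊕ x) y) cU cKxy KxyU (λ _ q → q) refl
        (term ((K ⊕ x) ⊕ y) (U ∖ ((K ⊕ x) ⊕ y)) cKxy (λ w q → ⊕-old (K ⊕ x) y w (⊕-old K x w q)) KxyU
          (x , ⊕-old (K ⊕ x) y x (⊕-new K x) , kx) (λ _ q → q))
        (λ K′ cK′ f f′ _ → h K′ cK′ (λ w q → f w (⊕-old (K ⊕ x) y w (⊕-old K x w q))) f′
          (x , f x (⊕-old (K ⊕ x) y x (⊕-new K x)) , kx))
      only-x : N ≤ val c (K ⊕ x) (O ⊕ y)
      only-x = term (K ⊕ x) (O ⊕ y) cKx (⊕-old K x) KxU (x , ⊕-new K x , kx) out-y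
      only-y : N ≤ val c (K ⊕ y) (O ⊕ x)
      only-y = term (K ⊕ y) (O ⊕ x) cKy (⊕-old K y) KyU (y , ⊕-new K y , ky) out-x
      neither : N₀ ≤ val c K ((O ⊕ x) ⊕ y)
      neither = start ((O ⊕ x) ⊕ y) outxy
      combine : ∀ {a b d} → a ≤ val c (K ⊕ x) (O ⊕ y) → b ≤ val c (K ⊕ y) (O ⊕ x) → d ≤ val c K ((O ⊕ x) ⊕ y) →
        (N + N * p + a) + (b + d) ≤ val c K O
      combine ha hb hd = ≤-trans (+-mono-≤ (≤-trans (+-mono-≤ both ha) (split c (K ⊕ x) O y))
        (≤-trans (+-mono-≤ hb hd) (split c K (O ⊕ x) y))) (split c K O x)

    -- Split by membership of `x` and `y`: both give `p + 1` sets, `x` alone and `y` alone give one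
    -- each, and neither leaves `K`. Since `U ∖ K` has `p + 2` elements, this is one more than a
    -- chain.
    grown-fork : Grown U K 1
    grown-fork c N₀ N h₀ h = ≤-trans (≤-reflexive (trans (cong (λ k → N₀ + N * (k + 1)) p≡) (lem N₀ N p))) (combine only-x only-y neither)
      where
      open Count c N₀ N h₀ h
      lem : ∀ a N p → a + N * (2 + p + 1) ≡ (N + N * p + N) + (N + a)
      lem = solve-∀

    -- A further vertex `w` is adjacent to `K`, to `x` or to `y`. Accordingly it provides a second
    -- set in the class with neither, with `x` alone or with `y` alone.
    grown-wide : 1 ≤ p → Grown U K 2
    grown-wide 1≤p c N₀ N h₀ h = ≤-trans (≤-reflexive (cong (λ k → N₀ + N * (k + 2)) p≡)) (extra third)
      where
      open Count c N₀ N h₀ h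
      third : ∃ λ u → ∃ λ w → (((K ⊕ x) ⊕ y) u ≡ true) × (U w ≡ true) × (((K ⊕ x) ⊕ y) w ≡ false) × (G u w ≡ true)
      third = let w , hw = card-exists (U ∖ ((K ⊕ x) ⊕ y)) 1≤p in
        boundary cU KxyU {y} {w} (⊕-new (K ⊕ x) y) (∖-⊑ U ((K ⊕ x) ⊕ y) w hw) (∖-out U ((K ⊕ x) ⊕ y) {w} hw)
      extra : (∃ λ u → ∃ λ w → (((K ⊕ x) ⊕ y) u ≡ true) × (U w ≡ true) × (((K ⊕ x) ⊕ y) w ≡ false) × (G u w ≡ true)) →
        N₀ + N * (2 + p + 2) ≤ val c K (U ∖ U)
      extra (u , w , hu , uw , hw , g) = byCase (⊕-elim (K ⊕ x) y hu)
        where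
        kxw : (K ⊕ x) w ≡ false
        kxw = ≢true⇒false (λ q → true≢false (⊕-old (K ⊕ x) y w q) hw)
        kw : K w ≡ false
        kw = ≢true⇒false (λ q → true≢false (⊕-old K x w q) kxw)
        w≢x : w ≢ x
        w≢x refl = true≢false (⊕-new K w) kxw
        w≢y : w ≢ y
        w≢y refl = true≢false (⊕-new (K ⊕ x) w) hw
        byK : K u ≡ true → N₀ + N * (2 + p + 2) ≤ val c K (U ∖ U)
        byK ku = ≤-trans (≤-reflexive (lem N₀ N p)) (combine only-x only-y (≤-trans (+-mono-≤
            (term (K ⊕ w) ((O ⊕ x) ⊕ y) (Conn-⊕ cK ku g) (⊕-old K w) (⊕-⊑ KU uw) (w , ⊕-new K w , kw)
              (λ a q → ∖-intro U (K ⊕ w) (∖-⊑ U K a (outxy a q)) (≢true⇒false λ r → case ⊕-elim K w r of λ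
                { (inj₁ refl) → [ (λ e → w≢y e) , (λ q′ → [ (λ e → w≢x e) , (λ o → true≢false (∖-⊑ U U a o) (∖-out U U {a} o)) ]′ (⊕-elim O x q′)) ]′ (⊕-elim (O ⊕ x) y q)
                ; (inj₂ r) → true≢false r (∖-out U K {a} (outxy a q)) })))
            (start (((O ⊕ x) ⊕ y) ⊕ w) (⊕-⊑ {U = (O ⊕ x) ⊕ y} {W = U ∖ K} outxy (∖-intro U K uw kw))))
            (split c K ((O ⊕ x) ⊕ y) w)))
          where
          lem : ∀ a N p → a + N * (2 + p + 2) ≡ (N + N * p + N) + (N + (N + a))
          lem = solve-∀
        byx : u ≡ x → N₀ + N * (2 + p + 2) ≤ val c K (U ∖ U)
        byx refl = ≤-trans (≤-reflexive (lem N₀ N p)) (combine (≤-trans (+-mono-≤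
            (term ((K ⊕ x) ⊕ w) (O ⊕ y) (Conn-⊕ cKx (⊕-new K x) g) (λ a q → ⊕-old (K ⊕ x) w a (⊕-old K x a q)) (⊕-⊑ KxU uw)
              (x , ⊕-old (K ⊕ x) w x (⊕-new K x) , kx)
              (⊕-⊑ {U = O} {W = U ∖ ((K ⊕ x) ⊕ w)} (∖∖ {U} {(K ⊕ x) ⊕ w}) (∖-intro U ((K ⊕ x) ⊕ w) uy
                (≢true⇒false (λ r → [ (λ e → w≢y (sym e)) , (λ q → true≢false q Kx-y) ]′ (⊕-elim (K ⊕ x) w r))))))
            (term (K ⊕ x) ((O ⊕ y) ⊕ w) cKx (⊕-old K x) KxU (x , ⊕-new K x , kx)
              (⊕-⊑ {U = O ⊕ y} {W = U ∖ (K ⊕ x)} out-y (∖-intro U (K ⊕ x) uw kxw))))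
            (split c (K ⊕ x) (O ⊕ y) w)) only-y neither)
          where
          lem : ∀ a N p → a + N * (2 + p + 2) ≡ (N + N * p + (N + N)) + (N + a)
          lem = solve-∀
        kyw : (K ⊕ y) w ≡ false
        kyw = ≢true⇒false (λ r → [ w≢y , (λ q → true≢false q kw) ]′ (⊕-elim K y r))
        byy : u ≡ y → N₀ + N * (2 + p + 2) ≤ val c K (U ∖ U)
        byy refl = ≤-trans (≤-reflexive (lem N₀ N p)) (combine only-x (≤-trans (+-mono-≤
            (term ((K ⊕ y) ⊕ w) (O ⊕ x) (Conn-⊕ cKy (⊕-new K y) g) (λ a q → ⊕-old (K ⊕ y) w a (⊕-old K y a q)) (⊕-⊑ KyU uw)
              (y , ⊕-old (K ⊕ y) w y (⊕-new K y) , ky)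
              (⊕-⊑ {U = O} {W = U ∖ ((K ⊕ y) ⊕ w)} (∖∖ {U} {(K ⊕ y) ⊕ w}) (∖-intro U ((K ⊕ y) ⊕ w) ux
                (≢true⇒false (λ r → [ (λ e → w≢x (sym e)) , (λ q → true≢false q Ky-x) ]′ (⊕-elim (K ⊕ y) w r))))))
            (term (K ⊕ y) ((O ⊕ x) ⊕ w) cKy (⊕-old K y) KyU (y , ⊕-new K y , ky)
              (⊕-⊑ {U = O ⊕ x} {W = U ∖ (K ⊕ y)} out-x (∖-intro U (K ⊕ y) uw kyw))))
            (split c (K ⊕ y) (O ⊕ x) w)) neither)
          where
          lem : ∀ a N p → a + N * (2 + p + 2) ≡ (N + N * p + N) + ((N + N) + a)
          lem = solve-∀
        byCase : (u ≡ y) ⊎ ((K ⊕ x) u ≡ true) → N₀ + N * (2 + p + 2) ≤ val c K (U ∖ U)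
        byCase (inj₁ e) = byy e
        byCase (inj₂ q) = [ byx , byK ]′ (⊕-elim K x q)

  -- Up to the surplus needed later, three kinds of pieces matter: a path; a path whose last vertex
  -- carries all of the remaining two vertices, which is the tail of `Q` if these are not adjacent;
  -- and pieces that grow in at least two ways more than a path.
  data Shape (U : VSet n) (v : Fin n) : Set where
    path : ∀ {K z xs} → Chain U v K z xs → U ⊑ K → Shape U v
    fork : ∀ {K z xs} x y → Chain U v K z xs → U x ≡ true → U y ≡ true → K x ≡ false → K y ≡ false → x ≢ y →
      G z x ≡ true → G z y ≡ true → (∀ {w a} → U w ≡ true → K w ≡ false → K a ≡ true → G a w ≡ true → a ≡ z) →
      card (U ∖ K) ≡ 2 → Grows U v (card (U ⊖ v) + 1) → Shape U v
    wide : Grows U v (card (U ⊖ v) + 2) → Shape U v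

  -- The chain is followed until its last vertex has two neighbours ahead. Along the way, only the
  -- last vertex of the chain has neighbours outside it, and any surplus found at the current set is
  -- carried back to `v` by `grown-step`.
  shape : ∀ U v → Conn U → U v ≡ true → Shape U v
  shape U v cU uv = go (card (U ∖ ⟪ v ⟫)) base refl (λ _ _ e _ → eqF⇒≡ e) (λ _ w → Grown⇒Grows uv w)
    where
    go : ∀ p {K z xs} → Chain U v K z xs → card (U ∖ K) ≡ p →
      (∀ {w a} → U w ≡ true → K w ≡ false → K a ≡ true → G a w ≡ true → a ≡ z) →
      (∀ s → Grown U K s → Grows U v (card (U ⊖ v) + s)) → Shape U v
    go zero {K} c e _ _ = path c (λ y uy → [ id , (λ ky → ⊥-elim (true≢false (∖-intro U K uy ky) (card-0 (U ∖ K) e y))) ]′ (true? (K y)))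
    go (suc p) {K} {z} c e ends back = next (∖-exists U K e)
      where
      KU : K ⊑ U
      KU = chain-⊑ uv c
      next : (∃ λ y → (U y ≡ true) × (K y ≡ false)) → Shape U v
      next (w , uw , kw) = choose (boundary cU KU (chain-root c) uw kw)
        where
        choose : (∃ λ u → ∃ λ x → (K u ≡ true) × (U x ≡ true) × (K x ≡ false) × (G u x ≡ true)) → Shape U v
        choose (u , x , ku , ux , kx , g) = decide (any? (λ y → T? (((U y ∧ not (K y)) ∧ G z y) ∧ not (eqF y x))))
          where
          zx : G z x ≡ true
          zx = subst (λ a → G a x ≡ true) (ends ux kx ku g) g
          decide : Dec (∃ λ y → T (((U y ∧ not (K y)) ∧ G z y) ∧ not (eqF y x))) → Shape U v
          decide (no no-other) = go p (snoc c ux kx zx (λ ka h → ends ux kx ka h) unique) (card-∖-⊕ U K ux kx e)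
              (λ {w} {a} uw kw ka h → [ id , (λ q → ⊥-elim (true≢false (subst (λ t → (K ⊕ x) t ≡ true) (sym (unique uw (old kw) q h)) (⊕-new K x)) kw)) ]′ (⊕-elim K x ka))
              (λ s w → back s (grown-step (chain-conn c) KU ux kx (chain-last c) zx w))
            where
            old : ∀ {w} → (K ⊕ x) w ≡ false → K w ≡ false
            old {w} h = ≢true⇒false (λ q → true≢false (⊕-old K x w q) h)
            unique : ∀ {w y} → U w ≡ true → K w ≡ false → K y ≡ true → G y w ≡ true → w ≡ x
            unique {w} {y} uw kw ky h with w ≟ x
            ... | yes q = q
            ... | no q = ⊥-elim (no-other (w , ≡⇒T (∧-intro (∧-intro (∖-intro U K uw kw) (subst (λ a → G a w ≡ true) (ends uw kw ky h) h)) (not-intro (≢⇒eqF q)))))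
          decide (yes (y , h)) = finish (true? (card (U ∖ ((K ⊕ x) ⊕ y)) ≡ᵇ 0))
            where
            h₁ : ((U y ∧ not (K y)) ∧ G z y) ∧ not (eqF y x) ≡ true
            h₁ = T⇒≡ h
            h₂ : (U y ∧ not (K y)) ∧ G z y ≡ true
            h₂ = ∧-elimˡ {(U y ∧ not (K y)) ∧ G z y} h₁
            h₃ : (U ∖ K) y ≡ true
            h₃ = ∧-elimˡ {U y ∧ not (K y)} h₂
            x≢y : x ≢ y
            x≢y q = eqF⇒≢ (not-elim (∧-elimʳ {(U y ∧ not (K y)) ∧ G z y} h₁)) (sym q)
            module Fk = Fork {U} {K} {z} {x} {y} cU (chain-conn c) KU (chain-last c) ux (∖-⊑ U K y h₃) kx (∖-out U K {y} h₃) x≢y zx (∧-elimʳ {U y ∧ not (K y)} h₂)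
            finish : (card (U ∖ ((K ⊕ x) ⊕ y)) ≡ᵇ 0) ≡ true ⊎ (card (U ∖ ((K ⊕ x) ⊕ y)) ≡ᵇ 0) ≡ false → Shape U v
            finish (inj₁ q) = fork x y c ux (∖-⊑ U K y h₃) kx (∖-out U K {y} h₃) x≢y zx (∧-elimʳ {U y ∧ not (K y)} h₂) ends
              (trans Fk.p≡ (cong (2 +_) (≡ᵇ⇒≡ _ 0 (≡⇒T q)))) (back 1 Fk.grown-fork)
            finish (inj₂ q) = wide (back 2 (Fk.grown-wide (n≢0⇒n>0 (λ r → true≢false (T⇒≡ (≡⇒≡ᵇ _ 0 r)) q))))

-- Isomorphism from an enumeration of the vertices

-- At xs i y : y stands at position i of xs, counted from the end of the list.
data At {n} : List (Fin n) → ℕ → Fin n → Set where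
  here : ∀ {x xs} → At (x ∷ xs) (length xs) x
  there : ∀ {x xs i y} → At xs i y → At (x ∷ xs) i y

-- The newest vertex stands first and is compared with all earlier ones, so only the values
-- `pat i j` with `i < j` matter.
data Ordered {n} (G : Graph n) (pat : ℕ → ℕ → Bool) : List (Fin n) → Set where
  [] : Ordered G pat []
  snoc : ∀ {x xs} → Ordered G pat xs → x ∉ xs → (∀ {i y} → At xs i y → G y x ≡ pat i (length xs)) →
    Ordered G pat (x ∷ xs)

At-∈ : {xs : List (Fin n)} {i : ℕ} {y : Fin n} → At xs i y → y ∈ xs
At-∈ here = here refl
At-∈ (there a) = there (At-∈ a)

∈-At : {xs : List (Fin n)} {y : Fin n} → y ∈ xs → ∃ λ i → At xs i y
∈-At (here refl) = _ , here
∈-At (there m) = let i , a = ∈-At m in i , there a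

At-< : {xs : List (Fin n)} {i : ℕ} {y : Fin n} → At xs i y → i < length xs
At-< here = ≤-refl
At-< (there a) = m≤n⇒m≤1+n (At-< a)

At-functional : {xs : List (Fin n)} {i : ℕ} {y z : Fin n} → At xs i y → At xs i z → y ≡ z
At-functional here here = refl
At-functional here (there b) = ⊥-elim (<-irrefl refl (At-< b))
At-functional (there a) here = ⊥-elim (<-irrefl refl (At-< a))
At-functional (there a) (there b) = At-functional a b

At-injective : {xs : List (Fin n)} → Unique xs → {i j : ℕ} {y : Fin n} → At xs i y → At xs j y → i ≡ j
At-injective u here here = refl
At-injective (ux ∷ u) here (there b) = ⊥-elim (All.lookup ux (At-∈ b) refl)
At-injective (ux ∷ u) (there a) here = ⊥-elim (All.lookup ux (At-∈ a) refl)
At-injective (ux ∷ u) (there a) (there b) = At-injective u a b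

At-lookup : (xs : List (Fin n)) {i : ℕ} → i < length xs → ∃ λ y → At xs i y
At-lookup (x ∷ xs) {i} (s≤s h) with m≤n⇒m<n∨m≡n h
... | inj₁ l = let y , a = At-lookup xs l in y , there a
... | inj₂ refl = x , here

module _ {G : Graph n} {pat : ℕ → ℕ → Bool} where

  ordered-unique : ∀ {xs} → Ordered G pat xs → Unique xs
  ordered-unique [] = []
  ordered-unique (snoc o nx _) = ∉⇒All≢ nx ∷ ordered-unique o

  ordered-adj : ∀ {xs i j y z} → Ordered G pat xs → At xs i y → At xs j z → i < j → G y z ≡ pat i j
  ordered-adj (snoc o nx f) (there a) here l = f a
  ordered-adj (snoc o nx f) here here l = ⊥-elim (<-irrefl refl l)
  ordered-adj (snoc o nx f) here (there b) l = ⊥-elim (<-asym l (At-< b))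
  ordered-adj (snoc o nx f) (there a) (there b) l = ordered-adj o a b l

patGraph : (ℕ → ℕ → Bool) → Graph n
patGraph pat i j = ((toℕ i <ᵇ toℕ j) ∧ pat (toℕ i) (toℕ j)) ∨ ((toℕ j <ᵇ toℕ i) ∧ pat (toℕ j) (toℕ i))

<ᵇ-true : ∀ {i j} → i < j → (i <ᵇ j) ≡ true
<ᵇ-true l = T⇒≡ (<⇒<ᵇ l)

<ᵇ-false : ∀ {i j} → ¬ (i < j) → (i <ᵇ j) ≡ false
<ᵇ-false {i} {j} h = ≢true⇒false (λ e → h (<ᵇ⇒< i j (≡⇒T e)))

patGraph-< : (pat : ℕ → ℕ → Bool) {i j : Fin n} → toℕ i < toℕ j → patGraph pat i j ≡ pat (toℕ i) (toℕ j)
patGraph-< pat {i} {j} l rewrite <ᵇ-true l | <ᵇ-false (<-asym l) with pat (toℕ i) (toℕ j)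
... | true = refl
... | false = refl

patGraph-simple : (pat : ℕ → ℕ → Bool) → IsSimple (patGraph {n} pat)
patGraph-simple pat = (λ i j → ∨-comm ((toℕ i <ᵇ toℕ j) ∧ pat (toℕ i) (toℕ j)) _) , λ i → irr i
  where
  irr : ∀ i → patGraph pat i i ≡ false
  irr i rewrite <ᵇ-false {toℕ i} (<-irrefl refl) = refl

Unique-complete : {xs : List (Fin n)} → Unique xs → length xs ≡ n → ∀ y → y ∈ xs
Unique-complete {n} {xs} u l y with Any.any? (y ≟_) xs
... | yes m = m
... | no m = ⊥-elim (1+n≰n (≤-trans (≤-reflexive (cong suc (sym l))) (≤-trans
      (Unique-⊆-length {xs = y ∷ xs} (∉⇒All≢ m ∷ u) (λ {z} _ → ∈-allFin z)) (≤-reflexive (length-tabulate id)))))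

ordered⇒≅ : {G : Graph n} {pat : ℕ → ℕ → Bool} {xs : List (Fin n)} → IsSimple G → Ordered G pat xs → length xs ≡ n →
  G ≅ patGraph pat
ordered⇒≅ {n} {G} {pat} {xs} (G-sym , G-irr) o l = permutation f g fg gf , adj
  where
  u : Unique xs
  u = ordered-unique o
  pos : ∀ y → ∃ λ i → At xs i y
  pos y = ∈-At (Unique-complete u l y)
  lt : ∀ y → proj₁ (pos y) < n
  lt y = ≤-trans (At-< (proj₂ (pos y))) (≤-reflexive l)
  f g : Fin n → Fin n
  f y = fromℕ< (lt y)
  find′ : ∀ i → ∃ λ y → At xs (toℕ i) y
  find′ i = At-lookup xs (≤-trans (toℕ<n i) (≤-reflexive (sym l)))
  g i = proj₁ (find′ i)
  f≡ : ∀ y → toℕ (f y) ≡ proj₁ (pos y)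
  f≡ y = toℕ-fromℕ< (lt y)
  fg : ∀ i → f (g i) ≡ i
  fg i = toℕ-injective (trans (f≡ (g i)) (At-injective u (proj₂ (pos (g i))) (proj₂ (find′ i))))
  gf : ∀ y → g (f y) ≡ y
  gf y = At-functional (proj₂ (find′ (f y))) (subst (λ i → At xs i y) (sym (f≡ y)) (proj₂ (pos y)))
  lower : ∀ i j → toℕ (f i) < toℕ (f j) → G i j ≡ patGraph pat (f i) (f j)
  lower i j l = trans (trans (ordered-adj o (proj₂ (pos i)) (proj₂ (pos j)) (subst₂ _<_ (f≡ i) (f≡ j) l))
    (cong₂ pat (sym (f≡ i)) (sym (f≡ j)))) (sym (patGraph-< pat l))
  adj : ∀ i j → G i j ≡ patGraph pat (f i) (f j)
  adj i j with <-cmp (toℕ (f i)) (toℕ (f j))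
  ... | tri< l _ _ = lower i j l
  ... | tri> _ _ l = trans (G-sym i j) (trans (lower j i l) (proj₁ (patGraph-simple pat) (f j) (f i)))
  ... | tri≈ _ e _ with trans (sym (gf i)) (trans (cong g (toℕ-injective e)) (gf j))
  ... | refl = trans (G-irr i) (sym (proj₂ (patGraph-simple pat) (f i)))

≅-common : {G H P : Graph n} → G ≅ P → H ≅ P → G ≅ H
≅-common {P = P} (σ , a) (τ , b) = permutation (λ i → τ ⟨$⟩ˡ (σ ⟨$⟩ʳ i)) (λ i → σ ⟨$⟩ˡ (τ ⟨$⟩ʳ i))
    (λ i → trans (cong (τ ⟨$⟩ˡ_) (inverseʳ σ)) (inverseˡ τ))
    (λ i → trans (cong (σ ⟨$⟩ˡ_) (inverseʳ τ)) (inverseˡ σ)) ,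
  λ i j → trans (a i j) (sym (trans (b _ _) (cong₂ P (inverseʳ τ) (inverseʳ τ))))

≅-refl : {G : Graph n} → G ≅ G
≅-refl = permutation id id (λ _ → refl) (λ _ → refl) , λ _ _ → refl

≅-sym : {G H : Graph n} → G ≅ H → H ≅ G
≅-sym {G = G} {H} h = ≅-common {G = H} {G} {H} (≅-refl {G = H}) h

-- Invariance of `F` under isomorphism

length-rel : {B : Set} {xs : List A} {ys : List B} (R : A → B → Set) → Unique xs →
  (∀ {x} → x ∈ xs → ∃ λ y → (y ∈ ys) × R x y) → (∀ {x x′ y} → x ∈ xs → x′ ∈ xs → R x y → R x′ y → x ≡ x′) →
  length xs ≤ length ys
length-rel {xs = []} R u f inj = z≤n
length-rel {xs = x ∷ xs} R (ux ∷ u) f inj with f (here refl)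
... | y , my , r with ∈-remove my
... | zs , e , g rewrite e = s≤s (length-rel R u
  (λ m → let y′ , my′ , r′ = f (there m) in y′ , g my′ (λ { refl → All.lookup ux m (inj (here refl) (there m) r r′) }) , r′)
  (λ a b → inj (there a) (there b)))

-- An injective relation serves in place of a map: the image of a subgraph comes from `Us-make` and
-- is described only by its vertex and edge predicates.
cnt-rel : {B : Set} (p : A → Bool) (q : B → Bool) {xs : List A} {ys : List B} (R : A → B → Set) → Unique xs →
  (∀ {x} → x ∈ xs → p x ≡ true → ∃ λ y → (y ∈ ys) × (q y ≡ true) × R x y) →
  (∀ {x x′ y} → x ∈ xs → x′ ∈ xs → R x y → R x′ y → x ≡ x′) → cnt p xs ≤ cnt q ys
cnt-rel p q {xs} {ys} R u f inj rewrite cnt-length p xs | cnt-length q ys = length-rel R (Uniq.filter⁺ _ u)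
  (λ m → let a , b = ∈-filterᵇ⁻ p {xs = xs} m ; y , c , d , r = f a b in y , ∈-filterᵇ⁺ q c d , r)
  (λ a b → inj (proj₁ (∈-filterᵇ⁻ p {xs = xs} a)) (proj₁ (∈-filterᵇ⁻ p {xs = xs} b)))

F-≅-≤ : {G H : Graph n} → IsSimple G → IsSimple H → G ≅ H → F G ≤ F H
F-≅-≤ {n} {G} {H} gs hs (σ , adj) = ≤-trans (≤-reflexive (sym (cnt-length conn UG.Us)))
    (≤-trans (cnt-rel conn conn R UG.Us-unique image (λ {s} {s′} {t} → inj {s} {s′} {t})) (≤-reflexive (cnt-length conn UH.Us)))
  where
  module UG = Universe G gs
  module UH = Universe H hs
  to from : Fin n → Fin n
  to = σ ⟨$⟩ʳ_
  from = σ ⟨$⟩ˡ_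
  R : Sub n → Sub n → Set
  R s t = (∀ x → V t (to x) ≡ V s x) × (∀ x y → E t (to x) (to y) ≡ E s x y)
  image : ∀ {s} → s ∈ UG.Us → conn s ≡ true → ∃ λ t → (t ∈ UH.Us) × (conn t ≡ true) × R s t
  image {s} m c with UH.Us-make (λ x → V s (from x)) (λ x y → E s (from x) (from y))
    (λ x y h → UG.E-symm s (from x) (from y) h)
    (λ {x} {y} h → let g , a , b = UG.E-valid {s} m h in
      trans (sym (trans (adj (from x) (from y)) (cong₂ H (inverseʳ σ) (inverseʳ σ)))) g , a , b)
  ... | t , mt , eV , eE = t , mt , conn-t , rV , rE
    where
    rV : ∀ x → V t (to x) ≡ V s x
    rV x = trans (eV (to x)) (cong (V s) (inverseˡ σ))
    rE : ∀ x y → E t (to x) (to y) ≡ E s x y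
    rE x y = trans (eE (to x) (to y)) (cong₂ (E s) (inverseˡ σ) (inverseˡ σ))
    push : ∀ {x y} → Walk (E s) x y → Walk (E t) (to x) (to y)
    push nil = nil
    push (cons {x} {y} e w) = cons (trans (rE x y) e) (push w)
    conn-t : conn t ≡ true
    conn-t with conn-elim s c
    ... | (x , vx) , w = conn-intro t (trans (rV x) vx) λ {a} {b} va vb →
      subst₂ (Walk (E t)) (inverseʳ σ) (inverseʳ σ) (push (w (trans (sym (eV a)) va) (trans (sym (eV b)) vb)))
  inj : ∀ {s s′ t} → s ∈ UG.Us → s′ ∈ UG.Us → R s t → R s′ t → s ≡ s′
  inj a b (v , e) (v′ , e′) = UG.Us-ext a b (λ x → trans (sym (v x)) (v′ x)) (λ x y → trans (sym (e x y)) (e′ x y))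

F-≅ : {G H : Graph n} → IsSimple G → IsSimple H → G ≅ H → F G ≡ F H
F-≅ {G = G} {H} gs hs i = ≤-antisym (F-≅-≤ gs hs i) (F-≅-≤ hs gs (≅-sym {G = G} {H} i))

-- Graphs with a nontrivial block

-- Position patterns, for i < j: the path 0, …, n−1 with the chord {0, m−1}; and, for Q, the path 0, …, n−2
-- with that chord and a further leaf n−1 at n−3.
patL : ℕ → ℕ → ℕ → Bool
patL m i j = (suc i ≡ᵇ j) ∨ ((i ≡ᵇ 0) ∧ (suc j ≡ᵇ m))

patQ : ℕ → ℕ → ℕ → ℕ → Bool
patQ m n i j = ((suc i ≡ᵇ j) ∧ (suc j <ᵇ n)) ∨ (((i ≡ᵇ 0) ∧ (suc j ≡ᵇ m)) ∨ ((3 + i ≡ᵇ n) ∧ (suc j ≡ᵇ n)))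

≡ᵇ-true : ∀ {a b} → a ≡ b → (a ≡ᵇ b) ≡ true
≡ᵇ-true {a} {b} e = T⇒≡ (≡⇒≡ᵇ a b e)

≡ᵇ-false : ∀ {a b} → a ≢ b → (a ≡ᵇ b) ≡ false
≡ᵇ-false {a} {b} h = ≢true⇒false (λ e → h (≡ᵇ⇒≡ a b (≡⇒T e)))

≡ᵇ-elim : ∀ {a b} → (a ≡ᵇ b) ≡ true → a ≡ b
≡ᵇ-elim {a} {b} e = ≡ᵇ⇒≡ a b (≡⇒T e)

patL-tail : ∀ {m i j} → suc j ≢ m → patL m i j ≡ (suc i ≡ᵇ j)
patL-tail {m} {i} {j} h rewrite ≡ᵇ-false h with suc i ≡ᵇ j | i ≡ᵇ 0
... | true | _ = refl
... | false | true = refl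
... | false | false = refl

patQ-patL : ∀ {m n i j} → suc j < n → patQ m n i j ≡ patL m i j
patQ-patL {m} {n} {i} {j} h rewrite <ᵇ-true h | ≡ᵇ-false {suc j} {n} (λ e → <-irrefl e h)
  with suc i ≡ᵇ j | i ≡ᵇ 0 | suc j ≡ᵇ m | 3 + i ≡ᵇ n
... | true | _ | _ | _ = refl
... | false | true | true | _ = refl
... | false | true | false | true = refl
... | false | true | false | false = refl
... | false | false | _ | true = refl
... | false | false | _ | false = refl

patQ-last : ∀ {m n i j} → suc j ≡ n → m < n → patQ m n i j ≡ (3 + i ≡ᵇ n)
patQ-last {m} {n} {i} {j} refl h rewrite <ᵇ-false {suc j} {suc j} (<-irrefl refl) | ≡ᵇ-false {suc j} {m} (λ e → <-irrefl (sym e) h)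
  | ≡ᵇ-true {suc j} refl with suc i ≡ᵇ j | i ≡ᵇ 0 | 3 + i ≡ᵇ suc j
... | true | true | true = refl
... | true | true | false = refl
... | true | false | true = refl
... | true | false | false = refl
... | false | true | true = refl
... | false | true | false = refl
... | false | false | true = refl
... | false | false | false = refl

ordered-map : {G : Graph n} {pat pat′ : ℕ → ℕ → Bool} {xs : List (Fin n)} →
  (∀ {i j} → i < j → j < length xs → pat i j ≡ pat′ i j) → Ordered G pat xs → Ordered G pat′ xs
ordered-map h [] = []
ordered-map h (snoc o nx f) = snoc (ordered-map (λ l l′ → h l (m≤n⇒m≤1+n l′)) o) nx (λ a → trans (f a) (h (At-< a) ≤-refl))

path-At-last : {E : Graph n} {x y : Fin n} {ps : List (Fin n)} → Path E x y ps → At ps 0 y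
path-At-last (stop x) = here
path-At-last (step e nx p) = there (path-At-last p)

path-At-head : {E : Graph n} {x y : Fin n} {ps : List (Fin n)} → Path E x y ps → ∃ λ i → (suc i ≡ length ps) × At ps i x
path-At-head (stop x) = 0 , refl , here
path-At-head (step e nx p) = _ , refl , here

only-two : (U : VSet n) {a b w : Fin n} → ¬ (3 ≤ card U) → U a ≡ true → U b ≡ true → a ≢ b → U w ≡ true → (w ≡ a) ⊎ (w ≡ b)
only-two U {a} {b} {w} h ua ub ne uw with w ≟ a | w ≟ b
... | yes q | _ = inj₁ q
... | no _ | yes q = inj₂ q
... | no p | no q = ⊥-elim (h (≤-trans (s≤s (two-elements (U ⊖ a) (⊖-intro U (ne ∘ sym) ub) (⊖-intro U p uw) q)) (≤-reflexive (sym (card-⊖ U ua)))))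

fork-arith : ∀ k → 1 ≤ k → tri′ (k + 1) + (k ∸ 1) ≡ tri′ k + suc k + (1 + 1 * (k ∸ 1))
fork-arith (suc k) _ rewrite +-comm k 1 = lemma (tri′ k) k
  where
  lemma : ∀ t k → t + (2 + k) + (2 + suc k) + k ≡ t + (2 + k) + suc (suc k) + (1 + 1 * k)
  lemma = solve-∀

path-arith : ∀ m k → m * m + 1 + tri′ k + tri m * k ≡ Φ m k
path-arith m k rewrite tri′≡tri k = lemma (m * m) (tri k) (tri m) k
  where
  lemma : ∀ a t r k → a + 1 + (t + k) + r * k ≡ a + 1 + t + (r + 1) * k
  lemma = solve-∀

two-tips-excess : ∀ m k → m * m + 1 + tri′ (k + 1) + tri m * (k + 1 + 1) + (2 * m + k * m) ≡ Φ (m + 1) k + (1 + (m * m + m))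
two-tips-excess m k = trans (lemma₁ m k (m * m + 1 + tri′ (k + 1) + tri m * (k + 1 + 1))) (trans (one-root-excess m 1 k) (lemma₂ (Φ (m + 1) k) m (tri m)))
  where
  lemma₁ : ∀ m k x → x + (2 * m + k * m) ≡ x + (0 + 2 * (m * 1) + k * 0 + k * (m * 1))
  lemma₁ = solve-∀
  lemma₂ : ∀ p m r → p + (1 + 1 * (m * m + m) + r * 0) ≡ p + (1 + (m * m + m))
  lemma₂ = solve-∀

-- By `two-tips-excess` the margin is `1 + m * (m - 1 - k)`.
two-tips-strict : ∀ m k → k < m → suc (Φ (m + 1) k) ≤ m * m + 1 + tri′ (k + 1) + tri m * (k + 1 + 1)
two-tips-strict m k k<m = +-cancelʳ-≤ (2 * m + k * m) _ _ (≤-trans (≤-trans (≤-reflexive (sym (+-suc (Φ (m + 1) k) _)))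
  (+-monoʳ-≤ (Φ (m + 1) k) (s≤s (≤-trans (≤-reflexive (lemma m k)) (+-monoˡ-≤ m (*-monoˡ-≤ m k<m)))))) (≤-reflexive (sym (two-tips-excess m k))))
  where
  lemma : ∀ m k → 2 * m + k * m ≡ suc k * m + m
  lemma = solve-∀

-- For `m = k`, a surplus of one set at the root is `k - 1` short of `Φ`. One more set is worth
-- `tri k`, which is at least `k`.
two-tips-wide : ∀ k → suc (Φ (k + 1) k) ≤ k * k + 1 + tri′ (k + 1) + tri k * (k + 1 + 2)
two-tips-wide k = +-cancelʳ-≤ (2 * k + k * k) _ _ (≤-trans
  (≤-trans (≤-reflexive (sym (+-suc (Φ (k + 1) k) _))) (≤-trans (+-monoʳ-≤ (Φ (k + 1) k) (s≤s (≤-trans (≤-reflexive (lemma₁ k)) (+-monoʳ-≤ (k * k + k) (m≤tri k)))))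
    (≤-reflexive (lemma₂ (Φ (k + 1) k) (k * k + k) (tri k)))))
  (≤-reflexive (trans (cong (_+ tri k) (sym (two-tips-excess k k))) (lemma₃ (k * k + 1 + tri′ (k + 1)) (tri k) k))))
  where
  lemma₁ : ∀ k → 2 * k + k * k ≡ k * k + k + k
  lemma₁ = solve-∀
  lemma₂ : ∀ p a t → p + suc (a + t) ≡ p + (1 + a) + t
  lemma₂ = solve-∀
  lemma₃ : ∀ a t k → a + t * (k + 1 + 1) + (2 * k + k * k) + t ≡ a + t * (k + 1 + 2) + (2 * k + k * k)
  lemma₃ = solve-∀

-- The additional `k ∸ 1` subgraphs found by `fork-count` close the gap exactly, so the value of `L`
-- is met a second time.
two-tips-fork : ∀ k → 1 ≤ k → k * k + 1 + (tri′ (k + 1) + (k ∸ 1)) + tri k * (k + 1 + 1) ≡ Φ (k + 1) k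
two-tips-fork (suc j) _ = +-cancelʳ-≡ (1 + (suc j * suc j + suc j)) _ _ (trans (lemma (suc j * suc j) (tri′ (suc j + 1)) (tri (suc j) * (suc j + 1 + 1)) j) (two-tips-excess (suc j) (suc j)))
  where
  lemma : ∀ q t r j → q + 1 + (t + j) + r + (1 + (q + suc j)) ≡ q + 1 + t + r + (2 * suc j + q)
  lemma = solve-∀

module OneRoot {n : ℕ} (G : Graph n) (G-simple : IsSimple G) (G-conn : ∀ x y → Walk G x y)
  (𝔅 : Blocks.Block G G-simple G-conn) where
  open Roots G G-simple G-conn 𝔅
  open Shapes G G-simple G-conn

  Listed : (ℕ → ℕ → Bool) → Set
  Listed pat = ∃ λ xs → Ordered G pat xs × (length xs ≡ n)

  Outcome : ℕ → Set
  Outcome k = (suc (Φ (n ∸ k) k) ≤ F G) ⊎ ((Φ (n ∸ k) k ≤ F G) ×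
    (Listed (patL (n ∸ k)) ⊎ ((n ≡ 2 * k + 1) × Listed (patQ k n))))

  -- Three disjoint classes: inside `K ⊕ x` and beyond `v`; through `y` inside `K ⊕ y`; containing
  -- `z`, `x` and `y` together. The total exceeds the bound of `pairs-bound` by `card K ∸ 1`.
  fork-count : ∀ {U v K z xs x y} → Conn U → U v ≡ true → Chain U v K z xs → U x ≡ true → U y ≡ true →
    K x ≡ false → K y ≡ false → x ≢ y → G z x ≡ true → G z y ≡ true → card (U ∖ K) ≡ 2 →
    tri′ (card K + 1) + (card K ∸ 1) ≤ cnt (insideBeyond U v) Us
  fork-count {U} {v} {K} {z} {xs} {x} {y} cU uv c ux uy kx ky x≢y zx zy e2 =
    ≤-trans (≤-reflexive (fork-arith (card K) (card-pos {U = K} {v} kv)))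
      (≤-trans (+-mono-≤ (+-mono-≤ class₁ class₂) class₃)
      (≤-trans (+-monoˡ-≤ _ (cnt-disjoint (insideBeyond Kx v) (counted (within Ky) ⟪ y ⟫ ∅) P₁₂ Us
        (λ s h → ∨-introˡ h) (λ s h → ∨-introʳ {insideBeyond Kx v s} h)
        (λ s h h′ → let _ , _ , r , _ = counted-elim (within Ky) ⟪ y ⟫ ∅ s h′ in
          true≢false (⊑ᵇ-elim {U = V s} {W = Kx} (∧-elimʳ {conn s} (∧-elimˡ {inside Kx s} h)) y (r y (eqF-refl y))) Kx-y)))
      (cnt-disjoint P₁₂ (counted (within U) T₃ ∅) (insideBeyond U v) Us
        (λ s h → [ (λ q → up₁ s q) , (λ q → up₂ s q) ]′ (∨-elim {insideBeyond Kx v s} h))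
        (λ s h → let a , b , r , _ = counted-elim (within U) T₃ ∅ s h in
          ∧-intro (∧-intro a b) (meets-intro (U ⊖ v) s (⊖-intro U y≢v uy) (r y (⊕-new (⟪ z ⟫ ⊕ x) y))))
        (λ s h h′ → let _ , _ , r , _ = counted-elim (within U) T₃ ∅ s h′ in
          [ (λ q → true≢false (⊑ᵇ-elim {U = V s} {W = Kx} (∧-elimʳ {conn s} (∧-elimˡ {inside Kx s} q)) y (r y (⊕-new (⟪ z ⟫ ⊕ x) y))) Kx-y)
          , (λ q → let _ , b , _ = counted-elim (within Ky) ⟪ y ⟫ ∅ s q in
               true≢false (⊑ᵇ-elim {U = V s} {W = Ky} b x (r x (⊕-old (⟪ z ⟫ ⊕ x) y x (⊕-new ⟪ z ⟫ x)))) Ky-x) ]′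
          (∨-elim {insideBeyond Kx v s} h)))))
    where
    open Fork {U} {K} {z} {x} {y} cU (chain-conn c) (chain-⊑ uv c) (chain-last c) ux uy kx ky x≢y zx zy
    kv : K v ≡ true
    kv = chain-root c
    Kx Ky T₃ : VSet n
    Kx = K ⊕ x
    Ky = K ⊕ y
    T₃ = (⟪ z ⟫ ⊕ x) ⊕ y
    P₁₂ : Sub n → Bool
    P₁₂ s = insideBeyond Kx v s ∨ counted (within Ky) ⟪ y ⟫ ∅ s
    y≢v : y ≢ v
    y≢v refl = true≢false kv ky
    up₁ : ∀ s → insideBeyond Kx v s ≡ true → insideBeyond U v s ≡ true
    up₁ s h with meets-elim (Kx ⊖ v) s (∧-elimʳ {inside Kx s} h)
    ... | w , hw , vw = ∧-intro (∧-intro (∧-elimˡ {conn s} (∧-elimˡ {inside Kx s} h))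
      (⊑ᵇ-intro (λ a q → KxU a (⊑ᵇ-elim {U = V s} {W = Kx} (∧-elimʳ {conn s} (∧-elimˡ {inside Kx s} h)) a q))))
      (meets-intro (U ⊖ v) s (⊖-intro U (⊖-≢ Kx hw) (KxU w (⊖-⊑ Kx v w hw))) vw)
    up₂ : ∀ s → counted (within Ky) ⟪ y ⟫ ∅ s ≡ true → insideBeyond U v s ≡ true
    up₂ s h = let a , b , r , _ = counted-elim (within Ky) ⟪ y ⟫ ∅ s h in
      ∧-intro (∧-intro a (⊑ᵇ-intro (λ w q → KyU w (⊑ᵇ-elim {U = V s} {W = Ky} b w q))))
        (meets-intro (U ⊖ v) s (⊖-intro U y≢v uy) (r y (eqF-refl y)))
    class₁ : tri′ (card K) ≤ cnt (insideBeyond Kx v) Us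
    class₁ = ≤-trans (≤-reflexive (cong tri′ (suc-injective (trans (sym (card-⊕ K kx)) (card-⊖ Kx (⊕-old K x v kv))))))
      (pairs-bound Kx cKx (⊕-old K x v kv))
    class₂ : suc (card K) ≤ val (count (within Ky)) ⟪ y ⟫ ∅
    class₂ = ≤-trans (≤-reflexive (sym (card-⊕ K ky))) (through-bound Ky cKy (⊕-new K y))
    kz : K z ≡ true
    kz = chain-last c
    T₃U : T₃ ⊑ U
    T₃U = ⊕-⊑ {U = ⟪ z ⟫ ⊕ x} {W = U} (⊕-⊑ {U = ⟪ z ⟫} {W = U}
      (λ w q → subst (λ a → U a ≡ true) (sym (eqF⇒≡ q)) (chain-⊑ uv c z kz)) ux) uy
    cT₃ : Conn T₃
    cT₃ = Conn-⊕ (Conn-⊕ (Conn-⟪⟫ z) (eqF-refl z) zx) (⊕-old ⟪ z ⟫ x z (eqF-refl z)) zy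
    cardT₃ : card T₃ ≡ 3
    cardT₃ = trans (card-⊕ (⟪ z ⟫ ⊕ x) (≢true⇒false (λ q → [ (λ e → x≢y (sym e)) , (λ e → true≢false (subst (λ a → K a ≡ true) (sym (eqF⇒≡ e)) kz) ky) ]′ (⊕-elim ⟪ z ⟫ x q))))
      (cong suc (trans (card-⊕ ⟪ z ⟫ (≢true⇒false (λ e → true≢false (subst (λ a → K a ≡ true) (sym (eqF⇒≡ e)) kz) kx))) (cong suc (card-⟪⟫ z))))
    -- `U` has `card K + 2` vertices, and three of them form `T₃`.
    rest : card (U ∖ T₃) ≡ card K ∸ 1
    rest = trans (cong (_∸ 3) (trans (cong (_+ card (U ∖ T₃)) (trans (sym cardT₃) (card-cong {U = T₃} {W = U ⊓ T₃} (λ w q → ∧-intro (T₃U w q) q) (λ w q → ∧-elimʳ {U w} q))))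
        (sym (card-split U T₃)))) (trans (cong (_∸ 3) (trans (card-split U K) (cong₂ _+_ (card-cong {U = U ⊓ K} {W = K} (λ w q → ∧-elimʳ {U w} q) (λ w q → ∧-intro (chain-⊑ uv c w q) q)) e2)))
        (cong (_∸ 3) (+-comm (card K) 2)))
    term : ∀ K′ → Conn K′ → T₃ ⊑ K′ → K′ ⊑ U → 1 ≤ val (count (within U)) K′ (U ∖ K′)
    term K′ cK′ f f′ = count-pos (within U) K′ (U ∖ K′) cK′ (f y (⊕-new (⟪ z ⟫ ⊕ x) y))
      (λ w a b → true≢false b (∖-out U K′ {w} a)) (λ s eq → ⊑ᵇ-intro (λ w q → f′ w (trans (sym (eq w)) q)))
    class₃ : 1 + 1 * (card K ∸ 1) ≤ val (count (within U)) T₃ ∅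
    class₃ = ≤-trans (≤-reflexive (cong (λ k → 1 + 1 * k) (sym rest))) (≤-trans
      (grow₁ (count (within U)) U (card (U ∖ T₃)) {z = y} 1 1 (⊕-new (⟪ z ⟫ ⊕ x) y) cU cT₃ T₃U (λ _ q → q) refl
        (term T₃ cT₃ (λ _ q → q) T₃U) (λ K′ cK′ f f′ _ → term K′ cK′ f f′))
      (anti (count (within U)) {T₃} {T₃} {∅} {U ∖ U} (λ _ q → q) (λ _ ())))

  -- The block is a cycle as soon as its degrees are at most two.
  module Cycle {u : Fin n} (bu : B u ≡ true) (deg : ∀ {x} → B x ≡ true → ¬ (3 ≤ card ((G ∣ B) x))) where

    private
      E′ : Graph n
      E′ = G ∣ (B ⊖ u)

    data Neigh : Set where
      neigh : ∀ p q → p ≢ q → (G ∣ B) u p ≡ true → (G ∣ B) u q ≡ true → Neigh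

    neighbours : Neigh
    neighbours =
      let p , gp = card-exists ((G ∣ B) u) (≤-trans (s≤s z≤n) (B-degree bu))
          q , gq = card-exists ((G ∣ B) u ⊖ p) (≤-pred (≤-trans (B-degree bu) (≤-reflexive (card-⊖ ((G ∣ B) u) gp))))
      in neigh p q (⊖-≢ ((G ∣ B) u) gq ∘ sym) gp (⊖-⊑ ((G ∣ B) u) p q gq)

    B-sym : ∀ {x y} → (G ∣ B) x y ≡ true → (G ∣ B) y x ≡ true
    B-sym {x} {y} = ∣-symm B G-sym x y

    E′-B : ∀ {x y} → E′ x y ≡ true → (G ∣ B) x y ≡ true
    E′-B {x} {y} h with ∣-elim G (B ⊖ u) {x} {y} h
    ... | a , b , g = ∣-intro G B (⊖-⊑ B u x a) (⊖-⊑ B u y b) g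

    -- Every vertex of the path already has two neighbours in the block, namely its neighbours on
    -- the path, with `pre` before the first vertex and `u` after the last. The degree bound admits
    -- no others.
    closed : ∀ {x q pre ps} → Path E′ x q ps → (G ∣ B) u q ≡ true → (G ∣ B) x pre ≡ true → pre ∉ ps → (x ≡ q → pre ≢ u) →
      ∀ {w w′} → w ∈ ps → (G ∣ B) w w′ ≡ true → (w′ ∈ ps) ⊎ ((w′ ≡ u) ⊎ (w′ ≡ pre))
    closed {q = q} {pre} (stop .q) uq xp np ne {w} {w′} (here refl) g =
      case only-two ((G ∣ B) q) (deg (proj₁ (∣-elim G B {q} {pre} xp))) xp (B-sym uq) (ne refl) g of λ
        { (inj₁ e) → inj₂ (inj₂ e) ; (inj₂ e) → inj₂ (inj₁ e) }
    closed {x} {q} {pre} (step {y = y} e nx p) uq xp np ne {w} {w′} (here refl) g =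
      case only-two ((G ∣ B) x) (deg (proj₁ (∣-elim G B {x} {pre} xp))) xp (E′-B e) (λ { refl → np (there (path-head p)) }) g of λ
        { (inj₁ e) → inj₂ (inj₂ e) ; (inj₂ refl) → inj₁ (there (path-head p)) }
    closed {x} {q} {pre} (step {y = y} e nx p) uq xp np ne (there m) g =
      case closed p uq (B-sym (E′-B e)) nx (λ _ → ⊖-≢ B (proj₁ (∣-elim G (B ⊖ u) {x} {y} e))) m g of λ
        { (inj₁ a) → inj₁ (there a) ; (inj₂ (inj₁ a)) → inj₂ (inj₁ a) ; (inj₂ (inj₂ refl)) → inj₁ (here refl) }

    path-B : ∀ {x q ps} → Path E′ x q ps → (B ⊖ u) x ≡ true → ∀ {w} → w ∈ ps → (B ⊖ u) w ≡ true
    path-B (stop x) h (here refl) = h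
    path-B (step e nx p) h (here refl) = h
    path-B (step {x} {y} e nx p) h (there m) = path-B p (proj₁ (proj₂ (∣-elim G (B ⊖ u) {x} {y} e))) m

    ordered-path : ∀ {x q pre ps} → Path E′ x q ps → (G ∣ B) x pre ≡ true → pre ∉ ps → length ps < m → Ordered G (patL m) ps
    ordered-path (stop x) _ _ _ = snoc [] (λ ()) (λ ())
    ordered-path {x} {q} {pre} (step {y = y} {ps = ps} e nx p) xp np l =
      snoc (ordered-path p (B-sym (E′-B e)) nx (<-trans ≤-refl l)) nx
        (λ {i} {w} a → trans (bool-ext (to a) (from a)) (sym (patL-tail {m} {i} {length ps} (<⇒≢ l))))
      where
      h : ∃ λ i → (suc i ≡ length ps) × At ps i y
      h = path-At-head p
      Bw : ∀ {w} → w ∈ ps → B w ≡ true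
      Bw mw = ⊖-⊑ B u _ (path-B p (proj₁ (proj₂ (∣-elim G (B ⊖ u) {x} {y} e))) mw)
      to : ∀ {i w} → At ps i w → G w x ≡ true → (suc i ≡ᵇ length ps) ≡ true
      to {i} {w} a g with only-two ((G ∣ B) x) (deg (proj₁ (∣-elim G B {x} {pre} xp))) xp (E′-B e) (λ { refl → np (there (path-head p)) })
                     (∣-intro G B (proj₁ (∣-elim G B {x} {pre} xp)) (Bw (At-∈ a)) (G-sym _ _ g))
      ... | inj₁ refl = ⊥-elim (np (there (At-∈ a)))
      ... | inj₂ refl = ≡ᵇ-true (trans (cong suc (At-injective (path-unique p) a (proj₂ (proj₂ h)))) (proj₁ (proj₂ h)))
      from : ∀ {i w} → At ps i w → (suc i ≡ᵇ length ps) ≡ true → G w x ≡ true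
      from {i} {w} a eq with At-functional a (subst (λ j → At ps j y) (suc-injective (trans (proj₁ (proj₂ h)) (sym (≡ᵇ-elim {suc i} eq)))) (proj₂ (proj₂ h)))
      ... | refl = G-sym _ _ (proj₂ (proj₂ (∣-elim G (B ⊖ u) {x} {w} e)))

    -- Lists are newest first: the cycle is enumerated so that u comes last and its two neighbours take the
    -- places 0 and m − 2.
    CycleList : Set
    CycleList = ∃ λ ps → Ordered G (patL m) (u ∷ ps) × (suc (length ps) ≡ m) × (∀ {w} → w ∈ ps → (B ⊖ u) w ≡ true)

    module _ {p q : Fin n} {ps : List (Fin n)} (p≢q : p ≢ q) (up : (G ∣ B) u p ≡ true) (uq : (G ∣ B) u q ≡ true)
      (hp : (B ⊖ u) p ≡ true) (pth : Path E′ p q ps) where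

      private
        inB : ∀ {w} → w ∈ ps → (B ⊖ u) w ≡ true
        inB = path-B pth hp

        u∉ : u ∉ ps
        u∉ mu = ⊖-≢ B (inB mu) refl

        u-neighbour : ∀ {w} → (G ∣ B) u w ≡ true → (w ≡ p) ⊎ (w ≡ q)
        u-neighbour = only-two ((G ∣ B) u) (deg bu) up uq p≢q

        inv : ∀ {a b} → (G ∣ B) a b ≡ true → a ∈ u ∷ ps → b ∈ u ∷ ps
        inv {a} {b} g (here e) = [ (λ r → there (subst (_∈ ps) (sym r) (path-head pth))) , (λ r → there (subst (_∈ ps) (sym r) (path-last pth))) ]′
          (u-neighbour (subst (λ z → (G ∣ B) z b ≡ true) e g))
        inv g (there ma) = [ there , [ here , here ]′ ]′ (closed pth uq (B-sym up) u∉ (λ e → ⊥-elim (p≢q e)) ma g)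

        all-B : ∀ {w} → Walk (G ∣ B) u w → w ∈ u ∷ ps
        all-B w = walk-inv (λ y → y ∈ u ∷ ps) inv w (here refl)

        toB : ∀ {x} → x ∈ u ∷ ps → x ∈ filterᵇ B (allFin n)
        toB {x} (here e) = ∈-filterᵇ⁺ B (∈-allFin x) (subst (λ z → B z ≡ true) (sym e) bu)
        toB {x} (there mw) = ∈-filterᵇ⁺ B (∈-allFin x) (⊖-⊑ B u x (inB mw))

        fromB : ∀ {x} → x ∈ filterᵇ B (allFin n) → x ∈ u ∷ ps
        fromB {x} mx = all-B (B-conn bu (proj₂ (∈-filterᵇ⁻ B {xs = allFin n} mx)))

        len : suc (length ps) ≡ m
        len = trans (≤-antisym (Unique-⊆-length {xs = u ∷ ps} {ys = filterᵇ B (allFin n)} (∉⇒All≢ u∉ ∷ path-unique pth) toB)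
          (Unique-⊆-length {xs = filterᵇ B (allFin n)} {ys = u ∷ ps} (Uniq.filter⁺ _ (Uniq.allFin⁺ n)) fromB))
          (sym (cnt-length B (allFin n)))

        i₀ : ℕ
        i₀ = proj₁ (path-At-head pth)

        eq₀ : suc i₀ ≡ length ps
        eq₀ = proj₁ (proj₂ (path-At-head pth))

        at₀ : At ps i₀ p
        at₀ = proj₂ (proj₂ (path-At-head pth))

        u-edge : ∀ {w} → (G ∣ B) u w ≡ true → G w u ≡ true
        u-edge {w} h = G-sym _ _ (proj₂ (proj₂ (∣-elim G B {u} {w} h)))

        to : ∀ {i w} → At ps i w → G w u ≡ true → patL m i (length ps) ≡ true
        to {i} {w} a g = [ (λ r → ∨-introˡ (≡ᵇ-true (trans (cong suc (At-injective (path-unique pth) (subst (At ps i) r a) at₀)) eq₀)))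
                         , (λ r → ∨-introʳ {suc i ≡ᵇ length ps} (∧-intro (≡ᵇ-true (At-injective (path-unique pth) (subst (At ps i) r a) (path-At-last pth))) (≡ᵇ-true len))) ]′
          (u-neighbour (∣-intro G B bu (⊖-⊑ B u w (inB (At-∈ a))) (G-sym _ _ g)))

        from : ∀ {i w} → At ps i w → patL m i (length ps) ≡ true → G w u ≡ true
        from {i} {w} a e = [ (λ r → subst (λ z → G z u ≡ true) (sym (At-functional a (subst (λ j → At ps j p) (suc-injective (trans eq₀ (sym (≡ᵇ-elim {suc i} r)))) at₀))) (u-edge up))
                           , (λ r → subst (λ z → G z u ≡ true) (sym (At-functional a (subst (λ j → At ps j q) (sym (≡ᵇ-elim {i} (∧-elimˡ {i ≡ᵇ 0} r))) (path-At-last pth)))) (u-edge uq)) ]′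
          (∨-elim {suc i ≡ᵇ length ps} e)

      cycle-from : CycleList
      cycle-from = ps , snoc (ordered-path pth (B-sym up) u∉ (≤-reflexive len)) u∉ (λ a → bool-ext (to a) (from a)) , len , inB

    cycle-ordered : CycleList
    cycle-ordered = go neighbours
      where
      go : Neigh → CycleList
      go (neigh p q p≢q up uq) = cycle-from p≢q up uq (inside-B up) (proj₂ (walk⇒path (B-conn⊖ u {p} {q} (inside-B up) (inside-B uq))))
        where
        inside-B : ∀ {w} → (G ∣ B) u w ≡ true → (B ⊖ u) w ≡ true
        inside-B {w} h = let _ , b , g = ∣-elim G B {u} {w} h in ⊖-intro B (λ e → G-irr g (sym e)) b

    module _ {ps : List (Fin n)} (o : Ordered G (patL m) (u ∷ ps)) (len : suc (length ps) ≡ m)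
      (inB : ∀ {w} → w ∈ ps → (B ⊖ u) w ≡ true) where

      ChainList : List (Fin n) → Fin n → Set
      ChainList xs z = Ordered G (patL m) (xs ++ ps) × (∃ λ i → (suc i ≡ length (xs ++ ps)) × At (xs ++ ps) i z) × (m ≤ length (xs ++ ps))

      no-edge : ∀ {w x} → w ∈ ps → H u x ≡ true → x ≢ u → G w x ≡ true → ⊥
      no-edge {w} {x} mw hx x≢u g = ⊖-≢ B (inB mw) (trans (sym (ρ-fix (⊖-⊑ B u w (inB mw))))
        (trans (ρ-edge g (λ _ bx → x≢u (H-B hx bx))) (eqF⇒≡ hx)))

      chain-∉ : ∀ {K z xs x} → Chain (H u) u K z xs → H u x ≡ true → K x ≡ false → x ∉ xs ++ ps
      chain-∉ {K} {xs = xs} {x} c ux kx mx = [ (λ a → true≢false (chain-∈ c a) kx)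
        , (λ a → true≢false (subst (λ z → K z ≡ true) (sym (H-B ux (⊖-⊑ B u x (inB a)))) (chain-root c)) kx) ]′ (∈-++⁻ xs mx)

      -- The last vertex `u` of the cycle list is also the root of the chain, so the chain continues
      -- the path of the pattern and the chord remains the only other edge.
      chain-ordered : ∀ {K z xs} → Chain (H u) u K z xs → ChainList xs z
      chain-ordered base = o , (length ps , refl , here) , ≤-reflexive (sym len)
      chain-ordered (snoc {K} {z} {xs} {x} c ux kx zx uniq _) = extend (chain-ordered c)
        where
        extend : ChainList xs z → ChainList (x ∷ xs) x
        extend (o′ , (i₀ , eq₀ , at₀) , m≤) =
            snoc o′ (chain-∉ c ux kx) (λ {i} {w} a → trans (bool-ext (to a) (from a)) (sym (patL-tail {m} {i} (λ e → <-irrefl (sym e) (s≤s m≤))))) ,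
            (length (xs ++ ps) , refl , here) , m≤n⇒m≤1+n m≤
          where
          x≢u : x ≢ u
          x≢u e = true≢false (subst (λ z → K z ≡ true) (sym e) (chain-root c)) kx
          to : ∀ {i w} → At (xs ++ ps) i w → G w x ≡ true → (suc i ≡ᵇ length (xs ++ ps)) ≡ true
          to {i} {w} a g = [ (λ mw → ≡ᵇ-true (trans (cong suc (At-injective (ordered-unique o′) (subst (At (xs ++ ps) i) (uniq (chain-∈ c mw) g) a) at₀)) eq₀))
                           , (λ mw → ⊥-elim (no-edge mw ux x≢u g)) ]′ (∈-++⁻ xs (At-∈ a))
          from : ∀ {i w} → At (xs ++ ps) i w → (suc i ≡ᵇ length (xs ++ ps)) ≡ true → G w x ≡ true
          from {i} {w} a e = subst (λ y → G y x ≡ true) (sym (At-functional a (subst (λ j → At (xs ++ ps) j z) (suc-injective (trans eq₀ (sym (≡ᵇ-elim {suc i} e)))) at₀))) zx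

  module _ {u : Fin n} {k : ℕ} (ru : roots u ≡ true) (r1 : card roots ≡ 1) (ck : card cut ≡ k) (1≤k : 1 ≤ k) (k≤m : k ≤ m)
    (13≤n : 13 ≤ n) (girth : GirthAtLeast k G) where

    private
      bu : B u ≡ true
      bu = ∧-elimˡ {B u} ru

      hangs-at : ∀ {x} → B x ≡ false → ρ x ≡ u
      hangs-at {x} bx with ρ x ≟ u
      ... | yes e = e
      ... | no ne = ⊥-elim (1+n≰n (≤-trans (two-elements roots ru
              (∧-intro (ρ-in x) (root-cut (ρ-in x) (eqF-refl (ρ x)) (λ e → true≢false (subst (λ z → B z ≡ true) (sym e) (ρ-in x)) bx))) ne) (≤-reflexive r1)))

      h≡ : card (H u ⊖ u) ≡ card (full ∖ B)
      h≡ = card-cong (λ x q → ∖-intro full B refl (≢true⇒false (λ b → ⊖-≢ (H u) q (H-B (⊖-⊑ (H u) u x q) b))))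
        (λ x q → ⊖-intro (H u) (λ e → true≢false (subst (λ z → B z ≡ true) (sym e) bu) (∖-out full B {x} q)) (≡⇒eqF (hangs-at (∖-out full B {x} q))))

      t≡ : card (tips u) ≡ card tip
      t≡ = card-cong (λ x q → ∧-elimˡ {tip x} q) (λ x q → ∧-intro q (≡⇒eqF (hangs-at (not-elim (∧-elimˡ {not (B x)} q)))))

      hangs : ∃ λ x → (H u x ≡ true) × (x ≢ u)
      hangs = cut-hangs bu (∧-elimʳ {B u} ru)

      bound : ∀ {q τ} → Grows (H u) u q → τ ≤ cnt (insideBeyond (H u) u) Us → m * m + 1 + (e ∸ m) + τ + tri m * q ≤ F G
      bound {q} {τ} gr hτ = ≤-trans (+-monoʳ-≤ (m * m + 1 + (e ∸ m) + τ) (*-monoˡ-≤ q tri≤R′))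
        (≤-trans (glue-first bu gr hτ) (total≤F (attached (∅ ⊕ u))))

      bound₀ : ∀ {q τ} → Grows (H u) u q → τ ≤ cnt (insideBeyond (H u) u) Us → m * m + 1 + τ + tri m * q ≤ F G
      bound₀ {q} {τ} gr hτ = ≤-trans (+-monoˡ-≤ (tri m * q) (+-monoˡ-≤ τ (m≤m+n (m * m + 1) (e ∸ m)))) (bound gr hτ)

      -- An edge of the block in excess of `m` contributes to `e ∸ m` in the count of the block
      -- itself, which is enough for strictness.
      bound₁ : ∀ {q τ} → suc m ≤ e → Grows (H u) u q → τ ≤ cnt (insideBeyond (H u) u) Us → suc (m * m + 1 + τ + tri m * q) ≤ F G
      bound₁ {q} {τ} l gr hτ = ≤-trans (≤-trans (≤-reflexive (lem (m * m + 1) τ (tri m * q))) (+-monoˡ-≤ (tri m * q) (+-monoˡ-≤ τ (+-monoʳ-≤ (m * m + 1)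
          (≤-trans (≤-reflexive (sym (m+n∸n≡m 1 m))) (∸-monoˡ-≤ m l)))))) (bound gr hτ)
        where
        lem : ∀ a t r → suc (a + t + r) ≡ a + 1 + t + r
        lem = solve-∀

      pairs : tri′ (card (H u ⊖ u)) ≤ cnt (insideBeyond (H u) u) Us
      pairs = pairs-bound (H u) (H-conn bu) (H-self bu)

      big : Dec (∃ λ x → (B x ≡ true) × (3 ≤ card ((G ∣ B) x)))
      big with any? (λ x → (T? (B x)) ×-dec (3 ≤? card ((G ∣ B) x)))
      ... | yes (x , b , l) = yes (x , T⇒≡ b , l)
      ... | no h = no (λ { (x , b , l) → h (x , ≡⇒T b , l) })

    module _ {d : ℕ} (td : card (tips u) ≡ suc d) where

      private
        hk : card (H u ⊖ u) ≡ k + d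
        hk = +-cancelʳ-≡ 1 _ _ (trans (cong₂ _+_ h≡ (sym r1)) (trans outside-count (trans (cong₂ _+_ ck (trans (sym t≡) td)) (lem k d))))
          where
          lem : ∀ k d → k + suc d ≡ k + d + 1
          lem = solve-∀

        nmk : n ≡ m + (k + d)
        nmk = trans n≡m+ (cong (m +_) (trans (sym h≡) hk))

        n∸k : n ∸ k ≡ m + d
        n∸k = trans (cong (_∸ k) (trans nmk (lem m k d))) (m+n∸n≡m (m + d) k)
          where
          lem : ∀ m k d → m + (k + d) ≡ m + d + k
          lem = solve-∀

        pairs′ : tri′ (k + d) ≤ cnt (insideBeyond (H u) u) Us
        pairs′ = ≤-trans (≤-reflexive (cong tri′ (sym hk))) pairs

        growsBy : ∀ {q q′} → card (H u ⊖ u) + q ≡ q′ → Grows (H u) u (card (H u ⊖ u) + q) → Grows (H u) u q′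
        growsBy e = subst (Grows (H u) u) e

        growsTips : Grows (H u) u (k + d + (d + ch2 d))
        growsTips = subst (Grows (H u) u) (cong₂ (λ a b → a + ch2 b) hk td) (Grows-H bu (proj₁ (proj₂ hangs)) (proj₂ (proj₂ hangs)))

        above : suc (Φ (m + d) k) ≤ F G → Outcome k
        above h = inj₁ (≤-trans (≤-reflexive (cong (λ c → suc (Φ c k)) n∸k)) h)

        length-chain : ∀ {K z xs ps} → Chain (H u) u K z xs → suc (length ps) ≡ m → length (xs ++ ps) + 1 ≡ card K + m
        length-chain {K} {xs = xs} {ps} c len = trans (cong (_+ 1) (length-++ xs)) (trans (+-assoc (length xs) (length ps) 1)
          (cong₂ _+_ (sym (chain-card c)) (trans (+-comm (length ps) 1) len)))

        cardH : card (H u) ≡ suc (k + d)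
        cardH = trans (card-⊖ (H u) (H-self bu)) (cong suc hk)

        tip-conn : ∀ {y} → tips u y ≡ true → Conn (H u ⊖ y)
        tip-conn {y} h ha hb = walk ha ◅◅ walk-rev (∣-symm (H u ⊖ y) G-sym) (walk hb)
          where
          walk : ∀ {a} → (H u ⊖ y) a ≡ true → Walk (G ∣ (H u ⊖ y)) a u
          walk {a} ha = subst (λ z → Walk (G ∣ (H z ⊖ y)) a z) (eqF⇒≡ (⊖-⊑ (H u) y a ha)) (tip-walk (∧-elimˡ {tip y} h) (⊖-≢ (H u) ha))

      many-tips : 2 ≤ d → Outcome k
      many-tips 2≤d = above (≤-trans (one-root-strict m d k 3≤m 1≤k k≤m 2≤d (≤-trans 13≤n (≤-reflexive nmk))) (bound₀ growsTips pairs′))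

      one-tip : d ≡ 0 → Outcome k
      one-tip d0 = byShape (shape (H u) u (H-conn bu) (H-self bu))
        where
        hk₀ : card (H u ⊖ u) ≡ k
        hk₀ = trans hk (trans (cong (k +_) d0) (+-identityʳ k))
        m≡ : n ∸ k ≡ m
        m≡ = trans n∸k (trans (cong (m +_) d0) (+-identityʳ m))
        pairs₀ : tri′ k ≤ cnt (insideBeyond (H u) u) Us
        pairs₀ = ≤-trans (≤-reflexive (cong tri′ (sym hk₀))) pairs
        -- Without any surplus the bound equals `Φ m k` by `path-arith`; each surplus set at the
        -- root is worth `tri m`, which is positive.
        extra : ∀ {s} → Grows (H u) u (card (H u ⊖ u) + suc s) → Outcome k
        extra {s} gr = inj₁ (≤-trans (≤-reflexive (cong (λ c → suc (Φ c k)) m≡)) (≤-trans (s≤s (≤-reflexive (sym (path-arith m k))))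
          (≤-trans (≤-trans (≤-reflexive (+-comm 1 _)) (≤-trans (+-monoʳ-≤ (m * m + 1 + tri′ k + tri m * k) (≤-trans (≤-trans (≤-trans (s≤s z≤n) 3≤m) (m≤tri m)) (m≤m*n (tri m) (suc s))))
            (≤-reflexive (lem (m * m + 1 + tri′ k) (tri m) k (suc s))))) (bound₀ (growsBy (cong (_+ suc s) hk₀) gr) pairs₀))))
          where
          lem : ∀ a t k s → a + t * k + t * s ≡ a + t * (k + s)
          lem = solve-∀
        growsPlain : Grows (H u) u k
        growsPlain = subst (λ z → Grows (H u) u z) (trans (cong (λ z → k + z + (z + ch2 z)) d0) (trans (+-identityʳ (k + 0)) (+-identityʳ k))) growsTips
        isL : ∀ {K z xs} → Chain (H u) u K z xs → H u ⊑ K → (∀ {x} → B x ≡ true → ¬ (3 ≤ card ((G ∣ B) x))) → Listed (patL (n ∸ k))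
        isL {K} {z} {xs} c HK deg = let ps , o , len , inB = Cycle.cycle-ordered bu deg
                                        o′ , _ = Cycle.chain-ordered bu deg o len inB c in
          xs ++ ps , subst (λ c → Ordered G (patL c) (xs ++ ps)) (sym m≡) o′ ,
          +-cancelʳ-≡ 1 _ _ (trans (length-chain c len) (trans (cong (_+ m) (trans (card-cong {U = K} {W = H u} (chain-⊑ (H-self bu) c) HK) cardH))
            (trans (lem k d m) (cong (_+ 1) (sym nmk)))))
          where
          lem : ∀ k d m → suc (k + d) + m ≡ m + (k + d) + 1
          lem = solve-∀
        byShape : Shape (H u) u → Outcome k
        byShape (wide gr) = extra gr
        byShape (fork _ _ _ _ _ _ _ _ _ _ _ _ gr) = extra gr
        byShape (path c HK) = decide big
          where
          decide : Dec (∃ λ x → (B x ≡ true) × (3 ≤ card ((G ∣ B) x))) → Outcome k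
          decide (yes (x , b , l)) = inj₁ (≤-trans (≤-reflexive (trans (cong (λ c → suc (Φ c k)) m≡) (cong suc (sym (path-arith m k))))) (bound₁ (m<e b l) growsPlain pairs₀))
          decide (no h) = inj₂ (≤-trans (≤-reflexive (trans (cong (λ c → Φ c k) m≡) (sym (path-arith m k)))) (bound₀ growsPlain pairs₀) ,
            inj₁ (isL c HK (λ {x} b l → h (x , b , l))))

      two-tips : d ≡ 1 → Outcome k
      two-tips d1 = cmp (k <? m)
        where
        hk₁ : card (H u ⊖ u) ≡ k + 1
        hk₁ = trans hk (cong (k +_) d1)
        above₁ : suc (Φ (m + 1) k) ≤ F G → Outcome k
        above₁ h = above (≤-trans (≤-reflexive (cong (λ z → suc (Φ (m + z) k)) d1)) h)
        pairs₁ : tri′ (k + 1) ≤ cnt (insideBeyond (H u) u) Us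
        pairs₁ = ≤-trans (≤-reflexive (cong tri′ (sym hk₁))) pairs
        growsOne : Grows (H u) u (k + 1 + 1)
        growsOne = subst (λ z → Grows (H u) u (k + z + (z + ch2 z))) d1 growsTips
        module Equal (k≡m : k ≡ m) where
          n≡ : n ≡ 2 * k + 1
          n≡ = trans nmk (trans (cong₂ (λ a b → a + (k + b)) (sym k≡m) d1) (lem k))
            where
            lem : ∀ k → k + (k + 1) ≡ 2 * k + 1
            lem = solve-∀
          4≤k : 4 ≤ k
          4≤k with 4 ≤? k
          ... | yes q = q
          ... | no q = ⊥-elim (1+n≰n (≤-trans (m≤m+n 8 5) (≤-trans 13≤n (≤-trans (≤-reflexive n≡) (+-monoˡ-≤ 1 (*-monoʳ-≤ 2 (≤-pred (≰⇒> q))))))))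
          toK : ∀ {q τ x} → x ≤ k * k + 1 + τ + tri k * q → Grows (H u) u q → τ ≤ cnt (insideBeyond (H u) u) Us → x ≤ F G
          toK {q} {τ} h gr hτ = ≤-trans h (≤-trans (≤-reflexive (cong (λ z → z * z + 1 + τ + tri z * q) k≡m)) (bound₀ gr hτ))
          above₂ : suc (Φ (k + 1) k) ≤ F G → Outcome k
          above₂ h = above₁ (≤-trans (≤-reflexive (cong (λ z → suc (Φ (z + 1) k)) (sym k≡m))) h)
          -- A path hanging at `u` has a single removable vertex besides `u`, whereas `d = 1` means
          -- that there are two tips.
          noPath : ∀ {K z xs} → Chain (H u) u K z xs → H u ⊑ K → ⊥
          noPath {K} {z} c HK = 1+n≰n (≤-trans (≤-reflexive (trans (cong suc (sym d1)) (sym td)))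
              (≤-trans (card-mono {U = tips u} {W = ⟪ z ⟫} only) (≤-reflexive (card-⟪⟫ z))))
            where
            only : tips u ⊑ ⟪ z ⟫
            only y h = ≡⇒eqF (chain-noncut c HK (∧-elimʳ {tip y} h) (⊖-≢ (H u) (tips⊑ bu y h)) (tip-conn h)
              (chain-⊑ (H-self bu) c z (chain-last c)) (H-self bu))
          isFork : ∀ {K z xs} x y → Chain (H u) u K z xs → H u x ≡ true → H u y ≡ true → K x ≡ false → K y ≡ false → x ≢ y →
            G z x ≡ true → G z y ≡ true → (∀ {w a} → H u w ≡ true → K w ≡ false → K a ≡ true → G a w ≡ true → a ≡ z) →
            card (H u ∖ K) ≡ 2 → Outcome k
          isFork {K} {z} {xs} x y c hx hy kx ky x≢y zx zy ends e2 = decide big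
            where
            cardK : card K ≡ k
            cardK = +-cancelʳ-≡ 2 _ _ (trans (cong₂ _+_ (card-cong {U = K} {W = H u ⊓ K} (λ w q → ∧-intro (chain-⊑ (H-self bu) c w q) q) (λ w q → ∧-elimʳ {H u w} q)) (sym e2))
              (trans (sym (card-split (H u) K)) (trans cardH (trans (cong (λ z → suc (k + z)) d1) (lem k)))))
              where
              lem : ∀ k → suc (k + 1) ≡ k + 2
              lem = solve-∀
            count′ : tri′ (k + 1) + (k ∸ 1) ≤ cnt (insideBeyond (H u) u) Us
            count′ = subst (λ z → tri′ (z + 1) + (z ∸ 1) ≤ cnt (insideBeyond (H u) u) Us) cardK
              (fork-count (H-conn bu) (H-self bu) c hx hy kx ky x≢y zx zy e2)
            -- An edge `xy` would complete a triangle with `z`, against girth at least `k ≥ 4`. So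
            -- both end vertices are leaves, as in `Q`.
            triangle-free : G x y ≡ true → ⊥
            triangle-free xy = 1+n≰n (≤-trans 4≤k (girth (z ∷ x ∷ y ∷ [])
              (s≤s (s≤s (s≤s z≤n)) , ((λ e → G-irr zx e) ∷ (λ e → G-irr zy e) ∷ []) ∷ (x≢y ∷ []) ∷ [] ∷ [] ,
               ≡⇒T (∧-intro zx (∧-intro xy (G-sym _ _ zy))))))
            listed : (∀ {x} → B x ≡ true → ¬ (3 ≤ card ((G ∣ B) x))) → Listed (patQ k n)
            listed deg = let ps , o , len , inB = Cycle.cycle-ordered bu deg
                             o′ , (i₀ , eq₀ , at₀) , m≤ = Cycle.chain-ordered bu deg o len inB c in
              build ps o len inB o′ i₀ eq₀ at₀ m≤
              where
              build : ∀ ps → Ordered G (patL m) (u ∷ ps) → suc (length ps) ≡ m → (∀ {w} → w ∈ ps → (B ⊖ u) w ≡ true) →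
                Ordered G (patL m) (xs ++ ps) → ∀ i₀ → suc i₀ ≡ length (xs ++ ps) → At (xs ++ ps) i₀ z → m ≤ length (xs ++ ps) → Listed (patQ k n)
              build ps o len inB o′ i₀ eq₀ at₀ m≤ = y ∷ x ∷ ℓ , snoc (ordered-map patEq (snoc o′ x∉ adjx)) y∉ adjy , len₂
                where
                ℓ : List (Fin n)
                ℓ = xs ++ ps
                len₂ : suc (suc (length ℓ)) ≡ n
                len₂ = +-cancelʳ-≡ 1 _ _ (trans (cong (λ z → suc (suc z)) (trans (length-chain c len) (cong (_+ m) cardK)))
                  (trans (lem k m) (cong (_+ 1) (sym (trans nmk (cong (λ z → m + (k + z)) d1))))))
                  where
                  lem : ∀ k m → suc (suc (k + m)) ≡ m + (k + 1) + 1
                  lem = solve-∀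
                patEq : ∀ {i j} → i < j → j < suc (length ℓ) → patL m i j ≡ patQ k n i j
                patEq {i} {j} _ l = trans (cong (λ z → patL z i j) (sym k≡m)) (sym (patQ-patL {k} {n} {i} {j} (≤-trans (s≤s l) (≤-reflexive len₂))))
                ≢u : ∀ {w} → K w ≡ false → w ≢ u
                ≢u kw e = true≢false (subst (λ z → K z ≡ true) (sym e) (chain-root c)) kw
                x∉ : x ∉ ℓ
                x∉ = Cycle.chain-∉ bu deg o len inB c hx kx
                only-z : ∀ {w a} → H u w ≡ true → K w ≡ false → a ∈ ℓ → G a w ≡ true → a ≡ z
                only-z hw kw ma g = [ (λ q → ends hw kw (chain-∈ c q) g) , (λ q → ⊥-elim (Cycle.no-edge bu deg o len inB q hw (≢u kw) g)) ]′ (∈-++⁻ xs ma)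
                at-z : ∀ {i w} → At ℓ i w → w ≡ z → suc i ≡ length ℓ
                at-z {i} a e = trans (cong suc (At-injective (ordered-unique o′) (subst (At ℓ i) e a) at₀)) eq₀
                z-at : ∀ {i w} → At ℓ i w → suc i ≡ length ℓ → w ≡ z
                z-at a e = At-functional a (subst (λ j → At ℓ j z) (suc-injective (trans eq₀ (sym e))) at₀)
                adjx : ∀ {i w} → At ℓ i w → G w x ≡ patL m i (length ℓ)
                adjx {i} {w} a = trans (bool-ext (λ g → ≡ᵇ-true (at-z a (only-z hx kx (At-∈ a) g)))
                  (λ q → subst (λ b → G b x ≡ true) (sym (z-at a (≡ᵇ-elim {suc i} q))) zx)) (sym (patL-tail {m} {i} (λ e → <-irrefl (sym e) (s≤s m≤))))
                y∉ : y ∉ x ∷ ℓ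
                y∉ (here e) = x≢y (sym e)
                y∉ (there q) = Cycle.chain-∉ bu deg o len inB c hy ky q
                k<n : k < n
                k<n = ≤-trans (≤-reflexive (+-comm 1 k)) (≤-trans (m≤n+m (k + 1) m) (≤-reflexive (sym (trans nmk (cong (λ z → m + (k + z)) d1)))))
                last : ∀ i → patQ k n i (suc (length ℓ)) ≡ (3 + i ≡ᵇ n)
                last i = patQ-last {k} {n} {i} len₂ k<n
                adjy : ∀ {i w} → At (x ∷ ℓ) i w → G w y ≡ patQ k n i (suc (length ℓ))
                adjy here = trans (≢true⇒false triangle-free) (sym (trans (last (length ℓ)) (≡ᵇ-false {3 + length ℓ} {n} (λ e → 1+n≢n (trans e (sym len₂))))))
                adjy {i} {w} (there a) = trans (bool-ext
                    (λ g → ≡ᵇ-true (trans (cong (λ z → suc (suc z)) (at-z a (only-z hy ky (At-∈ a) g))) len₂))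
                    (λ q → subst (λ b → G b y ≡ true) (sym (z-at a (suc-injective (suc-injective (trans (≡ᵇ-elim {3 + i} q) (sym len₂)))))) zy))
                  (sym (last i))
            decide : Dec (∃ λ x → (B x ≡ true) × (3 ≤ card ((G ∣ B) x))) → Outcome k
            decide (yes (w , b , l)) = above₂ (≤-trans (s≤s (≤-reflexive (sym (two-tips-fork k 1≤k))))
              (≤-trans (≤-reflexive (cong (λ z → suc (z * z + 1 + (tri′ (k + 1) + (k ∸ 1)) + tri z * (k + 1 + 1))) k≡m)) (bound₁ (m<e b l) growsOne count′)))
            decide (no h) = inj₂ (≤-trans (≤-reflexive (cong (λ c → Φ c k) (trans n∸k (cong₂ _+_ (sym k≡m) d1)))) (toK (≤-reflexive (sym (two-tips-fork k 1≤k))) growsOne count′) ,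
              inj₂ (n≡ , listed (λ {w} b l → h (w , b , l))))
          byShape : Shape (H u) u → Outcome k
          byShape (path c HK) = ⊥-elim (noPath c HK)
          byShape (wide gr) = above₂ (toK (two-tips-wide k) (growsBy (cong (_+ 2) hk₁) gr) pairs₁)
          byShape (fork x y c hx hy kx ky x≢y zx zy ends e2 _) = isFork x y c hx hy kx ky x≢y zx zy ends e2
        cmp : Dec (k < m) → Outcome k
        cmp (yes k<m) = above₁ (≤-trans (two-tips-strict m k k<m) (bound₀ growsOne pairs₁))
        cmp (no k≮m) = Equal.byShape (≤-antisym k≤m (≮⇒≥ k≮m)) (shape (H u) u (H-conn bu) (H-self bu))

    one-root : Outcome k
    one-root = go (proj₁ (tips-card bu (∧-elimʳ {B u} ru))) (proj₁ (proj₂ (tips-card bu (∧-elimʳ {B u} ru))))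
      where
      go : ∀ d → card (tips u) ≡ suc d → Outcome k
      go zero td = one-tip td refl
      go (suc zero) td = two-tips td refl
      go (suc (suc d)) td = many-tips td (s≤s (s≤s z≤n))

  block-outcome : ∀ {k} → card cut ≡ k → 1 ≤ k → 13 ≤ n → GirthAtLeast k G → Outcome k
  block-outcome {k} ck 1≤k 13≤n girth = go (root-exists (≤-trans 1≤k (≤-reflexive (sym ck)))) (2 ≤? card roots)
    where
    k≤m : k ≤ m
    k≤m = ≤-trans (girth (proj₁ B-cycle) (proj₁ (proj₂ B-cycle))) (proj₂ (proj₂ B-cycle))
    go : (∃ λ u → roots u ≡ true) → Dec (2 ≤ card roots) → Outcome k
    go _ (yes 2≤r) = inj₁ (many-roots k ck 1≤k k≤m 2≤r)
    go (u , ru) (no 2≰r) = one-root ru (≤-antisym (≤-pred (≰⇒> 2≰r)) (card-pos {U = roots} {u} ru)) ck 1≤k k≤m 13≤n girth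

-- Trees

path⇒walk : {E : Graph n} {x y : Fin n} {ps : List (Fin n)} → Path E x y ps → Walk E x y
path⇒walk (stop x) = nil
path⇒walk (step e nx p) = cons e (path⇒walk p)

card-∪-≤ : (U W : VSet n) → card (U ∪ W) ≤ card U + card W
card-∪-≤ U W = ≤-trans (≤-reflexive (card-split (U ∪ W) U)) (+-mono-≤ (card-mono {U = (U ∪ W) ⊓ U} {W = U} (λ x h → ∧-elimʳ {(U ∪ W) x} h))
  (card-mono {U = (U ∪ W) ∖ U} {W = W} (λ x h → [ (λ q → ⊥-elim (true≢false q (∖-out (U ∪ W) U {x} h))) , id ]′ (∨-elim {U x} (∖-⊑ (U ∪ W) U x h)))))

-- Replacing `b` by `c ∸ a` only lowers the sum, and for `a > c` the case `a = c` suffices. This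
-- leaves finitely many values to check.
pow-sum : ∀ c S → (∀ {a} → a < suc c → S ≤ 2 ^ a + 2 ^ (c ∸ a)) → ∀ a b → c ≤ a + b → S ≤ 2 ^ a + 2 ^ b
pow-sum c S h a b l with a ≤? c
... | yes q = ≤-trans (h (s≤s q)) (+-monoʳ-≤ (2 ^ a) (^-monoʳ-≤ 2 (≤-trans (∸-monoˡ-≤ a l) (≤-reflexive (m+n∸m≡n a b)))))
... | no q = ≤-trans (h {c} ≤-refl) (≤-trans (+-mono-≤ (^-monoʳ-≤ 2 (<⇒≤ (≰⇒> q))) (≤-trans (≤-reflexive (cong (2 ^_) (n∸n≡0 c))) (m^n>0 2 b))) ≤-refl)

-- The least value of 2 ^ a + 2 ^ b ∸ 2 with a + b = c, needed only for small c.
slack : ℕ → ℕ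
slack 7 = 22
slack 8 = 30
slack 9 = 46
slack _ = 0

slack-bound : ∀ c a b → c ≤ a + b → slack c + 2 ≤ 2 ^ a + 2 ^ b
slack-bound c a b l with c ≟ℕ 7 | c ≟ℕ 8 | c ≟ℕ 9
... | yes refl | _ | _ = pow-sum 7 24 (toWitness {a? = allUpTo? (λ a → 24 ≤? 2 ^ a + 2 ^ (7 ∸ a)) 8} tt) a b l
... | no _ | yes refl | _ = pow-sum 8 32 (toWitness {a? = allUpTo? (λ a → 32 ≤? 2 ^ a + 2 ^ (8 ∸ a)) 9} tt) a b l
... | no _ | no _ | yes refl = pow-sum 9 48 (toWitness {a? = allUpTo? (λ a → 48 ≤? 2 ^ a + 2 ^ (9 ∸ a)) 10} tt) a b l
... | no p | no q | no r = ≤-trans (≤-reflexive (cong (_+ 2) (zero-slack c p q r))) (+-mono-≤ (m^n>0 2 a) (m^n>0 2 b))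
  where
  zero-slack : ∀ c → c ≢ 7 → c ≢ 8 → c ≢ 9 → slack c ≡ 0
  zero-slack 0 _ _ _ = refl
  zero-slack 1 _ _ _ = refl
  zero-slack 2 _ _ _ = refl
  zero-slack 3 _ _ _ = refl
  zero-slack 4 _ _ _ = refl
  zero-slack 5 _ _ _ = refl
  zero-slack 6 _ _ _ = refl
  zero-slack 7 p _ _ = ⊥-elim (p refl)
  zero-slack 8 _ q _ = ⊥-elim (q refl)
  zero-slack 9 _ _ r = ⊥-elim (r refl)
  zero-slack (suc (suc (suc (suc (suc (suc (suc (suc (suc (suc c)))))))))) _ _ _ = refl

-- With `c` leaves and `k` cut vertices, the summands stand for the subgraphs that contain all cut
-- vertices, those lying on one side of one of the `k ∸ 1` edges between cut vertices, and those
-- without leaves. The first summand is one too large, which `tree-bound` makes up for.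
treeValue : ℕ → ℕ → ℕ
treeValue c k = 2 ^ c + (k ∸ 1) * slack c + (1 + tri′ (k ∸ 1))

tri-mono : ∀ {a b} → a ≤ b → tri a ≤ tri b
tri-mono {zero} h = z≤n
tri-mono {suc a} {suc b} (s≤s h) = +-mono-≤ (tri-mono h) (s≤s h)

Φ-mono : ∀ c {k l} → k ≤ l → Φ c k ≤ Φ c l
Φ-mono c h = +-mono-≤ (+-monoʳ-≤ (c * c + 1) (tri-mono h)) (*-monoʳ-≤ (tri c + 1) h)

-- Raising `c` by one doubles the power but less than doubles the left side, because
-- `4 * c + 1 ≤ tri c * c`. The start 10 is the first value that works: for `c = 9` the left side is
-- 543 and the power 512.
Φ<2^ : ∀ o → 2 + Φ (10 + o) (10 + o) ≤ 2 ^ (10 + o)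
Φ<2^ zero = toWitness {a? = 2 + Φ 10 10 ≤? 2 ^ 10} tt
Φ<2^ (suc o) = begin
  2 + Φ (suc c) (suc c) ≡⟨ lemma₁ c (tri c) ⟩
  2 * (c * c) + 6 * c + 7 + 2 * tri c + tri c * c
    ≤⟨ +-monoʳ-≤ (2 * (c * c) + 6 * c + 7 + 2 * tri c) big ⟩
  2 * (c * c) + 6 * c + 7 + 2 * tri c + (2 * (tri c * c) ∸ (4 * c + 1))
    ≡⟨ lemma₂ ⟩
  2 * (2 + Φ c c) ≤⟨ *-monoʳ-≤ 2 (Φ<2^ o) ⟩
  2 ^ (10 + suc o) ∎
  where
  open ≤-Reasoning
  c : ℕ
  c = 10 + o
  lemma₁ : ∀ c t → 2 + (suc c * suc c + 1 + (t + suc c) + (t + suc c + 1) * suc c) ≡ 2 * (c * c) + 6 * c + 7 + 2 * t + t * c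
  lemma₁ = solve-∀
  five : 4 * c + 1 ≤ tri c * c
  five = ≤-trans (≤-trans (+-monoʳ-≤ (4 * c) (s≤s z≤n)) (≤-reflexive (lem c))) (*-monoˡ-≤ c (≤-trans (toWitness {a? = 5 ≤? 10} tt) (≤-trans (m≤m+n 10 o) (m≤tri c))))
    where
    lem : ∀ c → 4 * c + c ≡ 5 * c
    lem = solve-∀
  big : tri c * c ≤ 2 * (tri c * c) ∸ (4 * c + 1)
  big = ≤-trans (≤-reflexive (sym (m+n∸n≡m (tri c * c) (tri c * c)))) (≤-trans (≤-reflexive (cong (_∸ (tri c * c)) (cong (tri c * c +_) (sym (+-identityʳ _))))) (∸-monoʳ-≤ (2 * (tri c * c)) five))
  lemma₂ : 2 * (c * c) + 6 * c + 7 + 2 * tri c + (2 * (tri c * c) ∸ (4 * c + 1)) ≡ 2 * (2 + Φ c c)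
  lemma₂ = trans (cong (_+ (2 * (tri c * c) ∸ (4 * c + 1))) (lem₁ c (tri c))) (trans (+-assoc (2 * (c * c) + 2 * c + 6 + 2 * tri c) (4 * c + 1) _)
    (trans (cong (2 * (c * c) + 2 * c + 6 + 2 * tri c +_) (m+[n∸m]≡n (≤-trans five (m≤m+n (tri c * c) _)))) (lem₂ c (tri c))))
    where
    lem₁ : ∀ c t → 2 * (c * c) + 6 * c + 7 + 2 * t ≡ 2 * (c * c) + 2 * c + 6 + 2 * t + (4 * c + 1)
    lem₁ = solve-∀
    lem₂ : ∀ c t → 2 * (c * c) + 2 * c + 6 + 2 * t + 2 * (t * c) ≡ 2 * (2 + (c * c + 1 + t + (t + 1) * c))
    lem₂ = solve-∀

-- The hypotheses force `c ≥ 7`. From 10 on the power of two is enough; for 7, 8 and 9 the other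
-- summands of `treeValue` are needed and the finitely many `k` are evaluated. Of the 2 on the left,
-- one unit is lost in `tree-bound` and the other gives strictness.
tree-arith : ∀ c k → k ≤ c → 13 ≤ c + k → 2 + Φ c k ≤ treeValue c k
tree-arith c k k≤c 13≤n with 10 ≤? c
... | yes q with m≤n⇒∃[o]m+o≡n q
... | o , refl = ≤-trans (+-monoʳ-≤ 2 (Φ-mono (10 + o) k≤c)) (≤-trans (Φ<2^ o) (≤-trans (m≤m+n (2 ^ (10 + o)) _) (m≤m+n _ _)))
tree-arith c k k≤c 13≤n | no q with c ≟ℕ 7 | c ≟ℕ 8 | c ≟ℕ 9
... | yes refl | _ | _ = toWitness {a? = allUpTo? (λ k → (13 ≤? 7 + k) →-dec (2 + Φ 7 k ≤? treeValue 7 k)) 8} tt (s≤s k≤c) 13≤n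
... | no _ | yes refl | _ = toWitness {a? = allUpTo? (λ k → (13 ≤? 8 + k) →-dec (2 + Φ 8 k ≤? treeValue 8 k)) 9} tt (s≤s k≤c) 13≤n
... | no _ | no _ | yes refl = toWitness {a? = allUpTo? (λ k → (13 ≤? 9 + k) →-dec (2 + Φ 9 k ≤? treeValue 9 k)) 10} tt (s≤s k≤c) 13≤n
... | no a | no b | no d = ⊥-elim (1+n≰n (≤-trans 13≤n (+-mono-≤ c≤6 (≤-trans k≤c c≤6))))
  where
  c≤6 : c ≤ 6
  c≤6 = ≤-pred (≤∧≢⇒< (≤-pred (≤∧≢⇒< (≤-pred (≤∧≢⇒< (≤-pred (≰⇒> q)) d)) b)) a)

module Trees {n : ℕ} (G : Graph n) (G-simple : IsSimple G) (G-conn : ∀ x y → Walk G x y)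
  (tree : Blocks.Treelike G G-simple G-conn) where
  open Counting G G-simple
  open Blocks G G-simple G-conn hiding (Treelike)

  leaf : VSet n
  leaf x = not (cut x)

  -- If `z` were not a cut vertex, `p` and `q` would be linked without it, which puts `q` into the
  -- block of the edge `pz`.
  middle-cut : ∀ {p z q} → G p z ≡ true → G z q ≡ true → p ≢ q → cut z ≡ true
  middle-cut {p} {z} {q} pz zq p≢q with true? (cut z)
  ... | inj₁ h = h
  ... | inj₂ h = ⊥-elim (true≢false (blockOf-intro {p} {z} {q} λ w ne →
          (λ p≢w → toP w ne p≢w (z ≟ w)) , (λ z≢w → link-edge (G-sym _ _ zq) (ne ∘ sym) z≢w)) (tree pz (p≢q ∘ sym) (G-irr zq ∘ sym)))
    where
    toP : ∀ w → w ≢ q → p ≢ w → Dec (z ≡ w) → link w q p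
    toP w ne p≢w (yes refl) = noncut⇒Conn h (⊖-intro full (ne ∘ sym) refl) (⊖-intro full p≢w refl)
    toP w ne p≢w (no z≢w) = link-edge (G-sym _ _ zq) (ne ∘ sym) z≢w ◅◅ link-edge (G-sym _ _ pz) z≢w p≢w

  path-cut : ∀ {x y ps} → Path G x y ps → cut x ≡ true → cut y ≡ true → ∀ {w} → w ∈ ps → cut w ≡ true
  path-cut (stop x) a b (here refl) = a
  path-cut (step e nx p) a b (here refl) = a
  path-cut (step e nx p@(stop _)) a b (there m) = path-cut p b b m
  path-cut (step {x} {y} e nx p@(step {y = w} e′ ny q)) a b (there m) =
    path-cut p (middle-cut e e′ (λ { refl → nx (there (path-head q)) })) b m

  cut-conn : Conn cut
  cut-conn {x} {y} a b = let ps , p = walk⇒path (G-conn x y) in path-within {U = cut} p (path-cut p a b)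

  module _ {r : Fin n} (cr : cut r ≡ true) where

    -- If a neighbour `z` of `y` were a leaf too, then by `middle-cut` neither of them would have
    -- another neighbour. The graph would consist of `y` and `z` alone, leaving no place for the cut
    -- vertex `r`.
    leaf-neighbour : ∀ {y} → leaf y ≡ true → ∃ λ z → (cut z ≡ true) × (G z y ≡ true)
    leaf-neighbour {y} ly = go (first-step (G-conn y r) (λ { refl → true≢false cr (not-elim ly) }))
      where
      go : (∃ λ z → G y z ≡ true) → ∃ λ z → (cut z ≡ true) × (G z y ≡ true)
      go (z , yz) with true? (cut z)
      ... | inj₁ h = z , h , G-sym _ _ yz
      ... | inj₂ h = ⊥-elim ([ (λ e → true≢false cr (subst (λ w → cut w ≡ false) (sym e) (not-elim ly))) , (λ e → true≢false cr (subst (λ w → cut w ≡ false) (sym e) h)) ]′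
              (walk-inv (λ w → (w ≡ y) ⊎ (w ≡ z)) inv (G-conn y r) (inj₁ refl)))
        where
        inv : ∀ {a b} → G a b ≡ true → (a ≡ y) ⊎ (a ≡ z) → (b ≡ y) ⊎ (b ≡ z)
        inv {a} {b} g (inj₁ refl) with b ≟ z
        ... | yes q = inj₂ q
        ... | no q = ⊥-elim (true≢false (middle-cut (G-sym _ _ g) yz q) (not-elim ly))
        inv {a} {b} g (inj₂ refl) with b ≟ y
        ... | yes q = inj₁ q
        ... | no q = ⊥-elim (true≢false (middle-cut (G-sym _ _ g) (G-sym _ _ yz) q) h)

    leavesOf : VSet n → VSet n
    leavesOf K y = leaf y ∧ any (λ z → K z ∧ G z y) (allFin n)

    leavesOf-intro : ∀ K {z y} → leaf y ≡ true → K z ≡ true → G z y ≡ true → leavesOf K y ≡ true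
    leavesOf-intro K {z} l k g = ∧-intro l (any-intro _ (∈-allFin z) (∧-intro k g))

    leavesOf-elim : ∀ K {y} → leavesOf K y ≡ true → (leaf y ≡ true) × (∃ λ z → (K z ≡ true) × (G z y ≡ true))
    leavesOf-elim K {y} h = let z , _ , e = any-elim _ (allFin n) (∧-elimʳ {leaf y} h) in ∧-elimˡ h , z , ∧-elimˡ e , ∧-elimʳ {K z} e

    withLeaf : Valuation n
    withLeaf = count (meets leaf)

    -- `K` remains connected when any set of leaves adjacent to it is added. The empty choice
    -- contains no leaf and accounts for the `suc`.
    leaves-bound : ∀ K {z} → K z ≡ true → K ⊑ cut → Conn K → 2 ^ card (leavesOf K) ≤ suc (val withLeaf K (full ∖ (K ∪ leavesOf K)))
    leaves-bound K {z} kz KX cK = grow-proper withLeaf full (card (leavesOf K)) {K ∪ leavesOf K} {K} (λ x → ∨-introˡ) (λ _ _ → refl)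
        (card-cong {U = (K ∪ leavesOf K) ∖ K} {W = leavesOf K} to from)
        (λ K′ f f′ (y , ky , ny) → count-pos (meets leaf) K′ (full ∖ K′) (connK′ K′ f f′) (f z kz) (λ w a b → true≢false b (∖-out full K′ {w} a))
          (λ s eq → meets-intro leaf s (∧-elimˡ (to y (∖-intro (K ∪ leavesOf K) K (f′ y ky) ny))) (trans (eq y) ky)))
      where
      to : ((K ∪ leavesOf K) ∖ K) ⊑ leavesOf K
      to x h = [ (λ q → ⊥-elim (true≢false q (∖-out (K ∪ leavesOf K) K {x} h))) , id ]′ (∨-elim {K x} (∖-⊑ (K ∪ leavesOf K) K x h))
      from : leavesOf K ⊑ ((K ∪ leavesOf K) ∖ K)
      from x h = ∖-intro (K ∪ leavesOf K) K (∨-introʳ {K x} h) (≢true⇒false (λ k → true≢false (KX x k) (not-elim (∧-elimˡ h))))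
      connK′ : ∀ K′ → K ⊑ K′ → K′ ⊑ (K ∪ leavesOf K) → Conn K′
      connK′ K′ f f′ {x} {y} a b = hub a ◅◅ (∣-mono f (cK (proj₁ (proj₂ (base a))) (proj₁ (proj₂ (base b)))) ◅◅ walk-rev (∣-symm K′ G-sym) (hub b))
        where
        base : ∀ {x} → K′ x ≡ true → ∃ λ w → (K w ≡ true) × Walk (G ∣ K′) x w
        base {x} h = [ (λ k → x , k , nil) , (λ l → let _ , w , kw , g = leavesOf-elim K l in w , kw , cons (∣-intro G K′ h (f w kw) (G-sym _ _ g)) nil) ]′ (∨-elim {K x} (f′ x h))
        hub : ∀ {x} (h : K′ x ≡ true) → Walk (G ∣ K′) x (proj₁ (base h))
        hub h = proj₂ (proj₂ (base h))

    -- Removing `x` divides the cut vertices: `near` is the part connected to `r`, and `far`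
    -- consists of `x` and everything behind it. Both are connected, and together they contain all
    -- cut vertices.
    module Side {x : Fin n} (cx : cut x ≡ true) (x≢r : x ≢ r) where
      near far : VSet n
      near y = cut y ∧ (not (eqF y x) ∧ walkᵇ (G ∣ (full ⊖ x)) y r)
      far = cut ∖ near

      private
        near-intro : ∀ {y} → cut y ≡ true → y ≢ x → Walk (G ∣ (full ⊖ x)) y r → near y ≡ true
        near-intro a b w = ∧-intro a (∧-intro (not-intro (≢⇒eqF b)) (walkᵇ-complete w))

        near-elim : ∀ {y} → near y ≡ true → (cut y ≡ true) × (y ≢ x) × Walk (G ∣ (full ⊖ x)) y r
        near-elim {y} h = let a , b = ∧-elim {cut y} h ; c , d = ∧-elim {not (eqF y x)} b in
          a , eqF⇒≢ (not-elim c) , walkᵇ-sound (∣-symm (full ⊖ x) G-sym) d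

      near-r : near r ≡ true
      near-r = near-intro cr (x≢r ∘ sym) nil

      far-x : far x ≡ true
      far-x = ∖-intro cut near cx (≢true⇒false (λ h → proj₁ (proj₂ (near-elim h)) refl))

      near-conn : Conn near
      near-conn {y} {w} a b = to a ◅◅ walk-rev (∣-symm near G-sym) (to b)
        where
        G′ : Graph n
        G′ = G ∣ (full ⊖ x)
        avoid : ∀ {y w ps} → Path G′ y w ps → y ≢ x → ∀ {a} → a ∈ ps → a ≢ x
        avoid (stop _) ne (here refl) = ne
        avoid (step _ _ _) ne (here refl) = ne
        avoid (step {y} {z} e _ p) ne (there m) = avoid p (⊖-≢ full (proj₁ (proj₂ (∣-elim G (full ⊖ x) {y} {z} e)))) m
        to : ∀ {y} → near y ≡ true → Walk (G ∣ near) y r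
        to {y} h = let cy , ne , w = near-elim h ; ps , p = walk⇒path w
                       p′ = path-map {E = G′} {G} (λ {a} {b} e → proj₂ (proj₂ (∣-elim G (full ⊖ x) {a} {b} e))) p in
          path-within {U = near} p′ (λ {a} m → near-intro (path-cut p′ cy cr m) (avoid p ne m) (path⇒walk (proj₁ (proj₂ (path-suffix p m)))))

      far-conn : Conn far
      far-conn {y} {w} a b = to a ◅◅ walk-rev (∣-symm far G-sym) (to b)
        where
        to : ∀ {y} → far y ≡ true → Walk (G ∣ far) y x
        to {y} h = let ps , p = walk⇒path (G-conn y x) in path-within {U = far} p (λ {a} m → inFar p m (a ≟ x))
          where
          inFar : ∀ {ps} → Path G y x ps → ∀ {a} → a ∈ ps → Dec (a ≡ x) → far a ≡ true
          inFar p m (yes refl) = far-x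
          inFar p {a} m (no a≢x) = ∖-intro cut near (path-cut p (∖-⊑ cut near y h) cx m) (≢true⇒false (λ na →
            [ (λ { (y≢x , q) → true≢false (near-intro (∖-⊑ cut near y h) y≢x (walk-rev (∣-symm (full ⊖ x) G-sym) q ◅◅ proj₂ (proj₂ (near-elim na)))) (∖-out cut near {y} h) })
            , (λ { (x≢x , _) → x≢x refl }) ]′ (split-walks G-sym p m (a≢x ∘ sym))))

      -- Every leaf hangs at `near` or at `far`. Adding a nonempty choice of leaves to one side
      -- gives `2 ^ a + 2 ^ b - 2` subgraphs with `a + b` at least the number of leaves. Those over
      -- `near` contain `K` and miss `x`, those over `far` contain `x` and miss `K`.
      side-bound : ∀ {K} → K ⊑ near → slack (card leaf) ≤ val withLeaf K ⟪ x ⟫ + val withLeaf ⟪ x ⟫ K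
      side-bound {K} Kn = +-cancelʳ-≤ 2 _ _ (≤-trans (slack-bound (card leaf) (card (leavesOf near)) (card (leavesOf far))
            (≤-trans (card-mono {U = leaf} {W = leavesOf near ∪ leavesOf far} cover) (card-∪-≤ (leavesOf near) (leavesOf far))))
          (≤-trans (+-mono-≤ (≤-trans (leaves-bound near near-r (λ y h → ∧-elimˡ h) near-conn) (s≤s nearVal))
                             (≤-trans (leaves-bound far far-x (∖-⊑ cut near) far-conn) (s≤s farVal)))
            (≤-reflexive (lem (val withLeaf K ⟪ x ⟫) (val withLeaf ⟪ x ⟫ K)))))
        where
        lem : ∀ a b → suc a + suc b ≡ a + b + 2
        lem = solve-∀
        cover : leaf ⊑ (leavesOf near ∪ leavesOf far)
        cover y h = let z , cz , g = leaf-neighbour h in [ (λ q → ∨-introˡ (leavesOf-intro near h q g))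
          , (λ q → ∨-introʳ {leavesOf near y} (leavesOf-intro far h (∖-intro cut near cz q) g)) ]′ (true? (near z))
        nearVal : val withLeaf near (full ∖ (near ∪ leavesOf near)) ≤ val withLeaf K ⟪ x ⟫
        nearVal = anti withLeaf {K} {near} {⟪ x ⟫} {full ∖ (near ∪ leavesOf near)} Kn
          (λ y e → ∖-intro full (near ∪ leavesOf near) refl (≢true⇒false (λ h → [ (λ q → proj₁ (proj₂ (near-elim q)) (eqF⇒≡ e))
            , (λ q → true≢false (subst (λ z → cut z ≡ true) (sym (eqF⇒≡ e)) cx) (not-elim (∧-elimˡ q))) ]′ (∨-elim {near y} h))))
        farVal : val withLeaf far (full ∖ (far ∪ leavesOf far)) ≤ val withLeaf ⟪ x ⟫ K
        farVal = anti withLeaf {⟪ x ⟫} {far} {K} {full ∖ (far ∪ leavesOf far)}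
          (λ y e → subst (λ z → far z ≡ true) (sym (eqF⇒≡ e)) far-x)
          (λ y k → ∖-intro full (far ∪ leavesOf far) refl (≢true⇒false (λ h → [ (λ q → true≢false (Kn y k) (∖-out cut near {y} q))
            , (λ q → true≢false (proj₁ (near-elim (Kn y k))) (not-elim (∧-elimˡ q))) ]′ (∨-elim {far y} h))))

      near-⊒ : ∀ {K} → K ⊑ cut → Conn K → K r ≡ true → K x ≡ false → K ⊑ near
      near-⊒ {K} KX cK kr kx y ky = near-intro (KX y ky) (λ { refl → true≢false ky kx })
        (∣-mono {E = G} {U = K} {W = full ⊖ x} (λ w kw → ⊖-intro full (λ { refl → true≢false kw kx }) refl) (cK ky kr))

    private
      s : ℕ
      s = slack (card leaf)

      start : ℕ
      start = val withLeaf ⟪ r ⟫ ∅ + val withLeaf ∅ ⟪ r ⟫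

      -- While `K` grows from `{r}` to the set of all cut vertices, subgraphs with a leaf are
      -- tracked if they contain all of `K` or miss it entirely. A new vertex `x` drops those with
      -- `K` but without `x` and those with `x` but without `K`; by `side-bound` at least `s`
      -- subgraphs are lost each time.
      Progress : VSet n → Set
      Progress K = val withLeaf K ∅ + val withLeaf ∅ K + card (K ⊖ r) * s ≤ start

    progress : Progress cut
    progress = grow-ind Progress cut cut-conn cr resp base step′
      where
      resp : ∀ {K K′} → K ⊑ K′ → K′ ⊑ K → Progress K → Progress K′
      resp {K} {K′} f g h = ≤-trans (+-mono-≤ (+-mono-≤ (anti withLeaf {K} {K′} {∅} {∅} f (λ _ q → q)) (anti withLeaf {∅} {∅} {K} {K′} (λ _ q → q) f))
        (*-monoˡ-≤ s (card-mono {U = K′ ⊖ r} {W = K ⊖ r} (λ y q → ⊖-intro K (⊖-≢ K′ q) (g y (⊖-⊑ K′ r y q)))))) h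
      base : Progress ⟪ r ⟫
      base = ≤-reflexive (trans (cong (λ k → start + k * s) (suc-injective (trans (sym (card-⊖ ⟪ r ⟫ (eqF-refl r))) (card-⟪⟫ r)))) (+-identityʳ start))
      step′ : ∀ {K x u} → Conn K → K r ≡ true → K u ≡ true → K x ≡ false → G u x ≡ true → (K ⊕ x) ⊑ cut → Progress K → Progress (K ⊕ x)
      step′ {K} {x} cK kr ku kx g KX h = ≤-trans (≤-trans (≤-reflexive (cong (λ k → val withLeaf (K ⊕ x) ∅ + val withLeaf ∅ (K ⊕ x) + k * s) e))
          (≤-trans (+-monoʳ-≤ (val withLeaf (K ⊕ x) ∅ + val withLeaf ∅ (K ⊕ x)) (+-monoˡ-≤ (card (K ⊖ r) * s) side))
          (≤-trans (≤-reflexive (lem (val withLeaf (K ⊕ x) ∅) (val withLeaf ∅ (K ⊕ x)) (val withLeaf K ⟪ x ⟫) (val withLeaf ⟪ x ⟫ K) (card (K ⊖ r) * s)))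
            (+-monoˡ-≤ (card (K ⊖ r) * s) (+-mono-≤
              (≤-trans (+-monoʳ-≤ (val withLeaf (K ⊕ x) ∅) (anti withLeaf {K} {K} {∅ ⊕ x} {⟪ x ⟫} (λ _ q → q) (λ y q → [ ≡⇒eqF , (λ ()) ]′ (⊕-elim ∅ x q)))) (split withLeaf K ∅ x))
              (≤-trans (+-monoˡ-≤ (val withLeaf ∅ (K ⊕ x)) (anti withLeaf {∅ ⊕ x} {⟪ x ⟫} {K} {K} (λ y q → [ ≡⇒eqF , (λ ()) ]′ (⊕-elim ∅ x q)) (λ _ q → q))) (split withLeaf ∅ K x))))))) h
        where
        lem : ∀ a b c d t → a + b + (c + d + t) ≡ (a + c) + (d + b) + t
        lem = solve-∀
        x≢r : x ≢ r
        x≢r e = true≢false (subst (λ z → K z ≡ true) (sym e) kr) kx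
        side : s ≤ val withLeaf K ⟪ x ⟫ + val withLeaf ⟪ x ⟫ K
        side = Side.side-bound (KX x (⊕-new K x)) x≢r (Side.near-⊒ (KX x (⊕-new K x)) x≢r (λ y q → KX y (⊕-old K x y q)) cK kr kx)
        e : card ((K ⊕ x) ⊖ r) ≡ suc (card (K ⊖ r))
        e = suc-injective (trans (sym (card-⊖ (K ⊕ x) (⊕-old K x r kr))) (trans (card-⊕ K kx) (cong suc (card-⊖ K kr))))

    -- The subgraphs with a leaf are bounded by `progress`, evaluated at the set of all cut
    -- vertices; those without a leaf are bounded by `inside-bound` on that set.
    tree-bound : 2 ^ card leaf + (card cut ∸ 1) * s + (1 + tri′ (card cut ∸ 1)) ≤ suc (F G)
    tree-bound = ≤-trans (+-mono-≤ (+-mono-≤ all-leaves (≤-reflexive (cong (_* s) k-1)))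
        (≤-trans (≤-reflexive (cong (λ k → 1 + tri′ k) k-1)) (inside-bound cut cut-conn cr)))
      (s≤s (≤-trans (+-monoˡ-≤ (cnt (inside cut) Us) (≤-trans (+-monoˡ-≤ (card (cut ⊖ r) * s) (m≤m+n (val withLeaf cut ∅) (val withLeaf ∅ cut))) progress))
      (≤-trans (+-monoˡ-≤ (cnt (inside cut) Us) (cnt-disjoint (counted (meets leaf) ⟪ r ⟫ ∅) (counted (meets leaf) ∅ ⟪ r ⟫) touching Us
          (λ t h → let a , b , _ = counted-elim (meets leaf) ⟪ r ⟫ ∅ t h in ∧-intro a b)
          (λ t h → let a , b , _ = counted-elim (meets leaf) ∅ ⟪ r ⟫ t h in ∧-intro a b)
          (λ t h h′ → let _ , _ , c , _ = counted-elim (meets leaf) ⟪ r ⟫ ∅ t h ; _ , _ , _ , d = counted-elim (meets leaf) ∅ ⟪ r ⟫ t h′ in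
            d r (eqF-refl r) (c r (eqF-refl r)))))
      (≤-trans (cnt-disjoint touching (inside cut) conn Us (λ t h → ∧-elimˡ h) (λ t h → ∧-elimˡ h)
          (λ t h h′ → let y , ly , vy = meets-elim leaf t (∧-elimʳ {conn t} h) in
            true≢false (⊑ᵇ-elim {U = V t} {W = cut} (∧-elimʳ {conn t} h′) y vy) (not-elim ly)))
        (≤-reflexive (cnt-length conn Us))))))
      where
      touching : Sub n → Bool
      touching t = conn t ∧ meets leaf t
      k-1 : card cut ∸ 1 ≡ card (cut ⊖ r)
      k-1 = cong (_∸ 1) (card-⊖ cut cr)
      all-leaves : 2 ^ card leaf ≤ suc (val withLeaf cut ∅)
      all-leaves = ≤-trans (^-monoʳ-≤ 2 (card-mono {U = leaf} {W = leavesOf cut} (λ y h → let z , cz , g = leaf-neighbour h in leavesOf-intro cut h cz g)))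
        (≤-trans (leaves-bound cut cr (λ _ q → q) cut-conn) (s≤s (anti withLeaf {cut} {cut} {∅} {full ∖ (cut ∪ leavesOf cut)} (λ _ q → q) (λ _ ()))))

  tree-above : ∀ k → card cut ≡ k → 1 ≤ k → 2 * k ≤ n → 13 ≤ n → suc (Φ (n ∸ k) k) ≤ F G
  tree-above k ck 1≤k 2k≤n 13≤n = go (card-exists cut (≤-trans 1≤k (≤-reflexive (sym ck))))
    where
    leaf≡ : card leaf ≡ n ∸ k
    leaf≡ = trans (sym (m+n∸m≡n k (card leaf))) (cong (_∸ k) (trans (cong (_+ card leaf) (sym ck))
      (trans (sym (card-split full cut)) card-full)))
    k≤n : k ≤ n
    k≤n = ≤-trans (m≤m+n k (k + 0)) 2k≤n
    k≤c : k ≤ n ∸ k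
    k≤c = ≤-trans (≤-reflexive (sym (trans (cong (_∸ k) (cong (k +_) (+-identityʳ k))) (m+n∸n≡m k k)))) (∸-monoˡ-≤ k 2k≤n)
    go : (∃ λ r → cut r ≡ true) → suc (Φ (n ∸ k) k) ≤ F G
    go (r , cr) = ≤-pred (≤-trans (tree-arith (n ∸ k) k k≤c (≤-trans 13≤n (≤-reflexive (sym (m∸n+n≡m k≤n)))))
      (≤-trans (≤-reflexive (cong₂ (λ c k → 2 ^ c + (k ∸ 1) * slack c + (1 + tri′ (k ∸ 1))) (sym leaf≡) (sym ck))) (tree-bound cr)))

-- Exact counts by deciding one edge after another

_+ᵉ_ : Graph n → Fin n × Fin n → Graph n
(I +ᵉ e) a b = I a b ∨ adjIn (e ∷ []) a b

+ᵉ-old : (I : Graph n) (e : Fin n × Fin n) {a b : Fin n} → I a b ≡ true → (I +ᵉ e) a b ≡ true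
+ᵉ-old I e h = ∨-introˡ h

+ᵉ-new : (I : Graph n) (u x : Fin n) → (I +ᵉ (u , x)) u x ≡ true
+ᵉ-new I u x = ∨-introʳ {I u x} (adjIn-introˡ {ES = (u , x) ∷ []} {u} {x} (here refl))

+ᵉ-new′ : (I : Graph n) (u x : Fin n) → (I +ᵉ (u , x)) x u ≡ true
+ᵉ-new′ I u x = ∨-introʳ {I x u} (adjIn-introʳ {ES = (u , x) ∷ []} {x} {u} (here refl))

+ᵉ-elim : (I : Graph n) {u x a b : Fin n} → (I +ᵉ (u , x)) a b ≡ true →
  (I a b ≡ true) ⊎ (((a ≡ u) × (b ≡ x)) ⊎ ((a ≡ x) × (b ≡ u)))
+ᵉ-elim I {u} {x} {a} {b} h with ∨-elim {I a b} h
... | inj₁ q = inj₁ q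
... | inj₂ q with adjIn-elim ((u , x) ∷ []) {a} {b} q
... | inj₁ (here refl) = inj₂ (inj₁ (refl , refl))
... | inj₂ (here refl) = inj₂ (inj₂ (refl , refl))

∅ᵉ : Graph n
∅ᵉ _ _ = false

module Exact {n : ℕ} (G : Graph n) (G-simple : IsSimple G) where
  open Universe G G-simple

  -- A decision tree for the connected subgraphs that contain the vertices `K` and the edges `I` and
  -- avoid the edges `O`. At a `leaf` no edge at `K` is undecided, so the subgraph cannot extend
  -- beyond `K` and exactly one remains.
  data Enum : VSet n → Graph n → Graph n → ℕ → Set where
    leaf : ∀ {K I O} → (∀ {u w} → K u ≡ true → G u w ≡ true → (I u w ≡ true) ⊎ (O u w ≡ true)) → Enum K I O 1
    node : ∀ {K I O a b} u x → K u ≡ true → G u x ≡ true → I u x ≡ false → O u x ≡ false →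
      Enum (K ⊕ x) (I +ᵉ (u , x)) O a → Enum K I (O +ᵉ (u , x)) b → Enum K I O (a + b)

  cast : ∀ {K I O a b} → a ≡ b → Enum K I O a → Enum K I O b
  cast refl e = e

  private
    incᵉ excᵉ : Graph n → Sub n → Bool
    incᵉ I s = all (λ a → all (λ b → not (I a b) ∨ E s a b) (allFin n)) (allFin n)
    excᵉ O s = all (λ a → all (λ b → not (O a b ∧ E s a b)) (allFin n)) (allFin n)

    inc-intro : ∀ I s → (∀ a b → I a b ≡ true → E s a b ≡ true) → incᵉ I s ≡ true
    inc-intro I s f = all-intro _ (allFin n) λ {a} _ → ⊑ᵇ-intro {U = I a} {W = E s a} (f a)

    inc-elim : ∀ I s → incᵉ I s ≡ true → ∀ a b → I a b ≡ true → E s a b ≡ true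
    inc-elim I s h a = ⊑ᵇ-elim {U = I a} {W = E s a} (all-elim _ h (∈-allFin a))

    exc-intro : ∀ O s → (∀ a b → O a b ≡ true → E s a b ≡ true → ⊥) → excᵉ O s ≡ true
    exc-intro O s f = all-intro _ (allFin n) λ {a} _ → disjᵇ-intro {D = O a} {W = E s a} (f a)

    exc-elim : ∀ O s → excᵉ O s ≡ true → ∀ a b → O a b ≡ true → E s a b ≡ true → ⊥
    exc-elim O s h a = disjᵇ-elim {D = O a} {W = E s a} (all-elim _ h (∈-allFin a))

    record SatP (K : VSet n) (I O : Graph n) (s : Sub n) : Set where
      constructor sat
      field
        s-conn : conn s ≡ true
        s-K : K ⊑ V s
        s-I : ∀ a b → I a b ≡ true → E s a b ≡ true
        s-O : ∀ a b → O a b ≡ true → E s a b ≡ true → ⊥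
    open SatP

  Sat : VSet n → Graph n → Graph n → Sub n → Bool
  Sat K I O s = (conn s ∧ (K ⊑ᵇ V s)) ∧ (incᵉ I s ∧ excᵉ O s)

  private
    Sat-intro : ∀ {K I O s} → SatP K I O s → Sat K I O s ≡ true
    Sat-intro {K} {I} {O} {s} (sat a b c d) = ∧-intro (∧-intro a (⊑ᵇ-intro b)) (∧-intro (inc-intro I s c) (exc-intro O s d))

    Sat-elim : ∀ {K I O s} → Sat K I O s ≡ true → SatP K I O s
    Sat-elim {K} {I} {O} {s} h = let p , q = ∧-elim {conn s ∧ (K ⊑ᵇ V s)} h ; a , b = ∧-elim {conn s} p ; c , d = ∧-elim {incᵉ I s} q in
      sat a (⊑ᵇ-elim b) (inc-elim I s c) (exc-elim O s d)

  -- The invariant that makes the subgraph at a leaf of the tree exist: `I` alone connects `K`, and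
  -- no edge is both required and forbidden.
  record Good (K : VSet n) (I O : Graph n) : Set where
    field
      some : ∃ λ z → K z ≡ true
      linked : ∀ {x y} → K x ≡ true → K y ≡ true → Walk I x y
      valid : ∀ {x y} → I x y ≡ true → (G x y ≡ true) × (K x ≡ true) × (K y ≡ true)
      I-symm : Symm I
      O-symm : Symm O
      apart : ∀ {x y} → I x y ≡ true → O x y ≡ true → ⊥
  open Good

  +ᵉ-symm : ∀ {I : Graph n} {e} → Symm I → Symm (I +ᵉ e)
  +ᵉ-symm {I} {u , x} s a b h = [ (λ q → ∨-introˡ (s a b q)) , [ (λ { (refl , refl) → +ᵉ-new′ I u x }) , (λ { (refl , refl) → +ᵉ-new I u x }) ]′ ]′ (+ᵉ-elim I {u} {x} h)

  good-in : ∀ {K I O u x} → Good K I O → K u ≡ true → G u x ≡ true → O u x ≡ false → Good (K ⊕ x) (I +ᵉ (u , x)) O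
  good-in {K} {I} {O} {u} {x} g ku ux oux = record
    { some = x , ⊕-new K x
    ; linked = λ a b → toU a ◅◅ walk-rev (+ᵉ-symm {e = u , x} (I-symm g)) (toU b)
    ; valid = λ {a} {b} h → [ (λ q → let p , r , t = valid g q in p , ⊕-old K x a r , ⊕-old K x b t)
        , [ (λ { (refl , refl) → ux , ⊕-old K x u ku , ⊕-new K x }) , (λ { (refl , refl) → G-sym _ _ ux , ⊕-new K x , ⊕-old K x u ku }) ]′ ]′ (+ᵉ-elim I {u} {x} h)
    ; I-symm = +ᵉ-symm {e = u , x} (I-symm g)
    ; O-symm = O-symm g
    ; apart = λ {a} {b} h o → [ (λ q → apart g q o) , [ (λ { (refl , refl) → true≢false o oux }) , (λ { (refl , refl) → true≢false (O-symm g _ _ o) oux }) ]′ ]′ (+ᵉ-elim I {u} {x} h) }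
    where
    toU : ∀ {a} → (K ⊕ x) a ≡ true → Walk (I +ᵉ (u , x)) a u
    toU h = [ (λ { refl → cons (+ᵉ-new′ I u x) nil }) , (λ q → walk-map (λ {a} {b} → +ᵉ-old I (u , x) {a} {b}) (linked g q ku)) ]′ (⊕-elim K x h)

  good-out : ∀ {K I O u x} → Good K I O → I u x ≡ false → Good K I (O +ᵉ (u , x))
  good-out {K} {I} {O} {u} {x} g iux = record
    { some = some g ; linked = linked g ; valid = valid g ; I-symm = I-symm g ; O-symm = +ᵉ-symm {e = u , x} (O-symm g)
    ; apart = λ {a} {b} h o → [ apart g h , [ (λ { (refl , refl) → true≢false h iux }) , (λ { (refl , refl) → true≢false (I-symm g _ _ h) iux }) ]′ ]′ (+ᵉ-elim O {u} {x} o) }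

  enum-count : ∀ {K I O N} → Good K I O → Enum K I O N → cnt (Sat K I O) Us ≡ N
  enum-count {K} {I} {O} g (leaf cl) = ≤-antisym upper lower
    where
    V≡K : ∀ {s} → s ∈ Us → SatP K I O s → ∀ x → V s x ≡ K x
    V≡K {s} m h x = bool-ext (λ vx → walk-inv (λ y → K y ≡ true) inv (proj₂ (conn-elim s (s-conn h)) (s-K h _ (proj₂ (some g))) vx) (proj₂ (some g))) (s-K h x)
      where
      inv : ∀ {a b} → E s a b ≡ true → K a ≡ true → K b ≡ true
      inv {a} {b} e ka = [ (λ i → proj₂ (proj₂ (valid g i))) , (λ o → ⊥-elim (s-O h a b o e)) ]′ (cl ka (proj₁ (E-valid {s} m e)))
    E≡I : ∀ {s} → s ∈ Us → SatP K I O s → ∀ x y → E s x y ≡ I x y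
    E≡I {s} m h x y = bool-ext (λ e → let gxy , vx , _ = E-valid {s} m e in
      [ id , (λ o → ⊥-elim (s-O h x y o e)) ]′ (cl (trans (sym (V≡K m h x)) vx) gxy)) (s-I h x y)
    upper : cnt (Sat K I O) Us ≤ 1
    upper = cnt-≤1 (Sat K I O) Us-unique (λ {s} {t} ms mt hs ht → Us-ext ms mt
      (λ x → trans (V≡K ms (Sat-elim {s = s} hs) x) (sym (V≡K mt (Sat-elim {s = t} ht) x)))
      (λ x y → trans (E≡I ms (Sat-elim {s = s} hs) x y) (sym (E≡I mt (Sat-elim {s = t} ht) x y))))
    lower : 1 ≤ cnt (Sat K I O) Us
    lower = let s , m , eV , eE = Us-make K I (I-symm g) (valid g) in cnt-pos (Sat K I O) m (Sat-intro {s = s} (sat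
      (conn-intro s (trans (eV _) (proj₂ (some g))) (λ {a} {b} va vb → walk-map (λ {x} {y} e → trans (eE x y) e) (linked g (trans (sym (eV a)) va) (trans (sym (eV b)) vb))))
      (λ x k → trans (eV x) k) (λ a b i → trans (eE a b) i) (λ a b o e → apart g (trans (sym (eE a b)) e) o)))
  enum-count {K} {I} {O} g (node {a = p} {b = q} u x ku ux iux oux t₁ t₂) = trans (cnt-split (Sat K I O) (λ s → E s u x) Us)
    (cong₂ _+_
      (trans (cnt-cong-∈ (λ s → Sat K I O s ∧ E s u x) (Sat (K ⊕ x) (I +ᵉ (u , x)) O) Us
        (λ {s} m h → let r = Sat-elim {s = s} (∧-elimˡ {Sat K I O s} h) ; e = ∧-elimʳ {Sat K I O s} h in Sat-intro {s = s} (sat (s-conn r)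
          (⊕-⊑ {U = K} {W = V s} (s-K r) (proj₂ (proj₂ (E-valid {s} m e))))
          (λ a b i → [ s-I r a b , [ (λ { (refl , refl) → e }) , (λ { (refl , refl) → E-symm s _ _ e }) ]′ ]′ (+ᵉ-elim I {u} {x} i)) (s-O r)))
        (λ {s} m h → let r = Sat-elim {s = s} h in ∧-intro (Sat-intro {s = s} (sat (s-conn r) (λ y k → s-K r y (⊕-old K x y k)) (λ a b i → s-I r a b (+ᵉ-old I (u , x) {a} {b} i)) (s-O r)))
          (s-I r u x (+ᵉ-new I u x)))) (enum-count (good-in g ku ux oux) t₁))
      (trans (cnt-cong-∈ (λ s → Sat K I O s ∧ not (E s u x)) (Sat K I (O +ᵉ (u , x))) Us
        (λ {s} m h → let r = Sat-elim {s = s} (∧-elimˡ {Sat K I O s} h) ; e = not-elim (∧-elimʳ {Sat K I O s} h) in Sat-intro {s = s} (sat (s-conn r) (s-K r) (s-I r)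
          (λ a b o f → [ (λ q → s-O r a b q f) , [ (λ { (refl , refl) → true≢false f e }) , (λ { (refl , refl) → true≢false (E-symm s _ _ f) e }) ]′ ]′ (+ᵉ-elim O {u} {x} o))))
        (λ {s} m h → let r = Sat-elim {s = s} h in ∧-intro (Sat-intro {s = s} (sat (s-conn r) (s-K r) (s-I r) (λ a b o → s-O r a b (+ᵉ-old O (u , x) {a} {b} o))))
          (not-intro (≢true⇒false (s-O r u x (+ᵉ-new O u x)))))) (enum-count (good-out g iux) t₂)))

  -- Vertices are treated in turn; D holds those already excluded.
  touch : VSet n → Graph n → Graph n
  touch D O x y = O x y ∨ (D x ∨ D y)

  data Enum* (O : Graph n) : VSet n → ℕ → Set where
    done : ∀ {D} → (∀ x → D x ≡ true) → Enum* O D 0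
    next : ∀ {D a b} v → D v ≡ false → Enum ⟪ v ⟫ ∅ᵉ (touch D O) a → Enum* O (D ⊕ v) b → Enum* O D (a + b)

  Sat* : Graph n → VSet n → Sub n → Bool
  Sat* O D s = conn s ∧ (disjᵇ D (V s) ∧ excᵉ O s)

  private
    Sat*-intro : ∀ {O D s} → conn s ≡ true → Disjoint D (V s) → (∀ a b → O a b ≡ true → E s a b ≡ true → ⊥) → Sat* O D s ≡ true
    Sat*-intro {O} {D} {s} a b c = ∧-intro a (∧-intro (disjᵇ-intro b) (exc-intro O s c))

    Sat*-elim : ∀ {O D s} → Sat* O D s ≡ true → (conn s ≡ true) × Disjoint D (V s) × (∀ a b → O a b ≡ true → E s a b ≡ true → ⊥)
    Sat*-elim {O} {D} {s} h = let a , q = ∧-elim {conn s} h ; b , c = ∧-elim {disjᵇ D (V s)} q in a , disjᵇ-elim b , exc-elim O s c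

  enum*-count : ∀ {O D N} → Symm O → Enum* O D N → cnt (Sat* O D) Us ≡ N
  enum*-count {O} {D} so (done d) = cnt-none (Sat* O D) Us (λ {s} m h → let a , b , _ = Sat*-elim {s = s} h ; (x , vx) , _ = conn-elim s a in b x (d x) vx)
  enum*-count {O} {D} so (next v dv t₁ t₂) = trans (cnt-split (Sat* O D) (λ s → V s v) Us) (cong₂ _+_
    (trans (cnt-cong-∈ (λ s → Sat* O D s ∧ V s v) (Sat ⟪ v ⟫ ∅ᵉ (touch D O)) Us
      (λ {s} m h → let a , b , c = Sat*-elim {s = s} (∧-elimˡ {Sat* O D s} h) ; vv = ∧-elimʳ {Sat* O D s} h in Sat-intro {s = s} (sat a
        (λ y e → subst (λ z → V s z ≡ true) (sym (eqF⇒≡ e)) vv) (λ _ _ ())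
        (λ x y o e → let _ , vx , vy = E-valid {s} m e in [ (λ q → c x y q e) , (λ q → [ (λ r → b x r vx) , (λ r → b y r vy) ]′ (∨-elim {D x} q)) ]′ (∨-elim {O x y} o))))
      (λ {s} m h → let r = Sat-elim {s = s} h in ∧-intro (Sat*-intro {s = s} (s-conn r)
        -- A connected subgraph that contains `v`, which is not in `D`, and has no edge touching `D`
        -- cannot meet `D`.
        (λ x dx vx → true≢false dx (walk-inv (λ y → D y ≡ false) (λ {a} {b} e _ → ≢true⇒false (λ db → s-O r a b (∨-introʳ {O a b} (∨-introʳ {D a} db)) e))
          (proj₂ (conn-elim s (s-conn r)) (s-K r v (eqF-refl v)) vx) dv))
        (λ a b o → s-O r a b (∨-introˡ o))) (s-K r v (eqF-refl v)))) (enum-count good t₁))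
    (trans (cnt-cong-∈ (λ s → Sat* O D s ∧ not (V s v)) (Sat* O (D ⊕ v)) Us
      (λ {s} m h → let a , b , c = Sat*-elim {s = s} (∧-elimˡ {Sat* O D s} h) in Sat*-intro {s = s} a
        (λ x dx vx → [ (λ { refl → true≢false vx (not-elim (∧-elimʳ {Sat* O D s} h)) }) , (λ q → b x q vx) ]′ (⊕-elim D v dx)) c)
      (λ {s} m h → let a , b , c = Sat*-elim {s = s} h in ∧-intro (Sat*-intro {s = s} a (λ x dx → b x (⊕-old D v x dx)) c)
        (not-intro (≢true⇒false (b v (⊕-new D v)))))) (enum*-count so t₂)))
    where
    good : Good ⟪ v ⟫ ∅ᵉ (touch D O)
    good = record { some = v , eqF-refl v ; linked = λ a b → subst₂ (Walk ∅ᵉ) (sym (eqF⇒≡ a)) (sym (eqF⇒≡ b)) nil ; valid = λ () ; I-symm = λ _ _ ()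
      ; O-symm = λ x y h → [ (λ q → ∨-introˡ (so x y q)) , (λ q → ∨-introʳ {O y x} ([ ∨-introʳ {D y} , ∨-introˡ ]′ (∨-elim {D x} q))) ]′ (∨-elim {O x y} h) ; apart = λ () }

  -- Applied to a cycle edge at the vertex where the tail hangs. If the edge is present, so is that
  -- vertex, and the tail contributes a constant factor; if it is absent, an acyclic graph is left,
  -- which can be swept from one end.
  F-by-edge : ∀ {a b N₁ N₂} → G a b ≡ true → Enum (⟪ a ⟫ ⊕ b) (∅ᵉ +ᵉ (a , b)) ∅ᵉ N₁ → Enum* (∅ᵉ +ᵉ (a , b)) ∅ N₂ → F G ≡ N₁ + N₂
  F-by-edge {a} {b} ab t₁ t₂ = trans (sym (cnt-length conn Us)) (trans (cnt-split conn (λ s → E s a b) Us) (cong₂ _+_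
    (trans (cnt-cong-∈ (λ s → conn s ∧ E s a b) (Sat (⟪ a ⟫ ⊕ b) (∅ᵉ +ᵉ (a , b)) ∅ᵉ) Us
      (λ {s} m h → let c = ∧-elimˡ {conn s} h ; e = ∧-elimʳ {conn s} h ; _ , va , vb = E-valid {s} m e in Sat-intro {s = s} (sat c
        (⊕-⊑ {U = ⟪ a ⟫} {W = V s} (λ y q → subst (λ z → V s z ≡ true) (sym (eqF⇒≡ q)) va) vb)
        (λ x y i → [ (λ ()) , [ (λ { (refl , refl) → e }) , (λ { (refl , refl) → E-symm s _ _ e }) ]′ ]′ (+ᵉ-elim ∅ᵉ {a} {b} i)) (λ _ _ ())))
      (λ {s} m h → let r = Sat-elim {s = s} h in ∧-intro (s-conn r) (s-I r a b (+ᵉ-new ∅ᵉ a b))))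
      (enum-count (good-in {⟪ a ⟫} {∅ᵉ} {∅ᵉ} single (eqF-refl a) ab refl) t₁))
    (trans (cnt-cong-∈ (λ s → conn s ∧ not (E s a b)) (Sat* (∅ᵉ +ᵉ (a , b)) ∅) Us
      (λ {s} m h → Sat*-intro {s = s} (∧-elimˡ {conn s} h) (λ _ ()) (λ x y o e → [ (λ ()) , [ (λ { (refl , refl) → true≢false e (not-elim (∧-elimʳ {conn s} h)) })
        , (λ { (refl , refl) → true≢false (E-symm s _ _ e) (not-elim (∧-elimʳ {conn s} h)) }) ]′ ]′ (+ᵉ-elim ∅ᵉ {a} {b} o)))
      (λ {s} m h → let c , _ , d = Sat*-elim {s = s} h in ∧-intro c (not-intro (≢true⇒false (d a b (+ᵉ-new ∅ᵉ a b))))))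
      (enum*-count (+ᵉ-symm {∅ᵉ} {a , b} (λ _ _ ())) t₂))))
    where
    single : Good ⟪ a ⟫ ∅ᵉ ∅ᵉ
    single = record { some = a , eqF-refl a ; linked = λ p q → subst₂ (Walk ∅ᵉ) (sym (eqF⇒≡ p)) (sym (eqF⇒≡ q)) nil ; valid = λ () ; I-symm = λ _ _ () ; O-symm = λ _ _ () ; apart = λ () }

-- Counting in a cycle with a tail

tri-elim : {A B C R : Set} → Tri A B C → (A → R) → (B → R) → (C → R) → R
tri-elim (tri< a _ _) f g h = f a
tri-elim (tri≈ _ b _) f g h = g b
tri-elim (tri> _ _ c) f g h = h c

-- Covers both extremal graphs: the path `0, …, T` with the chord `{0, m - 1}`, where every vertex
-- after `T` is adjacent to `T` only. There is no such vertex for `L`, and there are two for `Q`.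
module Tailed {n : ℕ} (G : Graph n) (G-simple : IsSimple G) (m T : ℕ) (3≤m : 3 ≤ m) (m≤T : m ≤ suc T) (T<n : T < n)
  (consec : ∀ {u w : Fin n} → suc (toℕ u) ≡ toℕ w → toℕ w ≤ T → G u w ≡ true)
  (chord : ∀ {u w : Fin n} → toℕ u ≡ 0 → suc (toℕ w) ≡ m → G u w ≡ true)
  (edge-cases : ∀ {u w : Fin n} → G u w ≡ true → toℕ u < toℕ w →
    (suc (toℕ u) ≡ toℕ w) × (toℕ w ≤ T) ⊎ ((toℕ u ≡ 0) × (suc (toℕ w) ≡ m) ⊎ (toℕ u ≡ T) × (T < toℕ w))) where
  open Universe G G-simple
  open Exact G G-simple

  at : ∀ i → i ≤ T → Fin n
  at i l = fromℕ< (≤-trans (s≤s l) T<n)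

  toℕ-at : ∀ i l → toℕ (at i l) ≡ i
  toℕ-at i l = toℕ-fromℕ< (≤-trans (s≤s l) T<n)

  -- j is the right end of K, and only edges leading further right are undecided.
  record Front (K : VSet n) (I O : Graph n) (j : Fin n) : Set where
    field
      K-end : K j ≡ true
      K-max : ∀ {y} → K y ≡ true → toℕ y ≤ toℕ j
      I-in : ∀ {a b} → I a b ≡ true → K a ≡ true × K b ≡ true
      free : ∀ {a b} → toℕ j ≤ toℕ a → (toℕ b ≡ suc (toℕ a)) ⊎ ((toℕ a ≡ T) × (T < toℕ b)) → O a b ≡ false
      -- Either the chord is forbidden, or the front has already reached its right end, so that the
      -- chord does not lead ahead.
      chord-out : (∀ {a b} → toℕ a ≡ 0 → suc (toℕ b) ≡ m → (O a b ≡ true) × (O b a ≡ true)) ⊎ (m ≤ suc (toℕ j))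
      close : ∀ {u w} → K u ≡ true → G u w ≡ true → ((I u w ≡ true) ⊎ (O u w ≡ true)) ⊎ ((u ≡ j) × (toℕ j < toℕ w))
  open Front

  module Run {x : ℕ} (finish : ∀ {K I O j} → toℕ j ≡ T → Front K I O j → Enum K I O x) where

    -- At each of the `p` edges up to `T` one subgraph stops; the `x` ways of `finish` remain for
    -- those that reach `T`.
    run : ∀ p {K I O j} → toℕ j + p ≡ T → Front K I O j → Enum K I O (p + x)
    run zero {j = j} e f = finish (trans (sym (+-identityʳ (toℕ j))) e) f
    run (suc p) {K} {I} {O} {j} e f = cast (+-comm (p + x) 1)
        (node j j′ (K-end f) (consec (sym j′≡) j′≤T) (≢true⇒false (λ i → <⇒≱ (≤-reflexive (sym j′≡)) (K-max f (proj₂ (I-in f i)))))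
          (free f ≤-refl (inj₁ j′≡)) (run p (trans (cong (_+ p) j′≡) (trans (sym (+-suc (toℕ j) p)) e)) front′) (leaf closed))
      where
      j<T : toℕ j < T
      j<T = ≤-trans (≤-reflexive (+-comm 1 (toℕ j))) (≤-trans (+-monoʳ-≤ (toℕ j) (s≤s z≤n)) (≤-reflexive e))
      j′ : Fin n
      j′ = at (suc (toℕ j)) j<T
      j′≡ : toℕ j′ ≡ suc (toℕ j)
      j′≡ = toℕ-at (suc (toℕ j)) j<T
      j′≤T : toℕ j′ ≤ T
      j′≤T = ≤-trans (≤-reflexive j′≡) j<T
      right : ∀ {w} → G j w ≡ true → toℕ j < toℕ w → (w ≡ j′) ⊎ (O j w ≡ true)
      right {w} g l = [ (λ { (q , _) → inj₁ (toℕ-injective (trans (sym q) (sym j′≡))) })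
        , [ (λ { (q , r) → [ (λ c → inj₂ (proj₁ (c q r))) , (λ c → ⊥-elim (1+n≰n (≤-trans (≤-trans (s≤s (s≤s z≤n)) 3≤m) (≤-trans c (≤-reflexive (cong suc q)))))) ]′ (chord-out f) })
          , (λ { (q , _) → ⊥-elim (<-irrefl q j<T) }) ]′ ]′ (edge-cases g l)
      closed : ∀ {u w} → K u ≡ true → G u w ≡ true → (I u w ≡ true) ⊎ ((O +ᵉ (j , j′)) u w ≡ true)
      closed {u} {w} ku g = [ [ inj₁ , (λ o → inj₂ (+ᵉ-old O (j , j′) {u} {w} o)) ]′
        , (λ { (refl , l) → [ (λ { refl → inj₂ (+ᵉ-new O j j′) }) , (λ o → inj₂ (+ᵉ-old O (j , j′) {u} {w} o)) ]′ (right g l) }) ]′ (close f ku g)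
      front′ : Front (K ⊕ j′) (I +ᵉ (j , j′)) O j′
      front′ = record
        { K-end = ⊕-new K j′
        ; K-max = λ h → [ (λ { refl → ≤-refl }) , (λ q → ≤-trans (K-max f q) (≤-trans (n≤1+n _) (≤-reflexive (sym j′≡)))) ]′ (⊕-elim K j′ h)
        ; I-in = λ {a} {b} h → [ (λ q → let r , s = I-in f q in ⊕-old K j′ a r , ⊕-old K j′ b s)
            , [ (λ { (refl , refl) → ⊕-old K j′ j (K-end f) , ⊕-new K j′ }) , (λ { (refl , refl) → ⊕-new K j′ , ⊕-old K j′ j (K-end f) }) ]′ ]′ (+ᵉ-elim I {j} {j′} h)
        ; free = λ l → free f (≤-trans (≤-trans (n≤1+n _) (≤-reflexive (sym j′≡))) l)
        ; chord-out = [ inj₁ , (λ c → inj₂ (≤-trans c (s≤s (≤-trans (n≤1+n _) (≤-reflexive (sym j′≡)))))) ]′ (chord-out f)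
        ; close = λ {u} {w} h g → [ (λ { refl → atNew g }) , (λ ku → atOld ku g) ]′ (⊕-elim K j′ h) }
        where
        atNew : ∀ {w} → G j′ w ≡ true → (((I +ᵉ (j , j′)) j′ w ≡ true) ⊎ (O j′ w ≡ true)) ⊎ ((j′ ≡ j′) × (toℕ j′ < toℕ w))
        atNew {w} g = tri-elim (<-cmp (toℕ j′) (toℕ w))
          (λ l → inj₂ (refl , l))
          (λ q → ⊥-elim (G-irr g (toℕ-injective q)))
          (λ l → inj₁ ([ (λ { (q , _) → inj₁ (subst (λ z → (I +ᵉ (j , j′)) j′ z ≡ true) (toℕ-injective (suc-injective (sym (trans q j′≡)))) (+ᵉ-new′ I j j′)) })
            , [ (λ { (q , r) → [ (λ c → inj₂ (proj₂ (c q r))) , (λ c → ⊥-elim (1+n≰n (≤-trans (≤-reflexive (trans (cong suc (sym j′≡)) r)) c))) ]′ (chord-out f) })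
              , (λ { (q , _) → ⊥-elim (<⇒≱ l (≤-trans j′≤T (≤-reflexive (sym q)))) }) ]′ ]′ (edge-cases (G-sym _ _ g) l)))
        atOld : ∀ {u w} → K u ≡ true → G u w ≡ true → (((I +ᵉ (j , j′)) u w ≡ true) ⊎ (O u w ≡ true)) ⊎ ((u ≡ j′) × (toℕ j′ < toℕ w))
        atOld {u} {w} ku g = [ [ (λ i → inj₁ (inj₁ (+ᵉ-old I (j , j′) {u} {w} i))) , (λ o → inj₁ (inj₂ o)) ]′
          , (λ { (refl , l) → [ (λ { refl → inj₁ (inj₁ (+ᵉ-new I j j′)) }) , (λ o → inj₁ (inj₂ o)) ]′ (right g l) }) ]′ (close f ku g)

  m-1 : ℕ
  m-1 = m ∸ 1

  1+m-1 : suc m-1 ≡ m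
  1+m-1 = m+[n∸m]≡n (≤-trans (s≤s z≤n) 3≤m)

  m-1≤T : m-1 ≤ T
  m-1≤T = ≤-pred (≤-trans (≤-reflexive 1+m-1) m≤T)

  2≤m-1 : 2 ≤ m-1
  2≤m-1 = ≤-pred (≤-trans 3≤m (≤-reflexive (sym 1+m-1)))

  t o : Fin n
  t = at m-1 m-1≤T
  o = at 0 z≤n

  t≡ : toℕ t ≡ m-1
  t≡ = toℕ-at m-1 m-1≤T

  o≡ : toℕ o ≡ 0
  o≡ = toℕ-at 0 z≤n

  ot : G o t ≡ true
  ot = chord o≡ (trans (cong suc t≡) 1+m-1)

  -- K consists of an initial segment of the path ending in b and of the segment from l to t, joined by the chord;
  -- the edge following b is undecided only if `left`.
  record Arc (left : Set) (K : VSet n) (I O : Graph n) (b l : Fin n) : Set where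
    field
      b<l : toℕ b < toℕ l
      l≤t : toℕ l ≤ m-1
      K-b : K b ≡ true
      K-l : K l ≡ true
      K-t : K t ≡ true
      K-range : ∀ {y} → K y ≡ true → (toℕ y ≤ toℕ b) ⊎ ((toℕ l ≤ toℕ y) × (toℕ y ≤ m-1))
      I-in : ∀ {a c} → I a c ≡ true → K a ≡ true × K c ≡ true
      free-tail : ∀ {a c} → m-1 ≤ toℕ a → (toℕ c ≡ suc (toℕ a)) ⊎ ((toℕ a ≡ T) × (T < toℕ c)) → O a c ≡ false
      free-gap : ∀ {a c} → suc (toℕ a) ≡ toℕ c → toℕ b < toℕ a → toℕ c ≤ toℕ l → (O a c ≡ false) × (O c a ≡ false)
      -- `left` acts as a truth value: it is instantiated with `ℕ` for true and with `⊥` for false.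
      free-b : left → ∀ {c} → suc (toℕ b) ≡ toℕ c → O b c ≡ false
      I-b : left → suc (toℕ b) ≡ toℕ l → I b l ≡ false
      close : ∀ {u w} → K u ≡ true → G u w ≡ true →
        ((I u w ≡ true) ⊎ (O u w ≡ true)) ⊎ ((left × (u ≡ b) × (suc (toℕ b) ≡ toℕ w)) ⊎
          (((u ≡ l) × (suc (toℕ w) ≡ toℕ l)) ⊎ ((u ≡ t) × (m-1 < toℕ w))))

  TailFree : Graph n → Set
  TailFree O = ∀ {a c} → m-1 ≤ toℕ a → (toℕ c ≡ suc (toℕ a)) ⊎ ((toℕ a ≡ T) × (T < toℕ c)) → O a c ≡ false

  tailFree-+ᵉ : ∀ {O x y} → toℕ x ≤ m-1 → toℕ y ≤ m-1 → TailFree O → TailFree (O +ᵉ (x , y))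
  tailFree-+ᵉ {O} {x} {y} hx hy f {a} {c} q r = ≢true⇒false λ h → [ (λ s → true≢false s (f q r))
      , [ (λ { (refl , refl) → <⇒≱ beyond hy }) , (λ { (refl , refl) → <⇒≱ beyond hx }) ]′ ]′ (+ᵉ-elim O {x} {y} h)
    where
    beyond : m-1 < toℕ c
    beyond = [ (λ s → ≤-trans (s≤s q) (≤-reflexive (sym s))) , (λ { (_ , s) → ≤-trans (s≤s m-1≤T) s }) ]′ r

  in-+ᵉ : ∀ {K : VSet n} {I x y} → K x ≡ true → K y ≡ true → (∀ {a c} → I a c ≡ true → K a ≡ true × K c ≡ true) →
    ∀ {a c} → (I +ᵉ (x , y)) a c ≡ true → K a ≡ true × K c ≡ true
  in-+ᵉ {K} {I} {x} {y} kx ky f h = [ f , [ (λ { (refl , refl) → kx , ky }) , (λ { (refl , refl) → ky , kx }) ]′ ]′ (+ᵉ-elim I {x} {y} h)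

  in-⊕ : ∀ {K : VSet n} {I x y} → K x ≡ true → (∀ {a c} → I a c ≡ true → K a ≡ true × K c ≡ true) →
    ∀ {a c} → (I +ᵉ (x , y)) a c ≡ true → (K ⊕ y) a ≡ true × (K ⊕ y) c ≡ true
  in-⊕ {K} {I} {x} {y} kx f = in-+ᵉ {K ⊕ y} {I} (⊕-old K y x kx) (⊕-new K y) (λ {a} {c} h → let p , q = f h in ⊕-old K y a p , ⊕-old K y c q)

  arc-front : ∀ {left K I O b l} → Arc left K I O b l → ∀ {K′ I′ O′} → K ⊑ K′ → K′ ⊑ K →
    (∀ {a c} → I a c ≡ true → I′ a c ≡ true) → (∀ {a c} → O a c ≡ true → O′ a c ≡ true) →
    (∀ {a c} → I′ a c ≡ true → K a ≡ true × K c ≡ true) → TailFree O′ →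
    (left → ∀ {w} → suc (toℕ b) ≡ toℕ w → (I′ b w ≡ true) ⊎ (O′ b w ≡ true)) →
    (∀ {w} → suc (toℕ w) ≡ toℕ l → (I′ l w ≡ true) ⊎ (O′ l w ≡ true)) → Front K′ I′ O′ t
  arc-front {l = l} A {K′} {I′} {O′} KK′ K′K fI fO inI tf hb hl = record
    { K-end = KK′ t (Arc.K-t A)
    ; K-max = λ {y} k → ≤-trans ([ (λ q → ≤-trans q (≤-trans (<⇒≤ (Arc.b<l A)) (Arc.l≤t A))) , proj₂ ]′ (Arc.K-range A (K′K y k))) (≤-reflexive (sym t≡))
    ; I-in = λ {a} {c} h → let p , q = inI h in KK′ a p , KK′ c q
    ; free = λ q → tf (≤-trans (≤-reflexive (sym t≡)) q)
    ; chord-out = inj₂ (≤-reflexive (sym (trans (cong suc t≡) 1+m-1)))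
    ; close = λ {u} {w} ku g → [ [ (λ i → inj₁ (inj₁ (fI i))) , (λ q → inj₁ (inj₂ (fO q))) ]′
        , [ (λ { (lf , refl , q) → inj₁ (hb lf q) }) , [ (λ { (refl , q) → inj₁ (hl q) }) , (λ { (e , q) → inj₂ (e , ≤-trans (s≤s (≤-reflexive t≡)) q) }) ]′ ]′ ]′
        (Arc.close A (K′K u ku) g) }

  -- `τ` is the number of ways to continue from `t` along the tail. As the chord puts `t` into every
  -- subgraph considered, each way of deciding the cycle carries this same factor.
  module Cyclic {τ : ℕ} (tail : ∀ {K I O} → Front K I O t → Enum K I O τ) where

    -- The part before the gap is closed, and g vertices remain in the gap.
    stageB : ∀ g {K I O b l} → suc (toℕ b) + g ≡ toℕ l → (∀ {c} → suc (toℕ b) ≡ toℕ c → O c b ≡ true) →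
      Arc ⊥ K I O b l → Enum K I O (suc g * τ)
    stageB zero {K} {I} {O} {b} {l} e hb A = cast (sym (*-identityˡ τ)) (tail (arc-front A (λ _ q → q) (λ _ q → q) id id (Arc.I-in A) (Arc.free-tail A) (λ ())
      (λ {w} q → inj₂ (subst (λ z → O l z ≡ true) (toℕ-injective (suc-injective (trans (trans (sym (+-identityʳ _)) e) (sym q)))) (hb (trans (sym (+-identityʳ _)) e))))))
    stageB (suc g) {K} {I} {O} {b} {l} e hb A = cast (+-comm (suc g * τ) τ)
        (node l l′ (Arc.K-l A) (G-sym _ _ (consec sl′ l≤T)) (≢true⇒false (λ i → notK (proj₂ (Arc.I-in A i)))) (proj₂ (Arc.free-gap A sl′ b<l′ ≤-refl))
          (stageB g e′ hb A′)
          (tail (arc-front A {O′ = O +ᵉ (l , l′)} (λ _ q → q) (λ _ q → q) id (λ {a} {c} → +ᵉ-old O (l , l′) {a} {c}) (Arc.I-in A)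
            (tailFree-+ᵉ {O} (Arc.l≤t A) (<⇒≤ l′<m-1) (Arc.free-tail A)) (λ ())
            (λ {w} q → inj₂ (subst (λ z → (O +ᵉ (l , l′)) l z ≡ true) (toℕ-injective (suc-injective (trans sl′ (sym q)))) (+ᵉ-new O l l′))))))
      where
      l>0 : 1 ≤ toℕ l
      l>0 = ≤-trans (s≤s z≤n) (≤-reflexive e)
      pl≤T : toℕ l ∸ 1 ≤ T
      pl≤T = ≤-trans (m∸n≤m (toℕ l) 1) (≤-trans (Arc.l≤t A) m-1≤T)
      l′ : Fin n
      l′ = at (toℕ l ∸ 1) pl≤T
      sl′ : suc (toℕ l′) ≡ toℕ l
      sl′ = trans (cong suc (toℕ-at (toℕ l ∸ 1) pl≤T)) (m+[n∸m]≡n l>0)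
      l≤T : toℕ l ≤ T
      l≤T = ≤-trans (Arc.l≤t A) m-1≤T
      e′ : suc (toℕ b) + g ≡ toℕ l′
      e′ = suc-injective (trans (sym (+-suc (suc (toℕ b)) g)) (trans e (sym sl′)))
      b<l′ : toℕ b < toℕ l′
      b<l′ = ≤-trans (m≤m+n (suc (toℕ b)) g) (≤-reflexive e′)
      l′<l : toℕ l′ < toℕ l
      l′<l = ≤-reflexive sl′
      l′<m-1 : toℕ l′ < m-1
      l′<m-1 = ≤-trans l′<l (Arc.l≤t A)
      notK : K l′ ≡ true → ⊥
      notK k = [ (λ q → <⇒≱ b<l′ q) , (λ { (q , _) → <⇒≱ l′<l q }) ]′ (Arc.K-range A k)
      ArcClose : Fin n → Fin n → Set
      ArcClose u w = (((I +ᵉ (l , l′)) u w ≡ true) ⊎ (O u w ≡ true)) ⊎ ((⊥ × (u ≡ b) × (suc (toℕ b) ≡ toℕ w)) ⊎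
          (((u ≡ l′) × (suc (toℕ w) ≡ toℕ l′)) ⊎ ((u ≡ t) × (m-1 < toℕ w))))
      atNew : ∀ {w} → G l′ w ≡ true → ArcClose l′ w
      atNew {w} g = tri-elim (<-cmp (toℕ l′) (toℕ w))
        (λ q → [ (λ { (r , _) → inj₁ (inj₁ (subst (λ z → (I +ᵉ (l , l′)) l′ z ≡ true) (toℕ-injective (trans (sym sl′) r)) (+ᵉ-new′ I l l′))) })
            , [ (λ { (r , _) → ⊥-elim (<⇒≱ b<l′ (≤-trans (≤-reflexive r) z≤n)) }) , (λ { (r , _) → ⊥-elim (<⇒≱ l′<m-1 (≤-trans m-1≤T (≤-reflexive (sym r)))) }) ]′ ]′ (edge-cases g q))
        (λ q → ⊥-elim (G-irr g (toℕ-injective q)))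
        (λ q → [ (λ { (r , _) → inj₂ (inj₂ (inj₁ (refl , r))) })
            , [ (λ { (_ , r) → ⊥-elim (<-irrefl (suc-injective (trans r (sym 1+m-1))) l′<m-1) }) , (λ { (_ , r) → ⊥-elim (<⇒≱ r (≤-trans (<⇒≤ l′<l) l≤T)) }) ]′ ]′ (edge-cases (G-sym _ _ g) q))
      atOld : ∀ {u w} → K u ≡ true → G u w ≡ true → ArcClose u w
      atOld {u} {w} ku g = [ [ (λ i → inj₁ (inj₁ (+ᵉ-old I (l , l′) {u} {w} i))) , (λ q → inj₁ (inj₂ q)) ]′
        , [ (λ ()) , [ (λ { (refl , q) → inj₁ (inj₁ (subst (λ z → (I +ᵉ (l , l′)) l z ≡ true) (toℕ-injective (suc-injective (trans sl′ (sym q)))) (+ᵉ-new I l l′))) }) , (λ q → inj₂ (inj₂ (inj₂ q))) ]′ ]′ ]′ (Arc.close A ku g)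
      A′ : Arc ⊥ (K ⊕ l′) (I +ᵉ (l , l′)) O b l′
      A′ = record
        { b<l = b<l′ ; l≤t = <⇒≤ l′<m-1 ; K-b = ⊕-old K l′ b (Arc.K-b A) ; K-l = ⊕-new K l′ ; K-t = ⊕-old K l′ t (Arc.K-t A)
        ; K-range = λ {y} h → [ (λ { refl → inj₂ (≤-refl , <⇒≤ l′<m-1) }) , (λ q → [ inj₁ , (λ { (r , s) → inj₂ (≤-trans (<⇒≤ l′<l) r , s) }) ]′ (Arc.K-range A q)) ]′ (⊕-elim K l′ h)
        ; I-in = in-⊕ {K} {I} (Arc.K-l A) (Arc.I-in A)
        ; free-tail = Arc.free-tail A
        ; free-gap = λ q r s → Arc.free-gap A q r (≤-trans s (<⇒≤ l′<l))
        ; free-b = λ () ; I-b = λ ()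
        ; close = λ {u} {w} h g → [ (λ { refl → atNew g }) , (λ k → atOld k g) ]′ (⊕-elim K l′ h) }

    -- g vertices remain between b and t.
    stageA : ∀ g {K I O b} → suc (toℕ b) + g ≡ m-1 → Arc ℕ K I O b t → Enum K I O ((2 + tri′ g) * τ)
    stageA zero {K} {I} {O} {b} e A = cast (cong (τ +_) (sym (+-identityʳ τ)))
        (node b t (Arc.K-b A) (consec sb (≤-trans (≤-reflexive t≡) m-1≤T)) (Arc.I-b A 0 sb) (Arc.free-b A 0 sb)
          (tail (arc-front A {I′ = I +ᵉ (b , t)} (⊕-old K t) (⊕-⊑ {U = K} {W = K} (λ _ q → q) (Arc.K-t A)) (λ {a} {c} → +ᵉ-old I (b , t) {a} {c}) id
            (in-+ᵉ {K} {I} (Arc.K-b A) (Arc.K-t A) (Arc.I-in A)) (Arc.free-tail A)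
            (λ _ {w} q → inj₁ (subst (λ z → (I +ᵉ (b , t)) b z ≡ true) (toℕ-injective (trans (sym sb) q)) (+ᵉ-new I b t)))
            (λ {w} q → inj₁ (subst (λ z → (I +ᵉ (b , t)) t z ≡ true) (toℕ-injective (suc-injective (trans sb (sym q)))) (+ᵉ-new′ I b t)))))
          (tail (arc-front A {O′ = O +ᵉ (b , t)} (λ _ q → q) (λ _ q → q) id (λ {a} {c} → +ᵉ-old O (b , t) {a} {c}) (Arc.I-in A)
            (tailFree-+ᵉ {O} (≤-trans (<⇒≤ (Arc.b<l A)) (≤-reflexive t≡)) (≤-reflexive t≡) (Arc.free-tail A))
            (λ _ {w} q → inj₂ (subst (λ z → (O +ᵉ (b , t)) b z ≡ true) (toℕ-injective (trans (sym sb) q)) (+ᵉ-new O b t)))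
            (λ {w} q → inj₂ (subst (λ z → (O +ᵉ (b , t)) t z ≡ true) (toℕ-injective (suc-injective (trans sb (sym q)))) (+ᵉ-new′ O b t))))))
      where
      sb : suc (toℕ b) ≡ toℕ t
      sb = trans (trans (sym (+-identityʳ _)) e) (sym t≡)
    -- Taking the edge from `b` to `b′` leaves `g` vertices in the gap. Refusing it closes the left
    -- side, and the `suc g` vertices of the gap can then be entered only from the right, in `2 + g`
    -- ways.
    stageA (suc g) {K} {I} {O} {b} e A = cast (lem τ (tri′ g) g)
        (node b b′ (Arc.K-b A) (consec (sym b′≡) (<⇒≤ b′<T)) (≢true⇒false (λ i → notK (proj₂ (Arc.I-in A i)))) (Arc.free-b A 0 (sym b′≡))
          (stageA g (trans (cong (λ z → suc z + g) b′≡) (trans (sym (+-suc (suc (toℕ b)) g)) e)) A′)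
          (stageB (suc g) (trans e (sym t≡)) (λ {c} q → subst (λ z → (O +ᵉ (b , b′)) z b ≡ true) (toℕ-injective (trans b′≡ q)) (+ᵉ-new′ O b b′)) A″))
      where
      lem : ∀ τ x g → (2 + x) * τ + suc (suc g) * τ ≡ (2 + (x + (2 + g))) * τ
      lem = solve-∀
      sb<m-1 : suc (toℕ b) < m-1
      sb<m-1 = ≤-trans (≤-reflexive (+-comm 1 (suc (toℕ b)))) (≤-trans (+-monoʳ-≤ (suc (toℕ b)) (s≤s z≤n)) (≤-reflexive e))
      b′ : Fin n
      b′ = at (suc (toℕ b)) (≤-trans (<⇒≤ sb<m-1) m-1≤T)
      b′≡ : toℕ b′ ≡ suc (toℕ b)
      b′≡ = toℕ-at (suc (toℕ b)) (≤-trans (<⇒≤ sb<m-1) m-1≤T)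
      b′<m-1 : toℕ b′ < m-1
      b′<m-1 = ≤-trans (s≤s (≤-reflexive b′≡)) sb<m-1
      b′<T : toℕ b′ < T
      b′<T = ≤-trans b′<m-1 m-1≤T
      b<b′ : toℕ b < toℕ b′
      b<b′ = ≤-reflexive (sym b′≡)
      b′<t : toℕ b′ < toℕ t
      b′<t = ≤-trans b′<m-1 (≤-reflexive (sym t≡))
      notK : K b′ ≡ true → ⊥
      notK k = [ (λ q → <⇒≱ b<b′ q) , (λ { (q , _) → <⇒≱ b′<t q }) ]′ (Arc.K-range A k)
      ArcClose : Fin n → Fin n → Set
      ArcClose u w = (((I +ᵉ (b , b′)) u w ≡ true) ⊎ (O u w ≡ true)) ⊎ ((ℕ × (u ≡ b′) × (suc (toℕ b′) ≡ toℕ w)) ⊎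
          (((u ≡ t) × (suc (toℕ w) ≡ toℕ t)) ⊎ ((u ≡ t) × (m-1 < toℕ w))))
      atNew : ∀ {w} → G b′ w ≡ true → ArcClose b′ w
      atNew {w} g = tri-elim (<-cmp (toℕ b′) (toℕ w))
        (λ q → [ (λ { (r , _) → inj₂ (inj₁ (0 , refl , r)) })
            , [ (λ { (r , _) → ⊥-elim (<⇒≱ b<b′ (≤-trans (≤-reflexive r) z≤n)) }) , (λ { (r , _) → ⊥-elim (<-irrefl r b′<T) }) ]′ ]′ (edge-cases g q))
        (λ q → ⊥-elim (G-irr g (toℕ-injective q)))
        (λ q → [ (λ { (r , _) → inj₁ (inj₁ (subst (λ z → (I +ᵉ (b , b′)) b′ z ≡ true) (toℕ-injective (suc-injective (trans (sym b′≡) (sym r)))) (+ᵉ-new′ I b b′))) })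
            , [ (λ { (_ , r) → ⊥-elim (<-irrefl (suc-injective (trans r (sym 1+m-1))) b′<m-1) }) , (λ { (_ , r) → ⊥-elim (<⇒≱ r (<⇒≤ b′<T)) }) ]′ ]′ (edge-cases (G-sym _ _ g) q))
      atOld : ∀ {u w} → K u ≡ true → G u w ≡ true → ArcClose u w
      atOld {u} {w} ku g = [ [ (λ i → inj₁ (inj₁ (+ᵉ-old I (b , b′) {u} {w} i))) , (λ q → inj₁ (inj₂ q)) ]′
        , [ (λ { (_ , refl , q) → inj₁ (inj₁ (subst (λ z → (I +ᵉ (b , b′)) b z ≡ true) (toℕ-injective (trans b′≡ q)) (+ᵉ-new I b b′))) })
          , (λ q → inj₂ (inj₂ q)) ]′ ]′ (Arc.close A ku g)
      A′ : Arc ℕ (K ⊕ b′) (I +ᵉ (b , b′)) O b′ t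
      A′ = record
        { b<l = b′<t ; l≤t = ≤-reflexive t≡ ; K-b = ⊕-new K b′ ; K-l = ⊕-old K b′ t (Arc.K-t A) ; K-t = ⊕-old K b′ t (Arc.K-t A)
        ; K-range = λ {y} h → [ (λ { refl → inj₁ ≤-refl }) , (λ q → [ (λ r → inj₁ (≤-trans r (<⇒≤ b<b′))) , inj₂ ]′ (Arc.K-range A q)) ]′ (⊕-elim K b′ h)
        ; I-in = in-⊕ {K} {I} (Arc.K-b A) (Arc.I-in A)
        ; free-tail = Arc.free-tail A
        ; free-gap = λ q r s → Arc.free-gap A q (<-trans b<b′ r) s
        ; free-b = λ _ {c} q → proj₁ (Arc.free-gap A q b<b′ (≤-trans (≤-reflexive (sym q)) b′<t))
        ; I-b = λ _ q → ≢true⇒false λ h → [ (λ i → notK (proj₁ (Arc.I-in A i))) , [ (λ { (r , _) → <-irrefl (cong toℕ (sym r)) b<b′ }) , (λ { (_ , r) → <-irrefl (cong toℕ (sym r)) (<-trans b<b′ b′<t) }) ]′ ]′ (+ᵉ-elim I {b} {b′} h)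
        ; close = λ {u} {w} h g → [ (λ { refl → atNew g }) , (λ k → atOld k g) ]′ (⊕-elim K b′ h) }
      A″ : Arc ⊥ K I (O +ᵉ (b , b′)) b t
      A″ = record
        { b<l = Arc.b<l A ; l≤t = Arc.l≤t A ; K-b = Arc.K-b A ; K-l = Arc.K-l A ; K-t = Arc.K-t A ; K-range = Arc.K-range A ; I-in = Arc.I-in A
        ; free-tail = tailFree-+ᵉ {O} (<⇒≤ (<-trans b<b′ b′<m-1)) (<⇒≤ b′<m-1) (Arc.free-tail A)
        ; free-gap = λ {a} {c} q r s → let f = Arc.free-gap A q r s in
            (≢true⇒false λ h → [ (λ p → true≢false p (proj₁ f)) , [ (λ { (p , _) → <-irrefl (cong toℕ (sym p)) r }) , (λ { (_ , p) → <-irrefl (cong toℕ (sym p)) (<-trans r (≤-reflexive q)) }) ]′ ]′ (+ᵉ-elim O {b} {b′} h)) ,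
            (≢true⇒false λ h → [ (λ p → true≢false p (proj₂ f)) , [ (λ { (p , _) → <-irrefl (cong toℕ (sym p)) (<-trans r (≤-reflexive q)) }) , (λ { (_ , p) → <-irrefl (cong toℕ (sym p)) r }) ]′ ]′ (+ᵉ-elim O {b} {b′} h))
        ; free-b = λ () ; I-b = λ ()
        ; close = λ {u} {w} ku g → [ [ (λ i → inj₁ (inj₁ i)) , (λ q → inj₁ (inj₂ (+ᵉ-old O (b , b′) {u} {w} q))) ]′
            , [ (λ { (_ , refl , q) → inj₁ (inj₂ (subst (λ z → (O +ᵉ (b , b′)) b z ≡ true) (toℕ-injective (trans b′≡ q)) (+ᵉ-new O b b′))) }) , (λ q → inj₂ (inj₂ q)) ]′ ]′ (Arc.close A ku g) }

    -- The factor `2 + tri′ (m ∸ 2)` equals `1 + m * (m - 1) / 2`: the connected subgraphs of a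
    -- cycle that contain a given edge are the cycle itself and the paths through that edge.
    with-chord : Enum (⟪ o ⟫ ⊕ t) (∅ᵉ +ᵉ (o , t)) ∅ᵉ ((2 + tri′ (m ∸ 2)) * τ)
    with-chord = stageA (m ∸ 2) (trans (cong (λ z → suc z + (m ∸ 2)) o≡) (pred-∸ 3≤m)) (record
      { b<l = o<t ; l≤t = ≤-reflexive t≡ ; K-b = ⊕-old ⟪ o ⟫ t o (eqF-refl o) ; K-l = ⊕-new ⟪ o ⟫ t ; K-t = ⊕-new ⟪ o ⟫ t
      ; K-range = λ {y} h → [ (λ { refl → inj₂ (≤-refl , ≤-reflexive t≡) }) , (λ q → inj₁ (≤-reflexive (cong toℕ (eqF⇒≡ q)))) ]′ (⊕-elim ⟪ o ⟫ t h)
      ; I-in = in-⊕ {⟪ o ⟫} {∅ᵉ} (eqF-refl o) (λ ())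
      ; free-tail = λ _ _ → refl ; free-gap = λ _ _ _ → refl , refl ; free-b = λ _ _ → refl
      ; I-b = λ _ q → ⊥-elim (<-irrefl (trans (trans (cong suc (sym o≡)) q) t≡) 2≤m-1)
      ; close = λ {u} {w} h g → [ (λ { refl → atT g }) , (λ q → atO (eqF⇒≡ q) g) ]′ (⊕-elim ⟪ o ⟫ t h) })
      where
      I₀ : Graph n
      I₀ = ∅ᵉ +ᵉ (o , t)
      ArcClose : Fin n → Fin n → Set
      ArcClose u w = ((I₀ u w ≡ true) ⊎ (false ≡ true)) ⊎ ((ℕ × (u ≡ o) × (suc (toℕ o) ≡ toℕ w)) ⊎
          (((u ≡ t) × (suc (toℕ w) ≡ toℕ t)) ⊎ ((u ≡ t) × (m-1 < toℕ w))))
      0<m-1 : 0 < m-1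
      0<m-1 = ≤-trans (s≤s z≤n) 2≤m-1
      o<t : toℕ o < toℕ t
      o<t = ≤-trans (s≤s (≤-reflexive o≡)) (≤-trans 0<m-1 (≤-reflexive (sym t≡)))
      atO : ∀ {u w} → u ≡ o → G u w ≡ true → ArcClose u w
      atO {w = w} refl g = tri-elim (<-cmp (toℕ o) (toℕ w))
        (λ q → [ (λ { (r , _) → inj₂ (inj₁ (0 , refl , r)) })
            , [ (λ { (_ , r) → inj₁ (inj₁ (subst (λ z → I₀ o z ≡ true) (toℕ-injective (trans t≡ (suc-injective (trans 1+m-1 (sym r))))) (+ᵉ-new ∅ᵉ o t))) })
              , (λ { (r , _) → ⊥-elim (<⇒≱ 0<m-1 (≤-trans m-1≤T (≤-reflexive (trans (sym r) o≡)))) }) ]′ ]′ (edge-cases g q))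
        (λ q → ⊥-elim (G-irr g (toℕ-injective q)))
        (λ q → ⊥-elim (<⇒≱ q (≤-trans (≤-reflexive o≡) z≤n)))
      atT : ∀ {w} → G t w ≡ true → ArcClose t w
      atT {w} g = tri-elim (<-cmp (toℕ t) (toℕ w))
        (λ q → inj₂ (inj₂ (inj₂ (refl , ≤-trans (s≤s (≤-reflexive (sym t≡))) q))))
        (λ q → ⊥-elim (G-irr g (toℕ-injective q)))
        (λ q → [ (λ { (r , _) → inj₂ (inj₂ (inj₁ (refl , r))) })
            , [ (λ { (r , _) → inj₁ (inj₁ (subst (λ z → I₀ t z ≡ true) (toℕ-injective (trans o≡ (sym r))) (+ᵉ-new′ ∅ᵉ o t))) })
              , (λ { (r , _) → ⊥-elim (<⇒≱ q (≤-trans (≤-trans (≤-reflexive t≡) m-1≤T) (≤-reflexive (sym r)))) }) ]′ ]′ (edge-cases (G-sym _ _ g) q))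

  -- Subgraphs avoiding the chord, sorted by their least vertex.
  pathSum : ℕ → ℕ → ℕ → ℕ
  pathSum x r zero = r
  pathSum x r (suc p) = (p + x) + pathSum x r p

  module Chordless {x r : ℕ} (finish : ∀ {K I O j} → toℕ j ≡ T → Front K I O j → Enum K I O x)
    (rest : ∀ {D} → (∀ {y} → toℕ y ≤ T → D y ≡ true) → (∀ {y} → D y ≡ true → toℕ y ≤ T) → Enum* (∅ᵉ +ᵉ (o , t)) D r) where

    private
      O₁ : Graph n
      O₁ = ∅ᵉ +ᵉ (o , t)

    without-chord : ∀ p i {D} → i + p ≡ suc T → (∀ {y} → toℕ y < i → D y ≡ true) → (∀ {y} → D y ≡ true → toℕ y < i) →
      Enum* O₁ D (pathSum x r p)
    without-chord zero i {D} e lo hi = rest (λ {y} l → lo (≤-trans (s≤s l) (≤-reflexive (trans (sym e) (+-identityʳ i)))))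
      (λ {y} d → ≤-pred (≤-trans (hi d) (≤-reflexive (trans (sym (+-identityʳ i)) e))))
    without-chord (suc p) i {D} e lo hi = next v (≢true⇒false (λ d → <-irrefl v≡ (hi d)))
        (Run.run finish p (trans (cong (_+ p) v≡) (suc-injective (trans (sym (+-suc i p)) e))) front)
        (without-chord p (suc i) (trans (sym (+-suc i p)) e)
          (λ {y} l → [ (λ q → ⊕-old D v y (lo q)) , (λ q → subst (λ z → (D ⊕ v) z ≡ true) (toℕ-injective (trans v≡ (sym q))) (⊕-new D v)) ]′ (m≤n⇒m<n∨m≡n (≤-pred l)))
          (λ {y} h → [ (λ { refl → ≤-reflexive (cong suc v≡) }) , (λ d → m≤n⇒m≤1+n (hi d)) ]′ (⊕-elim D v h)))
      where
      i≤T : i ≤ T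
      i≤T = ≤-pred (≤-trans (≤-reflexive (+-comm 1 i)) (≤-trans (+-monoʳ-≤ i (s≤s z≤n)) (≤-reflexive e)))
      v : Fin n
      v = at i i≤T
      v≡ : toℕ v ≡ i
      v≡ = toℕ-at i i≤T
      0<m-1 : 0 < m-1
      0<m-1 = ≤-trans (s≤s z≤n) 2≤m-1
      no-O₁ : ∀ {a c} → (toℕ c ≡ suc (toℕ a)) ⊎ ((toℕ a ≡ T) × (T < toℕ c)) → O₁ a c ≡ true → ⊥
      no-O₁ q h = [ (λ ()) , [ (λ { (refl , refl) → [ (λ r → <-irrefl (trans (trans (cong suc (sym o≡)) (sym r)) t≡) 2≤m-1) , (λ { (r , _) → <⇒≱ 0<m-1 (≤-trans m-1≤T (≤-reflexive (trans (sym r) o≡))) }) ]′ q })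
        , (λ { (refl , refl) → [ (λ r → case trans (sym o≡) r of λ ()) , (λ { (_ , r) → <⇒≱ r (≤-trans (≤-reflexive o≡) z≤n) }) ]′ q }) ]′ ]′ (+ᵉ-elim ∅ᵉ {o} {t} h)
      front : Front ⟪ v ⟫ ∅ᵉ (touch D O₁) v
      front = record
        { K-end = eqF-refl v
        ; K-max = λ q → ≤-reflexive (cong toℕ (eqF⇒≡ q))
        ; I-in = λ ()
        ; free = λ {a} {c} l q → ≢true⇒false λ h → [ no-O₁ q , (λ d → [ (λ da → <⇒≱ (hi da) (≤-trans (≤-reflexive (sym v≡)) l))
            , (λ dc → <⇒≱ (hi dc) (≤-trans (≤-trans (≤-reflexive (sym v≡)) l) ([ (λ r → ≤-trans (n≤1+n _) (≤-reflexive (sym r))) , (λ { (r , s) → ≤-trans (≤-reflexive r) (<⇒≤ s) }) ]′ q))) ]′ (∨-elim {D a} d)) ]′ (∨-elim {O₁ a c} h)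
        ; chord-out = inj₁ (λ {a} {c} p q → both p q)
        ; close = λ {u} {w} h g → atV (eqF⇒≡ h) g }
        where
        both : ∀ {a c} → toℕ a ≡ 0 → suc (toℕ c) ≡ m → (touch D O₁ a c ≡ true) × (touch D O₁ c a ≡ true)
        both {a} {c} p q = subst₂ (λ a c → (touch D O₁ a c ≡ true) × (touch D O₁ c a ≡ true)) (toℕ-injective (trans o≡ (sym p)))
          (toℕ-injective (trans t≡ (suc-injective (trans 1+m-1 (sym q))))) (∨-introˡ (+ᵉ-new ∅ᵉ o t) , ∨-introˡ (+ᵉ-new′ ∅ᵉ o t))
        atV : ∀ {u w} → u ≡ v → G u w ≡ true → ((false ≡ true) ⊎ (touch D O₁ u w ≡ true)) ⊎ ((u ≡ v) × (toℕ v < toℕ w))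
        atV {w = w} refl g = tri-elim (<-cmp (toℕ v) (toℕ w))
          (λ l → inj₂ (refl , l))
          (λ q → ⊥-elim (G-irr g (toℕ-injective q)))
          (λ l → inj₁ (inj₂ (∨-introʳ {O₁ v w} (∨-introʳ {D v} (lo (≤-trans l (≤-reflexive v≡)))))))

    -- In the first summand, `T ∸ m-1` counts the places before `T` at which a subgraph containing
    -- the chord may stop on the tail. The second summand sorts the subgraphs without the chord by
    -- their least vertex.
    F-value : F G ≡ (2 + tri′ (m ∸ 2)) * (T ∸ m-1 + x) + pathSum x r (suc T)
    F-value = F-by-edge ot (Cyclic.with-chord (Run.run finish (T ∸ m-1) (trans (cong (_+ (T ∸ m-1)) t≡) (m+[n∸m]≡n m-1≤T))))
      (without-chord (suc T) 0 refl (λ ()) (λ ()))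

-- The two extremal graphs

patGraph-elim : (pat : ℕ → ℕ → Bool) {i j : Fin n} → patGraph pat i j ≡ true →
  ((toℕ i < toℕ j) × (pat (toℕ i) (toℕ j) ≡ true)) ⊎ ((toℕ j < toℕ i) × (pat (toℕ j) (toℕ i) ≡ true))
patGraph-elim pat {i} {j} h with ∨-elim {(toℕ i <ᵇ toℕ j) ∧ pat (toℕ i) (toℕ j)} h
... | inj₁ q = let a , b = ∧-elim {toℕ i <ᵇ toℕ j} q in inj₁ (<ᵇ⇒< (toℕ i) (toℕ j) (≡⇒T a) , b)
... | inj₂ q = let a , b = ∧-elim {toℕ j <ᵇ toℕ i} q in inj₂ (<ᵇ⇒< (toℕ j) (toℕ i) (≡⇒T a) , b)

patGraph-up : (pat : ℕ → ℕ → Bool) {i j : Fin n} → toℕ i < toℕ j → pat (toℕ i) (toℕ j) ≡ true → patGraph pat i j ≡ true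
patGraph-up pat l h = trans (patGraph-< pat l) h

patGraph-cases : (pat : ℕ → ℕ → Bool) {i j : Fin n} → patGraph pat i j ≡ true → toℕ i < toℕ j → pat (toℕ i) (toℕ j) ≡ true
patGraph-cases pat h l = trans (sym (patGraph-< pat l)) h

-- The cycle has `2 + j` vertices. The tail factor is `k + 1`, and without the chord there remain
-- the `tri (2 + j + k)` subpaths of a path.
path-total : ∀ j k → (2 + tri′ j) * (k + 1) + tri (2 + j + k) ≡ Φ (2 + j) k
path-total j k = trans (cong₂ (λ a b → (2 + a) * (k + 1) + b) (trans (tri′≡tri j) (cong (_+ j) (tri≡ch2 j)))
    (trans (tri-+ (2 + j) k) (cong (λ z → z + suc j + suc (suc j) + tri k + (2 + j) * k) (tri≡ch2 j))))
  (trans (lemma₁ j k (ch2 j) (tri k)) (sym (cong₂ (λ a b → a + 1 + tri k + (b + 1) * k)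
    (trans (lemma₂ j) (cong (λ z → z + 4 * j + 4) (sq≡ch2 j))) (cong (λ z → z + suc j + suc (suc j)) (tri≡ch2 j)))))
  where
  lemma₁ : ∀ j k x K → (2 + (x + j + j)) * (k + 1) + (x + j + suc j + suc (suc j) + K + (2 + j) * k)
    ≡ (2 * x + j + 4 * j + 4) + 1 + K + (x + j + suc j + suc (suc j) + 1) * k
  lemma₁ = solve-∀
  lemma₂ : ∀ j → (2 + j) * (2 + j) ≡ j * j + 4 * j + 4
  lemma₂ = solve-∀

-- In the tail factor, `1 + j` counts the stops before the star centre and 4 the choices of leaves
-- at it. The last bracket sums the subgraphs without the chord over their least vertex, the single
-- leaves included.
fork-total : ∀ j → (2 + tri′ j) * (1 + j + 4) + (2 + 4 * (3 + (j + j)) + ch2 (3 + (j + j))) ≡ Φ (3 + j) (2 + j)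
fork-total j = trans (cong₂ (λ a b → (2 + a) * (1 + j + 4) + (2 + 4 * (3 + (j + j)) + b)) (trans (tri′≡tri j) (cong (_+ j) (tri≡ch2 j)))
    (trans (ch2-+ 3 (j + j)) (cong (λ z → 3 + z + 3 * (j + j)) (trans (ch2-+ j j) (cong (ch2 j + ch2 j +_) (sq≡ch2 j))))))
  (trans (lemma₁ j (ch2 j)) (sym (trans (cong (λ z → (3 + j) * (3 + j) + 1 + (z + suc j + suc (suc j)) + (z + suc j + suc (suc j) + suc (suc (suc j)) + 1) * (2 + j)) (tri≡ch2 j))
    (trans (lemma₂ j (ch2 j)) (cong (λ z → 3 * z + (2 * (j * j) + 24 * j + 27 + 3 * ch2 j + ch2 j * j)) (sq≡ch2 j))))))
  where
  lemma₁ : ∀ j x → (2 + (x + j + j)) * (1 + j + 4) + (2 + 4 * (3 + (j + j)) + (3 + (x + x + (2 * x + j)) + 3 * (j + j)))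
    ≡ 3 * (2 * x + j) + (2 * (j * j) + 24 * j + 27 + 3 * x + x * j)
  lemma₁ = solve-∀
  lemma₂ : ∀ j x → (3 + j) * (3 + j) + 1 + (x + j + suc j + suc (suc j)) + (x + j + suc j + suc (suc j) + suc (suc (suc j)) + 1) * (2 + j)
    ≡ 3 * (j * j) + (2 * (j * j) + 24 * j + 27 + 3 * x + x * j)
  lemma₂ = solve-∀

pathL-chord : ∀ {m i j} → patL m i j ≡ true → (suc i ≡ j) ⊎ ((i ≡ 0) × (suc j ≡ m))
pathL-chord {m} {i} {j} h = [ (λ q → inj₁ (≡ᵇ-elim {suc i} q)) , (λ q → let a , b = ∧-elim {i ≡ᵇ 0} q in inj₂ (≡ᵇ-elim {i} a , ≡ᵇ-elim {suc j} b)) ]′ (∨-elim {suc i ≡ᵇ j} h)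

F-patL : ∀ j k → 1 ≤ j → F (patGraph {2 + j + k} (patL (2 + j))) ≡ Φ (2 + j) k
F-patL j k 1≤j = trans (X.Chordless.F-value finish rest) (trans (cong₂ (λ a b → (2 + tri′ j) * (a + 1) + b) (m+n∸m≡n j k) (sums (2 + j + k))) (path-total j k))
  where
  m top : ℕ
  m = 2 + j
  top = 1 + j + k
  G : Graph (suc top)
  G = patGraph (patL m)
  consec : ∀ {u w : Fin (suc top)} → suc (toℕ u) ≡ toℕ w → toℕ w ≤ top → G u w ≡ true
  consec e _ = patGraph-up (patL m) (≤-reflexive e) (∨-introˡ (≡ᵇ-true e))
  chord : ∀ {u w : Fin (suc top)} → toℕ u ≡ 0 → suc (toℕ w) ≡ m → G u w ≡ true
  chord {u} {w} a b = patGraph-up (patL m) (≤-trans (s≤s (≤-reflexive a)) (≤-trans (s≤s z≤n) (≤-reflexive (sym (suc-injective b)))))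
    (∨-introʳ {suc (toℕ u) ≡ᵇ toℕ w} (∧-intro (≡ᵇ-true a) (≡ᵇ-true b)))
  cases : ∀ {u w : Fin (suc top)} → G u w ≡ true → toℕ u < toℕ w →
    (suc (toℕ u) ≡ toℕ w) × (toℕ w ≤ top) ⊎ ((toℕ u ≡ 0) × (suc (toℕ w) ≡ m) ⊎ (toℕ u ≡ top) × (top < toℕ w))
  cases {u} {w} g l = [ (λ q → inj₁ (q , ≤-pred (toℕ<n w))) , (λ q → inj₂ (inj₁ q)) ]′ (pathL-chord {m} {toℕ u} {toℕ w} (patGraph-cases (patL m) {u} {w} g l))
  module X = Tailed G (patGraph-simple (patL m)) m top (s≤s (s≤s 1≤j)) (s≤s (s≤s (m≤m+n j k))) ≤-refl consec chord cases
  module Y = Exact G (patGraph-simple (patL m))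
  finish : ∀ {K I O j} → toℕ j ≡ top → X.Front K I O j → Y.Enum K I O 1
  finish e f = Y.leaf (λ {u} {w} ku g → [ id , (λ { (_ , l) → ⊥-elim (<⇒≱ (toℕ<n w) (≤-trans (s≤s (≤-reflexive (sym e))) l)) }) ]′ (X.Front.close f {u} {w} ku g))
  rest : ∀ {D} → (∀ {y} → toℕ y ≤ top → D y ≡ true) → (∀ {y} → D y ≡ true → toℕ y ≤ top) → Y.Enum* (∅ᵉ +ᵉ (X.o , X.t)) D 0
  rest lo _ = Y.done (λ x → lo (≤-pred (toℕ<n x)))
  sums : ∀ p → X.pathSum 1 0 p ≡ tri p
  sums zero = refl
  sums (suc p) = trans (cong (p + 1 +_) (sums p)) (lem p (tri p))
    where
    lem : ∀ p x → p + 1 + x ≡ x + suc p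
    lem = solve-∀

patQ-elim : ∀ {m n i j} → patQ m n i j ≡ true → ((suc i ≡ j) × (suc j < n)) ⊎ (((i ≡ 0) × (suc j ≡ m)) ⊎ ((3 + i ≡ n) × (suc j ≡ n)))
patQ-elim {m} {n} {i} {j} h = [ (λ q → let a , b = ∧-elim {suc i ≡ᵇ j} q in inj₁ (≡ᵇ-elim {suc i} a , <ᵇ⇒< (suc j) n (≡⇒T b)))
  , (λ q → [ (λ r → let a , b = ∧-elim {i ≡ᵇ 0} r in inj₂ (inj₁ (≡ᵇ-elim {i} a , ≡ᵇ-elim {suc j} b)))
           , (λ r → let a , b = ∧-elim {3 + i ≡ᵇ n} r in inj₂ (inj₂ (≡ᵇ-elim {3 + i} a , ≡ᵇ-elim {suc j} b))) ]′ (∨-elim {(i ≡ᵇ 0) ∧ (suc j ≡ᵇ m)} q)) ]′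
  (∨-elim {(suc i ≡ᵇ j) ∧ (suc j <ᵇ n)} h)

F-patQ : ∀ j → 1 ≤ j → F (patGraph {5 + (j + j)} (patQ (2 + j) (5 + (j + j)))) ≡ Φ (3 + j) (2 + j)
F-patQ j 1≤j = trans (X.Chordless.F-value finish rest) (trans (cong₂ (λ a b → (2 + tri′ j) * (a + 4) + b) arith (sums (3 + (j + j)))) (fork-total j))
  where
  m top N : ℕ
  m = 2 + j
  -- The star centre stands at position `N - 3`; the two leaves follow it.
  top = 2 + (j + j)
  N = 5 + (j + j)
  arith : suc (j + j) ∸ j ≡ 1 + j
  arith = m+n∸n≡m (suc j) j
  pat : ℕ → ℕ → Bool
  pat = patQ m N
  G : Graph N
  G = patGraph pat
  consec′ : ∀ {u w : Fin N} → suc (toℕ u) ≡ toℕ w → suc (toℕ w) < N → G u w ≡ true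
  consec′ e l = patGraph-up pat (≤-reflexive e) (∨-introˡ (∧-intro (≡ᵇ-true e) (<ᵇ-true l)))
  consec : ∀ {u w : Fin N} → suc (toℕ u) ≡ toℕ w → toℕ w ≤ top → G u w ≡ true
  consec e l = consec′ e (s≤s (s≤s (m≤n⇒m≤1+n l)))
  chord : ∀ {u w : Fin N} → toℕ u ≡ 0 → suc (toℕ w) ≡ m → G u w ≡ true
  chord {u} {w} a b = patGraph-up pat (≤-trans (s≤s (≤-reflexive a)) (≤-trans (s≤s z≤n) (≤-reflexive (sym (suc-injective b)))))
    (∨-introʳ {(suc (toℕ u) ≡ᵇ toℕ w) ∧ (suc (toℕ w) <ᵇ N)} (∨-introˡ (∧-intro (≡ᵇ-true a) (≡ᵇ-true b))))
  cases : ∀ {u w : Fin N} → G u w ≡ true → toℕ u < toℕ w →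
    (suc (toℕ u) ≡ toℕ w) × (toℕ w ≤ top) ⊎ ((toℕ u ≡ 0) × (suc (toℕ w) ≡ m) ⊎ (toℕ u ≡ top) × (top < toℕ w))
  cases {u} {w} g l = [ (λ { (q , r) → [ (λ s → inj₁ (q , ≤-pred s)) , (λ s → inj₂ (inj₂ (suc-injective (trans q s) , ≤-reflexive (sym s)))) ]′ (m≤n⇒m<n∨m≡n (≤-pred (≤-pred r))) })
    , [ (λ q → inj₂ (inj₁ q)) , (λ { (q , r) → inj₂ (inj₂ (suc-injective (suc-injective (suc-injective q)) , ≤-trans (n≤1+n (suc top)) (≤-reflexive (sym (suc-injective r))))) }) ]′ ]′
    (patQ-elim {m} {N} {toℕ u} {toℕ w} (patGraph-cases pat {u} {w} g l))
  module X = Tailed G (patGraph-simple pat) m top (s≤s (s≤s 1≤j)) (s≤s (s≤s (m≤n⇒m≤1+n (m≤m+n j j)))) (m≤n+m (3 + (j + j)) 2) consec chord cases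
  module Y = Exact G (patGraph-simple pat)
  module U = Universe G (patGraph-simple pat)
  a b : Fin N
  a = fromℕ< {suc top} (n≤1+n (2 + top))
  b = fromℕ< {suc (suc top)} ≤-refl
  a≡ : toℕ a ≡ suc top
  a≡ = toℕ-fromℕ< (n≤1+n (2 + top))
  b≡ : toℕ b ≡ suc (suc top)
  b≡ = toℕ-fromℕ< {suc (suc top)} ≤-refl
  a≢b : a ≢ b
  a≢b e = 1+n≢n (sym (trans (sym a≡) (trans (cong toℕ e) b≡)))
  beyond : ∀ {v w} → top < toℕ v → G v w ≡ true → toℕ w ≡ top
  beyond {v} {w} l g with <-cmp (toℕ v) (toℕ w)
  ... | tri≈ _ q _ = ⊥-elim (U.G-irr {v} {w} g (toℕ-injective q))
  ... | tri< q _ _ = [ (λ { (_ , r) → ⊥-elim (<⇒≱ l (≤-trans (<⇒≤ q) r)) }) , [ (λ { (r , _) → ⊥-elim (<⇒≱ l (≤-trans (≤-reflexive r) z≤n)) }) , (λ { (r , _) → ⊥-elim (<-irrefl (sym r) l) }) ]′ ]′ (cases {v} {w} g q)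
  ... | tri> _ _ q = [ (λ { (_ , r) → ⊥-elim (<⇒≱ l r) }) , [ (λ { (_ , r) → ⊥-elim (<⇒≱ l (≤-trans (≤-reflexive (suc-injective r)) (s≤s (m≤n⇒m≤1+n (m≤m+n j j))))) }) , proj₁ ]′ ]′ (cases {w} {v} (U.G-sym v w g) q)
  two : ∀ {w : Fin N} → top < toℕ w → (w ≡ a) ⊎ (w ≡ b)
  two {w} l = [ (λ q → inj₁ (toℕ-injective (trans (≤-antisym (≤-pred q) l) (sym a≡)))) , (λ q → inj₂ (toℕ-injective (trans q (sym b≡)))) ]′ (m≤n⇒m<n∨m≡n (≤-pred (toℕ<n w)))
  -- At the star centre each of the two leaves may be taken or refused, hence 4.
  finish : ∀ {K I O j} → toℕ j ≡ top → X.Front K I O j → Y.Enum K I O 4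
  finish {K} {I} {O} {c} e f =
      Y.node c a (X.Front.K-end f) ca (notI {a} top<a) (X.Front.free f ≤-refl (inj₂ (e , top<a)))
        (Y.node c b (⊕-old K a c (X.Front.K-end f)) cb I+cb (X.Front.free f ≤-refl (inj₂ (e , top<b)))
          (Y.leaf (closing ((K ⊕ a) ⊕ b) ((I +ᵉ (c , a)) +ᵉ (c , b)) O (λ {u} {w} i → +ᵉ-old (I +ᵉ (c , a)) (c , b) {u} {w} (+ᵉ-old I (c , a) {u} {w} i)) (λ {u} {w} q → q)
            (λ {u} h → [ (λ { refl → inj₂ (inj₂ (refl , +ᵉ-new′ (I +ᵉ (c , a)) c b)) }) , (λ h′ → [ (λ { refl → inj₂ (inj₁ (refl , +ᵉ-old (I +ᵉ (c , a)) (c , b) {a} {c} (+ᵉ-new′ I c a))) }) , inj₁ ]′ (⊕-elim K a h′)) ]′ (⊕-elim (K ⊕ a) b h))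
            (inj₁ (+ᵉ-old (I +ᵉ (c , a)) (c , b) {c} {a} (+ᵉ-new I c a))) (inj₁ (+ᵉ-new (I +ᵉ (c , a)) c b))))
          (Y.leaf (closing (K ⊕ a) (I +ᵉ (c , a)) (O +ᵉ (c , b)) (λ {u} {w} → +ᵉ-old I (c , a) {u} {w}) (λ {u} {w} → +ᵉ-old O (c , b) {u} {w})
            (λ {u} h → [ (λ { refl → inj₂ (inj₁ (refl , +ᵉ-new′ I c a)) }) , inj₁ ]′ (⊕-elim K a h))
            (inj₁ (+ᵉ-new I c a)) (inj₂ (+ᵉ-new O c b)))))
        (Y.node c b (X.Front.K-end f) cb (notI {b} top<b) O+cb
          (Y.leaf (closing (K ⊕ b) (I +ᵉ (c , b)) (O +ᵉ (c , a)) (λ {u} {w} → +ᵉ-old I (c , b) {u} {w}) (λ {u} {w} → +ᵉ-old O (c , a) {u} {w})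
            (λ {u} h → [ (λ { refl → inj₂ (inj₂ (refl , +ᵉ-new′ I c b)) }) , inj₁ ]′ (⊕-elim K b h))
            (inj₂ (+ᵉ-new O c a)) (inj₁ (+ᵉ-new I c b))))
          (Y.leaf (closing K I ((O +ᵉ (c , a)) +ᵉ (c , b)) (λ {u} {w} q → q) (λ {u} {w} q → +ᵉ-old (O +ᵉ (c , a)) (c , b) {u} {w} (+ᵉ-old O (c , a) {u} {w} q)) inj₁
            (inj₂ (+ᵉ-old (O +ᵉ (c , a)) (c , b) {c} {a} (+ᵉ-new O c a))) (inj₂ (+ᵉ-new (O +ᵉ (c , a)) c b)))))
    where
    top<a : top < toℕ a
    top<a = ≤-reflexive (sym a≡)
    top<b : top < toℕ b
    top<b = ≤-trans (n≤1+n (suc top)) (≤-reflexive (sym b≡))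
    ca : G c a ≡ true
    ca = consec′ (trans (cong suc e) (sym a≡)) (s≤s (≤-trans (s≤s (≤-reflexive a≡)) ≤-refl))
    cb : G c b ≡ true
    cb = patGraph-up pat (≤-trans (s≤s (≤-reflexive e)) top<b) (∨-introʳ {(suc (toℕ c) ≡ᵇ toℕ b) ∧ (suc (toℕ b) <ᵇ N)}
      (∨-introʳ {(toℕ c ≡ᵇ 0) ∧ (suc (toℕ b) ≡ᵇ m)} (∧-intro (≡ᵇ-true {3 + toℕ c} (cong (3 +_) e)) (≡ᵇ-true {suc (toℕ b)} (cong suc b≡)))))
    c≢a : c ≢ a
    c≢a q = <-irrefl (trans (sym e) (cong toℕ q)) top<a
    notI : ∀ {w} → top < toℕ w → I c w ≡ false
    notI l = ≢true⇒false (λ i → <⇒≱ l (≤-trans (X.Front.K-max f (proj₂ (X.Front.I-in f i))) (≤-reflexive e)))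
    I+cb : (I +ᵉ (c , a)) c b ≡ false
    I+cb = ≢true⇒false (λ h → [ (λ i → true≢false i (notI top<b)) , [ (λ { (_ , q) → a≢b (sym q) }) , (λ { (q , _) → c≢a q }) ]′ ]′ (+ᵉ-elim I {c} {a} h))
    O+cb : (O +ᵉ (c , a)) c b ≡ false
    O+cb = ≢true⇒false (λ h → [ (λ i → true≢false i (X.Front.free f ≤-refl (inj₂ (e , top<b)))) , [ (λ { (_ , q) → a≢b (sym q) }) , (λ { (q , _) → c≢a q }) ]′ ]′ (+ᵉ-elim O {c} {a} h))
    closing : ∀ (K′ : VSet N) (I′ O′ : Graph N) → (∀ {u w} → I u w ≡ true → I′ u w ≡ true) → (∀ {u w} → O u w ≡ true → O′ u w ≡ true) →
      (∀ {u} → K′ u ≡ true → (K u ≡ true) ⊎ (((u ≡ a) × (I′ a c ≡ true)) ⊎ ((u ≡ b) × (I′ b c ≡ true)))) →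
      (I′ c a ≡ true) ⊎ (O′ c a ≡ true) → (I′ c b ≡ true) ⊎ (O′ c b ≡ true) →
      ∀ {u w} → K′ u ≡ true → G u w ≡ true → (I′ u w ≡ true) ⊎ (O′ u w ≡ true)
    closing K′ I′ O′ fI fO hK ha hb {u} {w} ku g = [ old , [ (λ { (refl , i) → inj₁ (subst (λ z → I′ a z ≡ true) (toC {a} {w} top<a g) i) }) , (λ { (refl , i) → inj₁ (subst (λ z → I′ b z ≡ true) (toC {b} {w} top<b g) i) }) ]′ ]′ (hK {u} ku)
      where
      toC : ∀ {v w} → top < toℕ v → G v w ≡ true → c ≡ w
      toC {v} {w} l g = toℕ-injective (trans e (sym (beyond {v} {w} l g)))
      old : K u ≡ true → (I′ u w ≡ true) ⊎ (O′ u w ≡ true)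
      old k = [ [ (λ i → inj₁ (fI {u} {w} i)) , (λ q → inj₂ (fO {u} {w} q)) ]′ , (λ { (refl , l) → [ (λ { refl → ha }) , (λ { refl → hb }) ]′ (two (≤-trans (s≤s (≤-reflexive (sym e))) l)) }) ]′ (X.Front.close f {u} {w} k g)
  -- Once all vertices up to the star centre are excluded, only the two single leaves are left.
  rest : ∀ {D} → (∀ {y} → toℕ y ≤ top → D y ≡ true) → (∀ {y} → D y ≡ true → toℕ y ≤ top) → Y.Enum* (∅ᵉ +ᵉ (X.o , X.t)) D 2
  rest {D} lo hi = Y.next a (≢true⇒false (λ d → <⇒≱ (≤-reflexive (sym a≡)) (hi d))) (Y.leaf (λ {u} {w} q g → inj₂ (∨-introʳ {(∅ᵉ +ᵉ (X.o , X.t)) u w} (∨-introʳ {D u}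
      (lo (≤-reflexive (beyond {u} {w} (≤-trans (≤-reflexive (sym a≡)) (≤-reflexive (sym (cong toℕ (eqF⇒≡ q))))) g)))))))
    (Y.next b (≢true⇒false (λ d → [ (λ q → a≢b (sym q)) , (λ d′ → <⇒≱ (≤-trans (n≤1+n (suc top)) (≤-reflexive (sym b≡))) (hi d′)) ]′ (⊕-elim D a d)))
      (Y.leaf (λ {u} {w} q g → inj₂ (∨-introʳ {(∅ᵉ +ᵉ (X.o , X.t)) u w} (∨-introʳ {(D ⊕ a) u}
        (⊕-old D a w (lo (≤-reflexive (beyond {u} {w} (≤-trans (≤-trans (n≤1+n (suc top)) (≤-reflexive (sym b≡))) (≤-reflexive (sym (cong toℕ (eqF⇒≡ q))))) g))))))))
      (Y.done (λ x → [ (λ l → ⊕-old (D ⊕ a) b x (⊕-old D a x (lo (≤-pred l)))) , (λ l → [ (λ { refl → ⊕-old (D ⊕ a) b a (⊕-new D a) }) , (λ { refl → ⊕-new (D ⊕ a) b }) ]′ (two l)) ]′ (order x))))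
    where
    order : ∀ (x : Fin N) → (toℕ x < suc top) ⊎ (top < toℕ x)
    order x with toℕ x <? suc top
    ... | yes q = inj₁ q
    ... | no q = inj₂ (≮⇒≥ q)
  sums : ∀ p → X.pathSum 4 2 p ≡ 2 + 4 * p + ch2 p
  sums zero = refl
  sums (suc p) = trans (cong (p + 4 +_) (sums p)) (lem p (ch2 p))
    where
    lem : ∀ p x → p + 4 + (2 + 4 * p + x) ≡ 2 + 4 * suc p + (p + x)
    lem = solve-∀

-- Recognising the extremal graphs

-- The cycle 0, 1, …, m−1 is read as 1, …, m−1, 0; later vertices keep their place.
place unplace : ℕ → ℕ → ℕ
place m zero = m ∸ 1
place m (suc x) = if suc x <ᵇ m then x else suc x
unplace m y = if suc y <ᵇ m then suc y else (if suc y ≡ᵇ m then 0 else y)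

module Placing {m : ℕ} (1≤m : 1 ≤ m) where

  place-small : ∀ {x} → suc x < m → place m (suc x) ≡ x
  place-small h rewrite <ᵇ-true h = refl

  place-large : ∀ {x} → m ≤ x → place m x ≡ x
  place-large {zero} h = ⊥-elim (<⇒≱ 1≤m h)
  place-large {suc x} h rewrite <ᵇ-false (≤⇒≯ h) = refl

  unplace-small : ∀ {y} → suc y < m → unplace m y ≡ suc y
  unplace-small h rewrite <ᵇ-true h = refl

  unplace-last : ∀ {y} → suc y ≡ m → unplace m y ≡ 0
  unplace-last {y} h rewrite <ᵇ-false {suc y} {m} (<-irrefl h) | ≡ᵇ-true h = refl

  unplace-large : ∀ {y} → m ≤ y → unplace m y ≡ y
  unplace-large {y} h rewrite <ᵇ-false {suc y} {m} (≤⇒≯ (m≤n⇒m≤1+n h)) | ≡ᵇ-false {suc y} {m} (λ e → <⇒≱ (≤-reflexive e) h) = refl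

  data Where : ℕ → Set where
    first : Where 0
    small : ∀ {x} → suc x < m → Where (suc x)
    large : ∀ {x} → m ≤ x → Where x

  where′ : ∀ x → Where x
  where′ zero = first
  where′ (suc x) with suc x <? m
  ... | yes h = small h
  ... | no h = large (≮⇒≥ h)

  sucpred : suc (m ∸ 1) ≡ m
  sucpred = m+[n∸m]≡n 1≤m

  unplace-place : ∀ x → unplace m (place m x) ≡ x
  unplace-place x with where′ x
  ... | first = unplace-last sucpred
  ... | small h rewrite place-small h = unplace-small h
  ... | large h rewrite place-large h = unplace-large h

  place-unplace : ∀ y → place m (unplace m y) ≡ y
  place-unplace y with <-cmp (suc y) m
  ... | tri< h _ _ rewrite unplace-small h = place-small h
  ... | tri≈ _ h _ rewrite unplace-last h = suc-injective (trans sucpred (sym h))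
  ... | tri> _ _ h rewrite unplace-large (≤-pred h) = place-large (≤-pred h)

  place-< : ∀ {n x} → m ≤ n → x < n → place m x < n
  place-< {n} {x} mn l with where′ x
  ... | first = ≤-trans (≤-reflexive sucpred) mn
  ... | small h rewrite place-small h = <-trans (n<1+n _) l
  ... | large h rewrite place-large h = l

  unplace-< : ∀ {n y} → m ≤ n → y < n → unplace m y < n
  unplace-< {n} {y} mn l with <-cmp (suc y) m
  ... | tri< h _ _ rewrite unplace-small h = ≤-trans h mn
  ... | tri≈ _ h _ rewrite unplace-last h = ≤-trans 1≤m mn
  ... | tri> _ _ h rewrite unplace-large (≤-pred h) = l

fromEdges-elim : {es : List (ℕ × ℕ)} {i j : Fin n} → fromEdges es i j ≡ true →
  (i ≢ j) × (((toℕ i , toℕ j) ∈ es) ⊎ ((toℕ j , toℕ i) ∈ es))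
fromEdges-elim {es = es} {i} {j} h with ∧-elim {not (eqF i j)} h
... | a , b with any-elim _ es b
... | (p , q) , mp , e = eqF⇒≢ (not-elim a) , [ (λ r → let x , y = ∧-elim {p ≡ᵇ toℕ i} r in
        inj₁ (subst₂ (λ u v → (u , v) ∈ es) (≡ᵇ-elim {p} x) (≡ᵇ-elim {q} y) mp))
      , (λ r → let x , y = ∧-elim {p ≡ᵇ toℕ j} r in inj₂ (subst₂ (λ u v → (u , v) ∈ es) (≡ᵇ-elim {p} x) (≡ᵇ-elim {q} y) mp)) ]′
      (∨-elim {(p ≡ᵇ toℕ i) ∧ (q ≡ᵇ toℕ j)} e)

fromEdges-intro : {es : List (ℕ × ℕ)} {i j : Fin n} → i ≢ j → ((toℕ i , toℕ j) ∈ es) ⊎ ((toℕ j , toℕ i) ∈ es) → fromEdges es i j ≡ true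
fromEdges-intro {i = i} {j} ne (inj₁ h) = ∧-intro (not-intro (≢⇒eqF ne)) (any-intro _ h (∨-introˡ (∧-intro (≡ᵇ-true {toℕ i} refl) (≡ᵇ-true {toℕ j} refl))))
fromEdges-intro {i = i} {j} ne (inj₂ h) = ∧-intro (not-intro (≢⇒eqF ne)) (any-intro _ h
  (∨-introʳ {(toℕ j ≡ᵇ toℕ i) ∧ (toℕ i ≡ᵇ toℕ j)} (∧-intro (≡ᵇ-true {toℕ j} refl) (≡ᵇ-true {toℕ i} refl))))

-- The map `place` is the isomorphism. Rotating the cycle by one moves the root of the tail from 0
-- to `m - 1`, so that cycle and tail become a path with one chord. The listed edges may have either
-- orientation after the rotation.
fromEdges≅ : ∀ {n m} (es : List (ℕ × ℕ)) (pat : ℕ → ℕ → Bool) → 1 ≤ m → m ≤ n →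
  (∀ {a b} → (a , b) ∈ es → (place m a < place m b) × (pat (place m a) (place m b) ≡ true) ⊎
                            (place m b < place m a) × (pat (place m b) (place m a) ≡ true)) →
  (∀ {i j} → i < j → j < n → pat i j ≡ true → ((unplace m i , unplace m j) ∈ es) ⊎ ((unplace m j , unplace m i) ∈ es)) →
  fromEdges {n} es ≅ patGraph pat
fromEdges≅ {n} {m} es pat 1≤m m≤n to from = permutation f g fg gf , λ i j → bool-ext (there′ i j) (back i j)
  where
  open Placing 1≤m
  f g : Fin n → Fin n
  f x = fromℕ< (place-< m≤n (toℕ<n x))
  g x = fromℕ< (unplace-< m≤n (toℕ<n x))
  f≡ : ∀ x → toℕ (f x) ≡ place m (toℕ x)
  f≡ x = toℕ-fromℕ< (place-< m≤n (toℕ<n x))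
  g≡ : ∀ x → toℕ (g x) ≡ unplace m (toℕ x)
  g≡ x = toℕ-fromℕ< (unplace-< m≤n (toℕ<n x))
  fg : ∀ x → f (g x) ≡ x
  fg x = toℕ-injective (trans (f≡ (g x)) (trans (cong (place m) (g≡ x)) (place-unplace (toℕ x))))
  gf : ∀ x → g (f x) ≡ x
  gf x = toℕ-injective (trans (g≡ (f x)) (trans (cong (unplace m) (f≡ x)) (unplace-place (toℕ x))))
  edge : ∀ i j → (toℕ i , toℕ j) ∈ es → patGraph pat (f i) (f j) ≡ true
  edge i j h = [ (λ { (l , p) → patGraph-up pat {f i} {f j} (subst₂ _<_ (sym (f≡ i)) (sym (f≡ j)) l) (trans (cong₂ pat (f≡ i) (f≡ j)) p) })
    , (λ { (l , p) → trans (proj₁ (patGraph-simple pat) (f i) (f j)) (patGraph-up pat {f j} {f i} (subst₂ _<_ (sym (f≡ j)) (sym (f≡ i)) l) (trans (cong₂ pat (f≡ j) (f≡ i)) p)) }) ]′ (to h)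
  there′ : ∀ i j → fromEdges es i j ≡ true → patGraph pat (f i) (f j) ≡ true
  there′ i j h = [ edge i j , (λ q → trans (proj₁ (patGraph-simple pat) (f i) (f j)) (edge j i q)) ]′ (proj₂ (fromEdges-elim {es = es} h))
  undo : ∀ i → unplace m (toℕ (f i)) ≡ toℕ i
  undo i = trans (cong (unplace m) (f≡ i)) (unplace-place (toℕ i))
  mem : ∀ i j → toℕ (f i) < toℕ (f j) → pat (toℕ (f i)) (toℕ (f j)) ≡ true → ((toℕ i , toℕ j) ∈ es) ⊎ ((toℕ j , toℕ i) ∈ es)
  mem i j l p = [ (λ q → inj₁ (subst₂ (λ a b → (a , b) ∈ es) (undo i) (undo j) q)) , (λ q → inj₂ (subst₂ (λ a b → (a , b) ∈ es) (undo j) (undo i) q)) ]′ (from l (toℕ<n (f j)) p)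
  back : ∀ i j → patGraph pat (f i) (f j) ≡ true → fromEdges es i j ≡ true
  back i j h = fromEdges-intro {es = es} ne ([ (λ { (l , p) → mem i j l p }) , (λ { (l , p) → [ inj₂ , inj₁ ]′ (mem j i l p) }) ]′ (patGraph-elim pat {f i} {f j} h))
    where
    ne : i ≢ j
    ne refl = true≢false h (proj₂ (patGraph-simple pat) (f i))

≅-simple : {G P : Graph n} → G ≅ P → IsSimple P → IsSimple G
≅-simple (σ , a) (s , r) = (λ i j → trans (a i j) (trans (s _ _) (sym (a j i)))) , λ i → trans (a i i) (r _)

∈-pathEdges⁺ : (f : ℕ → ℕ) {i c : ℕ} → suc i < c → (f i , f (suc i)) ∈ pathEdges (applyUpTo f c)
∈-pathEdges⁺ f {zero} {suc (suc c)} l = here refl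
∈-pathEdges⁺ f {suc i} {suc (suc c)} (s≤s l) = there (∈-pathEdges⁺ (f ∘ suc) l)
∈-pathEdges⁺ f {i} {suc zero} (s≤s ())

∈-pathEdges⁻ : (f : ℕ → ℕ) (c : ℕ) {a b : ℕ} → (a , b) ∈ pathEdges (applyUpTo f c) → ∃ λ i → (suc i < c) × (a ≡ f i) × (b ≡ f (suc i))
∈-pathEdges⁻ f (suc (suc c)) (here refl) = 0 , s≤s (s≤s z≤n) , refl , refl
∈-pathEdges⁻ f (suc (suc c)) (there h) = let i , l , p , q = ∈-pathEdges⁻ (f ∘ suc) (suc c) h in suc i , s≤s l , p , q

lastOr-applyUpTo : (f : ℕ → ℕ) (c d : ℕ) → lastOr d (applyUpTo f (suc c)) ≡ f c
lastOr-applyUpTo f zero d = refl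
lastOr-applyUpTo f (suc c) d = lastOr-applyUpTo (f ∘ suc) c (f 0)

-- The vertices `0, m, m + 1, …` of the tail as a function of the index, so that membership in
-- `pathEdges` can be read off from `applyUpTo`.
tailVertex : ℕ → ℕ → ℕ
tailVertex m zero = 0
tailVertex m (suc i) = m + i

tail≡ : ∀ m k → 0 ∷ map (m +_) (upTo k) ≡ applyUpTo (tailVertex m) (suc k)
tail≡ m k = cong (0 ∷_) (map-applyUpTo id (m +_) k)

-- The part shared by both extremal graphs: `Lgraph` consists of it, and `Qgraph` adds two leaves at
-- the end of the tail.
coreEdges : ℕ → ℕ → List (ℕ × ℕ)
coreEdges m k = cycleEdges m ++ pathEdges (0 ∷ map (m +_) (upTo k))

module Core {m k : ℕ} (3≤m : 3 ≤ m) where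
  1≤m : 1 ≤ m
  1≤m = ≤-trans (s≤s z≤n) 3≤m

  open Placing 1≤m

  Joined : ℕ → ℕ → Set
  Joined i j = ((suc i ≡ j) × (j < m + k)) ⊎ ((i ≡ 0) × (suc j ≡ m))

  tail-place : ∀ i → place m (tailVertex m i) ≡ (m ∸ 1) + i
  tail-place zero = sym (+-identityʳ _)
  tail-place (suc i) = trans (place-large (m≤m+n m i)) (trans (cong (_+ i) (sym sucpred)) (sym (+-suc (m ∸ 1) i)))

  core-to : ∀ {a b} → (a , b) ∈ coreEdges m k → Joined (place m a) (place m b) ⊎ Joined (place m b) (place m a)
  core-to (here refl) = inj₁ (inj₁ (go 3≤m , ≤-trans (≤-reflexive sucpred) (m≤m+n m k)))
    where
    go : ∀ {m} → 3 ≤ m → suc (place m (m ∸ 1)) ≡ m ∸ 1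
    go {suc (suc m)} (s≤s (s≤s l)) rewrite <ᵇ-true {suc m} {suc (suc m)} ≤-refl = refl
  core-to {a} {b} (there h) with ∈-++⁻ (pathEdges (upTo m)) h
  ... | inj₁ q with ∈-pathEdges⁻ id m q
  ... | zero , l , refl , refl rewrite place-small l = inj₂ (inj₂ (refl , sucpred))
  ... | suc i , l , refl , refl rewrite place-small {i} (<-trans (n<1+n _) l) | place-small {suc i} l =
        inj₁ (inj₁ (refl , ≤-trans (<-trans (n<1+n _) l) (m≤m+n m k)))
  core-to {a} {b} (there h) | inj₂ q with ∈-pathEdges⁻ (tailVertex m) (suc k) {a} {b} (subst (λ z → (a , b) ∈ pathEdges z) (tail≡ m k) q)
  ... | i , l , refl , refl rewrite tail-place i | tail-place (suc i) =
        inj₁ (inj₁ (sym (+-suc (m ∸ 1) i) , ≤-trans (≤-reflexive (cong (_+ suc i) sucpred)) (+-monoʳ-≤ m (≤-pred l))))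

  core-from : ∀ {i j} → Joined i j → ((unplace m i , unplace m j) ∈ coreEdges m k) ⊎ ((unplace m j , unplace m i) ∈ coreEdges m k)
  core-from {i} {j} (inj₂ (refl , e)) rewrite unplace-last e | unplace-small {0} (≤-trans (s≤s (s≤s z≤n)) 3≤m) =
    inj₂ (there (∈-++⁺ˡ (∈-pathEdges⁺ id {0} (≤-trans (s≤s (s≤s z≤n)) 3≤m))))
  core-from {i} (inj₁ (refl , l)) with <-cmp (suc i) m
  ... | tri≈ _ e _ rewrite unplace-last e | unplace-large {suc i} (≤-reflexive (sym e)) =
        inj₁ (there (∈-++⁺ʳ (pathEdges (upTo m)) (subst (λ z → (0 , suc i) ∈ pathEdges z) (sym (tail≡ m k))
          (subst (λ z → (0 , z) ∈ pathEdges (applyUpTo (tailVertex m) (suc k))) (trans (+-identityʳ m) (sym e)) (∈-pathEdges⁺ (tailVertex m) {0} (s≤s (pos k e l)))))))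
    where
    pos : ∀ k → suc i ≡ m → suc i < m + k → 1 ≤ k
    pos zero e l = ⊥-elim (<-irrefl (trans e (sym (+-identityʳ m))) l)
    pos (suc k) _ _ = s≤s z≤n
  ... | tri> _ _ h with m≤n⇒∃[o]m+o≡n (≤-pred h)
  ... | d , refl rewrite unplace-large (≤-pred h) | unplace-large (m≤n⇒m≤1+n (≤-pred h)) =
        inj₁ (there (∈-++⁺ʳ (pathEdges (upTo m)) (subst (λ z → (m + d , suc (m + d)) ∈ pathEdges z) (sym (tail≡ m k))
          (subst (λ z → (m + d , z) ∈ pathEdges (applyUpTo (tailVertex m) (suc k))) (+-suc m d)
            (∈-pathEdges⁺ (tailVertex m) {suc d} (s≤s (+-cancelˡ-< m (suc d) k (≤-trans (s≤s (≤-reflexive (+-suc m d))) l))))))))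
  core-from {i} (inj₁ (refl , l)) | tri< h _ _ with m≤n⇒m<n∨m≡n h
  ... | inj₁ h′ rewrite unplace-small h | unplace-small h′ = inj₁ (there (∈-++⁺ˡ (∈-pathEdges⁺ id {suc i} h′)))
  ... | inj₂ refl rewrite unplace-small h | unplace-last {suc i} refl = inj₁ (here refl)

Lgraph≅ : ∀ {m k} → 3 ≤ m → Lgraph (m + k) k ≅ patGraph (patL m)
Lgraph≅ {m} {k} 3≤m = subst (λ c → fromEdges {m + k} (coreEdges c k) ≅ patGraph (patL m)) (sym (m+n∸n≡m m k))
    (fromEdges≅ (coreEdges m k) (patL m) 1≤m (m≤m+n m k) (λ h → [ (λ q → inj₁ (up q)) , (λ q → inj₂ (up q)) ]′ (core-to h))
      (λ l l′ p → core-from ([ (λ e → inj₁ (e , l′)) , inj₂ ]′ (pathL-chord {m} p))))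
  where
  open Core {m} {k} 3≤m
  up : ∀ {i j} → Joined i j → (i < j) × (patL m i j ≡ true)
  up {i} {j} (inj₁ (e , _)) = ≤-reflexive e , ∨-introˡ (≡ᵇ-true e)
  up {i} {j} (inj₂ (a , b)) = ≤-trans (s≤s (≤-reflexive a)) (≤-trans (s≤s z≤n) (≤-pred (≤-trans 3≤m (≤-reflexive (sym b))))) ,
    ∨-introʳ {suc i ≡ᵇ j} (∧-intro (≡ᵇ-true a) (≡ᵇ-true b))

-- With `k = 2 + j` the order `5 + (j + j)` is `2k + 1`, and the cycle of `Q` has `n - k - 1 = k`
-- vertices.
Qgraph≅ : ∀ j → 1 ≤ j → Qgraph (5 + (j + j)) (2 + j) ≅ patGraph (patQ (2 + j) (5 + (j + j)))
Qgraph≅ j 1≤j = subst₂ (λ c r → fromEdges {N} (cycleEdges c ++ pathEdges (0 ∷ map (c +_) (upTo (suc j))) ++ ((lastOr 0 (map (c +_) (upTo (suc j))) , r) ∷ (lastOr 0 (map (c +_) (upTo (suc j))) , suc r) ∷ [])) ≅ patGraph (patQ m N))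
    c≡ refl (fromEdges≅ es (patQ m N) (s≤s z≤n) m≤N to from)
  where
  m N ctr : ℕ
  m = 2 + j
  N = 5 + (j + j)
  ctr = lastOr 0 (map (m +_) (upTo (suc j)))
  c≡ : m ≡ N ∸ m ∸ 1
  c≡ = sym (cong (_∸ 1) (m+n∸n≡m (3 + j) j))
  ctr≡ : ctr ≡ m + j
  ctr≡ = trans (cong (lastOr 0) (map-applyUpTo id (m +_) (suc j))) (lastOr-applyUpTo (m +_) j 0)
  es : List (ℕ × ℕ)
  es = cycleEdges m ++ pathEdges (0 ∷ map (m +_) (upTo (suc j))) ++ ((ctr , 3 + (j + j)) ∷ (ctr , 4 + (j + j)) ∷ [])
  m≤N : m ≤ N
  m≤N = s≤s (s≤s (≤-trans (m≤m+n j j) (m≤n+m (j + j) 3)))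
  open Core {m} {suc j} (s≤s (s≤s 1≤j))
  open Placing {m} (s≤s z≤n)
  core⊆ : ∀ {e} → e ∈ coreEdges m (suc j) → e ∈ es
  core⊆ {e} h = [ (λ q → ∈-++⁺ˡ q) , (λ q → ∈-++⁺ʳ (cycleEdges m) (∈-++⁺ˡ q)) ]′ (∈-++⁻ (cycleEdges m) h)
  split′ : ∀ {e} → e ∈ es → (e ∈ coreEdges m (suc j)) ⊎ (e ∈ ((ctr , 3 + (j + j)) ∷ (ctr , 4 + (j + j)) ∷ []))
  split′ {e} h = [ (λ q → inj₁ (∈-++⁺ˡ q)) , (λ q → [ (λ r → inj₁ (∈-++⁺ʳ (cycleEdges m) r)) , inj₂ ]′ (∈-++⁻ (pathEdges (0 ∷ map (m +_) (upTo (suc j)))) q)) ]′ (∈-++⁻ (cycleEdges m) h)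
  extra⊆ : ∀ {e} → e ∈ ((ctr , 3 + (j + j)) ∷ (ctr , 4 + (j + j)) ∷ []) → e ∈ es
  extra⊆ h = ∈-++⁺ʳ (cycleEdges m) (∈-++⁺ʳ (pathEdges (0 ∷ map (m +_) (upTo (suc j)))) h)
  m+sj : m + suc j ≡ 3 + (j + j)
  m+sj = cong (λ z → suc (suc z)) (+-suc j j)
  up : ∀ {i l} → Joined i l → (i < l) × (patQ m N i l ≡ true)
  up {i} {l} (inj₁ (e , q)) = ≤-reflexive e , ∨-introˡ (∧-intro (≡ᵇ-true e) (<ᵇ-true (s≤s (≤-trans q (≤-trans (≤-reflexive m+sj) (n≤1+n _))))))
  up {i} {l} (inj₂ (a , b)) = ≤-trans (s≤s (≤-reflexive a)) (≤-trans (s≤s z≤n) (≤-reflexive (sym (suc-injective b)))) ,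
    ∨-introʳ {(suc i ≡ᵇ l) ∧ (suc l <ᵇ N)} (∨-introˡ (∧-intro (≡ᵇ-true a) (≡ᵇ-true b)))
  place-ctr : place m ctr ≡ 2 + (j + j)
  place-ctr = trans (cong (place m) ctr≡) (place-large (m≤m+n m j))
  m≤ : ∀ d → m ≤ 2 + d + (j + j)
  m≤ d = s≤s (s≤s (≤-trans (m≤m+n j j) (m≤n+m (j + j) d)))
  place-end : ∀ d → place m (2 + d + (j + j)) ≡ 2 + d + (j + j)
  place-end d = place-large (m≤ d)
  Target : ℕ → ℕ → Set
  Target i l = ((i < l) × (patQ m N i l ≡ true)) ⊎ ((l < i) × (patQ m N l i ≡ true))
  to : ∀ {a b} → (a , b) ∈ es → Target (place m a) (place m b)
  to {a} {b} h = [ (λ q → [ (λ r → inj₁ (up r)) , (λ r → inj₂ (up r)) ]′ (core-to q)) , extra ]′ (split′ h)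
    where
    extra : ∀ {a b} → (a , b) ∈ ((ctr , 3 + (j + j)) ∷ (ctr , 4 + (j + j)) ∷ []) → Target (place m a) (place m b)
    extra (here refl) = subst₂ Target (sym place-ctr) (sym (place-end 1)) (inj₁ (≤-refl , ∨-introˡ (∧-intro (≡ᵇ-true {3 + (j + j)} refl) (<ᵇ-true {4 + (j + j)} ≤-refl))))
    extra (there (here refl)) = subst₂ Target (sym place-ctr) (sym (place-end 2)) (inj₁ (n≤1+n _ , ∨-introʳ {(3 + (j + j) ≡ᵇ 4 + (j + j)) ∧ (N <ᵇ N)}
      (∨-introʳ {false} (∧-intro (≡ᵇ-true {N} refl) (≡ᵇ-true {N} refl)))))
  from : ∀ {i l} → i < l → l < N → patQ m N i l ≡ true → ((unplace m i , unplace m l) ∈ es) ⊎ ((unplace m l , unplace m i) ∈ es)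
  from {i} {l} il lN p = [ (λ { (e , q) → [ (λ r → core (inj₁ (e , ≤-trans r (≤-reflexive (sym m+sj))))) , (λ r → atEnd e r) ]′ (m≤n⇒m<n∨m≡n (≤-pred (≤-pred q))) })
    , [ (λ q → core (inj₂ q)) , (λ { (a , b) → inj₁ (extra⊆ (there (here (cong₂ _,_ (unctr a) (unend 2 (suc-injective b)))))) }) ]′ ]′ (patQ-elim {m} {N} {i} {l} p)
    where
    core : Joined i l → ((unplace m i , unplace m l) ∈ es) ⊎ ((unplace m l , unplace m i) ∈ es)
    core q = [ (λ r → inj₁ (core⊆ r)) , (λ r → inj₂ (core⊆ r)) ]′ (core-from q)
    unend : ∀ d {x} → x ≡ 2 + d + (j + j) → unplace m x ≡ 2 + d + (j + j)
    unend d refl = unplace-large (m≤ d)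
    unctr : 3 + i ≡ N → unplace m i ≡ ctr
    unctr e = trans (unend 0 (suc-injective (suc-injective (suc-injective e)))) (sym ctr≡)
    atEnd : suc i ≡ l → l ≡ 3 + (j + j) → ((unplace m i , unplace m l) ∈ es) ⊎ ((unplace m l , unplace m i) ∈ es)
    atEnd e q = inj₁ (extra⊆ (here (cong₂ _,_ (unctr (cong (λ z → suc (suc z)) (trans e q))) (unend 1 q))))

L-shape : ∀ {n k} → k ≤ n → 3 ≤ n ∸ k → (Lgraph n k ≅ patGraph (patL (n ∸ k))) × (F (Lgraph n k) ≡ Φ (n ∸ k) k)
L-shape {n} {k} k≤n 3≤m = subst (λ N → (Lgraph N k ≅ patGraph (patL (n ∸ k))) × (F (Lgraph N k) ≡ Φ (n ∸ k) k)) (m∸n+n≡m k≤n) (go (n ∸ k) 3≤m)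
  where
  go : ∀ m → 3 ≤ m → (Lgraph (m + k) k ≅ patGraph (patL m)) × (F (Lgraph (m + k) k) ≡ Φ m k)
  go (suc (suc j)) (s≤s (s≤s 1≤j)) = iso , trans (F-≅ (≅-simple {P = P} iso (patGraph-simple (patL (2 + j)))) (patGraph-simple (patL (2 + j))) iso) (F-patL j k 1≤j)
    where
    P : Graph (2 + j + k)
    P = patGraph (patL (2 + j))
    iso : Lgraph (2 + j + k) k ≅ P
    iso = Lgraph≅ {2 + j} {k} (s≤s (s≤s 1≤j))

Qgraph≅′ : ∀ {N} j → N ≡ 5 + (j + j) → 1 ≤ j → Qgraph N (2 + j) ≅ patGraph (patQ (2 + j) N)
Qgraph≅′ j refl 1≤j = Qgraph≅ j 1≤j

F-patQ′ : ∀ {N} j → N ≡ 5 + (j + j) → 1 ≤ j → F (patGraph {N} (patQ (2 + j) N)) ≡ Φ (3 + j) (2 + j)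
F-patQ′ j refl 1≤j = F-patQ j 1≤j

Q-shape : ∀ {n k} → n ≡ 2 * k + 1 → 3 ≤ k → (Qgraph n k ≅ patGraph (patQ k n)) × (F (Qgraph n k) ≡ Φ (n ∸ k) k)
Q-shape {n} {suc (suc j)} e (s≤s (s≤s 1≤j)) = iso , trans (F-≅ {G = Qgraph n (2 + j)} {H = patGraph (patQ (2 + j) n)}
    (≅-simple {P = patGraph (patQ (2 + j) n)} iso (patGraph-simple (patQ (2 + j) n))) (patGraph-simple (patQ (2 + j) n)) iso)
    (trans (F-patQ′ j n≡ 1≤j) (cong (λ c → Φ c (2 + j)) (sym (trans (cong (_∸ (2 + j)) n≡) (m+n∸n≡m (3 + j) j)))))
  where
  lemma : ∀ j → 2 * (2 + j) + 1 ≡ 5 + (j + j)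
  lemma = solve-∀
  n≡ : n ≡ 5 + (j + j)
  n≡ = trans e (lemma j)
  iso : Qgraph n (2 + j) ≅ patGraph (patQ (2 + j) n)
  iso = Qgraph≅′ j n≡ 1≤j

-- The lower bounds compared with the exact values of `L` and `Q`

theorem4p10 : ∀ (n k : ℕ) → 13 ≤ n → 1 ≤ k → 2 * k ≤ n →
    (G : Graph n) → IsSimple G → Connected G → cutCount G ≡ k → GirthAtLeast k G →
    (F (Lgraph n k) ≤ F G)
    × (n ≢ 2 * k + 1 → (F G ≡ F (Lgraph n k) ⇔ G ≅ Lgraph n k))
    × (n ≡ 2 * k + 1 → (F G ≡ F (Lgraph n k) ⇔ (G ≅ Lgraph n k ⊎ G ≅ Qgraph n k)))
theorem4p10 n k 13≤n 1≤k 2k≤n G G-simple connected cuts girth =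
    ≤-trans (≤-reflexive (proj₂ L)) lower ,
    (λ n≢ → mk⇔ (λ e → [ id , (λ { (n≡ , _) → ⊥-elim (n≢ n≡) }) ]′ (equal e)) sameL) ,
    (λ n≡ → mk⇔ (λ e → [ inj₁ , (λ { (_ , q) → inj₂ q }) ]′ (equal e)) [ sameL , sameQ n≡ ]′)
  where
  G-conn : ∀ x y → Walk G x y
  G-conn x y = Universe.Connected⇒Conn G G-simple connected refl refl
  card-cut : card (isCutᵇ G) ≡ k
  card-cut = trans (cnt-length (isCutᵇ G) (allFin n)) cuts
  k≤n : k ≤ n
  k≤n = ≤-trans (m≤m+n k (k + 0)) 2k≤n
  -- Otherwise `k ≤ n ∸ k ≤ 2`, and `n` would be at most 4.
  3≤m : 3 ≤ n ∸ k
  3≤m with 3 ≤? n ∸ k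
  ... | yes h = h
  ... | no h = ⊥-elim (1+n≰n (≤-trans (m≤m+n 5 8) (≤-trans 13≤n (≤-trans (≤-reflexive (sym (m∸n+n≡m k≤n))) (+-mono-≤ c≤2 (≤-trans k≤c c≤2))))))
    where
    c≤2 : n ∸ k ≤ 2
    c≤2 = ≤-pred (≰⇒> h)
    k≤c : k ≤ n ∸ k
    k≤c = ≤-trans (≤-reflexive (sym (trans (cong (λ z → k + z ∸ k) (+-identityʳ k)) (m+n∸n≡m k k)))) (∸-monoˡ-≤ k 2k≤n)
  L : (Lgraph n k ≅ patGraph (patL (n ∸ k))) × (F (Lgraph n k) ≡ Φ (n ∸ k) k)
  L = L-shape k≤n 3≤m
  L-simple : IsSimple (Lgraph n k)
  L-simple = ≅-simple {P = patGraph (patL (n ∸ k))} (proj₁ L) (patGraph-simple (patL (n ∸ k)))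
  Listed : (ℕ → ℕ → Bool) → Set
  Listed pat = ∃ λ xs → Ordered G pat xs × (length xs ≡ n)
  Outcome : Set
  Outcome = (suc (Φ (n ∸ k) k) ≤ F G) ⊎ ((Φ (n ∸ k) k ≤ F G) × (Listed (patL (n ∸ k)) ⊎ ((n ≡ 2 * k + 1) × Listed (patQ k n))))
  byBlocks : Blocks.Block G G-simple G-conn ⊎ Blocks.Treelike G G-simple G-conn → Outcome
  byBlocks (inj₁ 𝔅) = OneRoot.block-outcome G G-simple G-conn 𝔅 card-cut 1≤k 13≤n girth
  byBlocks (inj₂ tree) = inj₁ (Trees.tree-above G G-simple G-conn (λ {a} {b} {c} → tree {a} {b} {c}) k card-cut 1≤k 2k≤n 13≤n)
  outcome : Outcome
  outcome = byBlocks (Blocks.block-or-tree G G-simple G-conn)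
  lower : Φ (n ∸ k) k ≤ F G
  lower = [ <⇒≤ , proj₁ ]′ outcome
  3≤k : n ≡ 2 * k + 1 → 3 ≤ k
  3≤k n≡ with 3 ≤? k
  ... | yes h = h
  ... | no h = ⊥-elim (1+n≰n (≤-trans (m≤m+n 6 7) (≤-trans 13≤n (≤-trans (≤-reflexive n≡) (+-monoˡ-≤ 1 (*-monoʳ-≤ 2 (≤-pred (≰⇒> h))))))))
  equal : F G ≡ F (Lgraph n k) → (G ≅ Lgraph n k) ⊎ ((n ≡ 2 * k + 1) × (G ≅ Qgraph n k))
  equal e = [ (λ h → ⊥-elim (1+n≰n (≤-trans h (≤-reflexive (trans e (proj₂ L))))))
    , (λ { (_ , inj₁ (xs , o , l)) → inj₁ (≅-common {G = G} {Lgraph n k} {patGraph (patL (n ∸ k))} (ordered⇒≅ G-simple o l) (proj₁ L))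
         ; (_ , inj₂ (n≡ , xs , o , l)) → inj₂ (n≡ , ≅-common {G = G} {Qgraph n k} {patGraph (patQ k n)} (ordered⇒≅ G-simple o l) (proj₁ (Q-shape n≡ (3≤k n≡)))) }) ]′ outcome
  sameL : G ≅ Lgraph n k → F G ≡ F (Lgraph n k)
  sameL = F-≅ G-simple L-simple
  sameQ : n ≡ 2 * k + 1 → G ≅ Qgraph n k → F G ≡ F (Lgraph n k)
  sameQ n≡ i = let q , v = Q-shape n≡ (3≤k n≡) in
    trans (F-≅ G-simple (≅-simple {P = patGraph (patQ k n)} q (patGraph-simple (patQ k n))) i) (trans v (sym (proj₂ L)))
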